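{- Let $\zeta$-free notation be as in the context. For $0\le a\le 10$ put $$D_C(a,11):=\sum_{n\ge 0}\Big(M(a,11,n)-\tfrac{p(n)}{11}\Big)q^n .$$ Then, with $v_{11}$ as defined in the context, \begin{align*} D_{C}(0,11) &= v_{11}(10,-12,-2,8,6,4,-4,-6,-8,2),\\ D_{C}(1,11) &= v_{11}(-1,10,-2,-3,-5,4,7,5,3,2),\\ D_{C}(2,11) &= v_{11}(-1,-1,9,-3,6,-7,-4,-6,3,2),\\ D_{C}(3,11) &= v_{11}(-1,-1,-2,8,-5,4,-4,5,3,-9),\\ D_{C}(4,11) &= v_{11}(-1,-1,-2,-3,6,-7,7,5,-8,2),\\ D_{C}(5,11) &= v_{11}(-1,-1,-2,-3,-5,4,-4,-6,3,2). \end{align*}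
   Context: All series are formal power (or Laurent) series in $q$. $(x;q)_\infty=\prod_{i\ge0}(1-xq^i)$. For integers $a$ and $m>0$: $J_{a,m}:=(q^a;q^m)_\infty(q^{m-a};q^m)_\infty(q^m;q^m)_\infty$, $J_m:=(q^m;q^m)_\infty$, $P_i:=J_{i,11}$, $X_i:=J_{11i,121}$. $p(n)$ is the number of partitions of $n$ ($p(0)=1$). The crank of a partition $\pi$: let $\lambda(\pi)$ be its largest part, $\omega(\pi)$ its number of parts equal to $1$, and $\mu(\pi)$ its number of parts larger than $\omega(\pi)$; the crank is $\lambda(\pi)$ if $\omega(\pi)=0$ and $\mu(\pi)-\omega(\pi)$ otherwise. For $n\ge2$, $M(m,n)$ is the number of partitions of $n$ with crank $m$; for $n\le 1$ one sets $M(0,0)=1$, $M(0,1)=-1$, $M(1,1)=M(-1,1)=1$ and $M(m,n)=0$ otherwise (so $\sum_{n\ge0}\sum_m M(m,n)z^mq^n=\frac{(q;q)_\infty}{(zq;q)_\infty(z^{ -1}q;q)_\infty}$). $M(a,r,n):=\sum_{m\equiv a \ (\mathrm{mod}\ r)}M(m,n)$. Define \begin{align*} v_{11}(a_0,a_1,a_2,a_3,a_4,a_5,a_7,a_8,a_9,a_{10}):=\frac{J_{121}^2}{11}\Big(& a_0\frac{1}{X_1}+a_1q\frac{X_5}{X_2X_3}+a_2q^2\frac{X_3}{X_1X_4}+a_3q^3\frac{X_2}{X_1X_3}+a_4q^4\frac{1}{X_2}\\ &+a_5q^5\frac{X_4}{X_2X_5}+a_7q^7\frac{1}{X_3}+a_8q^{19}\frac{X_1}{X_4X_5}+a_9q^9\frac{1}{X_4}+a_{10}q^{10}\frac{1}{X_5}\Big).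 \end{align*} -}

module Defs where

open import Algebra.Properties.CommutativeMonoid.Sum as Sum using ()
open import Data.Bool using (if_then_else_)
open import Data.Empty using (⊥)
open import Data.Fin using (Fin; zero; suc; toℕ)
open import Data.Integer as ℤ using (ℤ; +_; -[1+_]; 0ℤ; 1ℤ; -1ℤ)
import Data.Integer.Properties as ℤ
open import Data.Integer.Divisibility.Signed as ℤ using (_∣?_)
open import Data.List using (List; []; _∷_; _++_; map; filter; foldr; length; upTo)
import Data.List.Properties as List
open import Data.List.Membership.Propositional using (_∈_)
open import Data.List.Membership.Propositional.Properties
  using (∈-map⁺; ∈-map⁻; ∈-++⁺ˡ; ∈-++⁺ʳ; ∈-++⁻; ∈-filter⁺; ∈-filter⁻)
open import Data.List.Relation.Unary.All as All using (All; []; _∷_)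
open import Data.List.Relation.Unary.AllPairs using ([]; _∷_)
open import Data.List.Relation.Unary.Any using (here)
open import Data.List.Relation.Unary.Linked using (Linked; linked?)
open import Data.List.Relation.Unary.Unique.Propositional using (Unique)
import Data.List.Relation.Unary.Unique.Propositional.Properties as Unique
open import Data.Nat as ℕ using (ℕ; zero; suc; NonZero; _∸_; _≥_; _<_; _≤_; _⊔_; z≤n; s≤s)
import Data.Nat.Properties as ℕ
open import Data.Nat.ListAction using (sum)
open import Data.Product using (_×_; _,_; proj₁; proj₂)
open import Data.Rational as ℚ using (ℚ; 0ℚ; 1ℚ)
import Data.Rational.Properties as ℚ
open import Data.Sum using (inj₁; inj₂)
open import Data.Vec using (Vec; []; _∷_; head; lookup)
open import Function using (_∘_)
open import Relation.Binary.PropositionalEquality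
  using (_≡_; _≢_; _≗_; refl; sym; trans; cong; cong₂; subst; module ≡-Reasoning)
open import Relation.Nullary using (does)
open import Relation.Nullary.Decidable using (dec-false)

open Sum ℚ.+-0-commutativeMonoid public using (sum-syntax)
open Sum ℚ.+-0-commutativeMonoid using (sum-cong-≗)

------------------------------------------------------------------------
-- Formal power series in q over ℚ, given by their coefficient functions.
-- Equality of series is pointwise equality _≗_.

Series : Set
Series = ℕ → ℚ

infixl 6 _+ˢ_ _-ˢ_
infixl 7 _*ˢ_ _/ˢ_
infixr 8 _•_

q^_ : ℕ → Series
(q^ k) n = if does (n ℕ.≟ k) then 1ℚ else 0ℚ

1ˢ : Series
1ˢ = q^ 0

_+ˢ_ _-ˢ_ _*ˢ_ : Series → Series → Series
(f +ˢ g) n = f n ℚ.+ g n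
(f -ˢ g) n = f n ℚ.- g n
(f *ˢ g) n = ∑[ k < suc n ] (f (toℕ k) ℚ.* g (n ∸ toℕ k))

_•_ : ℚ → Series → Series
(c • f) n = c ℚ.* f n

-- Coefficients bₙ, …, b₀ (in this order) of 1/f, where b₀ = 1/f₀ and
-- bₙ₊₁ = -(1/f₀) Σ_{k≤n} fₖ₊₁ bₙ₋ₖ.
inverse-coeffs : (f : Series) .{{_ : ℚ.NonZero (f 0)}} (n : ℕ) → Vec ℚ (suc n)
inverse-coeffs f zero    = (ℚ.1/ f 0) ∷ []
inverse-coeffs f (suc n) =
  (ℚ.- (ℚ.1/ f 0) ℚ.* (∑[ k < suc n ] (f (suc (toℕ k)) ℚ.* lookup bs k))) ∷ bs
  where bs = inverse-coeffs f n

inverse : (f : Series) .{{_ : ℚ.NonZero (f 0)}} → Series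
inverse f n = head (inverse-coeffs f n)

_/ˢ_ : (f g : Series) .{{_ : ℚ.NonZero (g 0)}} → Series
f /ˢ g = f *ˢ inverse g

∏ : ℕ → (ℕ → Series) → Series
∏ zero    f = 1ˢ
∏ (suc N) f = ∏ N f *ˢ f N

------------------------------------------------------------------------
-- Theta-type products

-- (q^a ; q^m)_∞ for a ≥ 0 and m > 0.  The factors with index i > n are
-- 1 - q^(a+mi) with a+mi > n, so they do not affect the coefficient of
-- qⁿ; see poch-stable below.
poch : (a m : ℕ) .{{_ : NonZero m}} → Series
poch a m n = ∏ (suc n) (λ i → 1ˢ -ˢ q^ (a ℕ.+ m ℕ.* i)) n

-- J_{a,m}; meaningful for 0 ≤ a ≤ m, because of the truncated m ∸ a.
J⟨_,_⟩ : (a m : ℕ) .{{_ : NonZero m}} → Series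
J⟨ a , m ⟩ = poch a m *ˢ poch (m ∸ a) m *ˢ poch m m

J : (m : ℕ) .{{_ : NonZero m}} → Series
J m = poch m m

X : ℕ → Series
X i = J⟨ 11 ℕ.* i , 121 ⟩

v₁₁ : (a₀ a₁ a₂ a₃ a₄ a₅ a₇ a₈ a₉ a₁₀ : ℤ) → Series
v₁₁ a₀ a₁ a₂ a₃ a₄ a₅ a₇ a₈ a₉ a₁₀ =
  (+ 1 ℚ./ 11) • (J 121 *ˢ J 121) *ˢ
  ( (a₀ ℚ./ 1)  • (1ˢ /ˢ X 1)
 +ˢ (a₁ ℚ./ 1)  • (q^ 1  *ˢ (X 5 /ˢ (X 2 *ˢ X 3)))
 +ˢ (a₂ ℚ./ 1)  • (q^ 2  *ˢ (X 3 /ˢ (X 1 *ˢ X 4)))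
 +ˢ (a₃ ℚ./ 1)  • (q^ 3  *ˢ (X 2 /ˢ (X 1 *ˢ X 3)))
 +ˢ (a₄ ℚ./ 1)  • (q^ 4  *ˢ (1ˢ /ˢ X 2))
 +ˢ (a₅ ℚ./ 1)  • (q^ 5  *ˢ (X 4 /ˢ (X 2 *ˢ X 5)))
 +ˢ (a₇ ℚ./ 1)  • (q^ 7  *ˢ (1ˢ /ˢ X 3))
 +ˢ (a₈ ℚ./ 1)  • (q^ 19 *ˢ (X 1 /ˢ (X 4 *ˢ X 5)))
 +ˢ (a₉ ℚ./ 1)  • (q^ 9  *ˢ (1ˢ /ˢ X 4))
 +ˢ (a₁₀ ℚ./ 1) • (q^ 10 *ˢ (1ˢ /ˢ X 5)))

------------------------------------------------------------------------
-- Partitions and the crank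

IsPartition : ℕ → List ℕ → Set
IsPartition n π = Linked _≥_ π × All (0 <_) π × sum π ≡ n

incHead : List ℕ → List ℕ
incHead []       = []
incHead (x ∷ xs) = suc x ∷ xs

-- All lists of positive integers with sum n: such a list with sum n + 2
-- arises from one with sum n + 1 by prepending 1 or by increasing the
-- first entry.
compositions : ℕ → List (List ℕ)
compositions zero          = [] ∷ []
compositions (suc zero)    = (1 ∷ []) ∷ []
compositions (suc (suc n)) =
  map (1 ∷_) (compositions (suc n)) ++ map incHead (compositions (suc n))

-- Each partition of n occurs exactly once; see ∈-partitions⁺,
-- ∈-partitions⁻ and partitions-unique below.
partitions : ℕ → List (List ℕ)
partitions n = filter (linked? ℕ._≥?_) (compositions n)

p : ℕ → ℕ
p n = length (partitions n)

largest ω μ : List ℕ → ℕ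
largest π = foldr _⊔_ 0 π
ω π       = length (filter (ℕ._≟ 1) π)
μ π       = length (filter (ω π ℕ.<?_) π)

crank : List ℕ → ℤ
crank π with ω π
... | zero  = + largest π
... | suc _ = + μ π ℤ.- + ω π

-- The conventional values of M(m,n) at n = 0 and n = 1; for n = 1 they
-- differ from the crank counts.
M₀ M₁ : ℤ → ℤ
M₀ (+ 0) = 1ℤ
M₀ _     = 0ℤ

M₁ (+ 0)    = -1ℤ
M₁ (+ 1)    = 1ℤ
M₁ -[1+ 0 ] = 1ℤ
M₁ _        = 0ℤ

M : ℤ → ℕ → ℤ
M m 0               = M₀ m
M m 1               = M₁ m
M m n@(suc (suc _)) = + length (filter (λ π → crank π ℤ.≟ m) (partitions n))

-- The integers -n, …, n.
interval : ℕ → List ℤ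
interval n = map (λ k → + k ℤ.- + n) (upTo (suc (n ℕ.+ n)))

-- M(a,r,n).  The sum over all integers m ≡ a (mod r) reduces to
-- |m| ≤ n, since the other terms vanish; see M-support below.
M⟨_,_,_⟩ : (a : ℤ) (r n : ℕ) → ℤ
M⟨ a , r , n ⟩ =
  foldr ℤ._+_ 0ℤ (map (λ m → M m n) (filter (λ m → + r ∣? (m ℤ.- a)) (interval n)))

D_C : (a : ℤ) (r : ℕ) .{{_ : NonZero r}} → Series
D_C a r n = M⟨ a , r , n ⟩ ℚ./ 1 ℚ.- + p n ℚ./ r

------------------------------------------------------------------------
-- The facts referred to above

Composition : ℕ → List ℕ → Set
Composition n c = All (0 <_) c × sum c ≡ n

compositions-step : ∀ {n cs} → (∀ {d} → d ∈ cs → Composition (suc n) d) →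
                    ∀ {c} → c ∈ map (1 ∷_) cs ++ map incHead cs → Composition (suc (suc n)) c
compositions-step {cs = cs} IH c∈ with ∈-++⁻ (map (1 ∷_) cs) c∈
... | inj₁ c∈₁ with _ , d∈ , refl ← ∈-map⁻ (1 ∷_) c∈₁ with pos , eq ← IH d∈ =
  s≤s z≤n ∷ pos , cong suc eq
... | inj₂ c∈₂ with ∈-map⁻ incHead c∈₂
...   | []    , d∈ , refl with () ← proj₂ (IH d∈)
...   | _ ∷ _ , d∈ , refl with _ ∷ pos , eq ← IH d∈ = s≤s z≤n ∷ pos , cong suc eq

compositions-sound : ∀ n {c} → c ∈ compositions n → Composition n c
compositions-sound zero          (here refl) = [] , refl
compositions-sound (suc zero)    (here refl) = s≤s z≤n ∷ [] , refl
compositions-sound (suc (suc n)) c∈          = compositions-step (compositions-sound (suc n)) c∈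

compositions-complete : ∀ n {c} → All (0 <_) c → sum c ≡ n → c ∈ compositions n
compositions-complete zero [] refl = here refl
compositions-complete zero (s≤s _ ∷ _) ()
compositions-complete (suc n) {suc zero ∷ []} _ refl = here refl
compositions-complete (suc zero) {suc zero ∷ _ ∷ _} (_ ∷ s≤s _ ∷ _) ()
compositions-complete (suc (suc n)) {suc zero ∷ xs} (_ ∷ pos) eq =
  ∈-++⁺ˡ (∈-map⁺ (1 ∷_) (compositions-complete (suc n) pos (ℕ.suc-injective eq)))
compositions-complete (suc zero) {suc (suc _) ∷ _} _ ()
compositions-complete (suc (suc n)) {suc (suc x) ∷ xs} (_ ∷ pos) eq =
  ∈-++⁺ʳ (map (1 ∷_) (compositions (suc n)))
    (∈-map⁺ incHead
      (compositions-complete (suc n) (s≤s z≤n ∷ pos) (ℕ.suc-injective eq)))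

compositions-unique : ∀ n → Unique (compositions n)
compositions-unique zero       = [] ∷ []
compositions-unique (suc zero) = [] ∷ []
compositions-unique (suc (suc n)) =
  Unique.++⁺ (Unique.map⁺ List.∷-injectiveʳ (compositions-unique (suc n)))
             (Unique.map⁺ incHead-injective (compositions-unique (suc n)))
             disjoint
  where
  incHead-injective : ∀ {c d} → incHead c ≡ incHead d → c ≡ d
  incHead-injective {[]}    {[]}    refl = refl
  incHead-injective {_ ∷ _} {_ ∷ _} refl = refl

  disjoint : ∀ {c} → (c ∈ map (1 ∷_) (compositions (suc n)))
                   × (c ∈ map incHead (compositions (suc n))) → ⊥
  disjoint (c∈₁ , c∈₂) with ∈-map⁻ (1 ∷_) c∈₁ | ∈-map⁻ incHead c∈₂
  ... | _ , _ , refl | zero ∷ _ , d∈ , refl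
    with () ∷ _ ← proj₁ (compositions-sound (suc n) d∈)

∈-partitions⁺ : ∀ {n π} → IsPartition n π → π ∈ partitions n
∈-partitions⁺ {n} (dec , pos , eq) =
  ∈-filter⁺ (linked? ℕ._≥?_) (compositions-complete n pos eq) dec

∈-partitions⁻ : ∀ {n π} → π ∈ partitions n → IsPartition n π
∈-partitions⁻ {n} π∈
  with c∈ , dec ← ∈-filter⁻ (linked? ℕ._≥?_) {xs = compositions n} π∈ =
  dec , compositions-sound n c∈

partitions-unique : ∀ n → Unique (partitions n)
partitions-unique n = Unique.filter⁺ (linked? ℕ._≥?_) (compositions-unique n)

largest≤sum : ∀ π → largest π ≤ sum π
largest≤sum []      = z≤n
largest≤sum (x ∷ π) =
  ℕ.⊔-lub (ℕ.m≤m+n x (sum π)) (ℕ.≤-trans (largest≤sum π) (ℕ.m≤n+m (sum π) x))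

length≤sum : ∀ {π} → All (0 <_) π → length π ≤ sum π
length≤sum []          = z≤n
length≤sum (0<x ∷ pos) = ℕ.+-mono-≤ 0<x (length≤sum pos)

∣crank∣≤ : ∀ {n π} → IsPartition n π → ℤ.∣ crank π ∣ ≤ n
∣crank∣≤ {π = π} (_ , pos , refl) with ω π
... | zero  = largest≤sum π
... | suc _ = subst (λ i → ℤ.∣ i ∣ ≤ sum π) (sym (ℤ.m-n≡m⊖n (μ π) (ω π)))
                (ℕ.≤-trans (ℤ.∣m⊝n∣≤m⊔n (μ π) (ω π)) (ℕ.⊔-lub μ≤ ω≤))
  where
  μ≤ : μ π ≤ sum π
  μ≤ = ℕ.≤-trans (List.length-filter (ω π ℕ.<?_) π) (length≤sum pos)

  ω≤ : ω π ≤ sum π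
  ω≤ = ℕ.≤-trans (List.length-filter (ℕ._≟ 1) π) (length≤sum pos)

M-support : ∀ m n → n < ℤ.∣ m ∣ → M m n ≡ 0ℤ
M-support (+ suc _)       0 _ = refl
M-support -[1+ _ ]        0 _ = refl
M-support (+ suc (suc _)) 1 _ = refl
M-support -[1+ suc _ ]    1 _ = refl
M-support (+ 1)           1 (s≤s ())
M-support -[1+ 0 ]        1 (s≤s ())
M-support m n@(suc (suc _)) n<∣m∣ =
  cong (+_ ∘ length)
    (List.filter-none (λ π → crank π ℤ.≟ m) {xs = partitions n}
      (All.tabulate λ π∈ crank≡m →
        ℕ.<⇒≱ n<∣m∣ (subst (λ c → ℤ.∣ c ∣ ≤ n) crank≡m (∣crank∣≤ (∈-partitions⁻ π∈)))))

*ˢ-cong-below : ∀ f {g h} n → (∀ i → i ≤ n → g i ≡ h i) → (f *ˢ g) n ≡ (f *ˢ h) n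
*ˢ-cong-below f n g≡h =
  sum-cong-≗ {suc n} λ k → cong (f (toℕ k) ℚ.*_) (g≡h (n ∸ toℕ k) (ℕ.m∸n≤m n (toℕ k)))

*ˢ-identityʳ : ∀ f → f *ˢ 1ˢ ≗ f
*ˢ-identityʳ f zero    = trans (ℚ.+-identityʳ _) (ℚ.*-identityʳ (f 0))
*ˢ-identityʳ f (suc n) = begin
  f 0 ℚ.* 0ℚ ℚ.+ ((f ∘ suc) *ˢ 1ˢ) n  ≡⟨ cong₂ ℚ._+_ (ℚ.*-zeroʳ (f 0)) (*ˢ-identityʳ (f ∘ suc) n) ⟩
  0ℚ ℚ.+ f (suc n)                     ≡⟨ ℚ.+-identityˡ (f (suc n)) ⟩
  f (suc n)                            ∎
  where open ≡-Reasoning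

q^-≢ : ∀ {j i} → i ≢ j → (q^ j) i ≡ 0ℚ
q^-≢ {j} {i} i≢j = cong (if_then 1ℚ else 0ℚ) (dec-false (i ℕ.≟ j) i≢j)

poch-stable : ∀ a m .{{_ : NonZero m}} n N → n < N →
              ∏ N (λ i → 1ˢ -ˢ q^ (a ℕ.+ m ℕ.* i)) n ≡ poch a m n
poch-stable a m n (suc N) n<1+N with ℕ.m≤n⇒m<n∨m≡n (ℕ.≤-pred n<1+N)
... | inj₂ refl = refl
... | inj₁ n<N  = begin
  (F *ˢ (1ˢ -ˢ q^ e)) n  ≡⟨ *ˢ-cong-below F n factor ⟩
  (F *ˢ 1ˢ) n            ≡⟨ *ˢ-identityʳ F n ⟩
  F n                    ≡⟨ poch-stable a m n N n<N ⟩
  poch a m n             ∎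
  where
  open ≡-Reasoning
  e = a ℕ.+ m ℕ.* N
  F = ∏ N (λ i → 1ˢ -ˢ q^ (a ℕ.+ m ℕ.* i))

  n<e : n < e
  n<e = ℕ.<-≤-trans n<N (ℕ.≤-trans (ℕ.m≤n*m N m) (ℕ.m≤n+m (m ℕ.* N) a))

  factor : ∀ i → i ≤ n → (1ˢ -ˢ q^ e) i ≡ 1ˢ i
  factor i i≤n =
    trans (cong (λ x → 1ˢ i ℚ.- x) (q^-≢ (ℕ.<⇒≢ (ℕ.≤-<-trans i≤n n<e))))
          (ℚ.+-identityʳ (1ˢ i))

lookup-inverse : ∀ f .{{_ : ℚ.NonZero (f 0)}} n (k : Fin (suc n)) →
                 lookup (inverse-coeffs f n) k ≡ inverse f (n ∸ toℕ k)
lookup-inverse f zero    zero    = refl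
lookup-inverse f (suc n) zero    = refl
lookup-inverse f (suc n) (suc k) = lookup-inverse f n k

inverseʳ : ∀ f .{{_ : ℚ.NonZero (f 0)}} → f *ˢ inverse f ≗ 1ˢ
inverseʳ f zero    = trans (ℚ.+-identityʳ _) (ℚ.*-inverseʳ (f 0))
inverseʳ f (suc n) = begin
  f 0 ℚ.* (ℚ.- r ℚ.* S) ℚ.+ T   ≡⟨ cong₂ ℚ._+_ (sym (ℚ.*-assoc (f 0) (ℚ.- r) S)) T≡S ⟩
  f 0 ℚ.* (ℚ.- r) ℚ.* S ℚ.+ S   ≡⟨ cong (λ x → x ℚ.* S ℚ.+ S) (sym (ℚ.neg-distribʳ-* (f 0) r)) ⟩
  ℚ.- (f 0 ℚ.* r) ℚ.* S ℚ.+ S   ≡⟨ cong (λ x → ℚ.- x ℚ.* S ℚ.+ S) (ℚ.*-inverseʳ (f 0)) ⟩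
  ℚ.- 1ℚ ℚ.* S ℚ.+ S            ≡⟨ cong (ℚ._+ S) (sym (ℚ.neg-distribˡ-* 1ℚ S)) ⟩
  ℚ.- (1ℚ ℚ.* S) ℚ.+ S          ≡⟨ cong (λ x → ℚ.- x ℚ.+ S) (ℚ.*-identityˡ S) ⟩
  ℚ.- S ℚ.+ S                   ≡⟨ ℚ.+-inverseˡ S ⟩
  0ℚ                            ∎
  where
  open ≡-Reasoning
  r = ℚ.1/ f 0
  S = ∑[ k < suc n ] (f (suc (toℕ k)) ℚ.* lookup (inverse-coeffs f n) k)
  T = ∑[ k < suc n ] (f (suc (toℕ k)) ℚ.* inverse f (n ∸ toℕ k))

  T≡S : T ≡ S
  T≡S = sum-cong-≗ {suc n} λ k → cong (f (suc (toℕ k)) ℚ.*_) (sym (lookup-inverse f n k))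

{-# OPTIONS --safe #-}

-- The crank generating function is C(z) = (q)_∞ / ((zq)_∞ (q/z)_∞).  Hence, over the group ring of ℤ/11
-- (that is, with z¹¹ = 1), Jacobi's triple product gives ϑ(z) C(z) = (1 − z) (q)_∞² for
-- ϑ(z) = Σ (−1)ⁿ zⁿ q^{n(n−1)/2}.  Splitting n modulo 11 turns the components of ϑ(z) into ± q^k Xᵢ; splitting
-- the pentagonal number series in the same way and applying the quintuple product identity writes (q)_∞ as
-- J₁₂₁ times a combination of quotients X₂ᵢ / Xᵢ.  That the vector E(z) of the right-hand sides satisfies the
-- same equation ϑ(z) E(z) = (1 − z) (q)_∞² thus amounts to eleven identities between X₁, …, X₅.  They are
-- consequences of five Plücker relations, which hold because q^b X_{a+b} X_{a−b} is a 2 × 2 determinant.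
-- Now (1 − z) (C(z) − E(z)) = 0, so the components of C and E differ by one and the same series, and this
-- series is Σ p(n) qⁿ / 11 because the components of E add up to zero.
--
-- Everything takes place modulo q^N for an arbitrary N, where infinite sums and products become finite.

module Submission where

open import Defs
open import Algebra.Bundles using (CommutativeRing)
import Algebra.Properties.CommutativeMonoid.Sum as CommutativeMonoidSum
import Algebra.Properties.CommutativeSemigroup as CommutativeSemigroupProperties
import Algebra.Properties.CommutativeSemiring.Exp as CommutativeExp
import Algebra.Properties.Ring as RingProperties
import Algebra.Properties.Semiring.Exp as Exp
import Algebra.Properties.Semiring.Mult as Mult
open import Algebra.Structures using (IsCommutativeRing)
open import Data.Bool using (Bool; true; false; _∧_; T; if_then_else_)
import Data.Bool.Properties as Bool
open import Data.Bool.Properties using (T?)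
import Data.Empty
open import Data.Fin as Fin using (Fin; zero; suc; toℕ; #_)
import Data.Fin.Properties as Fin
open import Data.Integer as ℤ using (ℤ; +_; -[1+_]; 0ℤ; 1ℤ; _⊖_; ∣_∣)
import Data.Integer.DivMod as ℤ
open import Data.Integer.Divisibility.Signed as ℤ using (_∣_; _∣?_; divides)
import Data.Integer.Properties as ℤ
open import Data.List using (List; []; _∷_; _++_; map; filter; cartesianProduct; allFin; upTo; replicate; length; foldr)
open import Data.List.Membership.Propositional using (_∈_)
open import Data.List.Membership.Propositional.Properties using (∈-filter⁺; ∈-filter⁻; ∈-map⁺; ∈-map⁻; ∈-allFin; ∈-cartesianProduct⁺; ∈-upTo⁺; ∈-upTo⁻; ∈-++⁺ˡ; ∈-++⁺ʳ; ∈-++⁻)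
import Data.List.Properties as List
open import Data.List.Relation.Unary.All as All using (All; []; _∷_; all?)
import Data.List.Relation.Unary.All.Properties as All
open import Data.List.Relation.Unary.AllPairs using ([]; _∷_)
open import Data.List.Relation.Unary.Any using (here; there)
open import Data.List.Relation.Unary.Linked as Linked using (Linked; []; [-]; _∷_)
open import Data.List.Relation.Unary.Unique.Propositional using (Unique)
import Data.List.Relation.Unary.Unique.Propositional.Properties as Unique
open import Data.Nat as ℕ using (ℕ; zero; suc; s≤s; z≤n; _≤_; _<_; _≥_; _∸_; NonZero)
import Data.Nat.DivMod as ℕ
open import Data.Nat.ListAction using (sum)
import Data.Nat.Properties as ℕ
import Data.Nat.Solver as ℕ
open import Data.Product using (_×_; _,_; proj₁; proj₂; ∃; uncurry)
open import Data.Rational as ℚ using (ℚ; 0ℚ; 1ℚ)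
import Data.Rational.Properties as ℚ
import Data.Rational.Unnormalised as ℚᵘ
import Data.Rational.Unnormalised.Properties as ℚᵘ
open import Data.Sum using (_⊎_; inj₁; inj₂)
open import Data.Unit using (tt)
open import Data.Vec as Vec using (Vec; []; _∷_; lookup)
open import Data.Vec.N-ary using (N-ary; _$ⁿ_; curryⁿ; Eq; curryⁿ-cong)
import Data.Vec.Properties as Vec
open import Function using (id; _∘_)
open import Level using (0ℓ)
open import Relation.Binary.Definitions using (DecidableEquality)
open import Relation.Binary.PropositionalEquality as ≡ using (_≡_; _≢_; _≗_)
import Relation.Binary.Reasoning.Setoid as SetoidReasoning
open import Relation.Nullary using (yes; no; does; contradiction; Dec)
open import Relation.Nullary.Decidable using (_×-dec_; dec-true; dec-false; from-yes)
open import Relation.Unary using (Decidable)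

-- Ring identities by normalisation of polynomials

-- Working over the group ring instead of adjoining a root of unity avoids every question of linear
-- independence of its powers: components are compared directly. The price is that 1 - z is a zero
-- divisor, so the equation for C(z) alone does not determine it and the sum of all components has
-- to be known as well. The general results are stated for an arbitrary commutative ring with q^N =
-- 0 because the triple product is needed twice: over the group ring for ϑ(z), and over the series
-- for the Xᵢ. For the crank generating function, partitions are classified by their number of ones.
-- In a class with ones the crank is additive over the parts, so the class has a product formula;
-- the q-binomial theorem then adds up the classes. The determinant and quintuple product formulas
-- are changes of variables in double series: the index lattice is split by a parity, the quadratic
-- exponents are matched, and signs do the rest. What remains is an identity of Laurent polynomials
-- in q, X₁, ..., X₅ modulo the Plücker relations. Explicit multipliers certify that the difference
-- lies in their ideal, so normalisation suffices to check it.

infixl 6 _:+_ _:-_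
infixl 7 _:*_
infixr 8 _:^_
infix  9 :-_
infix  4 _:=_

data Expr (n : ℕ) : Set where
  var       : Fin n → Expr n
  con       : ℕ → Expr n
  _:+_ _:*_ : Expr n → Expr n → Expr n
  :-_       : Expr n → Expr n
  _:^_      : Expr n → ℕ → Expr n

_:-_ : ∀ {n} → Expr n → Expr n → Expr n
e :- f = e :+ :- f

_:=_ : ∀ {n} → Expr n → Expr n → Expr n × Expr n
_:=_ = _,_

Monomial : ℕ → Set
Monomial = Vec ℕ

-- (a , b) stands for the integer a − b, which any ring can interpret.
Coefficient : Set
Coefficient = ℕ × ℕ

Polynomial : ℕ → Set
Polynomial n = List (Coefficient × Monomial n)

one : ∀ {n} → Monomial n
one = Vec.replicate _ 0

unit : ∀ {n} → Fin n → Monomial n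
unit zero    = 1 ∷ one
unit (suc i) = 0 ∷ unit i

_·ᵐ_ : ∀ {n} → Monomial n → Monomial n → Monomial n
_·ᵐ_ = Vec.zipWith ℕ._+_

_+ᶜ_ _·ᶜ_ : Coefficient → Coefficient → Coefficient
(a , b) +ᶜ (c , d) = a ℕ.+ c , b ℕ.+ d
(a , b) ·ᶜ (c , d) = a ℕ.* c ℕ.+ b ℕ.* d , a ℕ.* d ℕ.+ b ℕ.* c

insert : ∀ {n} → Coefficient → Monomial n → Polynomial n → Polynomial n
insert c m []            = (c , m) ∷ []
insert c m ((d , l) ∷ p) with Vec.≡-dec ℕ._≟_ m l
... | yes _ = (c +ᶜ d , l) ∷ p
... | no  _ = (d , l) ∷ insert c m p

-- κ rewrites monomials to a canonical form.
module _ {n : ℕ} (κ : Monomial n → Monomial n) where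

  addᵖ : Polynomial n → Polynomial n → Polynomial n
  addᵖ []            r = r
  addᵖ ((c , m) ∷ p) r = insert c m (addᵖ p r)

  scaleᵖ : Coefficient → Monomial n → Polynomial n → Polynomial n
  scaleᵖ c m []            = []
  scaleᵖ c m ((d , l) ∷ p) = insert (c ·ᶜ d) (κ (m ·ᵐ l)) (scaleᵖ c m p)

  mulᵖ : Polynomial n → Polynomial n → Polynomial n
  mulᵖ []            r = []
  mulᵖ ((c , m) ∷ p) r = addᵖ (scaleᵖ c m r) (mulᵖ p r)

  powᵖ : Polynomial n → ℕ → Polynomial n
  powᵖ p zero    = ((1 , 0) , one) ∷ []
  powᵖ p (suc k) = mulᵖ p (powᵖ p k)

  normalise : Expr n → Polynomial n
  normalise (var i)  = ((1 , 0) , unit i) ∷ []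
  normalise (con k)  = ((k , 0) , one) ∷ []
  normalise (e :+ f) = addᵖ (normalise e) (normalise f)
  normalise (e :* f) = mulᵖ (normalise e) (normalise f)
  normalise (:- e)   = scaleᵖ (0 , 1) one (normalise e)
  normalise (e :^ k) = powᵖ (normalise e) k

-- `insert` never drops a monomial whose coefficient has cancelled; such a monomial stays in the
-- list with a pair (a , a).
isZero : ∀ {n} → Polynomial n → Bool
isZero []                  = true
isZero (((a , b) , _) ∷ p) = (a ℕ.≡ᵇ b) ∧ isZero p

module Solver (R : CommutativeRing 0ℓ 0ℓ) where
  open CommutativeRing R
  open RingProperties ring using (-‿+-comm; -‿involutive; -‿distribˡ-*; -‿distribʳ-*; -0#≈0#; -1*x≈-x)
  open CommutativeSemigroupProperties +-commutativeSemigroup using () renaming (interchange to +-interchange)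
  open CommutativeSemigroupProperties *-commutativeSemigroup using () renaming (interchange to *-interchange)
  open Exp semiring using (_^_; ^-homo-*; ^-congˡ)
  open Mult semiring using (×-homo-+; ×1-homo-*) renaming (_×_ to _⊗_)
  open SetoidReasoning setoid

  -- The separate clause for 1 makes `con 1` denote `1#` itself and not `1# + 0#`, so that solved
  -- equations match the goals definitionally.
  literal : ℕ → Carrier
  literal 0             = 0#
  literal 1             = 1#
  literal (suc (suc n)) = 1# + literal (suc n)

  literal-⊗ : ∀ n → n ⊗ 1# ≈ literal n
  literal-⊗ 0             = refl
  literal-⊗ 1             = +-identityʳ 1#
  literal-⊗ (suc (suc n)) = +-congˡ (literal-⊗ (suc n))

  ⟦_⟧ : ∀ {n} → Expr n → Vec Carrier n → Carrier
  ⟦ var i ⟧  ρ = Vec.lookup ρ i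
  ⟦ con k ⟧  ρ = literal k
  ⟦ e :+ f ⟧ ρ = ⟦ e ⟧ ρ + ⟦ f ⟧ ρ
  ⟦ e :* f ⟧ ρ = ⟦ e ⟧ ρ * ⟦ f ⟧ ρ
  ⟦ :- e ⟧   ρ = - ⟦ e ⟧ ρ
  ⟦ e :^ k ⟧ ρ = ⟦ e ⟧ ρ ^ k

  ⟦_⟧ᵐ : ∀ {n} → Monomial n → Vec Carrier n → Carrier
  ⟦ [] ⟧ᵐ    []      = 1#
  ⟦ e ∷ m ⟧ᵐ (x ∷ ρ) = x ^ e * ⟦ m ⟧ᵐ ρ

  ⟦_⟧ᶜ : Coefficient → Carrier
  ⟦ a , b ⟧ᶜ = a ⊗ 1# - b ⊗ 1#

  ⟦_⟧ᵖ : ∀ {n} → Polynomial n → Vec Carrier n → Carrier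
  ⟦ [] ⟧ᵖ          ρ = 0#
  ⟦ (c , m) ∷ p ⟧ᵖ ρ = ⟦ c ⟧ᶜ * ⟦ m ⟧ᵐ ρ + ⟦ p ⟧ᵖ ρ

  one-sound : ∀ {n} (ρ : Vec Carrier n) → ⟦ one ⟧ᵐ ρ ≈ 1#
  one-sound []      = refl
  one-sound (x ∷ ρ) = trans (*-identityˡ _) (one-sound ρ)

  unit-sound : ∀ {n} (i : Fin n) ρ → ⟦ unit i ⟧ᵐ ρ ≈ Vec.lookup ρ i
  unit-sound zero    (x ∷ ρ) = trans (*-cong (*-identityʳ x) (one-sound ρ)) (*-identityʳ x)
  unit-sound (suc i) (x ∷ ρ) = trans (*-identityˡ _) (unit-sound i ρ)

  ·ᵐ-sound : ∀ {n} (m l : Monomial n) ρ → ⟦ m ·ᵐ l ⟧ᵐ ρ ≈ ⟦ m ⟧ᵐ ρ * ⟦ l ⟧ᵐ ρ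
  ·ᵐ-sound []      []      []      = sym (*-identityˡ 1#)
  ·ᵐ-sound (d ∷ m) (e ∷ l) (x ∷ ρ) =
    trans (*-cong (^-homo-* x d e) (·ᵐ-sound m l ρ)) (*-interchange _ _ _ _)

  +ᶜ-sound : ∀ c d → ⟦ c +ᶜ d ⟧ᶜ ≈ ⟦ c ⟧ᶜ + ⟦ d ⟧ᶜ
  +ᶜ-sound (a , b) (c , d) = begin
    (a ℕ.+ c) ⊗ 1# - (b ℕ.+ d) ⊗ 1#
      ≈⟨ +-cong (×-homo-+ 1# a c) (-‿cong (×-homo-+ 1# b d)) ⟩
    (a ⊗ 1# + c ⊗ 1#) - (b ⊗ 1# + d ⊗ 1#)
      ≈⟨ +-congˡ (-‿+-comm _ _) ⟨
    (a ⊗ 1# + c ⊗ 1#) + (- (b ⊗ 1#) - d ⊗ 1#)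
      ≈⟨ +-interchange _ _ _ _ ⟩
    (a ⊗ 1# - b ⊗ 1#) + (c ⊗ 1# - d ⊗ 1#) ∎

  expand : ∀ a b c d → (a - b) * (c - d) ≈ (a * c + b * d) - (a * d + b * c)
  expand a b c d = begin
    (a - b) * (c - d)
      ≈⟨ distribʳ (c - d) a (- b) ⟩
    a * (c - d) + - b * (c - d)
      ≈⟨ +-cong (distribˡ a c (- d)) (distribˡ (- b) c (- d)) ⟩
    (a * c + a * - d) + (- b * c + - b * - d)
      ≈⟨ +-cong (+-congˡ (sym (-‿distribʳ-* a d))) (+-cong (sym (-‿distribˡ-* b c)) (trans (sym (-‿distribˡ-* b (- d))) (trans (-‿cong (sym (-‿distribʳ-* b d))) (-‿involutive _)))) ⟩
    (a * c - a * d) + (- (b * c) + b * d)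
      ≈⟨ +-congˡ (+-comm _ _) ⟩
    (a * c - a * d) + (b * d - b * c)
      ≈⟨ +-interchange _ _ _ _ ⟩
    (a * c + b * d) + (- (a * d) - b * c)
      ≈⟨ +-congˡ (-‿+-comm _ _) ⟩
    (a * c + b * d) - (a * d + b * c) ∎

  ·ᶜ-sound : ∀ c d → ⟦ c ·ᶜ d ⟧ᶜ ≈ ⟦ c ⟧ᶜ * ⟦ d ⟧ᶜ
  ·ᶜ-sound (a , b) (c , d) = trans (+-cong (eq a c b d) (-‿cong (eq a d b c))) (sym (expand _ _ _ _))
    where
    eq : ∀ a c b d → (a ℕ.* c ℕ.+ b ℕ.* d) ⊗ 1# ≈ (a ⊗ 1#) * (c ⊗ 1#) + (b ⊗ 1#) * (d ⊗ 1#)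
    eq a c b d = trans (×-homo-+ 1# (a ℕ.* c) (b ℕ.* d)) (+-cong (×1-homo-* a c) (×1-homo-* b d))

  insert-sound : ∀ {n} c (m : Monomial n) p ρ → ⟦ insert c m p ⟧ᵖ ρ ≈ ⟦ c ⟧ᶜ * ⟦ m ⟧ᵐ ρ + ⟦ p ⟧ᵖ ρ
  insert-sound c m []            ρ = refl
  insert-sound c m ((d , l) ∷ p) ρ with Vec.≡-dec ℕ._≟_ m l
  ... | yes ≡.refl = trans (+-congʳ (trans (*-congʳ (+ᶜ-sound c d)) (distribʳ _ _ _))) (+-assoc _ _ _)
  ... | no  _      = begin
    x + ⟦ insert c m p ⟧ᵖ ρ ≈⟨ +-congˡ (insert-sound c m p ρ) ⟩
    x + (y + z)             ≈⟨ +-assoc x y z ⟨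
    x + y + z               ≈⟨ +-congʳ (+-comm x y) ⟩
    y + x + z               ≈⟨ +-assoc y x z ⟩
    y + (x + z)             ∎
    where
    x = ⟦ d ⟧ᶜ * ⟦ l ⟧ᵐ ρ
    y = ⟦ c ⟧ᶜ * ⟦ m ⟧ᵐ ρ
    z = ⟦ p ⟧ᵖ ρ

  -- Soundness of `κ` is asked for at a single environment `ρ`. Hence relations between particular
  -- elements, such as x u = 1, can be built into the normal form.
  module _ {n} (κ : Monomial n → Monomial n) (ρ : Vec Carrier n) (κ-sound : ∀ m → ⟦ κ m ⟧ᵐ ρ ≈ ⟦ m ⟧ᵐ ρ) where

    addᵖ-sound : ∀ p r → ⟦ addᵖ κ p r ⟧ᵖ ρ ≈ ⟦ p ⟧ᵖ ρ + ⟦ r ⟧ᵖ ρ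
    addᵖ-sound []            r = sym (+-identityˡ _)
    addᵖ-sound ((c , m) ∷ p) r =
      trans (insert-sound c m (addᵖ κ p r) ρ) (trans (+-congˡ (addᵖ-sound p r)) (sym (+-assoc _ _ _)))

    scaleᵖ-sound : ∀ c m p → ⟦ scaleᵖ κ c m p ⟧ᵖ ρ ≈ ⟦ c ⟧ᶜ * ⟦ m ⟧ᵐ ρ * ⟦ p ⟧ᵖ ρ
    scaleᵖ-sound c m []            = sym (zeroʳ _)
    scaleᵖ-sound c m ((d , l) ∷ p) = begin
      ⟦ insert (c ·ᶜ d) (κ (m ·ᵐ l)) (scaleᵖ κ c m p) ⟧ᵖ ρ
        ≈⟨ insert-sound (c ·ᶜ d) (κ (m ·ᵐ l)) (scaleᵖ κ c m p) ρ ⟩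
      ⟦ c ·ᶜ d ⟧ᶜ * ⟦ κ (m ·ᵐ l) ⟧ᵐ ρ + ⟦ scaleᵖ κ c m p ⟧ᵖ ρ
        ≈⟨ +-cong (*-cong (·ᶜ-sound c d) (trans (κ-sound (m ·ᵐ l)) (·ᵐ-sound m l ρ))) (scaleᵖ-sound c m p) ⟩
      ⟦ c ⟧ᶜ * ⟦ d ⟧ᶜ * (⟦ m ⟧ᵐ ρ * ⟦ l ⟧ᵐ ρ) + ⟦ c ⟧ᶜ * ⟦ m ⟧ᵐ ρ * ⟦ p ⟧ᵖ ρ
        ≈⟨ +-congʳ (*-interchange _ _ _ _) ⟩
      ⟦ c ⟧ᶜ * ⟦ m ⟧ᵐ ρ * (⟦ d ⟧ᶜ * ⟦ l ⟧ᵐ ρ) + ⟦ c ⟧ᶜ * ⟦ m ⟧ᵐ ρ * ⟦ p ⟧ᵖ ρ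
        ≈⟨ distribˡ _ _ _ ⟨
      ⟦ c ⟧ᶜ * ⟦ m ⟧ᵐ ρ * (⟦ d ⟧ᶜ * ⟦ l ⟧ᵐ ρ + ⟦ p ⟧ᵖ ρ) ∎

    mulᵖ-sound : ∀ p r → ⟦ mulᵖ κ p r ⟧ᵖ ρ ≈ ⟦ p ⟧ᵖ ρ * ⟦ r ⟧ᵖ ρ
    mulᵖ-sound []            r = sym (zeroˡ _)
    mulᵖ-sound ((c , m) ∷ p) r = begin
      ⟦ addᵖ κ (scaleᵖ κ c m r) (mulᵖ κ p r) ⟧ᵖ ρ
        ≈⟨ addᵖ-sound (scaleᵖ κ c m r) (mulᵖ κ p r) ⟩
      ⟦ scaleᵖ κ c m r ⟧ᵖ ρ + ⟦ mulᵖ κ p r ⟧ᵖ ρ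
        ≈⟨ +-cong (scaleᵖ-sound c m r) (mulᵖ-sound p r) ⟩
      ⟦ c ⟧ᶜ * ⟦ m ⟧ᵐ ρ * ⟦ r ⟧ᵖ ρ + ⟦ p ⟧ᵖ ρ * ⟦ r ⟧ᵖ ρ
        ≈⟨ distribʳ _ _ _ ⟨
      (⟦ c ⟧ᶜ * ⟦ m ⟧ᵐ ρ + ⟦ p ⟧ᵖ ρ) * ⟦ r ⟧ᵖ ρ ∎

    constant-sound : ∀ k → ⟦ ((k , 0) , one) ∷ [] ⟧ᵖ ρ ≈ k ⊗ 1#
    constant-sound k = begin
      (k ⊗ 1# - 0#) * ⟦ one ⟧ᵐ ρ + 0#  ≈⟨ +-identityʳ _ ⟩
      (k ⊗ 1# - 0#) * ⟦ one ⟧ᵐ ρ       ≈⟨ *-cong (trans (+-congˡ -0#≈0#) (+-identityʳ _)) (one-sound ρ) ⟩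
      k ⊗ 1# * 1#                      ≈⟨ *-identityʳ _ ⟩
      k ⊗ 1#                           ∎

    1-sound : ⟦ ((1 , 0) , one) ∷ [] ⟧ᵖ ρ ≈ 1#
    1-sound = trans (constant-sound 1) (+-identityʳ 1#)

    powᵖ-sound : ∀ p k → ⟦ powᵖ κ p k ⟧ᵖ ρ ≈ ⟦ p ⟧ᵖ ρ ^ k
    powᵖ-sound p zero    = 1-sound
    powᵖ-sound p (suc k) = trans (mulᵖ-sound p (powᵖ κ p k)) (*-congˡ (powᵖ-sound p k))

    normalise-sound : ∀ e → ⟦ normalise κ e ⟧ᵖ ρ ≈ ⟦ e ⟧ ρ
    normalise-sound (var i)  = begin
      (1 ⊗ 1# - 0#) * ⟦ unit i ⟧ᵐ ρ + 0#  ≈⟨ +-identityʳ _ ⟩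
      (1 ⊗ 1# - 0#) * ⟦ unit i ⟧ᵐ ρ       ≈⟨ *-cong (trans (+-congˡ -0#≈0#) (trans (+-identityʳ _) (+-identityʳ 1#))) (unit-sound i ρ) ⟩
      1# * Vec.lookup ρ i                  ≈⟨ *-identityˡ _ ⟩
      Vec.lookup ρ i                       ∎
    normalise-sound (con k)  = trans (constant-sound k) (literal-⊗ k)
    normalise-sound (e :+ f) =
      trans (addᵖ-sound (normalise κ e) (normalise κ f)) (+-cong (normalise-sound e) (normalise-sound f))
    normalise-sound (e :* f) =
      trans (mulᵖ-sound (normalise κ e) (normalise κ f)) (*-cong (normalise-sound e) (normalise-sound f))
    normalise-sound (:- e)   = begin
      ⟦ scaleᵖ κ (0 , 1) one (normalise κ e) ⟧ᵖ ρ
        ≈⟨ scaleᵖ-sound (0 , 1) one (normalise κ e) ⟩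
      (0# - 1 ⊗ 1#) * ⟦ one ⟧ᵐ ρ * ⟦ normalise κ e ⟧ᵖ ρ
        ≈⟨ *-cong (*-cong (trans (+-identityˡ _) (-‿cong (+-identityʳ 1#))) (one-sound ρ)) (normalise-sound e) ⟩
      - 1# * 1# * ⟦ e ⟧ ρ
        ≈⟨ *-congʳ (*-identityʳ _) ⟩
      - 1# * ⟦ e ⟧ ρ
        ≈⟨ -1*x≈-x _ ⟩
      - ⟦ e ⟧ ρ ∎
    normalise-sound (e :^ k) = trans (powᵖ-sound (normalise κ e) k) (^-congˡ k (normalise-sound e))

  isZero-sound : ∀ {n} (p : Polynomial n) ρ → T (isZero p) → ⟦ p ⟧ᵖ ρ ≈ 0#
  isZero-sound []                  ρ _  = refl
  isZero-sound (((a , b) , m) ∷ p) ρ t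
    with a ℕ.≡ᵇ b in eq
  ... | true with ≡.refl ← ℕ.≡ᵇ⇒≡ a b (≡.subst T (≡.sym eq) tt) =
    trans (+-cong (trans (*-congʳ (-‿inverseʳ _)) (zeroˡ _)) (isZero-sound p ρ t)) (+-identityʳ 0#)

  prove : ∀ {n} (κ : Monomial n → Monomial n) (ρ : Vec Carrier n) →
          (∀ m → ⟦ κ m ⟧ᵐ ρ ≈ ⟦ m ⟧ᵐ ρ) →
          ∀ e f → T (isZero (normalise κ (e :- f))) → ⟦ e ⟧ ρ ≈ ⟦ f ⟧ ρ
  prove κ ρ κ-sound e f t = begin
    x               ≈⟨ +-identityʳ x ⟨
    x + 0#          ≈⟨ +-congˡ (-‿inverseˡ y) ⟨
    x + (- y + y)   ≈⟨ +-assoc x (- y) y ⟨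
    x - y + y       ≈⟨ +-congʳ (trans (sym (normalise-sound κ ρ κ-sound (e :- f))) (isZero-sound (normalise κ (e :- f)) ρ t)) ⟩
    0# + y          ≈⟨ +-identityˡ y ⟩
    y               ∎
    where
    x = ⟦ e ⟧ ρ
    y = ⟦ f ⟧ ρ

  solve : ∀ n (f : N-ary n (Expr n) (Expr n × Expr n)) →
          let e = f $ⁿ Vec.map var (Vec.allFin n) in
          {T (isZero (normalise id (proj₁ e :- proj₂ e)))} →
          Eq n _≈_ (curryⁿ ⟦ proj₁ e ⟧) (curryⁿ ⟦ proj₂ e ⟧)
  solve n f {t} = curryⁿ-cong _≈_ ⟦ proj₁ e ⟧ ⟦ proj₂ e ⟧ λ ρ → prove id ρ (λ _ → refl) (proj₁ e) (proj₂ e) t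
    where e = f $ⁿ Vec.map var (Vec.allFin n)

-- Sums over lists and summable families

-- Named so that module telescopes can state the hypothesis before the operations of the ring are in
-- scope.
PowerVanishes : (B : CommutativeRing 0ℓ 0ℓ) → CommutativeRing.Carrier B → ℕ → Set
PowerVanishes B q N = q ^ N ≈ 0#
  where
  open CommutativeRing B
  open Exp semiring using (_^_)

MutuallyInverse : (B : CommutativeRing 0ℓ 0ℓ) (x y : CommutativeRing.Carrier B) → Set
MutuallyInverse B x y = x * y ≈ 1#
  where open CommutativeRing B

unique-map : ∀ {I J : Set} {f : I → J} {xs} →
             (∀ {x y} → x ∈ xs → y ∈ xs → f x ≡ f y → x ≡ y) → Unique xs → Unique (map f xs)
unique-map inj []       = []
unique-map inj (p ∷ ps) =
  All.map⁺ (All.tabulate λ y∈ fx≡fy → All.lookup p y∈ (inj (here ≡.refl) (there y∈) fx≡fy))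
  ∷ unique-map (λ x∈ y∈ → inj (there x∈) (there y∈)) ps

module Sums (B : CommutativeRing 0ℓ 0ℓ) where
  open CommutativeRing B
  open RingProperties ring using (-‿+-comm; -0#≈0#)
  open CommutativeSemigroupProperties +-commutativeSemigroup using (x∙yz≈y∙xz) renaming (interchange to +-interchange)
  open SetoidReasoning setoid

  private variable
    I I′ Key : Set

  sumOver : (I → Carrier) → List I → Carrier
  sumOver f []       = 0#
  sumOver f (x ∷ xs) = f x + sumOver f xs

  sumOver-cong∈ : ∀ {f g : I → Carrier} xs → (∀ {x} → x ∈ xs → f x ≈ g x) → sumOver f xs ≈ sumOver g xs
  sumOver-cong∈ []       f≈g = refl
  sumOver-cong∈ (x ∷ xs) f≈g = +-cong (f≈g (here ≡.refl)) (sumOver-cong∈ xs (f≈g ∘ there))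

  sumOver-cong : ∀ {f g : I → Carrier} xs → (∀ x → f x ≈ g x) → sumOver f xs ≈ sumOver g xs
  sumOver-cong xs f≈g = sumOver-cong∈ xs λ {x} _ → f≈g x

  sumOver-0 : ∀ {f : I → Carrier} xs → (∀ {x} → x ∈ xs → f x ≈ 0#) → sumOver f xs ≈ 0#
  sumOver-0 []       f≈0 = refl
  sumOver-0 (x ∷ xs) f≈0 = trans (+-cong (f≈0 (here ≡.refl)) (sumOver-0 xs (f≈0 ∘ there))) (+-identityʳ 0#)

  sumOver-++ : ∀ (f : I → Carrier) xs ys → sumOver f (xs ++ ys) ≈ sumOver f xs + sumOver f ys
  sumOver-++ f []       ys = sym (+-identityˡ _)
  sumOver-++ f (x ∷ xs) ys = trans (+-congˡ (sumOver-++ f xs ys)) (sym (+-assoc _ _ _))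

  sumOver-map : ∀ (f : I′ → Carrier) (g : I → I′) xs → sumOver f (map g xs) ≡ sumOver (f ∘ g) xs
  sumOver-map f g []       = ≡.refl
  sumOver-map f g (x ∷ xs) = ≡.cong (λ s → f (g x) + s) (sumOver-map f g xs)

  sumOver-+ : ∀ (f g : I → Carrier) xs → sumOver (λ x → f x + g x) xs ≈ sumOver f xs + sumOver g xs
  sumOver-+ f g []       = sym (+-identityʳ 0#)
  sumOver-+ f g (x ∷ xs) = trans (+-congˡ (sumOver-+ f g xs)) (+-interchange _ _ _ _)

  sumOver-neg : ∀ (f : I → Carrier) xs → sumOver (λ x → - f x) xs ≈ - sumOver f xs
  sumOver-neg f []       = sym -0#≈0#
  sumOver-neg f (x ∷ xs) = trans (+-congˡ (sumOver-neg f xs)) (-‿+-comm _ _)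

  sumOver-*ˡ : ∀ c (f : I → Carrier) xs → sumOver (λ x → c * f x) xs ≈ c * sumOver f xs
  sumOver-*ˡ c f []       = sym (zeroʳ c)
  sumOver-*ˡ c f (x ∷ xs) = trans (+-congˡ (sumOver-*ˡ c f xs)) (sym (distribˡ _ _ _))

  sumOver-*ʳ : ∀ c (f : I → Carrier) xs → sumOver (λ x → f x * c) xs ≈ sumOver f xs * c
  sumOver-*ʳ c f xs =
    trans (sumOver-cong xs λ x → *-comm (f x) c) (trans (sumOver-*ˡ c f xs) (*-comm c _))

  sumOver-swap : ∀ (f : I → I′ → Carrier) xs ys →
                 sumOver (λ x → sumOver (f x) ys) xs ≈ sumOver (λ y → sumOver (λ x → f x y) xs) ys
  sumOver-swap f []       ys = sym (sumOver-0 ys λ _ → refl)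
  sumOver-swap f (x ∷ xs) ys = trans (+-congˡ (sumOver-swap f xs ys)) (sym (sumOver-+ (f x) _ ys))

  sumOver-× : ∀ (f : I → Carrier) (g : I′ → Carrier) xs ys →
              sumOver (λ p → f (proj₁ p) * g (proj₂ p)) (cartesianProduct xs ys) ≈ sumOver f xs * sumOver g ys
  sumOver-× f g []       ys = sym (zeroˡ _)
  sumOver-× f g (x ∷ xs) ys = begin
    sumOver h (map (x ,_) ys ++ cartesianProduct xs ys)
      ≈⟨ sumOver-++ h (map (x ,_) ys) _ ⟩
    sumOver h (map (x ,_) ys) + sumOver h (cartesianProduct xs ys)
      ≈⟨ +-cong (trans (reflexive (sumOver-map h (x ,_) ys)) (sumOver-*ˡ (f x) g ys)) (sumOver-× f g xs ys) ⟩
    f x * sumOver g ys + sumOver f xs * sumOver g ys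
      ≈⟨ distribʳ _ _ _ ⟨
    (f x + sumOver f xs) * sumOver g ys ∎
    where h = λ p → f (proj₁ p) * g (proj₂ p)

  private
    -- Removes x: the last two components say that the members of `ys′` are exactly those of `ys`
    -- other than x. This drives the induction in `sumOver-unique`.
    extract : ∀ {x : I} {ys} → x ∈ ys → Unique ys →
              ∃ λ ys′ → Unique ys′ × (∀ t → sumOver t ys ≈ t x + sumOver t ys′)
                      × (∀ {y} → y ∈ ys → y ≡ x ⊎ y ∈ ys′) × (∀ {y} → y ∈ ys′ → y ∈ ys × y ≢ x)
    extract {ys = _ ∷ ys} (here ≡.refl) (p ∷ ps) =
      ys , ps , (λ t → refl) , (λ { (here eq) → inj₁ eq ; (there y∈) → inj₂ y∈ })
         , λ y∈ → there y∈ , λ y≡x → All.lookup p y∈ (≡.sym y≡x)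
    extract {ys = y₀ ∷ ys} (there x∈) (p ∷ ps)
      with ys′ , u , s , to , from ← extract x∈ ps =
      y₀ ∷ ys′
      , All.tabulate (λ y∈ → All.lookup p (proj₁ (from y∈))) ∷ u
      , (λ t → trans (+-congˡ (s t)) (x∙yz≈y∙xz _ _ _))
      , (λ { (here eq) → inj₂ (here eq)
           ; (there y∈) → Data.Sum.map₂ there (to y∈) })
      , λ { (here ≡.refl) → here ≡.refl , λ y≡x → All.lookup p x∈ y≡x
          ; (there y∈)    → there (proj₁ (from y∈)) , proj₂ (from y∈) }

  -- Sums over duplicate-free lists only depend on the members at which the summand does not vanish.
  sumOver-unique : ∀ (t : I → Carrier) {xs ys} → Unique xs → Unique ys →
                   (∀ {x} → x ∈ xs → x ∈ ys ⊎ t x ≈ 0#) → (∀ {y} → y ∈ ys → y ∈ xs ⊎ t y ≈ 0#) →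
                   sumOver t xs ≈ sumOver t ys
  sumOver-unique t {[]} {ys} [] uys to from = sym (sumOver-0 ys λ y∈ → vanish (from y∈))
    where
    vanish : ∀ {y} → y ∈ [] ⊎ t y ≈ 0# → t y ≈ 0#
    vanish (inj₂ eq) = eq
  sumOver-unique t {x ∷ xs} {ys} (p ∷ ps) uys to from with to (here ≡.refl)
  ... | inj₂ tx≈0 =
    trans (+-cong tx≈0 (sumOver-unique t ps uys (to ∘ there) from′)) (+-identityˡ _)
    where
    from′ : ∀ {y} → y ∈ ys → y ∈ xs ⊎ t y ≈ 0#
    from′ y∈ with from y∈
    ... | inj₁ (here ≡.refl) = inj₂ tx≈0
    ... | inj₁ (there y∈xs)  = inj₁ y∈xs
    ... | inj₂ ty≈0          = inj₂ ty≈0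
  ... | inj₁ x∈ys with ys′ , u , s , split , back ← extract x∈ys uys =
    trans (+-congˡ (sumOver-unique t ps u to′ from′)) (sym (s t))
    where
    to′ : ∀ {y} → y ∈ xs → y ∈ ys′ ⊎ t y ≈ 0#
    to′ y∈xs with to (there y∈xs)
    ... | inj₂ ty≈0 = inj₂ ty≈0
    ... | inj₁ y∈ys with split y∈ys
    ...   | inj₁ y≡x   = contradiction (≡.sym y≡x) (All.lookup p y∈xs)
    ...   | inj₂ y∈ys′ = inj₁ y∈ys′
    from′ : ∀ {y} → y ∈ ys′ → y ∈ xs ⊎ t y ≈ 0#
    from′ y∈ with back y∈
    ... | y∈ys , y≢x with from y∈ys
    ...   | inj₂ ty≈0          = inj₂ ty≈0
    ...   | inj₁ (here y≡x)    = contradiction y≡x y≢x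
    ...   | inj₁ (there y∈xs)  = inj₁ y∈xs

  module _ (_≟_ : DecidableEquality Key) (κ : I → Key) where

    private
      class : Key → List I → List I
      class k = filter (λ x → κ x ≟ k)

      class-hit : ∀ t x xs → sumOver t (class (κ x) (x ∷ xs)) ≈ t x + sumOver t (class (κ x) xs)
      class-hit t x xs with κ x ≟ κ x
      ... | yes _ = refl
      ... | no ¬p = contradiction ≡.refl ¬p

      class-miss : ∀ t {k} x xs → κ x ≢ k → sumOver t (class k (x ∷ xs)) ≈ sumOver t (class k xs)
      class-miss t {k} x xs κx≢k with κ x ≟ k
      ... | yes κx≡k = contradiction κx≡k κx≢k
      ... | no  _    = refl

      class-∷ : ∀ t x xs {ks} → Unique ks → κ x ∈ ks →
                sumOver (λ k → sumOver t (class k (x ∷ xs))) ks ≈ t x + sumOver (λ k → sumOver t (class k xs)) ks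
      class-∷ t x xs {k ∷ ks} (p ∷ ps) (here ≡.refl) =
        trans (+-cong (class-hit t x xs) (sumOver-cong∈ ks λ k∈ → class-miss t x xs (All.lookup p k∈)))
              (+-assoc _ _ _)
      class-∷ t x xs {k ∷ ks} (p ∷ ps) (there κx∈) =
        trans (+-cong (class-miss t x xs λ κx≡k → All.lookup p κx∈ (≡.sym κx≡k)) (class-∷ t x xs ps κx∈))
              (x∙yz≈y∙xz _ _ _)

    sumOver-classes : ∀ t xs {ks} → Unique ks → (∀ {x} → x ∈ xs → κ x ∈ ks) →
                      sumOver t xs ≈ sumOver (λ k → sumOver t (filter (λ x → κ x ≟ k) xs)) ks
    sumOver-classes t []       {ks} u κ∈ = sym (sumOver-0 ks λ _ → refl)
    sumOver-classes t (x ∷ xs) {ks} u κ∈ =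
      trans (+-congˡ (sumOver-classes t xs u (κ∈ ∘ there))) (sym (class-∷ t x xs u (κ∈ (here ≡.refl))))

-- A bijection between I and r copies of J, along which a sum over I falls into r sums over J. It
-- serves for residue classes of ℤ and for the two parity classes of a lattice in ℤ².
record Split (r : ℕ) (J I : Set) : Set where
  field
    join      : Fin r → J → I
    part      : I → Fin r × J
    join-part : ∀ i → uncurry join (part i) ≡ i
    part-join : ∀ s j → part (join s j) ≡ (s , j)

-- Integer powers of units, and signs

module Powers (B : CommutativeRing 0ℓ 0ℓ) where
  open CommutativeRing B
  open Exp semiring using (_^_; ^-homo-*)
  open RingProperties ring using (-1*x≈-x; -‿involutive)
  open CommutativeSemigroupProperties *-commutativeSemigroup using () renaming (interchange to *-interchange)
  open SetoidReasoning setoid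

  module Unit (z w : Carrier) (zw≈1 : z * w ≈ 1#) where

    pow : ℤ → Carrier
    pow (+ n)    = z ^ n
    pow -[1+ n ] = w ^ suc n

    pow-⊖ : ∀ m n → pow (m ⊖ n) ≈ z ^ m * w ^ n
    pow-⊖ m       zero    = sym (*-identityʳ _)
    pow-⊖ zero    (suc n) = sym (*-identityˡ _)
    pow-⊖ (suc m) (suc n) = begin
      pow (suc m ⊖ suc n)        ≡⟨ ≡.cong pow (ℤ.[1+m]⊖[1+n]≡m⊖n m n) ⟩
      pow (m ⊖ n)                ≈⟨ pow-⊖ m n ⟩
      z ^ m * w ^ n              ≈⟨ *-identityˡ _ ⟨
      1# * (z ^ m * w ^ n)       ≈⟨ *-congʳ zw≈1 ⟨
      z * w * (z ^ m * w ^ n)    ≈⟨ *-interchange _ _ _ _ ⟩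
      z ^ suc m * w ^ suc n      ∎

    pow-+ : ∀ i j → pow (i ℤ.+ j) ≈ pow i * pow j
    pow-+ (+ m)    (+ n)    = ^-homo-* z m n
    pow-+ (+ m)    -[1+ n ] = pow-⊖ m (suc n)
    pow-+ -[1+ m ] (+ n)    = trans (pow-⊖ n (suc m)) (*-comm _ _)
    pow-+ -[1+ m ] -[1+ n ] = trans (reflexive (≡.cong (w ^_) (≡.cong suc (≡.sym (ℕ.+-suc m n))))) (^-homo-* w (suc m) (suc n))

  open Unit (- 1#) (- 1#) (trans (-1*x≈-x (- 1#)) (-‿involutive 1#)) public
    using () renaming (pow to ε; pow-+ to ε-+)

  ε² : ∀ i → ε i * ε i ≈ 1#
  ε² (+ n)    = square n
    where
    square : ∀ n → (- 1#) ^ n * (- 1#) ^ n ≈ 1#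
    square zero    = *-identityˡ 1#
    square (suc n) = trans (*-interchange _ _ _ _) (trans (*-cong (trans (-1*x≈-x (- 1#)) (-‿involutive 1#)) (square n)) (*-identityˡ 1#))
  ε² -[1+ n ] = ε² (+ suc n)

  ε-double : ∀ i → ε (i ℤ.+ i) ≈ 1#
  ε-double i = trans (ε-+ i i) (ε² i)

-- Infinite sums in a ring where q is nilpotent

module Nilpotent (B : CommutativeRing 0ℓ 0ℓ)
                 (q : CommutativeRing.Carrier B) (N : ℕ) (q^N≈0 : PowerVanishes B q N) where
  open CommutativeRing B
  open Exp semiring using (_^_)
  open Exp semiring using (^-homo-*)
  open CommutativeSemigroupProperties *-commutativeSemigroup using () renaming (interchange to *-interchange)
  open SetoidReasoning setoid
  open Sums B public

  q^≥N : ∀ {k} → N ℕ.≤ k → q ^ k ≈ 0#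
  q^≥N {k} N≤k = begin
    q ^ k                   ≡⟨ ≡.cong (q ^_) (≡.sym (ℕ.m+[n∸m]≡n N≤k)) ⟩
    q ^ (N ℕ.+ (k ℕ.∸ N))   ≈⟨ ^-homo-* q N (k ℕ.∸ N) ⟩
    q ^ N * q ^ (k ℕ.∸ N)   ≈⟨ *-congʳ q^N≈0 ⟩
    0# * q ^ (k ℕ.∸ N)      ≈⟨ zeroˡ _ ⟩
    0#                      ∎

  -- Only used with non-negative exponents, where it is multiplicative.
  qᶻ : ℤ → Carrier
  qᶻ i = q ^ ∣ i ∣

  qᶻ-+ : ∀ {i j} → 0ℤ ℤ.≤ i → 0ℤ ℤ.≤ j → qᶻ (i ℤ.+ j) ≈ qᶻ i * qᶻ j
  qᶻ-+ (ℤ.+≤+ {n = m} _) (ℤ.+≤+ {n = n} _) = ^-homo-* q m n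

  -- The formally infinite sum of `coef i` q^`expo i`. Any duplicate-free list containing all
  -- indices with exponent below N may be its support: further terms vanish because q^N = 0, so
  -- `total` does not depend on the choice.
  record Family (I : Set) : Set where
    field
      coef    : I → Carrier
      expo    : I → ℤ
      expo≥0  : ∀ i → 0ℤ ℤ.≤ expo i
      support : List I
      unique  : Unique support
      covers  : ∀ i → ∣ expo i ∣ ℕ.< N → i ∈ support

    term : I → Carrier
    term i = coef i * qᶻ (expo i)

    total : Carrier
    total = sumOver term support

    supported : ∀ i → i ∈ support ⊎ term i ≈ 0#
    supported i with ∣ expo i ∣ ℕ.<? N
    ... | yes e<N = inj₁ (covers i e<N)
    ... | no  e≮N = inj₂ (trans (*-congˡ (q^≥N (ℕ.≮⇒≥ e≮N))) (zeroʳ _))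

  open Family public using (total)

  private variable
    I I′ : Set

  total-cong : (F G : Family I) → (∀ i → Family.coef F i ≈ Family.coef G i) →
               (∀ i → Family.expo F i ≡ Family.expo G i) → total F ≈ total G
  total-cong F G c≈ e≡ =
    trans (sumOver-unique F.term F.unique G.unique
            (λ {x} _ → Data.Sum.map₂ (trans (eq x)) (G.supported x)) (λ {y} _ → F.supported y))
          (sumOver-cong G.support eq)
    where
    module F = Family F
    module G = Family G
    eq : ∀ i → F.term i ≈ G.term i
    eq i = *-cong (c≈ i) (reflexive (≡.cong qᶻ (e≡ i)))

  _⊗_ : Family I → Family I′ → Family (I × I′)
  F ⊗ G = record
    { coef    = λ (i , j) → F.coef i * G.coef j
    ; expo    = λ (i , j) → F.expo i ℤ.+ G.expo j
    ; expo≥0  = λ (i , j) → ℤ.+-mono-≤ (F.expo≥0 i) (G.expo≥0 j)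
    ; support = cartesianProduct F.support G.support
    ; unique  = Unique.cartesianProduct⁺ F.unique G.unique
    ; covers  = λ (i , j) e<N → ∈-cartesianProduct⁺
        (F.covers i (ℕ.≤-<-trans (ℕ.≤-trans (ℕ.m≤m+n _ _) (ℕ.≤-reflexive (≡.sym (abs (F.expo≥0 i) (G.expo≥0 j))))) e<N))
        (G.covers j (ℕ.≤-<-trans (ℕ.≤-trans (ℕ.m≤n+m _ _) (ℕ.≤-reflexive (≡.sym (abs (F.expo≥0 i) (G.expo≥0 j))))) e<N))
    }
    where
    module F = Family F
    module G = Family G
    abs : ∀ {i j} → 0ℤ ℤ.≤ i → 0ℤ ℤ.≤ j → ∣ i ℤ.+ j ∣ ≡ ∣ i ∣ ℕ.+ ∣ j ∣
    abs (ℤ.+≤+ _) (ℤ.+≤+ _) = ≡.refl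

  total-⊗ : (F : Family I) (G : Family I′) → total (F ⊗ G) ≈ total F * total G
  total-⊗ F G =
    trans (sumOver-cong (cartesianProduct F.support G.support) λ (i , j) →
             trans (*-congˡ (qᶻ-+ (F.expo≥0 i) (G.expo≥0 j))) (*-interchange _ _ _ _))
          (sumOver-× F.term G.term F.support G.support)
    where
    module F = Family F
    module G = Family G

  scale : Carrier → (k : ℤ) → 0ℤ ℤ.≤ k → Family I → Family I
  scale c k k≥0 F = record
    { coef    = λ i → c * F.coef i
    ; expo    = λ i → k ℤ.+ F.expo i
    ; expo≥0  = λ i → ℤ.+-mono-≤ k≥0 (F.expo≥0 i)
    ; support = F.support
    ; unique  = F.unique
    ; covers  = λ i e<N → F.covers i (ℕ.≤-<-trans (bound k≥0 (F.expo≥0 i)) e<N)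
    }
    where
    module F = Family F
    bound : ∀ {i j} → 0ℤ ℤ.≤ i → 0ℤ ℤ.≤ j → ∣ j ∣ ℕ.≤ ∣ i ℤ.+ j ∣
    bound (ℤ.+≤+ {n = m} _) (ℤ.+≤+ {n = n} _) = ℕ.m≤n+m n m

  total-scale : ∀ c k k≥0 (F : Family I) → total (scale c k k≥0 F) ≈ c * qᶻ k * total F
  total-scale c k k≥0 F =
    trans (sumOver-cong F.support λ i → trans (*-congˡ (qᶻ-+ k≥0 (F.expo≥0 i))) (*-interchange _ _ _ _))
          (sumOver-*ˡ (c * qᶻ k) F.term F.support)
    where module F = Family F

  module _ {r} (S : Split r I′ I) where
    open Split S

    pull : Family I → Fin r → Family I′
    pull F s = record
      { coef    = F.coef ∘ join s
      ; expo    = F.expo ∘ join s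
      ; expo≥0  = F.expo≥0 ∘ join s
      ; support = map (proj₂ ∘ part) (filter mine F.support)
      ; unique  = unique-map
          (λ {x} {y} x∈ y∈ eq → ≡.trans (≡.sym (restore x∈)) (≡.trans (≡.cong (join s) eq) (restore y∈)))
          (Unique.filter⁺ mine F.unique)
      ; covers  = λ j e<N → ≡.subst (_∈ _) (≡.cong proj₂ (part-join s j))
          (∈-map⁺ (proj₂ ∘ part) (∈-filter⁺ mine (F.covers (join s j) e<N) (≡.cong proj₁ (part-join s j))))
      }
      where
      module F = Family F
      mine = λ i → proj₁ (part i) Fin.≟ s
      restore : ∀ {i} → i ∈ filter mine F.support → join s (proj₂ (part i)) ≡ i
      restore {i} i∈ = ≡.trans (≡.cong (λ s → join s (proj₂ (part i))) (≡.sym (proj₂ (∈-filter⁻ mine {xs = F.support} i∈))))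
                               (join-part i)

    total-split : ∀ F → total F ≈ sumOver (λ s → total (pull F s)) (allFin r)
    total-split F =
      trans (sumOver-classes Fin._≟_ (proj₁ ∘ part) F.term F.support (Unique.allFin⁺ r) (λ {i} _ → ∈-allFin _))
            (sumOver-cong (allFin r) λ s → sym (eq s))
      where
      module F = Family F
      eq : ∀ s → total (pull F s) ≈ sumOver F.term (filter (λ i → proj₁ (part i) Fin.≟ s) F.support)
      eq s = trans (reflexive (sumOver-map _ (proj₂ ∘ part) (filter (λ i → proj₁ (part i) Fin.≟ s) F.support)))
                   (sumOver-cong∈ _ λ {i} i∈ → reflexive (≡.cong F.term
                     (≡.trans (≡.cong (λ s → join s (proj₂ (part i))) (≡.sym (proj₂ (∈-filter⁻ (λ i → proj₁ (part i) Fin.≟ s) {xs = F.support} i∈))))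
                              (join-part i))))

-- Jacobi's triple product

module ℤ-Solver = Solver ℤ.+-*-commutativeRing

interval-unique : ∀ n → Unique (interval n)
interval-unique n = Unique.map⁺ (λ {k} {l} eq → ℤ.+-injective (RingProperties.+-cancelʳ ℤ.+-*-ring (ℤ.- + n) (+ k) (+ l) eq)) (Unique.upTo⁺ (suc (n ℕ.+ n)))

∈-interval⁺ : ∀ {n} k → ∣ k ∣ ℕ.≤ n → k ∈ interval n
∈-interval⁺ {n} (+ k) k≤n =
  ≡.subst (_∈ interval n) (ℤ-Solver.solve 2 (λ k n → k :+ n :- n := k) (+ k) (+ n))
    (∈-map⁺ (λ k → + k ℤ.- + n) (∈-upTo⁺ (s≤s (ℕ.+-monoˡ-≤ n k≤n))))
∈-interval⁺ {n} -[1+ k ] k<n =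
  ≡.subst (_∈ interval n) eq
    (∈-map⁺ (λ k → + k ℤ.- + n) (∈-upTo⁺ (s≤s (ℕ.≤-trans (ℕ.m∸n≤m n (suc k)) (ℕ.m≤m+n n n)))))
  where
  eq : + (n ℕ.∸ suc k) ℤ.- + n ≡ -[1+ k ]
  eq = ≡.trans (≡.cong (ℤ._- + n) (≡.trans (≡.sym (ℤ.⊖-≥ k<n)) (≡.sym (ℤ.m-n≡m⊖n n (suc k)))))
               (ℤ-Solver.solve 2 (λ k n → n :- k :- n := :- k) (+ suc k) (+ n))

∈-interval⁻ : ∀ {n k} → k ∈ interval n → ∣ k ∣ ℕ.≤ n
∈-interval⁻ {n} k∈ with l , l∈ , ≡.refl ← ∈-map⁻ (λ k → + k ℤ.- + n) k∈ =
  ≡.subst (ℕ._≤ n) (≡.cong ∣_∣ (≡.sym (ℤ.m-n≡m⊖n l n))) (bound l n (ℕ.≤-pred (∈-upTo⁻ l∈)))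
  where
  bound : ∀ l n → l ℕ.≤ n ℕ.+ n → ∣ l ⊖ n ∣ ℕ.≤ n
  bound l n l≤ with ℕ.≤-total n l
  ... | inj₁ n≤l = ≡.subst (ℕ._≤ n) (≡.cong ∣_∣ (≡.sym (ℤ.⊖-≥ n≤l)))
                     (ℕ.≤-trans (ℕ.∸-monoˡ-≤ n l≤) (ℕ.≤-reflexive (ℕ.m+n∸n≡m n n)))
  ... | inj₂ l≤n = ≡.subst (ℕ._≤ n) (≡.sym (ℤ.∣⊖∣-≤ l≤n)) (ℕ.m∸n≤m n l)

double-injective : ∀ {i j} → i ℤ.+ i ≡ j ℤ.+ j → i ≡ j
double-injective {i} {j} eq =
  ℤ.*-cancelˡ-≡ (+ 2) i j (≡.trans (two i) (≡.trans eq (≡.sym (two j))))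
  where
  two : ∀ i → + 2 ℤ.* i ≡ i ℤ.+ i
  two = ℤ-Solver.solve 1 λ i → con 2 :* i := i :+ i

-- tri k = k (k − 1) / 2
tri : ℤ → ℤ
tri (+ n)    = + below n
  where
  below : ℕ → ℕ
  below zero    = zero
  below (suc n) = n ℕ.+ below n
tri -[1+ n ] = tri (+ suc (suc n))

private
  tri-double⁺ : ∀ n → tri (+ n) ℤ.+ tri (+ n) ≡ + n ℤ.* + n ℤ.- + n
  tri-double⁺ zero    = ≡.refl
  tri-double⁺ (suc n) = ≡.trans
    (ℤ-Solver.solve 2 (λ n t → (n :+ t) :+ (n :+ t) := (n :+ n) :+ (t :+ t)) (+ n) (tri (+ n)))
    (≡.trans (≡.cong (λ x → (+ n ℤ.+ + n) ℤ.+ x) (tri-double⁺ n))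
             (ℤ-Solver.solve 1 (λ n → (n :+ n) :+ (n :* n :- n) := (con 1 :+ n) :* (con 1 :+ n) :- (con 1 :+ n)) (+ n)))

tri-double : ∀ k → tri k ℤ.+ tri k ≡ k ℤ.* k ℤ.- k
tri-double (+ n)    = tri-double⁺ n
tri-double -[1+ n ] = ≡.trans (tri-double⁺ (suc (suc n)))
  (ℤ-Solver.solve 1 (λ n → (con 2 :+ n) :* (con 2 :+ n) :- (con 2 :+ n) := :- (con 1 :+ n) :* :- (con 1 :+ n) :- :- (con 1 :+ n)) (+ n))

tri≥0 : ∀ k → 0ℤ ℤ.≤ tri k
tri≥0 (+ n)    = ℤ.+≤+ z≤n
tri≥0 -[1+ n ] = ℤ.+≤+ z≤n

tri-+ : ∀ i j → tri (i ℤ.+ j) ≡ tri i ℤ.+ tri j ℤ.+ i ℤ.* j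
tri-+ i j = double-injective (≡.trans (tri-double (i ℤ.+ j)) (≡.trans
  (ℤ-Solver.solve 2 (λ i j → (i :+ j) :* (i :+ j) :- (i :+ j) := (i :* i :- i) :+ (j :* j :- j) :+ (i :* j :+ i :* j)) i j)
  (≡.trans (≡.cong₂ (λ x y → x ℤ.+ y ℤ.+ (i ℤ.* j ℤ.+ i ℤ.* j)) (≡.sym (tri-double i)) (≡.sym (tri-double j)))
    (ℤ-Solver.solve 3 (λ a b c → (a :+ a) :+ (b :+ b) :+ (c :+ c) := (a :+ b :+ c) :+ (a :+ b :+ c)) (tri i) (tri j) (i ℤ.* j)))))

-- Bounds of this kind show that an exponent below N forces |k| ≤ N, so that `interval N` is a valid
-- support. The summand 1 is there because of tri 1 = 0.
∣k∣≤1+tri : ∀ k → ∣ k ∣ ℕ.≤ suc ∣ tri k ∣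
∣k∣≤1+tri (+ zero)  = z≤n
∣k∣≤1+tri (+ suc n) = s≤s (ℕ.m≤m+n n _)
∣k∣≤1+tri -[1+ n ]  = ℕ.≤-trans (ℕ.m≤m+n (suc n) _) (ℕ.n≤1+n _)

∣k∣≤1+tri-suc : ∀ k → ∣ k ∣ ℕ.≤ suc ∣ tri (1ℤ ℤ.+ k) ∣
∣k∣≤1+tri-suc (+ n)            = ℕ.≤-trans (ℕ.m≤m+n n _) (ℕ.n≤1+n _)
∣k∣≤1+tri-suc -[1+ zero ]      = s≤s z≤n
∣k∣≤1+tri-suc -[1+ suc n ]     = s≤s (ℕ.m≤m+n (suc n) _)

-- c (k + 1) k / 2 + d k (k − 1) / 2, the exponent of q in q^{c k} (q^{c + d})^{k (k − 1) / 2}.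
θ-expo : ℕ → ℕ → ℤ → ℤ
θ-expo c d k = + c ℤ.* tri (1ℤ ℤ.+ k) ℤ.+ + d ℤ.* tri k

*≥0 : ∀ n {i} → 0ℤ ℤ.≤ i → 0ℤ ℤ.≤ + n ℤ.* i
*≥0 n {i} (ℤ.+≤+ {n = m} _) = ≡.subst (0ℤ ℤ.≤_) (ℤ.pos-* n m) (ℤ.+≤+ z≤n)

-- The reason for writing the exponent with two triangular numbers: both coefficients are natural
-- numbers.
θ-expo≥0 : ∀ c d k → 0ℤ ℤ.≤ θ-expo c d k
θ-expo≥0 c d k = ℤ.+-mono-≤ (*≥0 c (tri≥0 (1ℤ ℤ.+ k))) (*≥0 d (tri≥0 k))

θ-expo-formula : ∀ c d k → θ-expo c d k ≡ + (c ℕ.+ d) ℤ.* tri k ℤ.+ + c ℤ.* k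
θ-expo-formula c d k = ≡.trans (≡.cong (λ x → + c ℤ.* x ℤ.+ + d ℤ.* tri k) (tri-+ 1ℤ k))
  (ℤ-Solver.solve 4 (λ c d k t → c :* (con 0 :+ t :+ con 1 :* k) :+ d :* t := (c :+ d) :* t :+ c :* k) (+ c) (+ d) k (tri k))

∣k∣≤1+θ-expo : ∀ c d k → 1 ℕ.≤ c ℕ.+ d → ∣ k ∣ ℕ.≤ suc ∣ θ-expo c d k ∣
∣k∣≤1+θ-expo c d k 1≤c+d = ≡.subst (λ e → ∣ k ∣ ℕ.≤ suc e) (≡.sym eq) (bound c d 1≤c+d)
  where
  a = ∣ tri (1ℤ ℤ.+ k) ∣
  b = ∣ tri k ∣
  eq : ∣ θ-expo c d k ∣ ≡ c ℕ.* a ℕ.+ d ℕ.* b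
  eq = ≡.cong ∣_∣ (≡.trans (≡.cong₂ (λ x y → + c ℤ.* x ℤ.+ + d ℤ.* y) (≡.sym (ℤ.0≤i⇒+∣i∣≡i (tri≥0 (1ℤ ℤ.+ k)))) (≡.sym (ℤ.0≤i⇒+∣i∣≡i (tri≥0 k))))
         (≡.cong₂ ℤ._+_ (≡.sym (ℤ.pos-* c a)) (≡.sym (ℤ.pos-* d b))))
  bound : ∀ c d → 1 ℕ.≤ c ℕ.+ d → ∣ k ∣ ℕ.≤ suc (c ℕ.* a ℕ.+ d ℕ.* b)
  bound (suc c) d       _ = ℕ.≤-trans (∣k∣≤1+tri-suc k) (s≤s (ℕ.≤-trans (ℕ.m≤m+n a _) (ℕ.m≤m+n _ _)))
  bound zero    (suc d) _ = ℕ.≤-trans (∣k∣≤1+tri k) (s≤s (ℕ.m≤m+n b _))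

-- With m = c + d, the exponents at k and k - 1 differ by m (k - 1) + c. So the factor q^(c + m n)
-- carries index k - 1 to index k and leaves q^(m (n - k + 1)).
θ-expo-pred : ∀ c d n l k → + n ℤ.- (k ℤ.- 1ℤ) ≡ + l →
            θ-expo c d (k ℤ.- 1ℤ) ℤ.+ + (c ℕ.+ (c ℕ.+ d) ℕ.* n) ≡ θ-expo c d k ℤ.+ + ((c ℕ.+ d) ℕ.* l)
θ-expo-pred c d n l k eq = begin
  θ-expo c d (k ℤ.- 1ℤ) ℤ.+ + (c ℕ.+ m ℕ.* n)
    ≡⟨ ≡.cong₂ ℤ._+_ (θ-expo-formula c d (k ℤ.- 1ℤ)) (≡.cong (λ x → + c ℤ.+ x) (ℤ.pos-* m n)) ⟩
  + m ℤ.* tri (k ℤ.- 1ℤ) ℤ.+ + c ℤ.* (k ℤ.- 1ℤ) ℤ.+ (+ c ℤ.+ + m ℤ.* + n)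
    ≡⟨ ≡.cong (λ x → + m ℤ.* x ℤ.+ + c ℤ.* (k ℤ.- 1ℤ) ℤ.+ (+ c ℤ.+ + m ℤ.* + n)) (tri-+ k (ℤ.- 1ℤ)) ⟩
  + m ℤ.* (tri k ℤ.+ 1ℤ ℤ.+ k ℤ.* ℤ.- 1ℤ) ℤ.+ + c ℤ.* (k ℤ.- 1ℤ) ℤ.+ (+ c ℤ.+ + m ℤ.* + n)
    ≡⟨ ℤ-Solver.solve 5 (λ m t k c n → m :* (t :+ con 1 :+ k :* :- con 1) :+ c :* (k :- con 1) :+ (c :+ m :* n)
                            := m :* t :+ c :* k :+ m :* (n :- (k :- con 1))) (+ m) (tri k) k (+ c) (+ n) ⟩
  + m ℤ.* tri k ℤ.+ + c ℤ.* k ℤ.+ + m ℤ.* (+ n ℤ.- (k ℤ.- 1ℤ))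
    ≡⟨ ≡.cong (λ x → + m ℤ.* tri k ℤ.+ + c ℤ.* k ℤ.+ + m ℤ.* x) eq ⟩
  + m ℤ.* tri k ℤ.+ + c ℤ.* k ℤ.+ + m ℤ.* + l
    ≡⟨ ≡.cong₂ ℤ._+_ (≡.sym (θ-expo-formula c d k)) (≡.sym (ℤ.pos-* m l)) ⟩
  θ-expo c d k ℤ.+ + (m ℕ.* l) ∎
  where
  open ≡.≡-Reasoning
  m = c ℕ.+ d

θ-expo-suc : ∀ c d M l k → + M ℤ.+ (k ℤ.+ 1ℤ) ≡ + l →
             θ-expo c d (k ℤ.+ 1ℤ) ℤ.+ + (d ℕ.+ (c ℕ.+ d) ℕ.* M) ≡ θ-expo c d k ℤ.+ + ((c ℕ.+ d) ℕ.* l)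
θ-expo-suc c d M l k eq = begin
  θ-expo c d (k ℤ.+ 1ℤ) ℤ.+ + (d ℕ.+ m ℕ.* M)
    ≡⟨ ≡.cong₂ ℤ._+_ (θ-expo-formula c d (k ℤ.+ 1ℤ)) (≡.cong (λ x → + d ℤ.+ x) (ℤ.pos-* m M)) ⟩
  + m ℤ.* tri (k ℤ.+ 1ℤ) ℤ.+ + c ℤ.* (k ℤ.+ 1ℤ) ℤ.+ (+ d ℤ.+ + m ℤ.* + M)
    ≡⟨ ≡.cong (λ x → + m ℤ.* x ℤ.+ + c ℤ.* (k ℤ.+ 1ℤ) ℤ.+ (+ d ℤ.+ + m ℤ.* + M)) (tri-+ k 1ℤ) ⟩
  + m ℤ.* (tri k ℤ.+ 0ℤ ℤ.+ k ℤ.* 1ℤ) ℤ.+ + c ℤ.* (k ℤ.+ 1ℤ) ℤ.+ (+ d ℤ.+ + m ℤ.* + M)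
    ≡⟨ ℤ-Solver.solve 5 (λ t k c d M → (c :+ d) :* (t :+ con 0 :+ k :* con 1) :+ c :* (k :+ con 1) :+ (d :+ (c :+ d) :* M)
                            := (c :+ d) :* t :+ c :* k :+ (c :+ d) :* (M :+ (k :+ con 1))) (tri k) k (+ c) (+ d) (+ M) ⟩
  + m ℤ.* tri k ℤ.+ + c ℤ.* k ℤ.+ + m ℤ.* (+ M ℤ.+ (k ℤ.+ 1ℤ))
    ≡⟨ ≡.cong (λ x → + m ℤ.* tri k ℤ.+ + c ℤ.* k ℤ.+ + m ℤ.* x) eq ⟩
  + m ℤ.* tri k ℤ.+ + c ℤ.* k ℤ.+ + m ℤ.* + l
    ≡⟨ ≡.cong₂ ℤ._+_ (≡.sym (θ-expo-formula c d k)) (≡.sym (ℤ.pos-* m l)) ⟩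
  θ-expo c d k ℤ.+ + (m ℕ.* l) ∎
  where
  open ≡.≡-Reasoning
  m = c ℕ.+ d

-- Finite products and the inverses of (Q; Q)ₖ

module Products (B : CommutativeRing 0ℓ 0ℓ) where
  open CommutativeRing B
  open Exp semiring using (_^_; ^-assocʳ)
  open SetoidReasoning setoid
  open Solver B using (solve)

  prod : (ℕ → Carrier) → ℕ → Carrier
  prod f zero    = 1#
  prod f (suc n) = prod f n * f n

  prod-cong : ∀ {f g} n → (∀ i → f i ≈ g i) → prod f n ≈ prod g n
  prod-cong zero    f≈g = refl
  prod-cong (suc n) f≈g = *-cong (prod-cong n f≈g) (f≈g n)

  prod-stable : ∀ f {m n} → m ℕ.≤ n → (∀ i → m ℕ.≤ i → f i ≈ 1#) → prod f n ≈ prod f m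
  prod-stable f {m} {n} m≤n f≈1 with ℕ.m≤n⇒m<n∨m≡n m≤n
  ... | inj₂ ≡.refl = refl
  prod-stable f {m} {suc n} _ f≈1 | inj₁ (s≤s m≤n) =
    trans (*-cong (prod-stable f m≤n f≈1) (f≈1 n m≤n)) (*-identityʳ _)

  prod-first : ∀ f n → prod f (suc n) ≈ f 0 * prod (f ∘ suc) n
  prod-first f zero    = *-comm _ _
  prod-first f (suc n) = trans (*-congʳ (prod-first f n)) (*-assoc _ _ _)

  module QPochhammer (Q : Carrier) (N : ℕ) (Q^N≈0 : Q ^ N ≈ 0#) where

    geometric : Carrier → ℕ → Carrier
    geometric x zero    = 0#
    geometric x (suc n) = 1# + x * geometric x n

    geometric-sum : ∀ x n → (1# - x) * geometric x n ≈ 1# - x ^ n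
    geometric-sum x zero    = trans (zeroʳ _) (sym (-‿inverseʳ 1#))
    geometric-sum x (suc n) = begin
      (1# - x) * (1# + x * geometric x n)     ≈⟨ solve 2 (λ x g → (con 1 :- x) :* (con 1 :+ x :* g) := con 1 :- x :+ x :* ((con 1 :- x) :* g)) x (geometric x n) ⟩
      1# - x + x * ((1# - x) * geometric x n) ≈⟨ +-congˡ (*-congˡ (geometric-sum x n)) ⟩
      1# - x + x * (1# - x ^ n)               ≈⟨ solve 2 (λ x g → con 1 :- x :+ x :* (con 1 :- g) := con 1 :- x :* g) x (x ^ n) ⟩
      1# - x ^ suc n                          ∎

    Q^≥N : ∀ {k} → N ℕ.≤ k → Q ^ k ≈ 0#
    Q^≥N = Nilpotent.q^≥N B Q N Q^N≈0

    factor : ℕ → Carrier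
    factor i = 1# - Q ^ suc i

    -- The geometric series for 1 / (1 - Q^(i+1)) breaks off because Q^N = 0; this makes (Q; Q)ₖ
    -- invertible in every such ring.
    inverseFactor : ℕ → Carrier
    inverseFactor i = geometric (Q ^ suc i) N

    inverseFactor-correct : ∀ i → factor i * inverseFactor i ≈ 1#
    inverseFactor-correct i = begin
      factor i * inverseFactor i ≈⟨ geometric-sum (Q ^ suc i) N ⟩
      1# - (Q ^ suc i) ^ N       ≈⟨ +-congˡ (-‿cong (trans (^-assocʳ Q (suc i) N) (Q^≥N (ℕ.m≤m+n N _)))) ⟩
      1# - 0#                    ≈⟨ solve 0 (con 1 :- con 0 := con 1) ⟩
      1#                         ∎

    ⟨Q⟩ ⟨Q⟩⁻¹ : ℕ → Carrier
    ⟨Q⟩   = prod factor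
    ⟨Q⟩⁻¹ = prod inverseFactor

    ⟨Q⟩-inverse : ∀ k → ⟨Q⟩ k * ⟨Q⟩⁻¹ k ≈ 1#
    ⟨Q⟩-inverse zero    = *-identityˡ 1#
    ⟨Q⟩-inverse (suc k) = begin
      ⟨Q⟩ k * factor k * (⟨Q⟩⁻¹ k * inverseFactor k)   ≈⟨ solve 4 (λ a b c d → a :* b :* (c :* d) := a :* c :* (b :* d)) _ _ _ _ ⟩
      ⟨Q⟩ k * ⟨Q⟩⁻¹ k * (factor k * inverseFactor k)   ≈⟨ *-cong (⟨Q⟩-inverse k) (inverseFactor-correct k) ⟩
      1# * 1#                                           ≈⟨ *-identityˡ 1# ⟩
      1#                                                ∎

    factor-⟨Q⟩⁻¹ : ∀ k → factor k * ⟨Q⟩⁻¹ (suc k) ≈ ⟨Q⟩⁻¹ k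
    factor-⟨Q⟩⁻¹ k = begin
      factor k * (⟨Q⟩⁻¹ k * inverseFactor k)   ≈⟨ solve 3 (λ a b c → a :* (b :* c) := b :* (a :* c)) _ _ _ ⟩
      ⟨Q⟩⁻¹ k * (factor k * inverseFactor k)   ≈⟨ *-congˡ (inverseFactor-correct k) ⟩
      ⟨Q⟩⁻¹ k * 1#                             ≈⟨ *-identityʳ _ ⟩
      ⟨Q⟩⁻¹ k                                  ∎

    factor-trivial : ∀ i → N ℕ.≤ i → factor i ≈ 1#
    factor-trivial i N≤i = trans (+-congˡ (-‿cong (Q^≥N (ℕ.m≤n⇒m≤1+n N≤i)))) (solve 0 (con 1 :- con 0 := con 1))

    inverseFactor-trivial : ∀ i → N ℕ.≤ i → inverseFactor i ≈ 1#
    inverseFactor-trivial i N≤i = begin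
      inverseFactor i             ≈⟨ *-identityˡ _ ⟨
      1# * inverseFactor i        ≈⟨ *-congʳ (factor-trivial i N≤i) ⟨
      factor i * inverseFactor i  ≈⟨ inverseFactor-correct i ⟩
      1#                          ∎

    ⟨Q⟩-stable : ∀ {k} → N ℕ.≤ k → ⟨Q⟩ k ≈ ⟨Q⟩ N
    ⟨Q⟩-stable N≤k = prod-stable factor N≤k factor-trivial

    ⟨Q⟩⁻¹-stable : ∀ {k} → N ℕ.≤ k → ⟨Q⟩⁻¹ k ≈ ⟨Q⟩⁻¹ N
    ⟨Q⟩⁻¹-stable N≤k = prod-stable inverseFactor N≤k inverseFactor-trivial

module JacobiTripleProduct
  (B : CommutativeRing 0ℓ 0ℓ)
  (q : CommutativeRing.Carrier B) (N : ℕ) (q^N≈0 : PowerVanishes B q N)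
  (α β : CommutativeRing.Carrier B) (αβ≈1 : MutuallyInverse B α β) (c d : ℕ) (1≤c+d : 1 ℕ.≤ c ℕ.+ d) where
  open CommutativeRing B
  open Exp semiring using (_^_)

  open Exp semiring using (^-homo-*; ^-assocʳ)
  open SetoidReasoning setoid
  open Solver B using (solve)
  open Nilpotent B q N q^N≈0
  open Powers B
  open Unit α β αβ≈1
  open Products B

  private
    m = c ℕ.+ d
    Q = q ^ m

    Q^N≈0 : Q ^ N ≈ 0#
    Q^N≈0 = trans (^-assocʳ q m N) (q^≥N (ℕ.≤-trans (ℕ.≤-reflexive (≡.sym (ℕ.*-identityˡ N))) (ℕ.*-monoˡ-≤ N 1≤c+d)))

  open QPochhammer Q N Q^N≈0

  θ-family : Family ℤ
  θ-family = record
    { coef    = λ k → ε k * pow k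
    ; expo    = θ-expo c d
    ; expo≥0  = θ-expo≥0 c d
    ; support = interval N
    ; unique  = interval-unique N
    ; covers  = λ k e<N → ∈-interval⁺ k (ℕ.≤-trans (∣k∣≤1+θ-expo c d k 1≤c+d) e<N)
    }

  private
    open Family θ-family using (term)

    term-vanishes : ∀ k → N ℕ.< ∣ k ∣ → term k ≈ 0#
    term-vanishes k N<k = trans (*-congˡ (q^≥N (ℕ.≤-pred (ℕ.≤-trans N<k (∣k∣≤1+θ-expo c d k 1≤c+d))))) (zeroʳ _)

    -- One wider than the support of `θ-family`, so that shifting the index by ±1 loses no term that
    -- could be non-zero.
    range : List ℤ
    range = interval (suc N)

    shift : (f : ℤ → Carrier) (s : ℤ) → ∣ s ∣ ℕ.≤ 1 → (∀ k → N ℕ.< ∣ k ∣ → f k ≈ 0#) →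
            sumOver (λ k → f (k ℤ.+ s)) range ≈ sumOver f range
    shift f s ∣s∣≤1 f≈0 = trans (reflexive (≡.sym (sumOver-map f (ℤ._+ s) range)))
      (sumOver-unique f (Unique.map⁺ (λ {k} {l} → RingProperties.+-cancelʳ ℤ.+-*-ring s k l) (interval-unique (suc N))) (interval-unique (suc N))
        (λ {k} _ → inRange k) λ {k} _ → inImage k)
      where
      inRange : ∀ k → k ∈ range ⊎ f k ≈ 0#
      inRange k with ∣ k ∣ ℕ.≤? N
      ... | yes k≤N = inj₁ (∈-interval⁺ k (ℕ.m≤n⇒m≤1+n k≤N))
      ... | no  k≰N = inj₂ (f≈0 k (ℕ.≰⇒> k≰N))
      inImage : ∀ k → k ∈ map (ℤ._+ s) range ⊎ f k ≈ 0#
      inImage k with ∣ k ∣ ℕ.≤? N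
      ... | yes k≤N = inj₁ (≡.subst (_∈ map (ℤ._+ s) range) (ℤ-Solver.solve 2 (λ k s → k :- s :+ s := k) k s)
                        (∈-map⁺ (ℤ._+ s) (∈-interval⁺ (k ℤ.- s) (ℕ.≤-trans (ℤ.∣i-j∣≤∣i∣+∣j∣ k s)
                          (ℕ.≤-trans (ℕ.+-mono-≤ k≤N ∣s∣≤1) (ℕ.≤-reflexive (ℕ.+-comm N 1)))))))
      ... | no  k≰N = inj₂ (f≈0 k (ℕ.≰⇒> k≰N))

    -- 1 / (Q; Q)ₖ, with the convention that it is 0 for negative k.
    r : ℤ → Carrier
    r (+ k)    = ⟨Q⟩⁻¹ k
    r -[1+ _ ] = 0#

    Qᶻ : ℤ → Carrier
    Qᶻ i = Q ^ ∣ i ∣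

    -- At k = 0 both sides vanish, since 1 - Q⁰ = 0; this is what makes the convention for negative
    -- arguments consistent with the recursion.
    r-pred : ∀ k → r (k ℤ.- 1ℤ) ≈ (1# - Qᶻ k) * r k
    r-pred (+ zero)  = sym (trans (*-congʳ (-‿inverseʳ 1#)) (zeroˡ _))
    r-pred (+ suc k) = sym (factor-⟨Q⟩⁻¹ k)
    r-pred -[1+ k ]  = sym (zeroʳ _)

    -- The q-Pascal rule in the form 1 - Q^(u+j) = (1 - Q^j) + Q^j (1 - Q^u). If u or j is negative,
    -- `r` annihilates both sides.
    pascal : ∀ u j t → u ℤ.+ j ≡ + t →
             (1# - Q ^ t) * (r u * r j) ≈ (1# - Qᶻ j) * (r u * r j) + Qᶻ j * ((1# - Qᶻ u) * (r u * r j))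
    pascal (+ u)    (+ j)    _ ≡.refl =
      trans (*-congʳ (+-congˡ (-‿cong (^-homo-* Q u j))))
            (solve 3 (λ a b x → (con 1 :- a :* b) :* x := (con 1 :- b) :* x :+ b :* ((con 1 :- a) :* x)) _ _ _)
    pascal (+ u)    -[1+ j ] t _ = solve 5 (λ a b c d x → a :* (x :* con 0) := b :* (x :* con 0) :+ c :* (d :* (x :* con 0))) _ _ _ _ _
    pascal -[1+ u ] j        t _ = solve 5 (λ a b c d x → a :* (con 0 :* x) := b :* (con 0 :* x) :+ c :* (d :* (con 0 :* x))) _ _ _ _ _

    x y : Carrier
    x = α * q ^ c
    y = β * q ^ d

    -- The Gaussian binomial coefficient of n + M over M + k. Through the convention for `r` it
    -- vanishes unless -M ≤ k ≤ n.
    a : ℕ → ℕ → ℤ → Carrier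
    a n M k = ⟨Q⟩ (n ℕ.+ M) * (r (+ M ℤ.+ k) * r (+ n ℤ.- k))

    S : ℕ → ℕ → Carrier
    S n M = sumOver (λ k → term k * a n M k) range

    -- Moves the factor γ q^e Q^n from the index k′ to the adjacent index k.
    transfer : ∀ {γ e n l k k′} → pow k ≈ pow k′ * γ → ε k ≈ ε k′ * - 1# →
               θ-expo c d k′ ℤ.+ + (e ℕ.+ m ℕ.* n) ≡ θ-expo c d k ℤ.+ + (m ℕ.* l) →
               - (γ * q ^ e * Q ^ n) * term k′ ≈ Q ^ l * term k
    transfer {γ} {e} {n} {l} {k} {k′} pow≈ ε≈ eq = begin
      - (γ * q ^ e * Q ^ n) * (ε k′ * pow k′ * qᶻ E′)
        ≈⟨ solve 6 (λ g a b e p t → :- (g :* a :* b) :* (e :* p :* t) := e :* :- con 1 :* (p :* g) :* (t :* (a :* b))) _ _ _ _ _ _ ⟩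
      ε k′ * - 1# * (pow k′ * γ) * (qᶻ E′ * (q ^ e * Q ^ n))
        ≈⟨ *-cong (*-cong (sym ε≈) (sym pow≈)) (*-congˡ (trans (*-congˡ (^-assocʳ q m n)) (sym (^-homo-* q e (m ℕ.* n))))) ⟩
      ε k * pow k * (qᶻ E′ * q ^ (e ℕ.+ m ℕ.* n))
        ≈⟨ *-congˡ (sym (qᶻ-+ (θ-expo≥0 c d k′) (ℤ.+≤+ z≤n))) ⟩
      ε k * pow k * qᶻ (E′ ℤ.+ + (e ℕ.+ m ℕ.* n))
        ≡⟨ ≡.cong (λ x → ε k * pow k * qᶻ x) eq ⟩
      ε k * pow k * qᶻ (E ℤ.+ + (m ℕ.* l))
        ≈⟨ *-congˡ (trans (qᶻ-+ (θ-expo≥0 c d k) (ℤ.+≤+ z≤n)) (*-congˡ (sym (^-assocʳ q m l)))) ⟩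
      ε k * pow k * (qᶻ E * Q ^ l)
        ≈⟨ solve 3 (λ a b c → a :* (b :* c) := c :* (a :* b)) _ _ _ ⟩
      Q ^ l * (ε k * pow k * qᶻ E) ∎
      where
      E  = θ-expo c d k
      E′ = θ-expo c d k′

    -- The q-Pascal rule splits each Gaussian binomial in two. The first halves form `S n M`; the
    -- second halves are the same sum shifted by one index and multiplied by -x Q^n.
    step-x : ∀ n M → S (suc n) M ≈ S n M * (1# - x * Q ^ n)
    step-x n M = begin
      sumOver (λ k → term k * a (suc n) M k) range
        ≈⟨ sumOver-cong range pointwise ⟩
      sumOver (λ k → f k + - (x * Q ^ n) * f (k ℤ.- 1ℤ)) range
        ≈⟨ sumOver-+ f _ range ⟩
      sumOver f range + sumOver (λ k → - (x * Q ^ n) * f (k ℤ.- 1ℤ)) range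
        ≈⟨ +-congˡ (sumOver-*ˡ (- (x * Q ^ n)) _ range) ⟩
      sumOver f range + - (x * Q ^ n) * sumOver (λ k → f (k ℤ.- 1ℤ)) range
        ≈⟨ +-congˡ (*-congˡ (shift f (ℤ.- 1ℤ) (s≤s z≤n) λ k N<k → trans (*-congʳ (term-vanishes k N<k)) (zeroˡ _))) ⟩
      sumOver f range + - (x * Q ^ n) * sumOver f range
        ≈⟨ solve 2 (λ s x → s :+ :- x :* s := s :* (con 1 :- x)) _ _ ⟩
      sumOver f range * (1# - x * Q ^ n) ∎
      where
      f : ℤ → Carrier
      f k = term k * a n M k
      -- For negative j both sides vanish through `r j`; otherwise `Qᶻ j` is a genuine power of Q
      -- and `transfer` applies.
      move : ∀ k j → + n ℤ.- (k ℤ.- 1ℤ) ≡ j → - (x * Q ^ n) * term (k ℤ.- 1ℤ) * r j ≈ Qᶻ j * term k * r j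
      move k -[1+ _ ] _  = trans (zeroʳ _) (sym (zeroʳ _))
      move k (+ l)    eq = *-congʳ (transfer {k = k} {k′ = k ℤ.- 1ℤ}
        (trans (reflexive (≡.cong pow (ℤ-Solver.solve 1 (λ k → k := k :- con 1 :+ con 1) k)))
               (trans (pow-+ (k ℤ.- 1ℤ) 1ℤ) (*-congˡ (*-identityʳ α))))
        (trans (reflexive (≡.cong ε (ℤ-Solver.solve 1 (λ k → k := k :- con 1 :+ con 1) k)))
               (trans (ε-+ (k ℤ.- 1ℤ) 1ℤ) (*-congˡ (*-identityʳ (- 1#)))))
        (θ-expo-pred c d n l k eq))
      pointwise : ∀ k → term k * a (suc n) M k ≈ f k + - (x * Q ^ n) * f (k ℤ.- 1ℤ)
      pointwise k = begin
        t * (P * F * (r u * r (+ suc n ℤ.- k)))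
          ≡⟨ ≡.cong (λ i → t * (P * F * (r u * r i))) (ℤ-Solver.solve 2 (λ n k → con 1 :+ n :- k := n :- (k :- con 1)) (+ n) k) ⟩
        t * (P * F * (r u * r j))
          ≈⟨ solve 4 (λ t P F x → t :* (P :* F :* x) := t :* P :* (F :* x)) t P F _ ⟩
        t * P * (F * (r u * r j))
          ≈⟨ *-congˡ (pascal u j (suc (n ℕ.+ M)) (ℤ-Solver.solve 3 (λ n M k → M :+ k :+ (n :- (k :- con 1)) := con 1 :+ n :+ M) (+ n) (+ M) k)) ⟩
        t * P * ((1# - Qᶻ j) * (r u * r j) + Qᶻ j * ((1# - Qᶻ u) * (r u * r j)))
          ≈⟨ solve 6 (λ t P j u ru rj → t :* P :* ((con 1 :- j) :* (ru :* rj) :+ j :* ((con 1 :- u) :* (ru :* rj)))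
                        := t :* (P :* (ru :* ((con 1 :- j) :* rj))) :+ j :* t :* rj :* (P :* ((con 1 :- u) :* ru))) _ _ _ _ _ _ ⟩
        t * (P * (r u * ((1# - Qᶻ j) * r j))) + Qᶻ j * t * r j * (P * ((1# - Qᶻ u) * r u))
          ≈⟨ +-cong (*-congˡ (*-congˡ (*-congˡ (trans (sym (r-pred j)) (reflexive (≡.cong r (ℤ-Solver.solve 2 (λ n k → n :- (k :- con 1) :- con 1 := n :- k) (+ n) k)))))))
                    (*-cong (sym (move k j ≡.refl)) (*-congˡ (trans (sym (r-pred u)) (reflexive (≡.cong r (ℤ.+-assoc (+ M) k (ℤ.- 1ℤ))))))) ⟩
        f k + - (x * Q ^ n) * t′ * r j * (P * r (+ M ℤ.+ (k ℤ.- 1ℤ)))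
          ≈⟨ +-congˡ (solve 5 (λ x t rj P ru → x :* t :* rj :* (P :* ru) := x :* (t :* (P :* (ru :* rj)))) _ _ _ _ _) ⟩
        f k + - (x * Q ^ n) * f (k ℤ.- 1ℤ) ∎
        where
        t = term k
        t′ = term (k ℤ.- 1ℤ)
        P = ⟨Q⟩ (n ℕ.+ M)
        F = factor (n ℕ.+ M)
        u = + M ℤ.+ k
        j = + n ℤ.- (k ℤ.- 1ℤ)

    -- The mirror image of `step-x`: in the q-Pascal rule u and j change roles, and the shift is to
    -- k + 1.
    step-y : ∀ n M → S n (suc M) ≈ S n M * (1# - y * Q ^ M)
    step-y n M = begin
      sumOver (λ k → term k * a n (suc M) k) range
        ≈⟨ sumOver-cong range pointwise ⟩
      sumOver (λ k → f k + - (y * Q ^ M) * f (k ℤ.+ 1ℤ)) range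
        ≈⟨ sumOver-+ f _ range ⟩
      sumOver f range + sumOver (λ k → - (y * Q ^ M) * f (k ℤ.+ 1ℤ)) range
        ≈⟨ +-congˡ (sumOver-*ˡ (- (y * Q ^ M)) _ range) ⟩
      sumOver f range + - (y * Q ^ M) * sumOver (λ k → f (k ℤ.+ 1ℤ)) range
        ≈⟨ +-congˡ (*-congˡ (shift f 1ℤ (s≤s z≤n) λ k N<k → trans (*-congʳ (term-vanishes k N<k)) (zeroˡ _))) ⟩
      sumOver f range + - (y * Q ^ M) * sumOver f range
        ≈⟨ solve 2 (λ s x → s :+ :- x :* s := s :* (con 1 :- x)) _ _ ⟩
      sumOver f range * (1# - y * Q ^ M) ∎
      where
      f : ℤ → Carrier
      f k = term k * a n M k
      move : ∀ k u → + M ℤ.+ (k ℤ.+ 1ℤ) ≡ u → - (y * Q ^ M) * term (k ℤ.+ 1ℤ) * r u ≈ Qᶻ u * term k * r u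
      move k -[1+ _ ] _  = trans (zeroʳ _) (sym (zeroʳ _))
      move k (+ l)    eq = *-congʳ (transfer {k = k} {k′ = k ℤ.+ 1ℤ}
        (trans (reflexive (≡.cong pow (ℤ-Solver.solve 1 (λ k → k := k :+ con 1 :- con 1) k)))
               (trans (pow-+ (k ℤ.+ 1ℤ) (ℤ.- 1ℤ)) (*-congˡ (*-identityʳ β))))
        (trans (reflexive (≡.cong ε (ℤ-Solver.solve 1 (λ k → k := k :+ con 1 :- con 1) k)))
               (trans (ε-+ (k ℤ.+ 1ℤ) (ℤ.- 1ℤ)) (*-congˡ (*-identityʳ (- 1#)))))
        (θ-expo-suc c d M l k eq))
      pointwise : ∀ k → term k * a n (suc M) k ≈ f k + - (y * Q ^ M) * f (k ℤ.+ 1ℤ)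
      pointwise k = begin
        t * (⟨Q⟩ (n ℕ.+ suc M) * (r (+ suc M ℤ.+ k) * r j))
          ≡⟨ ≡.cong₂ (λ l i → t * (⟨Q⟩ l * (r i * r j))) (ℕ.+-suc n M) (ℤ-Solver.solve 2 (λ M k → con 1 :+ M :+ k := M :+ (k :+ con 1)) (+ M) k) ⟩
        t * (P * F * (r u * r j))
          ≈⟨ solve 5 (λ t P F x y → t :* (P :* F :* (x :* y)) := t :* P :* (F :* (y :* x))) t P F _ _ ⟩
        t * P * (F * (r j * r u))
          ≈⟨ *-congˡ (pascal j u (suc (n ℕ.+ M)) (ℤ-Solver.solve 3 (λ n M k → n :- k :+ (M :+ (k :+ con 1)) := con 1 :+ n :+ M) (+ n) (+ M) k)) ⟩
        t * P * ((1# - Qᶻ u) * (r j * r u) + Qᶻ u * ((1# - Qᶻ j) * (r j * r u)))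
          ≈⟨ solve 6 (λ t P j u ru rj → t :* P :* ((con 1 :- u) :* (rj :* ru) :+ u :* ((con 1 :- j) :* (rj :* ru)))
                        := t :* (P :* ((con 1 :- u) :* ru :* rj)) :+ u :* t :* ru :* (P :* ((con 1 :- j) :* rj))) _ _ _ _ _ _ ⟩
        t * (P * ((1# - Qᶻ u) * r u * r j)) + Qᶻ u * t * r u * (P * ((1# - Qᶻ j) * r j))
          ≈⟨ +-cong (*-congˡ (*-congˡ (*-congʳ (trans (sym (r-pred u)) (reflexive (≡.cong r (ℤ-Solver.solve 2 (λ M k → M :+ (k :+ con 1) :- con 1 := M :+ k) (+ M) k)))))))
                    (*-cong (sym (move k u ≡.refl)) (*-congˡ (trans (sym (r-pred j)) (reflexive (≡.cong r (ℤ-Solver.solve 2 (λ n k → n :- k :- con 1 := n :- (k :+ con 1)) (+ n) k)))))) ⟩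
        f k + - (y * Q ^ M) * t′ * r u * (P * r (+ n ℤ.- (k ℤ.+ 1ℤ)))
          ≈⟨ +-congˡ (solve 5 (λ x t rj P ru → x :* t :* rj :* (P :* ru) := x :* (t :* (P :* (rj :* ru)))) _ _ _ _ _) ⟩
        f k + - (y * Q ^ M) * f (k ℤ.+ 1ℤ) ∎
        where
        t = term k
        t′ = term (k ℤ.+ 1ℤ)
        P = ⟨Q⟩ (n ℕ.+ M)
        F = factor (n ℕ.+ M)
        u = + M ℤ.+ (k ℤ.+ 1ℤ)
        j = + n ℤ.- k

    S₀₀ : S 0 0 ≈ 1#
    S₀₀ = begin
      sumOver f range        ≈⟨ sumOver-unique f (interval-unique (suc N)) ([] ∷ []) (λ {k} _ → only k) (λ { (here ≡.refl) → inj₁ (∈-interval⁺ {suc N} (+ 0) z≤n) }) ⟩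
      f 0ℤ + 0#              ≡⟨⟩
      1# * 1# * qᶻ (θ-expo c d 0ℤ) * (1# * (1# * 1#)) + 0#
                             ≡⟨ ≡.cong (λ e → 1# * 1# * qᶻ e * (1# * (1# * 1#)) + 0#) (≡.trans (θ-expo-formula c d 0ℤ) (ℤ-Solver.solve 2 (λ m c → m :* con 0 :+ c :* con 0 := con 0) (+ m) (+ c))) ⟩
      1# * 1# * 1# * (1# * (1# * 1#)) + 0#
                             ≈⟨ solve 0 (con 1 :* con 1 :* con 1 :* (con 1 :* (con 1 :* con 1)) :+ con 0 := con 1) ⟩
      1#                     ∎
      where
      f : ℤ → Carrier
      f k = term k * a 0 0 k
      only : ∀ k → k ∈ 0ℤ ∷ [] ⊎ f k ≈ 0#
      only (+ zero)  = inj₁ (here ≡.refl)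
      only (+ suc k) = inj₂ (solve 3 (λ t p x → t :* (p :* (x :* con 0)) := con 0) _ _ _)
      only -[1+ k ]  = inj₂ (solve 3 (λ t p x → t :* (p :* (con 0 :* x)) := con 0) _ _ _)

    -- The finite form of the triple product: adding a factor on either side costs one application
    -- of `step-x` or `step-y`, starting from the empty products.
    finite : ∀ n M → S n M ≈ prod (λ i → 1# - x * Q ^ i) n * prod (λ i → 1# - y * Q ^ i) M
    finite zero    zero    = trans S₀₀ (sym (*-identityˡ 1#))
    finite zero    (suc M) = trans (step-y 0 M) (trans (*-congʳ (finite 0 M)) (*-assoc _ _ _))
    finite (suc n) M       = trans (step-x n M) (trans (*-congʳ (finite n M)) (solve 3 (λ a b c → a :* b :* c := a :* c :* b) _ _ _))

    -- With n = M = 2N the Gaussian binomials of the surviving terms have reached their limit 1 / (Q; Q)_∞.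
    limit : ⟨Q⟩ N * S (N ℕ.+ N) (N ℕ.+ N) ≈ total θ-family
    limit = begin
      ⟨Q⟩ N * S (N ℕ.+ N) (N ℕ.+ N)
        ≈⟨ sumOver-*ˡ (⟨Q⟩ N) _ range ⟨
      sumOver (λ k → ⟨Q⟩ N * (term k * a (N ℕ.+ N) (N ℕ.+ N) k)) range
        ≈⟨ sumOver-cong range pointwise ⟩
      sumOver term range
        ≈⟨ sumOver-unique term (interval-unique (suc N)) (interval-unique N) (λ {k} _ → Family.supported θ-family k)
             (λ {k} k∈ → inj₁ (∈-interval⁺ k (ℕ.m≤n⇒m≤1+n (∈-interval⁻ k∈)))) ⟩
      total θ-family ∎
      where
      r-limit : ∀ i → + N ℤ.≤ i → r i ≈ ⟨Q⟩⁻¹ N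
      r-limit (+ i) (ℤ.+≤+ N≤i) = ⟨Q⟩⁻¹-stable N≤i
      near : ∀ k → ∣ k ∣ ℕ.≤ N → + N ℤ.≤ + (N ℕ.+ N) ℤ.+ k
      near (+ k)    _   = ℤ.+≤+ (ℕ.≤-trans (ℕ.m≤m+n N N) (ℕ.m≤m+n (N ℕ.+ N) k))
      near -[1+ k ] k<N = ≡.subst (+ N ℤ.≤_) (≡.sym (ℤ.⊖-≥ (ℕ.≤-trans k<N (ℕ.m≤m+n N N))))
        (ℤ.+≤+ (ℕ.≤-trans (ℕ.≤-reflexive (≡.sym (ℕ.m+n∸n≡m N N))) (ℕ.∸-monoʳ-≤ (N ℕ.+ N) k<N)))
      pointwise : ∀ k → ⟨Q⟩ N * (term k * a (N ℕ.+ N) (N ℕ.+ N) k) ≈ term k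
      pointwise k with ∣ k ∣ ℕ.≤? N
      ... | no  k≰N = trans (*-congˡ (*-congʳ tk≈0)) (trans (solve 2 (λ a b → a :* (con 0 :* b) := con 0) _ _) (sym tk≈0))
        where tk≈0 = term-vanishes k (ℕ.≰⇒> k≰N)
      ... | yes k≤N = begin
        ⟨Q⟩ N * (term k * (⟨Q⟩ (N ℕ.+ N ℕ.+ (N ℕ.+ N)) * (r (+ (N ℕ.+ N) ℤ.+ k) * r (+ (N ℕ.+ N) ℤ.- k))))
          ≈⟨ *-congˡ (*-congˡ (*-cong (⟨Q⟩-stable (ℕ.≤-trans (ℕ.m≤m+n N N) (ℕ.m≤m+n (N ℕ.+ N) _)))
               (*-cong (r-limit _ (near k k≤N)) (r-limit _ (near (ℤ.- k) (≡.subst (ℕ._≤ N) (≡.sym (ℤ.∣-i∣≡∣i∣ k)) k≤N)))))) ⟩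
        ⟨Q⟩ N * (term k * (⟨Q⟩ N * (⟨Q⟩⁻¹ N * ⟨Q⟩⁻¹ N)))
          ≈⟨ solve 3 (λ p t r → p :* (t :* (p :* (r :* r))) := t :* ((p :* r) :* (p :* r))) _ _ _ ⟩
        term k * ((⟨Q⟩ N * ⟨Q⟩⁻¹ N) * (⟨Q⟩ N * ⟨Q⟩⁻¹ N))
          ≈⟨ *-congˡ (*-cong (⟨Q⟩-inverse N) (⟨Q⟩-inverse N)) ⟩
        term k * (1# * 1#)
          ≈⟨ solve 1 (λ t → t :* (con 1 :* con 1) := t) _ ⟩
        term k ∎

    factors-stable : ∀ γ e → prod (λ i → 1# - γ * q ^ e * Q ^ i) (N ℕ.+ N) ≈ prod (λ i → 1# - γ * q ^ e * Q ^ i) N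
    factors-stable γ e = prod-stable _ (ℕ.m≤m+n N N) λ i N≤i →
      trans (+-congˡ (-‿cong (*-congˡ (QPochhammer.Q^≥N Q N Q^N≈0 N≤i)))) (solve 1 (λ x → con 1 :- x :* con 0 := con 1) _)

  triple-product : prod (λ i → 1# - α * q ^ c * Q ^ i) N * prod (λ i → 1# - β * q ^ d * Q ^ i) N * prod (λ i → 1# - Q ^ suc i) N
                   ≈ total θ-family
  triple-product = begin
    prod f N * prod g N * ⟨Q⟩ N
      ≈⟨ *-congʳ (*-cong (factors-stable α c) (factors-stable β d)) ⟨
    prod f (N ℕ.+ N) * prod g (N ℕ.+ N) * ⟨Q⟩ N
      ≈⟨ *-comm _ _ ⟩
    ⟨Q⟩ N * (prod f (N ℕ.+ N) * prod g (N ℕ.+ N))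
      ≈⟨ *-congˡ (finite (N ℕ.+ N) (N ℕ.+ N)) ⟨
    ⟨Q⟩ N * S (N ℕ.+ N) (N ℕ.+ N)
      ≈⟨ limit ⟩
    total θ-family ∎
    where
    f = λ i → 1# - α * q ^ c * Q ^ i
    g = λ i → 1# - β * q ^ d * Q ^ i

-- The q-binomial theorem

module RangeSums (B : CommutativeRing 0ℓ 0ℓ) where
  open CommutativeRing B
  open Sums B

  sumOver-upTo-first : ∀ f n → sumOver f (upTo (suc n)) ≡ f 0 + sumOver (f ∘ suc) (upTo n)
  sumOver-upTo-first f n = ≡.cong (λ s → f 0 + s)
    (≡.trans (≡.cong (sumOver f) (≡.sym (List.map-upTo suc n))) (sumOver-map f suc (upTo n)))

  sumOver-upTo-last : ∀ f n → sumOver f (upTo (suc n)) ≈ sumOver f (upTo n) + f n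
  sumOver-upTo-last f n =
    trans (reflexive (≡.cong (sumOver f) (≡.sym (List.upTo-∷ʳ n))))
          (trans (sumOver-++ f (upTo n) (n ∷ [])) (+-congˡ (+-identityʳ (f n))))

module QBinomial
  (B : CommutativeRing 0ℓ 0ℓ)
  (q : CommutativeRing.Carrier B) (N : ℕ) (q^N≈0 : PowerVanishes B q N) where
  open CommutativeRing B
  open Exp semiring using (_^_)

  open Exp semiring using (^-congˡ)
  open CommutativeExp commutativeSemiring using (^-distrib-*)
  open SetoidReasoning setoid
  open Solver B using (solve)
  open Sums B
  open RangeSums B
  open Products B
  open QPochhammer q N q^N≈0

  rising : Carrier → ℕ → Carrier
  rising a = prod (λ i → 1# - a * q ^ i)

  Ψ-term : Carrier → Carrier → ℕ → Carrier
  Ψ-term a x j = x ^ j * rising a j * ⟨Q⟩⁻¹ j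

  -- The series of (a; q)ⱼ xʲ / (q; q)ⱼ. Where it is evaluated, x^N = 0, so the truncation omits
  -- nothing.
  Ψ : Carrier → Carrier → Carrier
  Ψ a x = sumOver (Ψ-term a x) (upTo (suc N))

  private
    x^N≈0⇒ : ∀ {x} → x ^ N ≈ 0# → x ^ suc N ≈ 0#
    x^N≈0⇒ x^N≈0 = trans (*-congˡ x^N≈0) (zeroʳ _)

    scaled^N≈0 : ∀ y {x} → x ^ N ≈ 0# → (y * x) ^ N ≈ 0#
    scaled^N≈0 y {x} x^N≈0 = trans (^-distrib-* y x N) (trans (*-congˡ x^N≈0) (zeroʳ _))

  -- The classical functional equation. It is a rearrangement of Ψ(x) - Ψ(qx) = x (Ψ(x) - a Ψ(qx)),
  -- which holds term against preceding term; x^N = 0 disposes of the term at the end of the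
  -- truncated sums.
  Ψ-scale : ∀ a x → x ^ N ≈ 0# → (1# - x) * Ψ a x ≈ (1# - a * x) * Ψ a (q * x)
  Ψ-scale a x x^N≈0 = begin
    (1# - x) * P
      ≈⟨ solve 4 (λ a x P P′ → (con 1 :- x) :* P := (con 1 :- a :* x) :* P′ :+ ((P :- P′) :- x :* (P :- a :* P′))) a x P P′ ⟩
    (1# - a * x) * P′ + ((P - P′) - x * (P - a * P′))
      ≈⟨ +-congˡ (+-congʳ difference) ⟩
    (1# - a * x) * P′ + (x * (P - a * P′) - x * (P - a * P′))
      ≈⟨ solve 2 (λ y x → y :+ (x :- x) := y) _ _ ⟩
    (1# - a * x) * P′ ∎
    where
    P  = Ψ a x
    P′ = Ψ a (q * x)
    t  = Ψ-term a x
    t′ = Ψ-term a (q * x)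
    step : ∀ i → t (suc i) - t′ (suc i) ≈ x * (t i - a * t′ i)
    step i = begin
      x * x ^ i * (A * (1# - a * Q)) * R′ - (q * x) ^ suc i * (A * (1# - a * Q)) * R′
        ≈⟨ +-congˡ (-‿cong (*-congʳ (*-congʳ (^-distrib-* q x (suc i))))) ⟩
      x * x ^ i * (A * (1# - a * Q)) * R′ - q ^ suc i * x ^ suc i * (A * (1# - a * Q)) * R′
        ≈⟨ solve 7 (λ x X A a Q q R → x :* X :* (A :* (con 1 :- a :* Q)) :* R :- (q :* Q) :* (x :* X) :* (A :* (con 1 :- a :* Q)) :* R
                      := x :* (X :* A :* (con 1 :- a :* Q) :* ((con 1 :- q :* Q) :* R))) x (x ^ i) A a Q q R′ ⟩
      x * (x ^ i * A * (1# - a * Q) * (factor i * R′))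
        ≈⟨ *-congˡ (*-congˡ (factor-⟨Q⟩⁻¹ i)) ⟩
      x * (x ^ i * A * (1# - a * Q) * R)
        ≈⟨ solve 6 (λ x X A a Q R → x :* (X :* A :* (con 1 :- a :* Q) :* R) := x :* (X :* A :* R :- a :* ((Q :* X) :* A :* R))) _ _ _ _ _ _ ⟩
      x * (x ^ i * A * R - a * (Q * x ^ i * A * R))
        ≈⟨ *-congˡ (+-congˡ (-‿cong (*-congˡ (*-congʳ (*-congʳ (^-distrib-* q x i)))))) ⟨
      x * (t i - a * t′ i) ∎
      where
      A  = rising a i
      Q  = q ^ i
      R  = ⟨Q⟩⁻¹ i
      R′ = ⟨Q⟩⁻¹ (suc i)
    subtract : ∀ (f g : ℕ → Carrier) xs → sumOver f xs - sumOver g xs ≈ sumOver (λ i → f i - g i) xs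
    subtract f g xs = trans (+-congˡ (sym (sumOver-neg g xs))) (sym (sumOver-+ f (λ i → - g i) xs))
    last≈0 : ∀ y → y ^ N ≈ 0# → Ψ-term a y (suc N) ≈ 0#
    last≈0 y y^N≈0 = trans (*-congʳ (trans (*-congʳ (x^N≈0⇒ y^N≈0)) (zeroˡ _))) (zeroˡ _)
    difference : P - P′ ≈ x * (P - a * P′)
    difference = begin
      P - P′
        ≈⟨ solve 2 (λ p p′ → p :- p′ := (p :+ con 0) :- (p′ :+ con 0)) P P′ ⟩
      (P + 0#) - (P′ + 0#)
        ≈⟨ +-cong (+-congˡ (last≈0 x x^N≈0)) (-‿cong (+-congˡ (last≈0 (q * x) (scaled^N≈0 q x^N≈0)))) ⟨
      (P + t (suc N)) - (P′ + t′ (suc N))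
        ≈⟨ +-cong (sumOver-upTo-last t (suc N)) (-‿cong (sumOver-upTo-last t′ (suc N))) ⟨
      sumOver t (upTo (suc (suc N))) - sumOver t′ (upTo (suc (suc N)))
        ≈⟨ subtract t t′ (upTo (suc (suc N))) ⟩
      sumOver (λ i → t i - t′ i) (upTo (suc (suc N)))
        ≡⟨ sumOver-upTo-first (λ i → t i - t′ i) (suc N) ⟩
      (t 0 - t′ 0) + sumOver (λ i → t (suc i) - t′ (suc i)) (upTo (suc N))
        ≈⟨ +-cong (-‿inverseʳ _) (sumOver-cong (upTo (suc N)) step) ⟩
      0# + sumOver (λ i → x * (t i - a * t′ i)) (upTo (suc N))
        ≈⟨ trans (+-identityˡ _) (sumOver-*ˡ x _ (upTo (suc N))) ⟩
      x * sumOver (λ i → t i - a * t′ i) (upTo (suc N))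
        ≈⟨ *-congˡ (subtract t (λ i → a * t′ i) (upTo (suc N))) ⟨
      x * (P - sumOver (λ i → a * t′ i) (upTo (suc N)))
        ≈⟨ *-congˡ (+-congˡ (-‿cong (sumOver-*ˡ a t′ (upTo (suc N))))) ⟩
      x * (P - a * P′) ∎

  Ψ-cong : ∀ a {x y} → x ≈ y → Ψ a x ≈ Ψ a y
  Ψ-cong a x≈y = sumOver-cong (upTo (suc N)) λ j → *-congʳ (*-congʳ (^-congˡ j x≈y))

  private
    iterate : ∀ a x → x ^ N ≈ 0# → ∀ n → rising x n * Ψ a x ≈ rising (a * x) n * Ψ a (q ^ n * x)
    iterate a x x^N≈0 zero    = *-congˡ (Ψ-cong a (sym (*-identityˡ x)))
    iterate a x x^N≈0 (suc n) = begin
      rising x n * (1# - x * q ^ n) * Ψ a x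
        ≈⟨ solve 3 (λ r f p → r :* f :* p := f :* (r :* p)) _ _ _ ⟩
      (1# - x * q ^ n) * (rising x n * Ψ a x)
        ≈⟨ *-cong (+-congˡ (-‿cong (*-comm x (q ^ n)))) (iterate a x x^N≈0 n) ⟩
      (1# - q ^ n * x) * (rising (a * x) n * Ψ a (q ^ n * x))
        ≈⟨ solve 3 (λ f r p → f :* (r :* p) := r :* (f :* p)) _ _ _ ⟩
      rising (a * x) n * ((1# - q ^ n * x) * Ψ a (q ^ n * x))
        ≈⟨ *-congˡ (Ψ-scale a (q ^ n * x) (scaled^N≈0 (q ^ n) x^N≈0)) ⟩
      rising (a * x) n * ((1# - a * (q ^ n * x)) * Ψ a (q * (q ^ n * x)))
        ≈⟨ *-assoc _ _ _ ⟨
      rising (a * x) n * (1# - a * (q ^ n * x)) * Ψ a (q * (q ^ n * x))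
        ≈⟨ *-cong (*-congˡ (+-congˡ (-‿cong (solve 3 (λ a x Q → a :* (Q :* x) := a :* x :* Q) a x (q ^ n)))))
                  (Ψ-cong a (sym (*-assoc q (q ^ n) x))) ⟩
      rising (a * x) (suc n) * Ψ a (q ^ suc n * x) ∎

    Ψ-0 : ∀ a {x} → x ≈ 0# → Ψ a x ≈ 1#
    Ψ-0 a {x} x≈0 = begin
      sumOver (Ψ-term a x) (upTo (suc N))
        ≡⟨ sumOver-upTo-first (Ψ-term a x) N ⟩
      1# * 1# * 1# + sumOver (Ψ-term a x ∘ suc) (upTo N)
        ≈⟨ +-congˡ (sumOver-0 (upTo N) λ {j} _ → trans (*-congʳ (*-congʳ (*-congʳ x≈0))) (solve 3 (λ a b c → con 0 :* a :* b :* c := con 0) _ _ _)) ⟩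
      1# * 1# * 1# + 0#
        ≈⟨ solve 0 (con 1 :* con 1 :* con 1 :+ con 0 := con 1) ⟩
      1# ∎

  -- Iterating the functional equation N times replaces x by q^N x = 0, where the series is 1.
  q-binomial : ∀ a x → x ^ N ≈ 0# → rising x N * Ψ a x ≈ rising (a * x) N
  q-binomial a x x^N≈0 =
    trans (iterate a x x^N≈0 N)
          (trans (*-congˡ (Ψ-0 a (trans (*-congʳ q^N≈0) (zeroˡ x)))) (*-identityʳ _))

-- The crank product from the q-binomial theorem

module CrankAlgebra
  (B : CommutativeRing 0ℓ 0ℓ)
  (q : CommutativeRing.Carrier B) (N : ℕ) (q^N≈0 : PowerVanishes B q N) (z w : CommutativeRing.Carrier B) (zw≈1 : MutuallyInverse B z w) where
  open CommutativeRing B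
  open Exp semiring using (_^_)

  open CommutativeExp commutativeSemiring using (^-distrib-*)
  open SetoidReasoning setoid
  open Solver B using (solve)
  open Sums B
  open RangeSums B
  open Products B
  open QPochhammer q N q^N≈0
  open QBinomial B q N q^N≈0
  open Nilpotent B q N q^N≈0 using (q^≥N)

  Z W : ℕ → Carrier
  Z = prod (λ i → 1# - z * q ^ suc i)
  W = prod (λ i → 1# - w * q ^ suc i)

  -- The part i + 1 > j contributes to the crank of a partition with j > 0 ones.
  weight : ℕ → ℕ → Carrier
  weight j i = if does (j ℕ.<? suc i) then z else 1#

  mixed : ℕ → ℕ → Carrier
  mixed j = prod (λ i → 1# - weight j i * q ^ suc i)

  private
    small : ∀ {j i} → i ℕ.< j → weight j i ≡ 1#
    small {j} {i} i<j = ≡.cong (if_then z else 1#) (dec-false (j ℕ.<? suc i) λ j<1+i → ℕ.<⇒≱ i<j (ℕ.≤-pred j<1+i))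

    large : ∀ {j i} → j ℕ.≤ i → weight j i ≡ z
    large {j} {i} j≤i = ≡.cong (if_then z else 1#) (dec-true (j ℕ.<? suc i) (s≤s j≤i))

    mixed-small : ∀ {j} k → k ℕ.≤ j → mixed j k ≈ ⟨Q⟩ k
    mixed-small zero    _   = refl
    mixed-small (suc k) k<j =
      *-cong (mixed-small k (ℕ.<⇒≤ k<j)) (+-congˡ (-‿cong (trans (*-congʳ (reflexive (small k<j))) (*-identityˡ _))))

    -- The weights are 1 up to the part j and z beyond it, so `mixed j k` is (q; q)ⱼ times the
    -- factors of (zq; q)ₖ that are missing in (zq; q)ⱼ.
    mixed-Z : ∀ {j} k → j ℕ.≤ k → mixed j k * Z j ≈ ⟨Q⟩ j * Z k
    mixed-Z {j} k j≤k with ℕ.m≤n⇒m<n∨m≡n j≤k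
    ... | inj₂ ≡.refl = *-congʳ (mixed-small k ℕ.≤-refl)
    mixed-Z {j} (suc k) _ | inj₁ (s≤s j≤k) = begin
      mixed j k * (1# - weight j k * q ^ suc k) * Z j
        ≈⟨ *-congʳ (*-congˡ (+-congˡ (-‿cong (*-congʳ (reflexive (large j≤k)))))) ⟩
      mixed j k * (1# - z * q ^ suc k) * Z j
        ≈⟨ solve 3 (λ a b c → a :* b :* c := a :* c :* b) _ _ _ ⟩
      mixed j k * Z j * (1# - z * q ^ suc k)
        ≈⟨ *-congʳ (mixed-Z k j≤k) ⟩
      ⟨Q⟩ j * Z k * (1# - z * q ^ suc k)
        ≈⟨ *-assoc _ _ _ ⟩
      ⟨Q⟩ j * Z (suc k) ∎

    scaled^N≈0 : ∀ y → (y * q) ^ N ≈ 0#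
    scaled^N≈0 y = trans (^-distrib-* y q N) (trans (*-congˡ q^N≈0) (zeroʳ _))

    shifted : ∀ y n → rising (y * q) n ≈ prod (λ i → 1# - y * q ^ suc i) n
    shifted y n = prod-cong n λ i → +-congˡ (-‿cong (*-assoc y q (q ^ i)))

    rising-0 : ∀ {a} n → a ≈ 0# → rising a n ≈ 1#
    rising-0 zero    a≈0 = refl
    rising-0 (suc n) a≈0 = trans (*-cong (rising-0 n a≈0) (trans (+-congˡ (-‿cong (*-congʳ a≈0))) (solve 1 (λ x → con 1 :- con 0 :* x := con 1) _))) (*-identityʳ 1#)

    euler : Z N * Ψ 0# (z * q) ≈ 1#
    euler = begin
      Z N * Ψ 0# (z * q)                ≈⟨ *-congʳ (shifted z N) ⟨
      rising (z * q) N * Ψ 0# (z * q)   ≈⟨ q-binomial 0# (z * q) (scaled^N≈0 z) ⟩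
      rising (0# * (z * q)) N           ≈⟨ rising-0 N (zeroˡ _) ⟩
      1#                                ∎

  Ψ₀-term : ∀ x j → Ψ-term 0# x j ≈ x ^ j * ⟨Q⟩⁻¹ j
  Ψ₀-term x j = *-congʳ (trans (*-congˡ (rising-0 j refl)) (*-identityʳ _))

  -- A j is the contribution of the partitions with j ones, for 1 ≤ j ≤ N.
  crank-product : (A : ℕ → Carrier) (K : ℕ) → N ℕ.≤ K →
                  (∀ j → 1 ℕ.≤ j → j ℕ.≤ N → A j * mixed j K ≈ (1# - q) * (w * q) ^ j) →
                  ((1# - q) * Ψ 0# (z * q) + sumOver (A ∘ suc) (upTo N)) * (Z N * W N) ≈ ⟨Q⟩ N
  crank-product A K N≤K A-mixed = begin
    ((1# - q) * Ψ 0# (z * q) + sumOver (A ∘ suc) (upTo N)) * (Z N * W N)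
      ≈⟨ solve 5 (λ f p s Z W → (f :* p :+ s) :* (Z :* W) := (f :* (Z :* p) :+ Z :* s) :* W) _ _ _ _ _ ⟩
    ((1# - q) * (Z N * Ψ 0# (z * q)) + Z N * sumOver (A ∘ suc) (upTo N)) * W N
      -- After multiplication by (zq; q)_∞ the class with j ones becomes 1 - q times (zq; q)ⱼ (wq)ʲ
      -- / (q; q)ⱼ. Euler's identity shows the same for j = 0, so all classes together form one
      -- q-binomial series.
      ≈⟨ *-congʳ (+-cong (*-congˡ (trans euler first)) (trans (sym (sumOver-*ˡ (Z N) (A ∘ suc) (upTo N))) (trans (sumOver-cong∈ (upTo N) λ {j} j∈ → ZA (suc j) (s≤s z≤n) (∈-upTo⁻ j∈)) (sumOver-*ˡ (1# - q) (t ∘ suc) (upTo N))))) ⟩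
    ((1# - q) * t 0 + (1# - q) * sumOver (t ∘ suc) (upTo N)) * W N
      ≈⟨ *-congʳ (sym (distribˡ _ _ _)) ⟩
    (1# - q) * (t 0 + sumOver (t ∘ suc) (upTo N)) * W N
      ≡⟨ ≡.cong (λ s → (1# - q) * s * W N) (≡.sym (sumOver-upTo-first t N)) ⟩
    (1# - q) * Ψ (z * q) (w * q) * W N
      ≈⟨ solve 3 (λ f p W → f :* p :* W := f :* (W :* p)) _ _ _ ⟩
    (1# - q) * (W N * Ψ (z * q) (w * q))
      ≈⟨ *-congˡ (trans (*-congʳ (sym (shifted w N))) (q-binomial (z * q) (w * q) (scaled^N≈0 w))) ⟩
    (1# - q) * rising (z * q * (w * q)) N
      -- Here z w = 1 enters: zq · wq = q², and 1 - q is exactly the factor that completes (q²; q)_∞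
      -- to (q; q)_∞.
      ≈⟨ *-cong (+-congˡ (-‿cong (sym (*-identityʳ q)))) (prod-cong N λ i → +-congˡ (-‿cong (q² i))) ⟩
    factor 0 * prod (factor ∘ suc) N
      ≈⟨ prod-first factor N ⟨
    ⟨Q⟩ (suc N)
      ≈⟨ ⟨Q⟩-stable (ℕ.n≤1+n N) ⟩
    ⟨Q⟩ N ∎
    where
    t = Ψ-term (z * q) (w * q)
    first : 1# ≈ t 0
    first = solve 0 (con 1 := con 1 :* con 1 :* con 1)
    q² : ∀ i → z * q * (w * q) * q ^ i ≈ q ^ suc (suc i)
    q² i = trans (solve 4 (λ z w q Q → z :* q :* (w :* q) :* Q := z :* w :* (q :* (q :* Q))) z w q (q ^ i))
                 (trans (*-congʳ zw≈1) (*-identityˡ _))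
    Z-stable : Z K ≈ Z N
    Z-stable = prod-stable _ N≤K λ i N≤i →
      trans (+-congˡ (-‿cong (*-congˡ (q^≥N (ℕ.m≤n⇒m≤1+n N≤i))))) (solve 1 (λ z → con 1 :- z :* con 0 := con 1) z)
    ZA : ∀ j → 1 ℕ.≤ j → j ℕ.≤ N → Z N * A j ≈ (1# - q) * t j
    ZA j 1≤j j≤N = begin
      Z N * A j
        ≈⟨ trans (*-congʳ (sym Z-stable)) (sym (*-identityˡ _)) ⟩
      1# * (Z K * A j)
        ≈⟨ *-congʳ (⟨Q⟩-inverse j) ⟨
      ⟨Q⟩ j * ⟨Q⟩⁻¹ j * (Z K * A j)
        ≈⟨ solve 4 (λ p r Z A → p :* r :* (Z :* A) := A :* (p :* Z) :* r) _ _ _ _ ⟩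
      A j * (⟨Q⟩ j * Z K) * ⟨Q⟩⁻¹ j
        ≈⟨ *-congʳ (*-congˡ (mixed-Z K (ℕ.≤-trans j≤N N≤K))) ⟨
      A j * (mixed j K * Z j) * ⟨Q⟩⁻¹ j
        ≈⟨ *-congʳ (trans (sym (*-assoc _ _ _)) (*-congʳ (A-mixed j 1≤j j≤N))) ⟩
      (1# - q) * (w * q) ^ j * Z j * ⟨Q⟩⁻¹ j
        ≈⟨ *-congʳ (*-congˡ (sym (shifted z j))) ⟩
      (1# - q) * (w * q) ^ j * rising (z * q) j * ⟨Q⟩⁻¹ j
        ≈⟨ solve 4 (λ a b c d → a :* b :* c :* d := a :* (b :* c :* d)) _ _ _ _ ⟩
      (1# - q) * t j ∎

-- The generating function of the crank

partitionsBelow : ℕ → List (List ℕ)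
partitionsBelow zero    = []
partitionsBelow (suc n) = partitionsBelow n ++ partitions n

∈-partitionsBelow⁺ : ∀ {π} N → IsPartition (sum π) π → sum π < N → π ∈ partitionsBelow N
∈-partitionsBelow⁺ (suc N) π-part (s≤s sum≤N) with ℕ.m≤n⇒m<n∨m≡n sum≤N
... | inj₁ sum<N  = ∈-++⁺ˡ (∈-partitionsBelow⁺ N π-part sum<N)
... | inj₂ ≡.refl = ∈-++⁺ʳ (partitionsBelow N) (∈-partitions⁺ π-part)

∈-partitionsBelow⁻ : ∀ {π} N → π ∈ partitionsBelow N → IsPartition (sum π) π × sum π < N
∈-partitionsBelow⁻ (suc N) π∈ with ∈-++⁻ (partitionsBelow N) π∈
... | inj₁ π∈′ with π-part , sum<N ← ∈-partitionsBelow⁻ N π∈′ = π-part , ℕ.m≤n⇒m≤1+n sum<N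
... | inj₂ π∈′ with linked , pos , ≡.refl ← ∈-partitions⁻ {N} π∈′ = (linked , pos , ≡.refl) , ℕ.≤-refl

partitionsBelow-unique : ∀ N → Unique (partitionsBelow N)
partitionsBelow-unique zero    = []
partitionsBelow-unique (suc N) =
  Unique.++⁺ (partitionsBelow-unique N) (partitions-unique N) λ (π∈ , π∈′) →
    ℕ.<-irrefl (proj₂ (proj₂ (∈-partitions⁻ {N} π∈′))) (proj₂ (∈-partitionsBelow⁻ N π∈))

head-max : ∀ {x π} → Linked _≥_ (x ∷ π) → All (_≤ x) π
head-max [-]          = []
head-max (x≥y ∷ link) = x≥y ∷ All.map (λ p≤y → ℕ.≤-trans p≤y x≥y) (head-max link)

cons-linked : ∀ {x π} → All (_≤ x) π → Linked _≥_ π → Linked _≥_ (x ∷ π)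
cons-linked []        []   = [-]
cons-linked (p ∷ _)   link = p ∷ link

Bounded : ℕ → ℕ → List ℕ → Set
Bounded j k π = ω π ≡ j × All (_≤ k) π

bounded? : ∀ j k → Decidable (Bounded j k)
bounded? j k π = (ω π ℕ.≟ j) ×-dec all? (ℕ._≤? k) π

parts≤sum : ∀ π → All (_≤ sum π) π
parts≤sum []      = []
parts≤sum (x ∷ π) = ℕ.m≤m+n x (sum π) ∷ All.map (λ p≤ → ℕ.≤-trans p≤ (ℕ.m≤n+m (sum π) x)) (parts≤sum π)

largest-head : ∀ {x π} → All (_≤ x) π → largest (x ∷ π) ≡ x
largest-head all = ℕ.m≥n⇒m⊔n≡m (bound all)
  where
  bound : ∀ {x π} → All (_≤ x) π → largest π ≤ x
  bound []       = z≤n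
  bound (p ∷ ps) = ℕ.⊔-lub p (bound ps)

ones : ∀ {π} → All (0 <_) π → All (_≤ 1) π → π ≡ replicate (ω π) 1
ones []             []              = ≡.refl
ones (s≤s z≤n ∷ ps) (s≤s z≤n ∷ ps′) = ≡.cong (1 ∷_) (ones ps ps′)

replicate-ones : ∀ j → Linked _≥_ (replicate j 1) × All (0 <_) (replicate j 1) × ω (replicate j 1) ≡ j × All (_≤ 1) (replicate j 1) × sum (replicate j 1) ≡ j
replicate-ones zero = [] , [] , ≡.refl , [] , ≡.refl
replicate-ones (suc j) with link , pos , ω≡ , small , sum≡ ← replicate-ones j =
  cons-linked small link , s≤s z≤n ∷ pos , ≡.cong suc ω≡ , ℕ.≤-refl ∷ small , ≡.cong suc sum≡

crank-without-ones : ∀ π → ω π ≡ 0 → crank π ≡ + largest π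
crank-without-ones π ω≡0 with ω π
... | zero = ≡.refl

crank-with-ones : ∀ π {j} → ω π ≡ suc j → crank π ≡ + μ π ℤ.- + ω π
crank-with-ones π ω≡ with ω π in eq
... | suc _ = ≡.cong (λ o → + length (filter (o ℕ.<?_) π) ℤ.- + o) eq

module CrankGeneratingFunction
  (B : CommutativeRing 0ℓ 0ℓ)
  (q : CommutativeRing.Carrier B) (N : ℕ) (q^N≈0 : PowerVanishes B q N) (z w : CommutativeRing.Carrier B) (zw≈1 : MutuallyInverse B z w) where
  open CommutativeRing B
  open Exp semiring using (_^_)

  open Exp semiring using (^-homo-*)
  open CommutativeExp commutativeSemiring using (^-distrib-*)
  open SetoidReasoning setoid
  open Solver B using (solve)
  open Sums B
  open RangeSums B
  open Products B
  open QPochhammer q N q^N≈0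
  open QBinomial B q N q^N≈0
  open CrankAlgebra B q N q^N≈0 z w zw≈1
  open Nilpotent B q N q^N≈0 using (q^≥N)
  open Powers B
  open Unit z w zw≈1

  private
    Π : List (List ℕ)
    Π = partitionsBelow N

    bounded : ℕ → ℕ → List (List ℕ)
    bounded j k = filter (bounded? j k) Π

    ∈-bounded⁺ : ∀ {j k π} → Linked _≥_ π → All (0 <_) π → Bounded j k π → sum π < N → π ∈ bounded j k
    ∈-bounded⁺ {j} {k} link pos b sum<N = ∈-filter⁺ (bounded? j k) (∈-partitionsBelow⁺ N (link , pos , ≡.refl) sum<N) b

    ∈-bounded⁻ : ∀ {j k π} → π ∈ bounded j k → Linked _≥_ π × All (0 <_) π × Bounded j k π × sum π < N
    ∈-bounded⁻ {j} {k} π∈ with π∈Π , b ← ∈-filter⁻ (bounded? j k) {xs = Π} π∈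
                          with (link , pos , _) , sum<N ← ∈-partitionsBelow⁻ N π∈Π = link , pos , b , sum<N

    bounded-unique : ∀ j k → Unique (bounded j k)
    bounded-unique j k = Unique.filter⁺ (bounded? j k) (partitionsBelow-unique N)

    -- Prepending a part may lead out of the finite list of partitions; the recursions stay valid
    -- because the terms lost in this way carry a power of q that vanishes.
    Negligible : (List ℕ → Carrier) → Set
    Negligible t = ∀ π → N ≤ sum π → t π ≈ 0#

    small-or-negligible : ∀ {t} → Negligible t → ∀ π → sum π < N ⊎ t π ≈ 0#
    small-or-negligible negl π with sum π ℕ.<? N
    ... | yes sum<N = inj₁ sum<N
    ... | no  sum≮N = inj₂ (negl π (ℕ.≮⇒≥ sum≮N))

    -- A partition with parts at most k + 2 either has all parts at most k + 1 or starts with k + 2.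
    peel : ∀ {t} → Negligible t → ∀ j k →
           sumOver t (bounded j (2 ℕ.+ k)) ≈ sumOver t (bounded j (1 ℕ.+ k)) + sumOver (λ π → t ((2 ℕ.+ k) ∷ π)) (bounded j (2 ℕ.+ k))
    peel {t} negl j k = begin
      sumOver t (bounded j (2 ℕ.+ k))
        ≈⟨ sumOver-unique t (bounded-unique j (2 ℕ.+ k)) rhs-unique (λ {π} π∈ → inj₁ (to π π∈)) from ⟩
      sumOver t (bounded j (1 ℕ.+ k) ++ map ((2 ℕ.+ k) ∷_) (bounded j (2 ℕ.+ k)))
        ≈⟨ sumOver-++ t (bounded j (1 ℕ.+ k)) _ ⟩
      sumOver t (bounded j (1 ℕ.+ k)) + sumOver t (map ((2 ℕ.+ k) ∷_) (bounded j (2 ℕ.+ k)))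
        ≡⟨ ≡.cong (λ s → sumOver t (bounded j (1 ℕ.+ k)) + s) (sumOver-map t ((2 ℕ.+ k) ∷_) (bounded j (2 ℕ.+ k))) ⟩
      sumOver t (bounded j (1 ℕ.+ k)) + sumOver (λ π → t ((2 ℕ.+ k) ∷ π)) (bounded j (2 ℕ.+ k)) ∎
      where
      rhs = bounded j (1 ℕ.+ k) ++ map ((2 ℕ.+ k) ∷_) (bounded j (2 ℕ.+ k))
      rhs-unique : Unique rhs
      rhs-unique = Unique.++⁺ (bounded-unique j (1 ℕ.+ k)) (Unique.map⁺ List.∷-injectiveʳ (bounded-unique j (2 ℕ.+ k))) disjoint
        where
        disjoint : ∀ {π} → π ∈ bounded j (1 ℕ.+ k) × π ∈ map ((2 ℕ.+ k) ∷_) (bounded j (2 ℕ.+ k)) → Data.Empty.⊥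
        disjoint (π∈ , π∈′) with _ , _ , ≡.refl ← ∈-map⁻ ((2 ℕ.+ k) ∷_) π∈′
                            with _ , _ , (_ , head≤ ∷ _) , _ ← ∈-bounded⁻ {j} {1 ℕ.+ k} π∈ = ℕ.1+n≰n head≤
      to : ∀ π → π ∈ bounded j (2 ℕ.+ k) → π ∈ rhs
      to π π∈ with ∈-bounded⁻ {j} {2 ℕ.+ k} π∈
      to [] π∈ | link , pos , (ω≡ , []) , sum<N = ∈-++⁺ˡ (∈-bounded⁺ link pos (ω≡ , []) sum<N)
      to (x ∷ π) π∈ | link , p ∷ pos , (ω≡ , x≤ ∷ small) , sum<N with ℕ.m≤n⇒m<n∨m≡n x≤
      ... | inj₁ (s≤s x≤1+k) = ∈-++⁺ˡ (∈-bounded⁺ link (p ∷ pos) (ω≡ , x≤1+k ∷ All.map (λ y≤x → ℕ.≤-trans y≤x x≤1+k) (head-max link)) sum<N)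
      ... | inj₂ ≡.refl = ∈-++⁺ʳ (bounded j (1 ℕ.+ k))
        (∈-map⁺ ((2 ℕ.+ k) ∷_) (∈-bounded⁺ (Linked.tail link) pos (ω≡ , small) (ℕ.≤-<-trans (ℕ.m≤n+m (sum π) (2 ℕ.+ k)) sum<N)))
      from : ∀ {π} → π ∈ rhs → π ∈ bounded j (2 ℕ.+ k) ⊎ t π ≈ 0#
      from π∈ with ∈-++⁻ (bounded j (1 ℕ.+ k)) π∈
      ... | inj₁ π∈′ with link , pos , (ω≡ , small) , sum<N ← ∈-bounded⁻ {j} {1 ℕ.+ k} π∈′ =
        inj₁ (∈-bounded⁺ link pos (ω≡ , All.map (λ x≤ → ℕ.m≤n⇒m≤1+n x≤) small) sum<N)
      ... | inj₂ π∈′ with π , π∈″ , ≡.refl ← ∈-map⁻ ((2 ℕ.+ k) ∷_) π∈′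
                     with link , pos , (ω≡ , small) , sum<N ← ∈-bounded⁻ {j} {2 ℕ.+ k} π∈″ =
        Data.Sum.map₁ (∈-bounded⁺ (cons-linked small link) (s≤s z≤n ∷ pos) (ω≡ , ℕ.≤-refl ∷ small))
                      (small-or-negligible negl ((2 ℕ.+ k) ∷ π))

    base : ∀ {t} → Negligible t → ∀ j → sumOver t (bounded j 1) ≈ t (replicate j 1)
    base {t} negl j = begin
      sumOver t (bounded j 1)
        ≈⟨ sumOver-unique t (bounded-unique j 1) ([] ∷ []) (λ {π} π∈ → inj₁ (to π π∈)) (λ { (here ≡.refl) → from }) ⟩
      t (replicate j 1) + 0#
        ≈⟨ +-identityʳ _ ⟩
      t (replicate j 1) ∎
      where
      to : ∀ π → π ∈ bounded j 1 → π ∈ replicate j 1 ∷ []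
      to π π∈ with _ , pos , (≡.refl , small) , _ ← ∈-bounded⁻ {j} {1} π∈ = here (ones pos small)
      from : replicate j 1 ∈ bounded j 1 ⊎ t (replicate j 1) ≈ 0#
      from with link , pos , ω≡ , small , _ ← replicate-ones j =
        Data.Sum.map₁ (∈-bounded⁺ link pos (ω≡ , small)) (small-or-negligible negl (replicate j 1))

    weighted : (ℕ → Carrier) → List ℕ → Carrier
    weighted v π = foldr (λ i s → v i * s) 1# π * q ^ sum π

    weighted-negligible : ∀ v → Negligible (weighted v)
    weighted-negligible v π N≤ = trans (*-congˡ (q^≥N N≤)) (zeroʳ _)

    weighted-∷ : ∀ v i π → weighted v (i ∷ π) ≈ v i * q ^ i * weighted v π
    weighted-∷ v i π = trans (*-congˡ (^-homo-* q i (sum π))) (solve 4 (λ a b c d → a :* b :* (c :* d) := a :* c :* (b :* d)) _ _ _ _)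

    weighted-ones : ∀ v j → weighted v (replicate j 1) ≈ (v 1 * q) ^ j
    weighted-ones v zero    = *-identityˡ 1#
    weighted-ones v (suc j) = trans (weighted-∷ v 1 (replicate j 1)) (*-cong (*-congˡ (*-identityʳ q)) (weighted-ones v j))

    -- Euler's product for multiplicative weights with the number of ones prescribed. By `peel`,
    -- admitting a larger part with contribution x turns the sum F into F′ = F + x F′, that is F′ (1
    -- - x) = F.
    weighted-product : ∀ v j k →
      sumOver (weighted v) (bounded j (suc k)) * prod (λ i → 1# - v (2 ℕ.+ i) * q ^ (2 ℕ.+ i)) k ≈ (v 1 * q) ^ j
    weighted-product v j zero = trans (*-identityʳ _) (trans (base (weighted-negligible v) j) (weighted-ones v j))
    weighted-product v j (suc k) = begin
      F′ * (P * (1# - x))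
        ≈⟨ solve 3 (λ F P x → F :* (P :* (con 1 :- x)) := (F :- x :* F) :* P) F′ P x ⟩
      (F′ - x * F′) * P
        ≈⟨ *-congʳ (+-congʳ (trans (peel (weighted-negligible v) j k) (+-congˡ (trans (sumOver-cong (bounded j (2 ℕ.+ k)) (weighted-∷ v (2 ℕ.+ k))) (sumOver-*ˡ x (weighted v) (bounded j (2 ℕ.+ k))))))) ⟩
      (F + x * F′ - x * F′) * P
        ≈⟨ *-congʳ (solve 2 (λ a b → a :+ b :- b := a) _ _) ⟩
      F * P
        ≈⟨ weighted-product v j k ⟩
      (v 1 * q) ^ j ∎
      where
      F′ = sumOver (weighted v) (bounded j (2 ℕ.+ k))
      F = sumOver (weighted v) (bounded j (1 ℕ.+ k))
      P = prod (λ i → 1# - v (2 ℕ.+ i) * q ^ (2 ℕ.+ i)) k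
      x = v (2 ℕ.+ k) * q ^ (2 ℕ.+ k)

    -- For a fixed positive number j of ones, z^crank is multiplicative over the parts: a one
    -- contributes w = 1/z and a part larger than j contributes z.
    crankWeight : ℕ → ℕ → Carrier
    crankWeight j zero          = 1#
    crankWeight j (suc zero)    = w
    crankWeight j (suc (suc i)) = weight j (suc i)

    crankWeight-correct : ∀ j {π} → All (0 <_) π →
      foldr (λ i s → crankWeight (suc j) i * s) 1# π ≈ z ^ length (filter (suc j ℕ.<?_) π) * w ^ ω π
    crankWeight-correct j {[]} [] = sym (*-identityˡ 1#)
    crankWeight-correct j {suc zero ∷ π} (_ ∷ pos) = trans (*-congˡ (crankWeight-correct j pos)) (solve 3 (λ a b c → a :* (b :* c) := b :* (a :* c)) _ _ _)
    -- Both the weight and the filter on the other side reduce to this Boolean comparison.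
    crankWeight-correct j {suc (suc i) ∷ π} (_ ∷ pos) with suc j ℕ.<ᵇ suc (suc i)
    ... | true  = trans (*-congˡ (crankWeight-correct j pos)) (sym (*-assoc _ _ _))
    ... | false = trans (*-identityˡ _) (crankWeight-correct j pos)

  crankTerm : List ℕ → Carrier
  crankTerm π = pow (crank π) * q ^ sum π

  private
    -- No part of a partition of a number below N exceeds this bound; a successor is the form that
    -- `weighted-product` expects.
    K = suc N

    ωClass : ∀ j → sumOver crankTerm (filter (λ π → ω π ℕ.≟ j) Π) ≈ sumOver crankTerm (bounded j K)
    ωClass j = sumOver-unique crankTerm (Unique.filter⁺ (λ π → ω π ℕ.≟ j) (partitionsBelow-unique N)) (bounded-unique j K) (inj₁ ∘ to) (inj₁ ∘ from)
      where
      to : ∀ {π} → π ∈ filter (λ π → ω π ℕ.≟ j) Π → π ∈ bounded j K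
      to {π} π∈ with π∈Π , ω≡ ← ∈-filter⁻ (λ π → ω π ℕ.≟ j) {xs = Π} π∈ =
        ∈-filter⁺ (bounded? j K) π∈Π
          (ω≡ , All.map (λ x≤ → ℕ.≤-trans x≤ (ℕ.m≤n⇒m≤1+n (ℕ.<⇒≤ (proj₂ (∈-partitionsBelow⁻ N π∈Π))))) (parts≤sum π))
      from : ∀ {π} → π ∈ bounded j K → π ∈ filter (λ π → ω π ℕ.≟ j) Π
      from π∈ with π∈Π , ω≡ , _ ← ∈-filter⁻ (bounded? j K) {xs = Π} π∈ = ∈-filter⁺ (λ π → ω π ℕ.≟ j) π∈Π ω≡

    A : ℕ → Carrier
    A j = sumOver crankTerm (bounded j K)

    A-mixed : ∀ j → 1 ≤ j → j ≤ N → A j * mixed j K ≈ (1# - q) * (w * q) ^ j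
    A-mixed (suc j) _ _ = begin
      A (suc j) * mixed (suc j) K
        ≈⟨ *-cong (sumOver-cong∈ (bounded (suc j) K) same) (prod-first (λ i → 1# - weight (suc j) i * q ^ suc i) N) ⟩
      F * ((1# - weight (suc j) 0 * (q * 1#)) * prod (λ i → 1# - crankWeight (suc j) (2 ℕ.+ i) * q ^ (2 ℕ.+ i)) N)
        -- As there is at least one 1, the part 1 has weight 1 in `mixed`. Its factor 1 - q has no
        -- counterpart in the product over the parts from 2 on and stays in front.
        ≈⟨ solve 3 (λ F q P → F :* ((con 1 :- con 1 :* (q :* con 1)) :* P) := (con 1 :- q) :* (F :* P)) _ _ _ ⟩
      (1# - q) * (F * prod (λ i → 1# - crankWeight (suc j) (2 ℕ.+ i) * q ^ (2 ℕ.+ i)) N)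
        ≈⟨ *-congˡ (weighted-product (crankWeight (suc j)) (suc j) N) ⟩
      (1# - q) * (w * q) ^ suc j ∎
      where
      F = sumOver (weighted (crankWeight (suc j))) (bounded (suc j) K)
      same : ∀ {π} → π ∈ bounded (suc j) K → crankTerm π ≈ weighted (crankWeight (suc j)) π
      same {π} π∈ with _ , pos , (ω≡ , _) , _ ← ∈-bounded⁻ {suc j} {K} π∈ = *-congʳ (begin
        pow (crank π)
          ≡⟨ ≡.cong pow (≡.trans (crank-with-ones π ω≡) (ℤ.m-n≡m⊖n (μ π) (ω π))) ⟩
        pow (μ π ⊖ ω π)
          ≈⟨ pow-⊖ (μ π) (ω π) ⟩
        z ^ μ π * w ^ ω π
          ≡⟨ ≡.cong (λ l → z ^ length (filter (l ℕ.<?_) π) * w ^ ω π) ω≡ ⟩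
        z ^ length (filter (suc j ℕ.<?_) π) * w ^ ω π
          ≈⟨ crankWeight-correct j pos ⟨
        foldr (λ i s → crankWeight (suc j) i * s) 1# π ∎)

    largestTerm : List ℕ → Carrier
    largestTerm π = z ^ largest π * q ^ sum π

    largestTerm-negligible : Negligible largestTerm
    largestTerm-negligible π N≤ = trans (*-congˡ (q^≥N N≤)) (zeroʳ _)

    -- Largest part i ≥ 2 contributes (zq)ⁱ / ((1 - q²) ... (1 - qⁱ)) = (1 - q) (zq)ⁱ / (q; q)ᵢ. The
    -- terms i = 0 and i = 1 on the right add up to 1 - q + zq, while the empty partition gives only
    -- 1: the difference is (z - 1) q, the correction at n = 1.
    without-ones : ∀ k → sumOver largestTerm (bounded 0 (suc k)) + (z - 1#) * q
                         ≈ (1# - q) * sumOver (λ i → (z * q) ^ i * ⟨Q⟩⁻¹ i) (upTo (2 ℕ.+ k))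
    without-ones zero = begin
      sumOver largestTerm (bounded 0 1) + (z - 1#) * q
        ≈⟨ +-congʳ (base largestTerm-negligible 0) ⟩
      1# * 1# + (z - 1#) * q
        ≈⟨ solve 2 (λ z q → con 1 :* con 1 :+ (z :- con 1) :* q := con 1 :- q :+ z :* q :* con 1) z q ⟩
      1# - q + z * q * 1#
        ≈⟨ +-congˡ (*-congˡ (factor-⟨Q⟩⁻¹ 0)) ⟨
      1# - q + z * q * (factor 0 * ⟨Q⟩⁻¹ 1)
        ≈⟨ solve 3 (λ z q r → con 1 :- q :+ z :* q :* ((con 1 :- q :* con 1) :* r) := (con 1 :- q) :* (con 1 :* con 1 :+ (z :* q :* con 1 :* r :+ con 0))) z q (⟨Q⟩⁻¹ 1) ⟩
      (1# - q) * sumOver (λ i → (z * q) ^ i * ⟨Q⟩⁻¹ i) (upTo 2) ∎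
    without-ones (suc k) = begin
      sumOver largestTerm (bounded 0 (2 ℕ.+ k)) + (z - 1#) * q
        ≈⟨ +-congʳ (trans (peel largestTerm-negligible 0 k) (+-congˡ (trans (sumOver-cong∈ (bounded 0 (2 ℕ.+ k)) term-∷) (sumOver-*ˡ ((z * q) ^ (2 ℕ.+ k)) _ (bounded 0 (2 ℕ.+ k)))))) ⟩
      sumOver largestTerm (bounded 0 (1 ℕ.+ k)) + (z * q) ^ (2 ℕ.+ k) * F + (z - 1#) * q
        ≈⟨ solve 3 (λ a b c → a :+ b :+ c := a :+ c :+ b) _ _ _ ⟩
      sumOver largestTerm (bounded 0 (1 ℕ.+ k)) + (z - 1#) * q + (z * q) ^ (2 ℕ.+ k) * F
        ≈⟨ +-cong (without-ones k) (*-congˡ F-value) ⟩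
      (1# - q) * sumOver g (upTo (2 ℕ.+ k)) + (z * q) ^ (2 ℕ.+ k) * ((1# - q) * ⟨Q⟩⁻¹ (2 ℕ.+ k))
        ≈⟨ solve 4 (λ f s x r → f :* s :+ x :* (f :* r) := f :* (s :+ x :* r)) _ _ _ _ ⟩
      (1# - q) * (sumOver g (upTo (2 ℕ.+ k)) + g (2 ℕ.+ k))
        ≈⟨ *-congˡ (sumOver-upTo-last g (2 ℕ.+ k)) ⟨
      (1# - q) * sumOver g (upTo (3 ℕ.+ k)) ∎
      where
      g = λ i → (z * q) ^ i * ⟨Q⟩⁻¹ i
      F = sumOver (weighted λ _ → 1#) (bounded 0 (2 ℕ.+ k))
      weight-1 : ∀ π → foldr (λ i s → 1# * s) 1# π ≈ 1#
      weight-1 []      = refl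
      weight-1 (_ ∷ π) = trans (*-identityˡ _) (weight-1 π)
      term-∷ : ∀ {π} → π ∈ bounded 0 (2 ℕ.+ k) → largestTerm ((2 ℕ.+ k) ∷ π) ≈ (z * q) ^ (2 ℕ.+ k) * weighted (λ _ → 1#) π
      term-∷ {π} π∈ with _ , _ , (_ , small) , _ ← ∈-bounded⁻ {0} {2 ℕ.+ k} π∈ = begin
        z ^ largest ((2 ℕ.+ k) ∷ π) * q ^ ((2 ℕ.+ k) ℕ.+ sum π)
          ≈⟨ *-cong (reflexive (≡.cong (z ^_) (largest-head small))) (^-homo-* q (2 ℕ.+ k) (sum π)) ⟩
        z ^ (2 ℕ.+ k) * (q ^ (2 ℕ.+ k) * q ^ sum π)
          ≈⟨ solve 3 (λ a b c → a :* (b :* c) := a :* b :* (con 1 :* c)) _ _ _ ⟩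
        z ^ (2 ℕ.+ k) * q ^ (2 ℕ.+ k) * (1# * q ^ sum π)
          ≈⟨ *-cong (^-distrib-* z q (2 ℕ.+ k)) (*-congʳ (weight-1 π)) ⟨
        (z * q) ^ (2 ℕ.+ k) * weighted (λ _ → 1#) π ∎
      F-value : F ≈ (1# - q) * ⟨Q⟩⁻¹ (2 ℕ.+ k)
      F-value = begin
        F
          ≈⟨ *-identityʳ F ⟨
        F * 1#
          ≈⟨ *-congˡ (⟨Q⟩-inverse (2 ℕ.+ k)) ⟨
        F * (⟨Q⟩ (2 ℕ.+ k) * R)
          ≈⟨ *-congˡ (*-congʳ (prod-first factor (suc k))) ⟩
        F * (factor 0 * prod (factor ∘ suc) (suc k) * R)
          ≈⟨ solve 4 (λ F q P R → F :* ((con 1 :- q :* con 1) :* P :* R) := (con 1 :- q) :* (F :* P) :* R) _ _ _ _ ⟩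
        (1# - q) * (F * prod (factor ∘ suc) (suc k)) * R
          ≈⟨ *-congʳ (*-congˡ (*-congˡ (prod-cong (suc k) λ i → +-congˡ (-‿cong (*-identityˡ _))))) ⟨
        (1# - q) * (F * prod (λ i → 1# - 1# * q ^ (2 ℕ.+ i)) (suc k)) * R
          ≈⟨ *-congʳ (*-congˡ (weighted-product (λ _ → 1#) 0 (suc k))) ⟩
        (1# - q) * 1# * R
          ≈⟨ *-congʳ (*-identityʳ _) ⟩
        (1# - q) * R ∎
        where R = ⟨Q⟩⁻¹ (2 ℕ.+ k)

  -- The summand (z − 1) q corrects the crank counts at n = 1 to the conventional values M(m, 1).
  crankSeries : Carrier
  crankSeries = sumOver crankTerm (partitionsBelow N) + (z - 1#) * q

  -- Partitions are classified by their number of ones: the class without ones is evaluated by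
  -- `without-ones`, and the others satisfy the hypothesis of `crank-product` by `A-mixed`.
  crank-generating-function : crankSeries * (Z N * W N) ≈ ⟨Q⟩ N
  crank-generating-function = trans (*-congʳ decompose) (crank-product A K (ℕ.n≤1+n N) A-mixed)
    where
    decompose : crankSeries ≈ (1# - q) * Ψ 0# (z * q) + sumOver (A ∘ suc) (upTo N)
    decompose = begin
      sumOver crankTerm Π + (z - 1#) * q
        ≈⟨ +-congʳ (sumOver-classes ℕ._≟_ ω crankTerm Π (Unique.upTo⁺ K) ω<K) ⟩
      sumOver (λ j → sumOver crankTerm (filter (λ π → ω π ℕ.≟ j) Π)) (upTo K) + (z - 1#) * q
        ≈⟨ +-congʳ (sumOver-cong (upTo K) ωClass) ⟩
      sumOver A (upTo K) + (z - 1#) * q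
        ≡⟨ ≡.cong (_+ ((z - 1#) * q)) (sumOver-upTo-first A N) ⟩
      A 0 + sumOver (A ∘ suc) (upTo N) + (z - 1#) * q
        ≈⟨ solve 3 (λ a b c → a :+ b :+ c := a :+ c :+ b) _ _ _ ⟩
      A 0 + (z - 1#) * q + sumOver (A ∘ suc) (upTo N)
        ≈⟨ +-congʳ (trans (+-congʳ (sumOver-cong∈ (bounded 0 K) same)) (trans (without-ones N) (*-congˡ tail))) ⟩
      (1# - q) * Ψ 0# (z * q) + sumOver (A ∘ suc) (upTo N) ∎
      where
      ω<K : ∀ {π} → π ∈ Π → ω π ∈ upTo K
      ω<K {π} π∈ with (_ , pos , _) , sum<N ← ∈-partitionsBelow⁻ N π∈ =
        ∈-upTo⁺ (s≤s (ℕ.≤-trans (List.length-filter (ℕ._≟ 1) π) (ℕ.≤-trans (length≤sum pos) (ℕ.<⇒≤ sum<N))))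
      same : ∀ {π} → π ∈ bounded 0 K → crankTerm π ≈ largestTerm π
      same {π} π∈ with _ , _ , (ω≡0 , _) , _ ← ∈-bounded⁻ {0} {K} π∈ = *-congʳ (reflexive (≡.cong pow (crank-without-ones π ω≡0)))
      tail : sumOver (λ i → (z * q) ^ i * ⟨Q⟩⁻¹ i) (upTo (2 ℕ.+ N)) ≈ Ψ 0# (z * q)
      tail = begin
        sumOver (λ i → (z * q) ^ i * ⟨Q⟩⁻¹ i) (upTo (2 ℕ.+ N))
          ≈⟨ sumOver-upTo-last _ K ⟩
        sumOver (λ i → (z * q) ^ i * ⟨Q⟩⁻¹ i) (upTo K) + (z * q) ^ K * ⟨Q⟩⁻¹ K
          ≈⟨ +-cong (sumOver-cong (upTo K) λ j → sym (Ψ₀-term (z * q) j))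
                    (*-congʳ (trans (^-distrib-* z q K) (*-congˡ (q^≥N (ℕ.n≤1+n N))))) ⟩
        Ψ 0# (z * q) + z ^ K * 0# * ⟨Q⟩⁻¹ K
          ≈⟨ solve 3 (λ p x r → p :+ x :* con 0 :* r := p) _ _ _ ⟩
        Ψ 0# (z * q) ∎

-- Power series modulo q^N and the group ring of ℤ/11

0ˢ : Series
0ˢ n = 0ℚ

-ˢ_ : Series → Series
(-ˢ f) n = ℚ.- f n

private
  module ℚ-Solver = Solver ℚ.+-*-commutativeRing
  open CommutativeMonoidSum ℚ.+-0-commutativeMonoid using (sum-cong-≗)

-- The Cauchy product unfolds at its first summand. Unfolding at the last one as well yields
-- commutativity by induction.
*ˢ-last : ∀ f g n → (f *ˢ g) (suc n) ≡ (f *ˢ (g ∘ suc)) n ℚ.+ f (suc n) ℚ.* g 0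
*ˢ-last f g zero    =
  ℚ-Solver.solve 4 (λ a b c d → a :* b :+ (c :* d :+ con 0) := a :* b :+ con 0 :+ c :* d) (f 0) (g 1) (f 1) (g 0)
*ˢ-last f g (suc n) =
  ≡.trans (≡.cong (λ x → f 0 ℚ.* g (suc (suc n)) ℚ.+ x) (*ˢ-last (f ∘ suc) g n)) (≡.sym (ℚ.+-assoc (f 0 ℚ.* g (suc (suc n))) (((f ∘ suc) *ˢ (g ∘ suc)) n) (f (suc (suc n)) ℚ.* g 0)))

*ˢ-comm : ∀ f g → f *ˢ g ≗ g *ˢ f
*ˢ-comm f g zero    = ≡.cong (ℚ._+ 0ℚ) (ℚ.*-comm (f 0) (g 0))
*ˢ-comm f g (suc n) = ≡.trans (ℚ.+-comm (f 0 ℚ.* g (suc n)) (((f ∘ suc) *ˢ g) n))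
  (≡.trans (≡.cong₂ ℚ._+_ (*ˢ-comm (f ∘ suc) g n) (ℚ.*-comm (f 0) (g (suc n)))) (≡.sym (*ˢ-last g f n)))

*ˢ-distribʳ : ∀ h f g → (f +ˢ g) *ˢ h ≗ f *ˢ h +ˢ g *ˢ h
*ˢ-distribʳ h f g zero    =
  ℚ-Solver.solve 3 (λ f g h → (f :+ g) :* h :+ con 0 := (f :* h :+ con 0) :+ (g :* h :+ con 0)) (f 0) (g 0) (h 0)
*ˢ-distribʳ h f g (suc n) = ≡.trans
  (≡.cong (λ x → (f 0 ℚ.+ g 0) ℚ.* h (suc n) ℚ.+ x) (*ˢ-distribʳ h (f ∘ suc) (g ∘ suc) n))
  (ℚ-Solver.solve 5 (λ f g h x y → (f :+ g) :* h :+ (x :+ y) := (f :* h :+ x) :+ (g :* h :+ y)) (f 0) (g 0) (h (suc n)) (((f ∘ suc) *ˢ h) n) (((g ∘ suc) *ˢ h) n))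

•-*ˢ : ∀ c f g → (c • f) *ˢ g ≗ c • (f *ˢ g)
•-*ˢ c f g zero    = ℚ-Solver.solve 3 (λ c f g → c :* f :* g :+ con 0 := c :* (f :* g :+ con 0)) c (f 0) (g 0)
•-*ˢ c f g (suc n) = ≡.trans
  (≡.cong (λ x → c ℚ.* f 0 ℚ.* g (suc n) ℚ.+ x) (•-*ˢ c (f ∘ suc) g n))
  (ℚ-Solver.solve 4 (λ c f g x → c :* f :* g :+ c :* x := c :* (f :* g :+ x)) c (f 0) (g (suc n)) (((f ∘ suc) *ˢ g) n))

*ˢ-assoc : ∀ f g h → (f *ˢ g) *ˢ h ≗ f *ˢ (g *ˢ h)
*ˢ-assoc f g h zero    =
  ℚ-Solver.solve 3 (λ f g h → (f :* g :+ con 0) :* h :+ con 0 := f :* (g :* h :+ con 0) :+ con 0) (f 0) (g 0) (h 0)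
*ˢ-assoc f g h (suc n) = begin
  (f 0 ℚ.* g 0 ℚ.+ 0ℚ) ℚ.* h (suc n) ℚ.+ ((f 0 • (g ∘ suc) +ˢ (f ∘ suc) *ˢ g) *ˢ h) n
    ≡⟨ ≡.cong (λ x → (f 0 ℚ.* g 0 ℚ.+ 0ℚ) ℚ.* h (suc n) ℚ.+ x)
         (≡.trans (*ˢ-distribʳ h (f 0 • (g ∘ suc)) ((f ∘ suc) *ˢ g) n)
                  (≡.cong₂ ℚ._+_ (•-*ˢ (f 0) (g ∘ suc) h n) (*ˢ-assoc (f ∘ suc) g h n))) ⟩
  (f 0 ℚ.* g 0 ℚ.+ 0ℚ) ℚ.* h (suc n) ℚ.+ (f 0 ℚ.* ((g ∘ suc) *ˢ h) n ℚ.+ ((f ∘ suc) *ˢ (g *ˢ h)) n)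
    ≡⟨ ℚ-Solver.solve 5 (λ f g h x y → (f :* g :+ con 0) :* h :+ (f :* x :+ y) := f :* (g :* h :+ x) :+ y) (f 0) (g 0) (h (suc n)) (((g ∘ suc) *ˢ h) n) (((f ∘ suc) *ˢ (g *ˢ h)) n) ⟩
  f 0 ℚ.* (g *ˢ h) (suc n) ℚ.+ ((f ∘ suc) *ˢ (g *ˢ h)) n ∎
  where open ≡.≡-Reasoning

infix 4 _≈[_]_

-- A record, so that both series and the modulus can be recovered from the type by unification.
record _≈[_]_ (f : Series) (N : ℕ) (g : Series) : Set where
  constructor mk≈
  field
    coefficients : ∀ k → k < N → f k ≡ g k

open _≈[_]_ public

≗⇒≈ : ∀ {f g N} → f ≗ g → f ≈[ N ] g
≗⇒≈ f≗g = mk≈ λ k _ → f≗g k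

≈⇒≗ : ∀ {f g} → (∀ N → f ≈[ N ] g) → f ≗ g
≈⇒≗ f≈g n = coefficients (f≈g (suc n)) n ℕ.≤-refl

-- The operations are made abstract because unfolding them to sums of rationals makes conversion checking explode.
abstract
  infixl 6 _⊞_
  infixl 7 _⊛_

  _⊞_ _⊛_ : Series → Series → Series
  _⊞_ = _+ˢ_
  _⊛_ = _*ˢ_

  ⊟_ : Series → Series
  ⊟_ = -ˢ_

  ⊞-≗ : ∀ f g → f ⊞ g ≗ f +ˢ g
  ⊞-≗ f g n = ≡.refl

  ⊛-≗ : ∀ f g → f ⊛ g ≗ f *ˢ g
  ⊛-≗ f g n = ≡.refl

  ⊟-≗ : ∀ f → ⊟ f ≗ -ˢ f
  ⊟-≗ f n = ≡.refl

  isCommutativeRing : ∀ N → IsCommutativeRing (_≈[ N ]_) _⊞_ _⊛_ ⊟_ 0ˢ 1ˢ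
  isCommutativeRing N = record
    { isRing = record
      { +-isAbelianGroup = record
        { isGroup = record
          { isMonoid = record
            { isSemigroup = record
              { isMagma = record
                { isEquivalence = record
                  { refl  = ≗⇒≈ λ _ → ≡.refl
                  ; sym   = λ f≈g → mk≈ λ k k<N → ≡.sym (coefficients f≈g k k<N)
                  ; trans = λ f≈g g≈h → mk≈ λ k k<N → ≡.trans (coefficients f≈g k k<N) (coefficients g≈h k k<N)
                  }
                ; ∙-cong = λ f≈f′ g≈g′ → mk≈ λ k k<N → ≡.cong₂ ℚ._+_ (coefficients f≈f′ k k<N) (coefficients g≈g′ k k<N)
                }
              ; assoc = λ f g h → ≗⇒≈ λ k → ℚ.+-assoc (f k) (g k) (h k)
              }
            ; identity = (λ f → ≗⇒≈ λ k → ℚ.+-identityˡ (f k)) , λ f → ≗⇒≈ λ k → ℚ.+-identityʳ (f k)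
            }
          ; inverse = (λ f → ≗⇒≈ λ k → ℚ.+-inverseˡ (f k)) , λ f → ≗⇒≈ λ k → ℚ.+-inverseʳ (f k)
          ; ⁻¹-cong = λ f≈g → mk≈ λ k k<N → ≡.cong ℚ.-_ (coefficients f≈g k k<N)
          }
        ; comm = λ f g → ≗⇒≈ λ k → ℚ.+-comm (f k) (g k)
        }
      ; *-cong = λ {f} {f′} {g} {g′} f≈f′ g≈g′ → mk≈ λ n n<N → sum-cong-≗ {suc n} λ k →
          ≡.cong₂ ℚ._*_ (coefficients f≈f′ (toℕ k) (ℕ.<-≤-trans (Fin.toℕ<n k) n<N))
                        (coefficients g≈g′ (n ∸ toℕ k) (ℕ.≤-<-trans (ℕ.m∸n≤m n (toℕ k)) n<N))
      ; *-assoc = λ f g h → ≗⇒≈ (*ˢ-assoc f g h)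
      ; *-identity = (λ f → ≗⇒≈ λ k → ≡.trans (*ˢ-comm 1ˢ f k) (*ˢ-identityʳ f k)) , λ f → ≗⇒≈ (*ˢ-identityʳ f)
      ; distrib = (λ f g h → ≗⇒≈ λ k → ≡.trans (*ˢ-comm f (g +ˢ h) k)
                     (≡.trans (*ˢ-distribʳ f g h k) (≡.cong₂ ℚ._+_ (*ˢ-comm g f k) (*ˢ-comm h f k))))
                , λ f g h → ≗⇒≈ (*ˢ-distribʳ f g h)
      }
    ; *-comm = λ f g → ≗⇒≈ (*ˢ-comm f g)
    }

-- Formal power series modulo q^N.
seriesRing : ℕ → CommutativeRing 0ℓ 0ℓ
seriesRing N = record
  { Carrier = Series ; _≈_ = _≈[ N ]_ ; _+_ = _⊞_ ; _*_ = _⊛_ ; -_ = ⊟_ ; 0# = 0ˢ ; 1# = 1ˢ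
  ; isCommutativeRing = isCommutativeRing N
  }

q^-*ˢ : ∀ k f n → (q^ k *ˢ f) (k ℕ.+ n) ≡ f n
q^-*ˢ zero    f n = ≡.trans (*ˢ-comm 1ˢ f n) (*ˢ-identityʳ f n)
q^-*ˢ (suc k) f n = ≡.trans (≡.cong₂ ℚ._+_ (ℚ.*-zeroˡ (f (suc k ℕ.+ n))) (q^-*ˢ k f n)) (ℚ.+-identityˡ (f n))

-- This needs equality of all coefficients; modulo q^N the same cancellation would lose the top k of
-- them.
q^-cancel : ∀ k {f g} → q^ k *ˢ f ≗ q^ k *ˢ g → f ≗ g
q^-cancel k {f} {g} eq n = ≡.trans (≡.sym (q^-*ˢ k f n)) (≡.trans (eq (k ℕ.+ n)) (q^-*ˢ k g n))

q^-+ : ∀ k l → q^ k *ˢ q^ l ≗ q^ (k ℕ.+ l)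
q^-+ zero    l n       = ≡.trans (*ˢ-comm 1ˢ (q^ l) n) (*ˢ-identityʳ (q^ l) n)
q^-+ (suc k) l zero    = ≡.trans (ℚ.+-identityʳ _) (ℚ.*-zeroˡ ((q^ l) 0))
q^-+ (suc k) l (suc n) = ≡.trans (≡.cong₂ ℚ._+_ (ℚ.*-zeroˡ ((q^ l) (suc n))) (q^-+ k l n)) (ℚ.+-identityˡ _)

module _ (N : ℕ) where
  open CommutativeRing (seriesRing N)
  open Exp semiring using (_^_)

  q^-power : ∀ k → (q^ 1) ^ k ≈ q^ k
  q^-power zero    = refl
  q^-power (suc k) = trans (*-congˡ {q^ 1} (q^-power k)) (trans (≗⇒≈ (⊛-≗ (q^ 1) (q^ k))) (≗⇒≈ (q^-+ 1 k)))

  q^N≈0 : (q^ 1) ^ N ≈ 0#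
  q^N≈0 = trans (q^-power N) (mk≈ λ k k<N → q^-≢ (ℕ.<⇒≢ k<N))

-- Arithmetic of residues modulo 11 and the convolution ring

infixl 6 _⊝_

-- Subtraction modulo 11 is the only operation used; a sum i + k is written i ⊝ (0 ⊝ k). Its laws
-- are checked exhaustively.
_⊝_ : Fin 11 → Fin 11 → Fin 11
i ⊝ j = (toℕ i ℕ.+ (11 ∸ toℕ j)) ℕ.mod 11

⊝-involutive : ∀ i j → i ⊝ (i ⊝ j) ≡ j
⊝-involutive = from-yes (Fin.all? λ i → Fin.all? λ j → i ⊝ (i ⊝ j) Fin.≟ j)

⊝-cancel : ∀ i j k → (i ⊝ k) ⊝ (j ⊝ k) ≡ i ⊝ j
⊝-cancel = from-yes (Fin.all? λ i → Fin.all? λ j → Fin.all? λ k → (i ⊝ k) ⊝ (j ⊝ k) Fin.≟ i ⊝ j)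

⊝-restore : ∀ i k → (i ⊝ k) ⊝ (Fin.zero ⊝ k) ≡ i
⊝-restore = from-yes (Fin.all? λ i → Fin.all? λ k → (i ⊝ k) ⊝ (Fin.zero ⊝ k) Fin.≟ i)

⊝-restore′ : ∀ i k → (i ⊝ (Fin.zero ⊝ k)) ⊝ k ≡ i
⊝-restore′ = from-yes (Fin.all? λ i → Fin.all? λ k → (i ⊝ (Fin.zero ⊝ k)) ⊝ k Fin.≟ i)

abstract
  -- Abstract, to keep convolutions from unfolding into eleven summands; `residues-≡` gives access
  -- to the list where the summands are wanted.
  residues : List (Fin 11)
  residues = allFin 11

  residues-≡ : residues ≡ allFin 11
  residues-≡ = ≡.refl

  residues-unique : Unique residues
  residues-unique = Unique.allFin⁺ 11

  ∈-residues : ∀ i → i ∈ residues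
  ∈-residues = ∈-allFin

module GroupRing (R : CommutativeRing 0ℓ 0ℓ) where
  open CommutativeRing R
  open Sums R
  open SetoidReasoning setoid

  private
    sum₁₁ : (Fin 11 → Carrier) → Carrier
    sum₁₁ f = sumOver f residues

    reindex : ∀ f (φ ψ : Fin 11 → Fin 11) → (∀ i → φ (ψ i) ≡ i) → (∀ i → ψ (φ i) ≡ i) → sum₁₁ (f ∘ φ) ≈ sum₁₁ f
    reindex f φ ψ φψ ψφ = trans (reflexive (≡.sym (sumOver-map f φ residues)))
      (sumOver-unique f (Unique.map⁺ (λ {i} {j} eq → ≡.trans (≡.sym (ψφ i)) (≡.trans (≡.cong ψ eq) (ψφ j))) residues-unique) residues-unique
        (λ {i} _ → inj₁ (∈-residues i)) (λ {i} _ → inj₁ (≡.subst (_∈ map φ residues) (φψ i) (∈-map⁺ φ (∈-residues (ψ i))))))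

    _⋆_ : (f g : Fin 11 → Carrier) → Fin 11 → Carrier
    (f ⋆ g) a = sum₁₁ λ i → f i * g (a ⊝ i)

    ⋆-comm : ∀ f g a → (f ⋆ g) a ≈ (g ⋆ f) a
    ⋆-comm f g a = begin
      sum₁₁ (λ i → f i * g (a ⊝ i))
        ≈⟨ reindex (λ i → f i * g (a ⊝ i)) (a ⊝_) (a ⊝_) (⊝-involutive a) (⊝-involutive a) ⟨
      sum₁₁ (λ i → f (a ⊝ i) * g (a ⊝ (a ⊝ i)))
        ≈⟨ sumOver-cong residues (λ i → trans (*-comm _ _) (*-congʳ (reflexive (≡.cong g (⊝-involutive a i))))) ⟩
      sum₁₁ (λ i → g i * f (a ⊝ i)) ∎

    ⋆-assoc : ∀ f g h a → ((f ⋆ g) ⋆ h) a ≈ (f ⋆ (g ⋆ h)) a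
    ⋆-assoc f g h a = begin
      sum₁₁ (λ k → sum₁₁ (λ i → f i * g (k ⊝ i)) * h (a ⊝ k))
        ≈⟨ sumOver-cong residues (λ k → sym (sumOver-*ʳ (h (a ⊝ k)) _ residues)) ⟩
      sum₁₁ (λ k → sum₁₁ λ i → f i * g (k ⊝ i) * h (a ⊝ k))
        ≈⟨ sumOver-swap _ residues residues ⟩
      sum₁₁ (λ i → sum₁₁ λ k → f i * g (k ⊝ i) * h (a ⊝ k))
        ≈⟨ sumOver-cong residues (λ i → trans (sumOver-cong residues (λ k → *-assoc _ _ _)) (sumOver-*ˡ (f i) _ residues)) ⟩
      sum₁₁ (λ i → f i * sum₁₁ λ k → g (k ⊝ i) * h (a ⊝ k))
        ≈⟨ sumOver-cong residues (λ i → *-congˡ (trans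
             (sumOver-cong residues (λ k → *-congˡ (reflexive (≡.cong h (≡.sym (⊝-cancel a k i))))))
             (reindex (λ j → g j * h ((a ⊝ i) ⊝ j)) (_⊝ i) (_⊝ (Fin.zero ⊝ i)) (λ k → ⊝-restore′ k i) (λ k → ⊝-restore k i)))) ⟩
      sum₁₁ (λ i → f i * sum₁₁ λ j → g j * h ((a ⊝ i) ⊝ j)) ∎

  basis : Fin 11 → Fin 11 → Carrier
  basis b i = if does (i Fin.≟ b) then 1# else 0#

  basis-≡ : ∀ b → basis b b ≡ 1#
  basis-≡ b = ≡.cong (if_then 1# else 0#) (dec-true (b Fin.≟ b) ≡.refl)

  basis-≢ : ∀ {b i} → i ≢ b → basis b i ≡ 0#
  basis-≢ {b} {i} i≢b = ≡.cong (if_then 1# else 0#) (dec-false (i Fin.≟ b) i≢b)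

  private
    basis-⋆ : ∀ b g a → (basis b ⋆ g) a ≈ g (a ⊝ b)
    basis-⋆ b g a = begin
      sum₁₁ (λ i → basis b i * g (a ⊝ i))
        ≈⟨ sumOver-unique _ residues-unique (All.[] ∷ []) (λ {i} _ → only i) (λ _ → inj₁ (∈-residues _)) ⟩
      basis b b * g (a ⊝ b) + 0#
        ≈⟨ trans (+-identityʳ _) (trans (*-congʳ (reflexive (basis-≡ b))) (*-identityˡ _)) ⟩
      g (a ⊝ b) ∎
      where
      decide : ∀ i → Dec (i ≡ b) → i ∈ b ∷ [] ⊎ basis b i * g (a ⊝ i) ≈ 0#
      decide i (yes i≡b) = inj₁ (here i≡b)
      decide i (no  i≢b) = inj₂ (trans (*-congʳ (reflexive (basis-≢ i≢b))) (zeroˡ _))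
      only : ∀ i → i ∈ b ∷ [] ⊎ basis b i * g (a ⊝ i) ≈ 0#
      only i = decide i (i Fin.≟ b)

    ⊝-0 : ∀ i → i ⊝ Fin.zero ≡ i
    ⊝-0 = from-yes (Fin.all? λ i → i ⊝ Fin.zero Fin.≟ i)

  infix 4 _≋_
  record _≋_ (f g : Fin 11 → Carrier) : Set where
    constructor mk≋
    field
      component : ∀ a → f a ≈ g a
  open _≋_ public

  groupRing : CommutativeRing 0ℓ 0ℓ
  groupRing = record
    { Carrier = Fin 11 → Carrier ; _≈_ = _≋_
    ; _+_ = λ f g a → f a + g a ; _*_ = _⋆_ ; -_ = λ f a → - f a ; 0# = λ _ → 0# ; 1# = basis Fin.zero
    ; isCommutativeRing = record
      { isRing = record
        { +-isAbelianGroup = record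
          { isGroup = record
            { isMonoid = record
              { isSemigroup = record
                { isMagma = record
                  { isEquivalence = record
                    { refl  = mk≋ λ _ → refl
                    ; sym   = λ f≈g → mk≋ λ a → sym (component f≈g a)
                    ; trans = λ f≈g g≈h → mk≋ λ a → trans (component f≈g a) (component g≈h a)
                    }
                  ; ∙-cong = λ f≈f′ g≈g′ → mk≋ λ a → +-cong (component f≈f′ a) (component g≈g′ a)
                  }
                ; assoc = λ f g h → mk≋ λ a → +-assoc (f a) (g a) (h a)
                }
              ; identity = (λ f → mk≋ λ a → +-identityˡ (f a)) , λ f → mk≋ λ a → +-identityʳ (f a)
              }
            ; inverse = (λ f → mk≋ λ a → -‿inverseˡ (f a)) , λ f → mk≋ λ a → -‿inverseʳ (f a)
            ; ⁻¹-cong = λ f≈g → mk≋ λ a → -‿cong (component f≈g a)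
            }
          ; comm = λ f g → mk≋ λ a → +-comm (f a) (g a)
          }
        ; *-cong = λ f≈f′ g≈g′ → mk≋ λ a → sumOver-cong residues λ i → *-cong (component f≈f′ i) (component g≈g′ (a ⊝ i))
        ; *-assoc = λ f g h → mk≋ (⋆-assoc f g h)
        ; *-identity = identityˡ , λ f → mk≋ λ a → trans (⋆-comm f (basis Fin.zero) a) (component (identityˡ f) a)
        ; distrib = (λ f g h → mk≋ (distˡ f g h))
                  , λ f g h → mk≋ λ a → trans (⋆-comm (λ b → g b + h b) f a) (trans (distˡ f g h a) (+-cong (⋆-comm f g a) (⋆-comm f h a)))
        }
      ; *-comm = λ f g → mk≋ (⋆-comm f g)
      }
    }
    where
    identityˡ : ∀ f → (basis Fin.zero ⋆ f) ≋ f
    identityˡ f = mk≋ λ a → trans (basis-⋆ Fin.zero f a) (reflexive (≡.cong f (⊝-0 a)))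
    distˡ : ∀ f g h a → (f ⋆ (λ b → g b + h b)) a ≈ (f ⋆ g) a + (f ⋆ h) a
    distˡ f g h a = trans (sumOver-cong residues λ i → distribˡ _ _ _) (sumOver-+ _ _ residues)

  private
    module G = CommutativeRing groupRing

  scalar : Carrier → Fin 11 → Carrier
  scalar c a = c * basis Fin.zero a

  scalar-* : ∀ c f a → (scalar c G.* f) a ≈ c * f a
  scalar-* c f a = trans (sumOver-cong residues λ i → *-assoc _ _ _)
    (trans (sumOver-*ˡ c _ residues) (*-congˡ (component (G.*-identityˡ f) a)))

  basis-* : ∀ b f a → (basis b G.* f) a ≈ f (a ⊝ b)
  basis-* = basis-⋆

-- Theta function identities

div-unique : ∀ r k k′ {s s′} → s ℕ.< r → s′ ℕ.< r →
             + r ℤ.* k ℤ.+ + s ≡ + r ℤ.* k′ ℤ.+ + s′ → k ≡ k′ × s ≡ s′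
div-unique r k k′ {s} {s′} s<r s′<r eq = k≡k′ , ℤ.+-injective s≡s′
  where
  difference : + r ℤ.* (k ℤ.- k′) ≡ + s′ ℤ.- + s
  difference = ≡.trans
    (ℤ-Solver.solve 4 (λ r k k′ s → r :* (k :- k′) := (r :* k :+ s) :- r :* k′ :- s) (+ r) k k′ (+ s))
    (≡.trans (≡.cong (λ x → x ℤ.- + r ℤ.* k′ ℤ.- + s) eq)
      (ℤ-Solver.solve 3 (λ x s s′ → x :+ s′ :- x :- s := s′ :- s) (+ r ℤ.* k′) (+ s) (+ s′)))
  small : ∣ + s′ ℤ.- + s ∣ ℕ.< r
  small = ≡.subst (λ x → ∣ x ∣ ℕ.< r) (≡.sym (ℤ.m-n≡m⊖n s′ s))
            (ℕ.≤-<-trans (ℤ.∣m⊝n∣≤m⊔n s′ s) (ℕ.⊔-lub s′<r s<r))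
  product<r : r ℕ.* ∣ k ℤ.- k′ ∣ ℕ.< r
  product<r = ≡.subst (ℕ._< r) (≡.trans (≡.cong ∣_∣ (≡.sym difference)) (ℤ.abs-* (+ r) (k ℤ.- k′))) small
  zero-factor : ∀ x → r ℕ.* x ℕ.< r → x ≡ 0
  zero-factor zero    _  = ≡.refl
  zero-factor (suc x) lt = contradiction (ℕ.m≤m*n r (suc x)) (ℕ.<⇒≱ lt)
  k≡k′ : k ≡ k′
  k≡k′ = ℤ.i-j≡0⇒i≡j k k′ (ℤ.∣i∣≡0⇒i≡0 (zero-factor _ product<r))
  s≡s′ : + s ≡ + s′
  s≡s′ = RingProperties.+-cancelˡ ℤ.+-*-ring (+ r ℤ.* k) (+ s) (+ s′)
           (≡.trans eq (≡.cong (λ x → + r ℤ.* x ℤ.+ + s′) (≡.sym k≡k′)))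

-- k = r l + s − t with 0 ≤ s < r.
module Residue (r : ℕ) .{{_ : NonZero r}} where

  private
    rem : ℤ → Fin r
    rem k = Fin.fromℕ< (ℤ.n%ℕd<d k r)

    quot : ℤ → ℤ
    quot k = k ℤ./ℕ r

  recompose : ∀ k → + r ℤ.* quot k ℤ.+ + toℕ (rem k) ≡ k
  recompose k = ≡.trans (≡.cong₂ ℤ._+_ (ℤ.*-comm (+ r) (quot k)) (≡.cong +_ (Fin.toℕ-fromℕ< (ℤ.n%ℕd<d k r))))
                  (≡.trans (ℤ.+-comm (quot k ℤ.* + r) (+ (k ℤ.%ℕ r))) (≡.sym (ℤ.a≡a%ℕn+[a/ℕn]*n k r)))

  decompose : ∀ s l k → + r ℤ.* l ℤ.+ + toℕ s ≡ k → rem k ≡ s × quot k ≡ l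
  decompose s l k eq with div-unique r (quot k) l (Fin.toℕ<n (rem k)) (Fin.toℕ<n s) (≡.trans (recompose k) (≡.sym eq))
  ... | quot≡ , rem≡ = Fin.toℕ-injective rem≡ , quot≡

  -- A bijection that becomes division by r after applying L.
  split-by : ∀ {I J : Set} (F : Fin r → J → I) (L : I → ℤ) (H : J → ℤ) (C : ℤ → I → J) →
             (∀ s j → + r ℤ.* H j ℤ.+ + toℕ s ≡ L (F s j)) → (∀ s j → C (H j) (F s j) ≡ j) →
             (∀ s k i → + r ℤ.* k ℤ.+ + toℕ s ≡ L i → F s (C k i) ≡ i) → Split r J I
  split-by F L H C L-F C-F F-C = record
    { join      = F
    ; part      = λ i → rem (L i) , C (quot (L i)) i
    ; join-part = λ i → F-C (rem (L i)) (quot (L i)) i (recompose (L i))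
    ; part-join = λ s j → let rem≡ , quot≡ = decompose s (H j) (L (F s j)) (L-F s j) in
        ≡.cong₂ _,_ rem≡ (≡.trans (≡.cong (λ k → C k (F s j)) quot≡) (C-F s j))
    }

  residue-split : ℤ → Split r ℤ ℤ
  residue-split t = split-by (λ s l → + r ℤ.* l ℤ.+ (+ toℕ s ℤ.- t)) (ℤ._+ t) id (λ l _ → l)
    (λ s l → ℤ-Solver.solve 3 (λ a s t → a :+ s := a :+ (s :- t) :+ t) (+ r ℤ.* l) (+ toℕ s) t)
    (λ _ _ → ≡.refl)
    (λ s l k eq → ≡.trans (ℤ-Solver.solve 3 (λ a s t → a :+ (s :- t) := a :+ s :- t) (+ r ℤ.* l) (+ toℕ s) t)
      (≡.trans (≡.cong (ℤ._- t) eq) (ℤ-Solver.solve 2 (λ k t → k :+ t :- t := k) k t)))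

-- Triangular numbers enter linearly; their defining relation is applied after doubling both sides.
by-tri : ∀ {L R} (xs : List (ℤ × ℤ)) →
         L ℤ.+ L ≡ (R ℤ.+ R) ℤ.+ foldr (λ (c , x) s → c ℤ.* ((tri x ℤ.+ tri x) ℤ.- (x ℤ.* x ℤ.- x)) ℤ.+ s) 0ℤ xs → L ≡ R
by-tri {L} {R} xs eq = double-injective (≡.trans eq (≡.trans (≡.cong (λ x → (R ℤ.+ R) ℤ.+ x) (vanish xs)) (ℤ.+-identityʳ _)))
  where
  vanish : ∀ xs → foldr (λ (c , x) s → c ℤ.* ((tri x ℤ.+ tri x) ℤ.- (x ℤ.* x ℤ.- x)) ℤ.+ s) 0ℤ xs ≡ 0ℤ
  vanish []             = ≡.refl
  vanish ((c , x) ∷ xs) = ≡.trans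
    (≡.cong₂ (λ d s → c ℤ.* d ℤ.+ s) (ℤ.i≡j⇒i-j≡0 (tri-double x)) (vanish xs))
    (≡.trans (ℤ.+-identityʳ _) (ℤ.*-zeroʳ c))

θ-expo-with : ∀ {c d m} → c ℕ.+ d ≡ m → ∀ k → θ-expo c d k ≡ + m ℤ.* tri k ℤ.+ + c ℤ.* k
θ-expo-with {c} {d} ≡.refl k = θ-expo-formula c d k

-- The exponents occurring in the quintuple product identity for p = 6 t − 1.
module QuintupleExponents (t i : ℤ) where

  -- The pentagonal exponent 3 y (y - 1) / 2 + y at y = t - i.
  δ : ℤ
  δ = + 3 ℤ.* tri t ℤ.+ t ℤ.+ + 3 ℤ.* tri i ℤ.+ (+ 2 ℤ.- + 3 ℤ.* t) ℤ.* i

  -- The exponent on the even half of the double series θ(p i) · (part ≡ t - i), in the coordinates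
  -- of `first-lattice`. The right side is the even class of `pentagonal-lattice`; `even-second`
  -- does the same for the other double series and the odd class.
  even-first : ∀ k n {p} → p ≡ + 6 ℤ.* t ℤ.- 1ℤ →
    let x = + 2 ℤ.* k ℤ.+ 0ℤ ℤ.- + 3 ℤ.* n ; y = p ℤ.* ℤ.- n ℤ.+ (t ℤ.- i) ; x′ = k ℤ.- + 2 ℤ.* n ℤ.+ 0ℤ in
    (p ℤ.* p ℤ.* tri x ℤ.+ p ℤ.* i ℤ.* x) ℤ.+ (+ 3 ℤ.* tri y ℤ.+ 1ℤ ℤ.* y)
    ≡ δ ℤ.+ ((+ 3 ℤ.* (p ℤ.* p) ℤ.* tri x′ ℤ.+ p ℤ.* p ℤ.* x′) ℤ.+ (p ℤ.* p ℤ.* tri k ℤ.+ + 2 ℤ.* (p ℤ.* i) ℤ.* k))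
  even-first k n {p} ≡.refl = by-tri ((p ℤ.* p , x) ∷ (+ 3 , y) ∷ (ℤ.- + 3 , t) ∷ (ℤ.- + 3 , i) ∷ (ℤ.- (+ 3 ℤ.* (p ℤ.* p)) , x′) ∷ (ℤ.- (p ℤ.* p) , k) ∷ [])
    (ℤ-Solver.solve 10 (λ t i k n t₁ t₂ t₃ t₄ t₅ t₆ →
      let p = con 6 :* t :- con 1
          x = con 2 :* k :+ con 0 :- con 3 :* n ; y = p :* :- n :+ (t :- i) ; x′ = k :- con 2 :* n :+ con 0
          l = (p :* p :* t₁ :+ p :* i :* x) :+ (con 3 :* t₂ :+ con 1 :* y)
          r = (con 3 :* t₃ :+ t :+ con 3 :* t₄ :+ (con 2 :- con 3 :* t) :* i)
              :+ ((con 3 :* (p :* p) :* t₅ :+ p :* p :* x′) :+ (p :* p :* t₆ :+ con 2 :* (p :* i) :* k))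
          d = λ t x → (t :+ t) :- (x :* x :- x)
      in l :+ l := (r :+ r) :+ (p :* p :* d t₁ x :+ (con 3 :* d t₂ y :+ (:- con 3 :* d t₃ t :+ (:- con 3 :* d t₄ i :+ (:- (con 3 :* (p :* p)) :* d t₅ x′ :+ (:- (p :* p) :* d t₆ k :+ con 0)))))))
      t i k n (tri x) (tri y) (tri t) (tri i) (tri x′) (tri k))
    where
    x = + 2 ℤ.* k ℤ.+ 0ℤ ℤ.- + 3 ℤ.* n
    y = p ℤ.* ℤ.- n ℤ.+ (t ℤ.- i)
    x′ = k ℤ.- + 2 ℤ.* n ℤ.+ 0ℤ

  even-second : ∀ k n {p} → p ≡ + 6 ℤ.* t ℤ.- 1ℤ →
    let x = + 3 ℤ.* n ℤ.- k ℤ.+ 0ℤ ℤ.- 1ℤ ; y = p ℤ.* (k ℤ.- n) ℤ.+ (t ℤ.+ i) ; x′ = k ℤ.- + 2 ℤ.* n ℤ.+ 1ℤ in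
    (p ℤ.* p ℤ.* tri x ℤ.+ p ℤ.* i ℤ.* x) ℤ.+ (+ 3 ℤ.* tri y ℤ.+ 1ℤ ℤ.* y)
    ≡ δ ℤ.+ ((+ 3 ℤ.* (p ℤ.* p) ℤ.* tri x′ ℤ.+ p ℤ.* p ℤ.* x′) ℤ.+ (p ℤ.* p ℤ.* tri k ℤ.+ + 2 ℤ.* (p ℤ.* i) ℤ.* k))
  even-second k n {p} ≡.refl = by-tri ((p ℤ.* p , x) ∷ (+ 3 , y) ∷ (ℤ.- + 3 , t) ∷ (ℤ.- + 3 , i) ∷ (ℤ.- (+ 3 ℤ.* (p ℤ.* p)) , x′) ∷ (ℤ.- (p ℤ.* p) , k) ∷ [])
    (ℤ-Solver.solve 10 (λ t i k n t₁ t₂ t₃ t₄ t₅ t₆ →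
      let p = con 6 :* t :- con 1
          x = con 3 :* n :- k :+ con 0 :- con 1 ; y = p :* (k :- n) :+ (t :+ i) ; x′ = k :- con 2 :* n :+ con 1
          l = (p :* p :* t₁ :+ p :* i :* x) :+ (con 3 :* t₂ :+ con 1 :* y)
          r = (con 3 :* t₃ :+ t :+ con 3 :* t₄ :+ (con 2 :- con 3 :* t) :* i)
              :+ ((con 3 :* (p :* p) :* t₅ :+ p :* p :* x′) :+ (p :* p :* t₆ :+ con 2 :* (p :* i) :* k))
          d = λ t x → (t :+ t) :- (x :* x :- x)
      in l :+ l := (r :+ r) :+ (p :* p :* d t₁ x :+ (con 3 :* d t₂ y :+ (:- con 3 :* d t₃ t :+ (:- con 3 :* d t₄ i :+ (:- (con 3 :* (p :* p)) :* d t₅ x′ :+ (:- (p :* p) :* d t₆ k :+ con 0)))))))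
      t i k n (tri x) (tri y) (tri t) (tri i) (tri x′) (tri k))
    where
    x = + 3 ℤ.* n ℤ.- k ℤ.+ 0ℤ ℤ.- 1ℤ
    y = p ℤ.* (k ℤ.- n) ℤ.+ (t ℤ.+ i)
    x′ = k ℤ.- + 2 ℤ.* n ℤ.+ 1ℤ

  -- The odd halves of the two double series have the same exponents. Their signs are opposite, so
  -- they cancel.
  odd : ∀ k n {p} → p ≡ + 6 ℤ.* t ℤ.- 1ℤ →
    let x = + 3 ℤ.* n ℤ.- k ℤ.+ 1ℤ ℤ.- 1ℤ ; y = p ℤ.* (k ℤ.- n) ℤ.+ (t ℤ.+ i)
        x′ = + 2 ℤ.* k ℤ.+ 1ℤ ℤ.- + 3 ℤ.* n ; y′ = p ℤ.* ℤ.- n ℤ.+ (t ℤ.- i) in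
    (p ℤ.* p ℤ.* tri x ℤ.+ p ℤ.* i ℤ.* x) ℤ.+ (+ 3 ℤ.* tri y ℤ.+ 1ℤ ℤ.* y)
    ≡ (p ℤ.* p ℤ.* tri x′ ℤ.+ p ℤ.* i ℤ.* x′) ℤ.+ (+ 3 ℤ.* tri y′ ℤ.+ 1ℤ ℤ.* y′)
  odd k n {p} ≡.refl = by-tri ((p ℤ.* p , x) ∷ (+ 3 , y) ∷ (ℤ.- (p ℤ.* p) , x′) ∷ (ℤ.- + 3 , y′) ∷ [])
    (ℤ-Solver.solve 8 (λ t i k n t₁ t₂ t₃ t₄ →
      let p = con 6 :* t :- con 1
          x = con 3 :* n :- k :+ con 1 :- con 1 ; y = p :* (k :- n) :+ (t :+ i)
          x′ = con 2 :* k :+ con 1 :- con 3 :* n ; y′ = p :* :- n :+ (t :- i)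
          l = (p :* p :* t₁ :+ p :* i :* x) :+ (con 3 :* t₂ :+ con 1 :* y)
          r = (p :* p :* t₃ :+ p :* i :* x′) :+ (con 3 :* t₄ :+ con 1 :* y′)
          d = λ t x → (t :+ t) :- (x :* x :- x)
      in l :+ l := (r :+ r) :+ (p :* p :* d t₁ x :+ (con 3 :* d t₂ y :+ (:- (p :* p) :* d t₃ x′ :+ (:- con 3 :* d t₄ y′ :+ con 0)))))
      t i k n (tri x) (tri y) (tri x′) (tri y′))
    where
    x = + 3 ℤ.* n ℤ.- k ℤ.+ 1ℤ ℤ.- 1ℤ
    y = p ℤ.* (k ℤ.- n) ℤ.+ (t ℤ.+ i)
    x′ = + 2 ℤ.* k ℤ.+ 1ℤ ℤ.- + 3 ℤ.* n
    y′ = p ℤ.* ℤ.- n ℤ.+ (t ℤ.- i)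

  middle : ∀ l {p} → p ≡ + 6 ℤ.* t ℤ.- 1ℤ → let y = p ℤ.* l ℤ.+ t in
    + 3 ℤ.* tri y ℤ.+ 1ℤ ℤ.* y ≡ (+ 3 ℤ.* tri t ℤ.+ t) ℤ.+ (+ 3 ℤ.* (p ℤ.* p) ℤ.* tri l ℤ.+ + 2 ℤ.* (p ℤ.* p) ℤ.* l)
  middle l {p} ≡.refl = by-tri ((+ 3 , p ℤ.* l ℤ.+ t) ∷ (ℤ.- + 3 , t) ∷ (ℤ.- (+ 3 ℤ.* (p ℤ.* p)) , l) ∷ [])
    (ℤ-Solver.solve 5 (λ t l t₁ t₂ t₃ →
      let p = con 6 :* t :- con 1
          y = p :* l :+ t
          L = con 3 :* t₁ :+ con 1 :* y
          r = (con 3 :* t₂ :+ t) :+ (con 3 :* (p :* p) :* t₃ :+ con 2 :* (p :* p) :* l)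
          d = λ t x → (t :+ t) :- (x :* x :- x)
      in L :+ L := (r :+ r) :+ (con 3 :* d t₁ y :+ (:- con 3 :* d t₂ t :+ (:- (con 3 :* (p :* p)) :* d t₃ l :+ con 0))))
      t l (tri (p ℤ.* l ℤ.+ t)) (tri t) (tri l))

-- Theta series, their determinants and the quintuple product

module Theta (B : CommutativeRing 0ℓ 0ℓ)
             (q : CommutativeRing.Carrier B) (N : ℕ) (q^N≈0 : PowerVanishes B q N) where
  open CommutativeRing B
  open Exp semiring using (_^_)
  open SetoidReasoning setoid
  open Solver B using (solve)
  open Nilpotent B q N q^N≈0
  open Powers B
  open Products B

  ε-parity : ∀ {i j} h → i ≡ j ℤ.+ (h ℤ.+ h) → ε i ≈ ε j
  ε-parity {i} {j} h ≡.refl = trans (ε-+ j (h ℤ.+ h)) (trans (*-congˡ (ε-double h)) (*-identityʳ _))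

  private
    ∣∣-mono : ∀ {i j} → 0ℤ ℤ.≤ i → 0ℤ ℤ.≤ j → ∣ i ∣ ℕ.≤ ∣ i ℤ.+ j ∣
    ∣∣-mono (ℤ.+≤+ {n = m} _) (ℤ.+≤+ {n = n} _) = ℕ.m≤m+n m n

    family : (coef : ℤ → Carrier) (expo : ℤ → ℤ) → (∀ k → 0ℤ ℤ.≤ expo k) → (∀ k → ∣ k ∣ ℕ.≤ suc ∣ expo k ∣) → Family ℤ
    family coef expo expo≥0 bound = record
      { coef = coef ; expo = expo ; expo≥0 = expo≥0
      ; support = interval N ; unique = interval-unique N
      ; covers = λ k e<N → ∈-interval⁺ k (ℕ.≤-trans (bound k) e<N) }

  -- The series form of the product J with parameters c and c + d; `θ 1 2` is Euler's pentagonal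
  -- number series.
  θ : ∀ c d → 1 ℕ.≤ c ℕ.+ d → Family ℤ
  θ c d 1≤c+d = family ε (θ-expo c d) (θ-expo≥0 c d) (λ k → ∣k∣≤1+θ-expo c d k 1≤c+d)

  -- The theta functions with respect to the doubled quadratic form, on even and odd arguments.
  θ-even θ-odd : ∀ c d → 1 ℕ.≤ c ℕ.+ d → Family ℤ
  θ-even c d 1≤c+d = family (λ _ → 1#) (λ k → θ-expo c d k ℤ.+ θ-expo c d k)
    (λ k → ℤ.+-mono-≤ (θ-expo≥0 c d k) (θ-expo≥0 c d k))
    (λ k → ℕ.≤-trans (∣k∣≤1+θ-expo c d k 1≤c+d) (s≤s (∣∣-mono (θ-expo≥0 c d k) (θ-expo≥0 c d k))))
  θ-odd c d 1≤c+d = family (λ _ → 1#) (λ k → θ-expo c d k ℤ.+ θ-expo c d (1ℤ ℤ.+ k))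
    (λ k → ℤ.+-mono-≤ (θ-expo≥0 c d k) (θ-expo≥0 c d (1ℤ ℤ.+ k)))
    (λ k → ℕ.≤-trans (∣k∣≤1+θ-expo c d k 1≤c+d) (s≤s (∣∣-mono (θ-expo≥0 c d k) (θ-expo≥0 c d (1ℤ ℤ.+ k)))))

  θ-product : ∀ c d 1≤c+d → prod (λ i → 1# - q ^ c * (q ^ (c ℕ.+ d)) ^ i) N * prod (λ i → 1# - q ^ d * (q ^ (c ℕ.+ d)) ^ i) N
                            * prod (λ i → 1# - (q ^ (c ℕ.+ d)) ^ suc i) N ≈ total (θ c d 1≤c+d)
  θ-product c d 1≤c+d = begin
    prod (λ i → 1# - q ^ c * Q ^ i) N * prod (λ i → 1# - q ^ d * Q ^ i) N * P
      ≈⟨ *-congʳ (*-cong (prod-cong N λ i → +-congˡ (-‿cong (*-congʳ (sym (*-identityˡ _)))))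
                         (prod-cong N λ i → +-congˡ (-‿cong (*-congʳ (sym (*-identityˡ _)))))) ⟩
    prod (λ i → 1# - 1# * q ^ c * Q ^ i) N * prod (λ i → 1# - 1# * q ^ d * Q ^ i) N * P
      ≈⟨ triple-product ⟩
    total θ-family
      ≈⟨ total-cong θ-family (θ c d 1≤c+d) (λ k → trans (*-congˡ (pow-1 k)) (*-identityʳ _)) (λ _ → ≡.refl) ⟩
    total (θ c d 1≤c+d) ∎
    where
    open JacobiTripleProduct B q N q^N≈0 1# 1# (*-identityˡ 1#) c d 1≤c+d
    Q = q ^ (c ℕ.+ d)
    P = prod (λ i → 1# - Q ^ suc i) N
    1^ : ∀ n → 1# ^ n ≈ 1#
    1^ zero    = refl
    1^ (suc n) = trans (*-identityˡ _) (1^ n)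
    pow-1 : ∀ k → Unit.pow 1# 1# (*-identityˡ 1#) k ≈ 1#
    pow-1 (+ n)    = 1^ n
    pow-1 -[1+ n ] = 1^ (suc n)

  private
    -- The substitution i = u + v, j = u - v + s diagonalises the sum of two equal quadratic forms;
    -- s is the parity of i + j.
    rotation : Split 2 (ℤ × ℤ) (ℤ × ℤ)
    rotation = split-by
      (λ s (u , v) → u ℤ.+ v , u ℤ.- v ℤ.+ + toℕ s) (λ (i , j) → i ℤ.+ j) proj₁ (λ u (i , _) → u , i ℤ.- u)
      (λ s (u , v) → ℤ-Solver.solve 3 (λ s u v → con 2 :* u :+ s := (u :+ v) :+ (u :- v :+ s)) (+ toℕ s) u v)
      (λ s (u , v) → ≡.cong (u ,_) (ℤ-Solver.solve 2 (λ u v → u :+ v :- u := v) u v))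
      (λ s u (i , j) eq → ≡.cong₂ _,_ (ℤ-Solver.solve 2 (λ u i → u :+ (i :- u) := i) u i)
        (≡.trans (ℤ-Solver.solve 3 (λ u i s → u :- (i :- u) :+ s := con 2 :* u :+ s :- i) u i (+ toℕ s))
          (≡.trans (≡.cong (ℤ._- i) eq) (ℤ-Solver.solve 2 (λ i j → i :+ j :- i := j) i j))))
      where open Residue 2

  -- q^b θ(a + b) θ(a − b) is a 2 × 2 determinant; here a = b + e.
  θ-determinant : ∀ b e {a′ b′ c′ e′ m} →
    b ℕ.+ e ℕ.+ a′ ≡ m → b ℕ.+ b′ ≡ m → b ℕ.+ e ℕ.+ b ℕ.+ c′ ≡ m → e ℕ.+ e′ ≡ m → ∀ 1≤a 1≤b 1≤c 1≤e →
    q ^ b * (total (θ (b ℕ.+ e ℕ.+ b) c′ 1≤c) * total (θ e e′ 1≤e))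
    ≈ total (θ-even (b ℕ.+ e) a′ 1≤a) * total (θ-odd b b′ 1≤b) - total (θ-odd (b ℕ.+ e) a′ 1≤a) * total (θ-even b b′ 1≤b)
  θ-determinant b e {a′} {b′} {c′} {e′} {m} a+a′ b+b′ c+c′ e+e′ 1≤a 1≤b 1≤c 1≤e = begin
    q ^ b * (total θc * total θe)
      ≈⟨ *-cong (sym (*-identityˡ _)) (sym (total-⊗ θc θe)) ⟩
    1# * q ^ b * total (θc ⊗ θe)
      ≈⟨ total-scale 1# (+ b) (ℤ.+≤+ z≤n) (θc ⊗ θe) ⟨
    total L
      -- On the class s the sign (-1)^(i+j) is constantly (-1)^s, so the two classes yield the two
      -- products of the determinant with opposite signs.
      ≈⟨ total-split rotation L ⟩
    total (pull rotation L Fin.zero) + (total (pull rotation L (Fin.suc Fin.zero)) + 0#)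
      ≈⟨ +-cong (total-cong (pull rotation L Fin.zero) (Ga ⊗ Fb) (λ (u , v) → sign₀ u v) (λ (u , v) → expo₀ u v))
                (trans (+-identityʳ _) (total-cong (pull rotation L (Fin.suc Fin.zero)) (scale (ε 1ℤ) 0ℤ ℤ.≤-refl (Fa ⊗ Gb)) (λ (u , v) → sign₁ u v) (λ (u , v) → expo₁ u v))) ⟩
    total (Ga ⊗ Fb) + total (scale (ε 1ℤ) 0ℤ ℤ.≤-refl (Fa ⊗ Gb))
      ≈⟨ +-cong (total-⊗ Ga Fb) (trans (total-scale (ε 1ℤ) 0ℤ ℤ.≤-refl (Fa ⊗ Gb)) (*-congˡ (total-⊗ Fa Gb))) ⟩
    total Ga * total Fb + - 1# * 1# * 1# * (total Fa * total Gb)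
      ≈⟨ solve 2 (λ x y → x :+ :- con 1 :* con 1 :* con 1 :* y := x :- y) _ _ ⟩
    total Ga * total Fb - total Fa * total Gb ∎
    where
    a = b ℕ.+ e
    c = b ℕ.+ e ℕ.+ b
    θc = θ c c′ 1≤c
    θe = θ e e′ 1≤e
    Ga = θ-even a a′ 1≤a
    Fa = θ-odd a a′ 1≤a
    Gb = θ-even b b′ 1≤b
    Fb = θ-odd b b′ 1≤b
    L = scale 1# (+ b) (ℤ.+≤+ z≤n) (θc ⊗ θe)
    sign₀ : ∀ u v → 1# * (ε (u ℤ.+ v) * ε (u ℤ.- v ℤ.+ 0ℤ)) ≈ 1# * 1#
    sign₀ u v = *-congˡ (trans (sym (ε-+ (u ℤ.+ v) (u ℤ.- v ℤ.+ 0ℤ)))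
      (ε-parity {j = 0ℤ} u (ℤ-Solver.solve 2 (λ u v → (u :+ v) :+ (u :- v :+ con 0) := con 0 :+ (u :+ u)) u v)))
    sign₁ : ∀ u v → 1# * (ε (u ℤ.+ v) * ε (u ℤ.- v ℤ.+ 1ℤ)) ≈ ε 1ℤ * (1# * 1#)
    sign₁ u v = trans (*-identityˡ _) (trans (sym (ε-+ (u ℤ.+ v) (u ℤ.- v ℤ.+ 1ℤ)))
      (trans (ε-parity {j = 1ℤ} u (ℤ-Solver.solve 2 (λ u v → (u :+ v) :+ (u :- v :+ con 1) := con 1 :+ (u :+ u)) u v))
        (solve 1 (λ x → x := x :* (con 1 :* con 1)) (ε 1ℤ))))
    expo₀ : ∀ u v → + b ℤ.+ (θ-expo c c′ (u ℤ.+ v) ℤ.+ θ-expo e e′ (u ℤ.- v ℤ.+ 0ℤ))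
                    ≡ (θ-expo a a′ u ℤ.+ θ-expo a a′ u) ℤ.+ (θ-expo b b′ v ℤ.+ θ-expo b b′ (1ℤ ℤ.+ v))
    expo₀ u v rewrite θ-expo-with {c} c+c′ (u ℤ.+ v) | θ-expo-with {e} e+e′ (u ℤ.- v ℤ.+ 0ℤ)
                    | θ-expo-with {a} a+a′ u | θ-expo-with {b} b+b′ v | θ-expo-with {b} b+b′ (1ℤ ℤ.+ v) =
      by-tri ((+ m , u ℤ.+ v) ∷ (+ m , u ℤ.- v ℤ.+ 0ℤ) ∷ (ℤ.- (+ 2 ℤ.* + m) , u) ∷ (ℤ.- + m , v) ∷ (ℤ.- + m , 1ℤ ℤ.+ v) ∷ [])
        (ℤ-Solver.solve 10 (λ m b e u v t₁ t₂ t₃ t₄ t₅ →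
          let x₁ = u :+ v ; x₂ = u :- v :+ con 0 ; x₅ = con 1 :+ v ; a = b :+ e
              l = b :+ ((m :* t₁ :+ (a :+ b) :* x₁) :+ (m :* t₂ :+ e :* x₂))
              r = ((m :* t₃ :+ a :* u) :+ (m :* t₃ :+ a :* u)) :+ ((m :* t₄ :+ b :* v) :+ (m :* t₅ :+ b :* x₅))
              d = λ t x → (t :+ t) :- (x :* x :- x)
          in l :+ l := (r :+ r) :+ (m :* d t₁ x₁ :+ (m :* d t₂ x₂ :+ (:- (con 2 :* m) :* d t₃ u :+ (:- m :* d t₄ v :+ (:- m :* d t₅ x₅ :+ con 0))))))
          (+ m) (+ b) (+ e) u v (tri (u ℤ.+ v)) (tri (u ℤ.- v ℤ.+ 0ℤ)) (tri u) (tri v) (tri (1ℤ ℤ.+ v)))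
    expo₁ : ∀ u v → + b ℤ.+ (θ-expo c c′ (u ℤ.+ v) ℤ.+ θ-expo e e′ (u ℤ.- v ℤ.+ 1ℤ))
                    ≡ 0ℤ ℤ.+ ((θ-expo a a′ u ℤ.+ θ-expo a a′ (1ℤ ℤ.+ u)) ℤ.+ (θ-expo b b′ v ℤ.+ θ-expo b b′ v))
    expo₁ u v rewrite θ-expo-with {c} c+c′ (u ℤ.+ v) | θ-expo-with {e} e+e′ (u ℤ.- v ℤ.+ 1ℤ)
                    | θ-expo-with {a} a+a′ u | θ-expo-with {a} a+a′ (1ℤ ℤ.+ u) | θ-expo-with {b} b+b′ v =
      by-tri ((+ m , u ℤ.+ v) ∷ (+ m , u ℤ.- v ℤ.+ 1ℤ) ∷ (ℤ.- + m , u) ∷ (ℤ.- + m , 1ℤ ℤ.+ u) ∷ (ℤ.- (+ 2 ℤ.* + m) , v) ∷ [])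
        (ℤ-Solver.solve 10 (λ m b e u v t₁ t₂ t₃ t₄ t₅ →
          let x₁ = u :+ v ; x₂ = u :- v :+ con 1 ; x₄ = con 1 :+ u ; a = b :+ e
              l = b :+ ((m :* t₁ :+ (a :+ b) :* x₁) :+ (m :* t₂ :+ e :* x₂))
              r = con 0 :+ (((m :* t₃ :+ a :* u) :+ (m :* t₄ :+ a :* x₄)) :+ ((m :* t₅ :+ b :* v) :+ (m :* t₅ :+ b :* v)))
              d = λ t x → (t :+ t) :- (x :* x :- x)
          in l :+ l := (r :+ r) :+ (m :* d t₁ x₁ :+ (m :* d t₂ x₂ :+ (:- m :* d t₃ u :+ (:- m :* d t₄ x₄ :+ (:- (con 2 :* m) :* d t₅ v :+ con 0))))))
          (+ m) (+ b) (+ e) u v (tri (u ℤ.+ v)) (tri (u ℤ.- v ℤ.+ 1ℤ)) (tri u) (tri (1ℤ ℤ.+ u)) (tri v))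

  private
    module R₂ = Residue 2

    -- On the left of the quintuple product identity the classes are the parities of the exponent of
    -- q^(r i), counted from q^δ: it is m - 3l in the first product and m + 3l + 1 in the second,
    -- since the pentagonal exponents at t + i and t - i differ by r i. On the right, index pairs
    -- are split by the parity of their sum.
    first-lattice second-lattice pentagonal-lattice : Split 2 (ℤ × ℤ) (ℤ × ℤ)
    first-lattice = R₂.split-by
      (λ s (k , n) → + 2 ℤ.* k ℤ.+ + toℕ s ℤ.- + 3 ℤ.* n , ℤ.- n) (λ (m , l) → m ℤ.- + 3 ℤ.* l) proj₁ (λ k (_ , l) → k , ℤ.- l)
      (λ s (k , n) → ℤ-Solver.solve 3 (λ s k n → con 2 :* k :+ s := con 2 :* k :+ s :- con 3 :* n :- con 3 :* :- n) (+ toℕ s) k n)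
      (λ s (k , n) → ≡.cong (k ,_) (ℤ.neg-involutive n))
      (λ s k (m , l) eq → ≡.cong₂ _,_
        (≡.trans (≡.cong (λ x → x ℤ.- + 3 ℤ.* ℤ.- l) eq) (ℤ-Solver.solve 2 (λ m l → m :- con 3 :* l :- con 3 :* :- l := m) m l))
        (ℤ.neg-involutive l))
    second-lattice = R₂.split-by
      (λ s (k , n) → + 3 ℤ.* n ℤ.- k ℤ.+ + toℕ s ℤ.- 1ℤ , k ℤ.- n) (λ (m , l) → m ℤ.+ + 3 ℤ.* l ℤ.+ 1ℤ) proj₁ (λ k (_ , l) → k , k ℤ.- l)
      (λ s (k , n) → ℤ-Solver.solve 3 (λ s k n → con 2 :* k :+ s := con 3 :* n :- k :+ s :- con 1 :+ con 3 :* (k :- n) :+ con 1) (+ toℕ s) k n)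
      (λ s (k , n) → ≡.cong (k ,_) (ℤ-Solver.solve 2 (λ k n → k :- (k :- n) := n) k n))
      (λ s k (m , l) eq → ≡.cong₂ _,_
        (≡.trans (ℤ-Solver.solve 3 (λ s k l → con 3 :* (k :- l) :- k :+ s :- con 1 := con 2 :* k :+ s :- con 3 :* l :- con 1) (+ toℕ s) k l)
          (≡.trans (≡.cong (λ x → x ℤ.- + 3 ℤ.* l ℤ.- 1ℤ) eq) (ℤ-Solver.solve 2 (λ m l → m :+ con 3 :* l :+ con 1 :- con 3 :* l :- con 1 := m) m l)))
        (ℤ-Solver.solve 2 (λ k l → k :- (k :- l) := l) k l))
    pentagonal-lattice = R₂.split-by
      (λ s (k , n) → k ℤ.- + 2 ℤ.* n ℤ.+ + toℕ s , k) (λ (l , k) → l ℤ.+ k) (λ (k , n) → k ℤ.- n) (λ h (_ , k) → k , k ℤ.- h)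
      (λ s (k , n) → ℤ-Solver.solve 3 (λ s k n → con 2 :* (k :- n) :+ s := k :- con 2 :* n :+ s :+ k) (+ toℕ s) k n)
      (λ s (k , n) → ≡.cong (k ,_) (ℤ-Solver.solve 2 (λ k n → k :- (k :- n) := n) k n))
      (λ s h (l , k) eq → ≡.cong (_, k)
        (≡.trans (ℤ-Solver.solve 3 (λ s k h → k :- con 2 :* (k :- h) :+ s := con 2 :* h :+ s :- k) (+ toℕ s) k h)
          (≡.trans (≡.cong (ℤ._- k) eq) (ℤ-Solver.solve 2 (λ l k → l :+ k :- k := l) l k))))

  -- The pentagonal series dissected modulo r = 6 t − 1; its part with index ≡ t is again a pentagonal series.
  module Pentagonal (r : ℕ) .{{_ : NonZero r}} (t : ℕ) (r≡ : + r ≡ + 6 ℤ.* + t ℤ.- 1ℤ) (τ : ℤ)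
                    {J J′ : ℕ} (J≡ : + J ≡ + r ℤ.* + r) (J′≡ : + J′ ≡ + 2 ℤ.* (+ r ℤ.* + r)) (1≤J : 1 ℕ.≤ J ℕ.+ J′) (1≤J′ : 1 ℕ.≤ J′ ℕ.+ J) where

    pentagonal-part : Fin r → Family ℤ
    pentagonal-part = pull (Residue.residue-split r τ) (θ 1 2 (s≤s z≤n))

    private
      J+J′≡ : + (J ℕ.+ J′) ≡ + 3 ℤ.* (+ r ℤ.* + r)
      J+J′≡ = ≡.trans (≡.cong₂ ℤ._+_ J≡ J′≡) (ℤ-Solver.solve 1 (λ x → x :+ con 2 :* x := con 3 :* x) (+ r ℤ.* + r))

      θ-expo-as : ∀ {c d m c′} → + (c ℕ.+ d) ≡ m → + c ≡ c′ → ∀ k → θ-expo c d k ≡ m ℤ.* tri k ℤ.+ c′ ℤ.* k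
      θ-expo-as {c} {d} ≡.refl ≡.refl k = θ-expo-formula c d k

      θ-expo-1-2 : ∀ {k k′} → k ≡ k′ → θ-expo 1 2 k ≡ + 3 ℤ.* tri k′ ℤ.+ 1ℤ ℤ.* k′
      θ-expo-1-2 {k} ≡.refl = θ-expo-formula 1 2 k

    pentagonal-middle : ∀ s (δ≥0 : 0ℤ ℤ.≤ + 3 ℤ.* tri (+ t) ℤ.+ + t) → + toℕ s ℤ.- τ ≡ + t →
                        total (pentagonal-part s) ≈ ε (+ t) * qᶻ (+ 3 ℤ.* tri (+ t) ℤ.+ + t) * total (θ J′ J 1≤J′)
    pentagonal-middle s δ≥0 s≡ = trans
      (total-cong (pentagonal-part s) (scale (ε (+ t)) _ δ≥0 (θ J′ J 1≤J′)) sign expo)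
      (total-scale (ε (+ t)) _ δ≥0 (θ J′ J 1≤J′))
      where
      sign : ∀ l → ε (+ r ℤ.* l ℤ.+ (+ toℕ s ℤ.- τ)) ≈ ε (+ t) * ε l
      sign l = trans (ε-parity {j = + t ℤ.+ l} ((+ 3 ℤ.* + t ℤ.- 1ℤ) ℤ.* l)
        (≡.trans (≡.cong₂ (λ p x → p ℤ.* l ℤ.+ x) r≡ s≡)
          (ℤ-Solver.solve 2 (λ t l → (con 6 :* t :- con 1) :* l :+ t := t :+ l :+ ((con 3 :* t :- con 1) :* l :+ (con 3 :* t :- con 1) :* l)) (+ t) l)))
        (ε-+ (+ t) l)
      expo : ∀ l → θ-expo 1 2 (+ r ℤ.* l ℤ.+ (+ toℕ s ℤ.- τ)) ≡ (+ 3 ℤ.* tri (+ t) ℤ.+ + t) ℤ.+ θ-expo J′ J l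
      expo l = ≡.trans (θ-expo-1-2 (≡.cong (λ x → + r ℤ.* l ℤ.+ x) s≡))
        (≡.trans (QuintupleExponents.middle (+ t) 0ℤ l r≡)
          (≡.cong (λ x → (+ 3 ℤ.* tri (+ t) ℤ.+ + t) ℤ.+ x)
            (≡.sym (θ-expo-as {J′} (≡.trans (ℤ.+-comm (+ J′) (+ J)) J+J′≡) J′≡ l))))

    -- The quintuple product identity.  On the left, the two parts of the pentagonal series with indices
    -- ≡ t − i and ≡ t + i are combined; their terms with odd total exponent of q^{r i} cancel.
    quintuple : ∀ i {c d c₂ d₂} s₁ s₂ (δ≥0 : 0ℤ ℤ.≤ QuintupleExponents.δ (+ t) (+ i)) 1≤c 1≤c₂ →
      + c ≡ + r ℤ.* + i → + (c ℕ.+ d) ≡ + r ℤ.* + r → + c₂ ≡ + 2 ℤ.* (+ r ℤ.* + i) → + (c₂ ℕ.+ d₂) ≡ + r ℤ.* + r →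
      + toℕ s₁ ℤ.- τ ≡ + t ℤ.- + i → + toℕ s₂ ℤ.- τ ≡ + t ℤ.+ + i →
      total (θ c d 1≤c) * (total (pentagonal-part s₁) + total (pentagonal-part s₂))
      ≈ ε (+ t ℤ.+ + i) * qᶻ (QuintupleExponents.δ (+ t) (+ i)) * (total (θ J J′ 1≤J) * total (θ c₂ d₂ 1≤c₂))
    quintuple i {c} {d} {c₂} {d₂} s₁ s₂ δ≥0 1≤c 1≤c₂ c≡ c+d c₂≡ c₂+d₂ s₁≡ s₂≡ = begin
      total θc * (total P₁ + total P₂)
        ≈⟨ trans (distribˡ _ _ _) (+-cong (sym (total-⊗ θc P₁)) (sym (total-⊗ θc P₂))) ⟩
      total A + total B′
        ≈⟨ +-cong (total-split first-lattice A) (total-split second-lattice B′) ⟩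
      (total A₀ + (total A₁ + 0#)) + (total B₀ + (total B₁ + 0#))
        ≈⟨ +-congˡ (+-congˡ (+-congʳ (trans (total-cong B₁ (scale (ε 1ℤ) 0ℤ ℤ.≤-refl A₁) (λ (k , n) → sign-B₁ k n) (λ (k , n) → expo-B₁ k n)) (total-scale (ε 1ℤ) 0ℤ ℤ.≤-refl A₁)))) ⟩
      (total A₀ + (total A₁ + 0#)) + (total B₀ + (- 1# * 1# * 1# * total A₁ + 0#))
        ≈⟨ solve 3 (λ a b c → (a :+ (b :+ con 0)) :+ (c :+ (:- con 1 :* con 1 :* con 1 :* b :+ con 0)) := a :+ (c :+ con 0)) _ _ _ ⟩
      total A₀ + (total B₀ + 0#)
        ≈⟨ +-cong (total-cong A₀ (pull pentagonal-lattice R Fin.zero) (λ (k , n) → sign-A₀ k n) (λ (k , n) → expo-A₀ k n))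
                  (+-congʳ (total-cong B₀ (pull pentagonal-lattice R (Fin.suc Fin.zero)) (λ (k , n) → sign-B₀ k n) (λ (k , n) → expo-B₀ k n))) ⟩
      total (pull pentagonal-lattice R Fin.zero) + (total (pull pentagonal-lattice R (Fin.suc Fin.zero)) + 0#)
        ≈⟨ total-split pentagonal-lattice R ⟨
      total R
        ≈⟨ trans (total-scale (ε (+ t ℤ.+ + i)) δ δ≥0 (θJ ⊗ θ₂)) (*-congˡ (total-⊗ θJ θ₂)) ⟩
      ε (+ t ℤ.+ + i) * qᶻ δ * (total θJ * total θ₂) ∎
      where
      open QuintupleExponents (+ t) (+ i)
      θc = θ c d 1≤c
      θ₂ = θ c₂ d₂ 1≤c₂
      θJ = θ J J′ 1≤J
      P₁ = pentagonal-part s₁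
      P₂ = pentagonal-part s₂
      A = θc ⊗ P₁
      B′ = θc ⊗ P₂
      R = scale (ε (+ t ℤ.+ + i)) δ δ≥0 (θJ ⊗ θ₂)
      A₀ = pull first-lattice A Fin.zero
      A₁ = pull first-lattice A (Fin.suc Fin.zero)
      B₀ = pull second-lattice B′ Fin.zero
      B₁ = pull second-lattice B′ (Fin.suc Fin.zero)

      index₁ : ∀ n → + r ℤ.* ℤ.- n ℤ.+ (+ toℕ s₁ ℤ.- τ) ≡ + r ℤ.* ℤ.- n ℤ.+ (+ t ℤ.- + i)
      index₁ n = ≡.cong (λ x → + r ℤ.* ℤ.- n ℤ.+ x) s₁≡
      index₂ : ∀ k n → + r ℤ.* (k ℤ.- n) ℤ.+ (+ toℕ s₂ ℤ.- τ) ≡ + r ℤ.* (k ℤ.- n) ℤ.+ (+ t ℤ.+ + i)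
      index₂ k n = ≡.cong (λ x → + r ℤ.* (k ℤ.- n) ℤ.+ x) s₂≡

      sign₂ : ∀ {x y y′ j} h → y ≡ y′ → x ℤ.+ y′ ≡ j ℤ.+ (h ℤ.+ h) → ε x * ε y ≈ ε j
      sign₂ {x} {y} {j = j} h ≡.refl eq = trans (sym (ε-+ x y)) (ε-parity {j = j} h eq)

      sign-A₀ : ∀ k n → ε (+ 2 ℤ.* k ℤ.+ 0ℤ ℤ.- + 3 ℤ.* n) * ε (+ r ℤ.* ℤ.- n ℤ.+ (+ toℕ s₁ ℤ.- τ))
                        ≈ ε (+ t ℤ.+ + i) * (ε (k ℤ.- + 2 ℤ.* n ℤ.+ 0ℤ) * ε k)
      -- The witness is half the difference of the two sign exponents, computed with r = 6 t - 1;
      -- the same holds for the witnesses in `sign-B₀` and `sign-B₁`.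
      sign-A₀ k n = trans (sign₂ {x = + 2 ℤ.* k ℤ.+ 0ℤ ℤ.- + 3 ℤ.* n} {j = + t ℤ.+ + i ℤ.+ (x ℤ.+ k)} (ℤ.- (+ 3 ℤ.* + t ℤ.* n) ℤ.- + i) (index₁ n)
        (≡.trans (≡.cong (λ p → (+ 2 ℤ.* k ℤ.+ 0ℤ ℤ.- + 3 ℤ.* n) ℤ.+ (p ℤ.* ℤ.- n ℤ.+ (+ t ℤ.- + i))) r≡)
          (ℤ-Solver.solve 4 (λ t i k n → (con 2 :* k :+ con 0 :- con 3 :* n) :+ ((con 6 :* t :- con 1) :* :- n :+ (t :- i))
            := (t :+ i :+ (k :- con 2 :* n :+ con 0 :+ k)) :+ ((:- (con 3 :* t :* n) :- i) :+ (:- (con 3 :* t :* n) :- i))) (+ t) (+ i) k n)))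
        (trans (ε-+ (+ t ℤ.+ + i) (x ℤ.+ k)) (*-congˡ (ε-+ x k)))
        where x = k ℤ.- + 2 ℤ.* n ℤ.+ 0ℤ
      sign-B₀ : ∀ k n → ε (+ 3 ℤ.* n ℤ.- k ℤ.+ 0ℤ ℤ.- 1ℤ) * ε (+ r ℤ.* (k ℤ.- n) ℤ.+ (+ toℕ s₂ ℤ.- τ))
                        ≈ ε (+ t ℤ.+ + i) * (ε (k ℤ.- + 2 ℤ.* n ℤ.+ 1ℤ) * ε k)
      sign-B₀ k n = trans (sign₂ {x = + 3 ℤ.* n ℤ.- k ℤ.+ 0ℤ ℤ.- 1ℤ} {j = + t ℤ.+ + i ℤ.+ (x ℤ.+ k)} ((+ 3 ℤ.- + 3 ℤ.* + t) ℤ.* n ℤ.+ (+ 3 ℤ.* + t ℤ.- + 2) ℤ.* k ℤ.- 1ℤ) (index₂ k n)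
        (≡.trans (≡.cong (λ p → (+ 3 ℤ.* n ℤ.- k ℤ.+ 0ℤ ℤ.- 1ℤ) ℤ.+ (p ℤ.* (k ℤ.- n) ℤ.+ (+ t ℤ.+ + i))) r≡)
          (ℤ-Solver.solve 4 (λ t i k n → let h = (con 3 :- con 3 :* t) :* n :+ (con 3 :* t :- con 2) :* k :- con 1 in
            (con 3 :* n :- k :+ con 0 :- con 1) :+ ((con 6 :* t :- con 1) :* (k :- n) :+ (t :+ i))
            := (t :+ i :+ (k :- con 2 :* n :+ con 1 :+ k)) :+ (h :+ h)) (+ t) (+ i) k n)))
        (trans (ε-+ (+ t ℤ.+ + i) (x ℤ.+ k)) (*-congˡ (ε-+ x k)))
        where x = k ℤ.- + 2 ℤ.* n ℤ.+ 1ℤ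
      sign-B₁ : ∀ k n → ε (+ 3 ℤ.* n ℤ.- k ℤ.+ 1ℤ ℤ.- 1ℤ) * ε (+ r ℤ.* (k ℤ.- n) ℤ.+ (+ toℕ s₂ ℤ.- τ))
                        ≈ ε 1ℤ * (ε (+ 2 ℤ.* k ℤ.+ 1ℤ ℤ.- + 3 ℤ.* n) * ε (+ r ℤ.* ℤ.- n ℤ.+ (+ toℕ s₁ ℤ.- τ)))
      sign-B₁ k n = trans (sign₂ {x = + 3 ℤ.* n ℤ.- k ℤ.+ 1ℤ ℤ.- 1ℤ} {j = 1ℤ ℤ.+ (x ℤ.+ y)} (+ 3 ℤ.* n ℤ.+ (+ 3 ℤ.* + t ℤ.- + 2) ℤ.* k ℤ.+ + i ℤ.- 1ℤ) (index₂ k n)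
        (≡.trans (≡.cong (λ p → (+ 3 ℤ.* n ℤ.- k ℤ.+ 1ℤ ℤ.- 1ℤ) ℤ.+ (p ℤ.* (k ℤ.- n) ℤ.+ (+ t ℤ.+ + i))) r≡)
          (≡.trans (ℤ-Solver.solve 4 (λ t i k n → let h = con 3 :* n :+ (con 3 :* t :- con 2) :* k :+ i :- con 1 in
            (con 3 :* n :- k :+ con 1 :- con 1) :+ ((con 6 :* t :- con 1) :* (k :- n) :+ (t :+ i))
            := (con 1 :+ ((con 2 :* k :+ con 1 :- con 3 :* n) :+ ((con 6 :* t :- con 1) :* :- n :+ (t :- i)))) :+ (h :+ h)) (+ t) (+ i) k n)
            (≡.cong (λ p → (1ℤ ℤ.+ (x ℤ.+ (p ℤ.* ℤ.- n ℤ.+ (+ t ℤ.- + i)))) ℤ.+ (h ℤ.+ h)) (≡.sym r≡)))))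
        (trans (ε-+ 1ℤ (x ℤ.+ y)) (*-congˡ (trans (ε-+ x y) (*-congˡ (reflexive (≡.cong ε (≡.sym (index₁ n))))))))
        where
        x = + 2 ℤ.* k ℤ.+ 1ℤ ℤ.- + 3 ℤ.* n
        y = + r ℤ.* ℤ.- n ℤ.+ (+ t ℤ.- + i)
        h = + 3 ℤ.* n ℤ.+ (+ 3 ℤ.* + t ℤ.- + 2) ℤ.* k ℤ.+ + i ℤ.- 1ℤ

      rhs-expo : ∀ l k → δ ℤ.+ (θ-expo J J′ l ℤ.+ θ-expo c₂ d₂ k)
        ≡ δ ℤ.+ ((+ 3 ℤ.* (+ r ℤ.* + r) ℤ.* tri l ℤ.+ + r ℤ.* + r ℤ.* l) ℤ.+ (+ r ℤ.* + r ℤ.* tri k ℤ.+ + 2 ℤ.* (+ r ℤ.* + i) ℤ.* k))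
      rhs-expo l k = ≡.cong₂ (λ x y → δ ℤ.+ (x ℤ.+ y)) (θ-expo-as {J} J+J′≡ J≡ l) (θ-expo-as {c₂} c₂+d₂ c₂≡ k)
      lhs-expo : ∀ m {l l′} → l ≡ l′ → θ-expo c d m ℤ.+ θ-expo 1 2 l
        ≡ (+ r ℤ.* + r ℤ.* tri m ℤ.+ + r ℤ.* + i ℤ.* m) ℤ.+ (+ 3 ℤ.* tri l′ ℤ.+ 1ℤ ℤ.* l′)
      lhs-expo m l≡ = ≡.cong₂ ℤ._+_ (θ-expo-as {c} c+d c≡ m) (θ-expo-1-2 l≡)

      expo-A₀ : ∀ k n → θ-expo c d (+ 2 ℤ.* k ℤ.+ 0ℤ ℤ.- + 3 ℤ.* n) ℤ.+ θ-expo 1 2 (+ r ℤ.* ℤ.- n ℤ.+ (+ toℕ s₁ ℤ.- τ))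
                        ≡ δ ℤ.+ (θ-expo J J′ (k ℤ.- + 2 ℤ.* n ℤ.+ 0ℤ) ℤ.+ θ-expo c₂ d₂ k)
      expo-A₀ k n = ≡.trans (lhs-expo _ (index₁ n)) (≡.trans (even-first k n r≡) (≡.sym (rhs-expo _ k)))
      expo-B₀ : ∀ k n → θ-expo c d (+ 3 ℤ.* n ℤ.- k ℤ.+ 0ℤ ℤ.- 1ℤ) ℤ.+ θ-expo 1 2 (+ r ℤ.* (k ℤ.- n) ℤ.+ (+ toℕ s₂ ℤ.- τ))
                        ≡ δ ℤ.+ (θ-expo J J′ (k ℤ.- + 2 ℤ.* n ℤ.+ 1ℤ) ℤ.+ θ-expo c₂ d₂ k)
      expo-B₀ k n = ≡.trans (lhs-expo _ (index₂ k n)) (≡.trans (even-second k n r≡) (≡.sym (rhs-expo _ k)))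
      expo-B₁ : ∀ k n → θ-expo c d (+ 3 ℤ.* n ℤ.- k ℤ.+ 1ℤ ℤ.- 1ℤ) ℤ.+ θ-expo 1 2 (+ r ℤ.* (k ℤ.- n) ℤ.+ (+ toℕ s₂ ℤ.- τ))
                        ≡ 0ℤ ℤ.+ (θ-expo c d (+ 2 ℤ.* k ℤ.+ 1ℤ ℤ.- + 3 ℤ.* n) ℤ.+ θ-expo 1 2 (+ r ℤ.* ℤ.- n ℤ.+ (+ toℕ s₁ ℤ.- τ)))
      expo-B₁ k n = ≡.trans (lhs-expo _ (index₂ k n)) (≡.trans (odd k n r≡) (≡.sym (≡.trans (ℤ.+-identityˡ _) (lhs-expo _ (index₁ n)))))

-- Product forms of theta series and the dissection of (q; q)_∞

module ThetaProducts (B : CommutativeRing 0ℓ 0ℓ)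
                     (q : CommutativeRing.Carrier B) (N : ℕ) (q^N≈0 : PowerVanishes B q N) where
  open CommutativeRing B
  open Exp semiring using (_^_)
  open Exp semiring using (^-homo-*; ^-assocʳ)
  open SetoidReasoning setoid
  open Solver B using (solve)
  open Nilpotent B q N q^N≈0
  open Theta B q N q^N≈0
  open Products B
  open Powers B

  private
    1-q^ : ℕ → Carrier
    1-q^ e = 1# - q ^ e

    1-q^-trivial : ∀ {e} → N ℕ.≤ e → 1-q^ e ≈ 1#
    1-q^-trivial {e} N≤e = trans (+-congˡ (-‿cong (q^≥N N≤e))) (solve 0 (con 1 :- con 0 := con 1))

  -- (q^a; q^m)_∞
  pochhammer : ℕ → ℕ → Carrier
  pochhammer a m = prod (λ i → 1# - q ^ (a ℕ.+ m ℕ.* i)) N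

  θ-pochhammer : ∀ {c d m} → c ℕ.+ d ≡ m → ∀ 1≤c+d → pochhammer c m * pochhammer d m * pochhammer m m ≈ total (θ c d 1≤c+d)
  θ-pochhammer {c} {d} ≡.refl 1≤c+d = trans
    (*-cong (*-cong (prod-cong N (factor c)) (prod-cong N (factor d))) (prod-cong N (factor m)))
    (θ-product c d 1≤c+d)
    where
    m = c ℕ.+ d
    factor : ∀ a i → 1-q^ (a ℕ.+ m ℕ.* i) ≈ 1# - q ^ a * (q ^ m) ^ i
    factor a i = +-congˡ (-‿cong (trans (^-homo-* q a (m ℕ.* i)) (*-congˡ (sym (^-assocʳ q m i)))))

  θ-0 : ∀ m (1≤m : 1 ℕ.≤ m) → total (θ 0 m 1≤m) ≈ 0#
  θ-0 m 1≤m = trans (sym (θ-pochhammer {0} {m} ≡.refl 1≤m))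
    (trans (*-congʳ (*-congʳ (vanish N q^N≈0))) (solve 2 (λ x y → con 0 :* x :* y := con 0) _ _))
    where
    vanish : ∀ n → q ^ n ≈ 0# → prod (λ i → 1-q^ (m ℕ.* i)) n ≈ 0#
    -- For N = 0 the product is empty and equals 1, but then q^N = 0 says 1 = 0. Otherwise the
    -- factor 1 - q⁰ makes it vanish.
    vanish zero    1≈0 = 1≈0
    vanish (suc n) _   = trans (prod-first (λ i → 1-q^ (m ℕ.* i)) n)
      (trans (*-congʳ (trans (reflexive (≡.cong 1-q^ (ℕ.*-zeroʳ m))) (-‿inverseʳ 1#))) (zeroˡ _))

  private
    prod-triple : ∀ f n → prod f (n ℕ.* 3) ≈ prod (λ i → f (i ℕ.* 3)) n * prod (λ i → f (1 ℕ.+ i ℕ.* 3)) n * prod (λ i → f (2 ℕ.+ i ℕ.* 3)) n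
    prod-triple f zero    = solve 0 (con 1 := con 1 :* con 1 :* con 1)
    prod-triple f (suc n) = trans (*-congʳ (*-congʳ (*-congʳ (prod-triple f n))))
      (solve 6 (λ a b c x y z → a :* b :* c :* x :* y :* z := (a :* x) :* (b :* y) :* (c :* z)) _ _ _ _ _ _)

  -- The multiples of s are sorted into three progressions with difference 3s. These are the three
  -- products of Jacobi's identity for c = s, d = 2s, whence the pentagonal number theorem
  -- `θ-pentagonal`.
  pochhammer-triple : ∀ s → 1 ℕ.≤ s → let s₃ = s ℕ.+ (s ℕ.+ s) in
                      pochhammer s s ≈ pochhammer s s₃ * pochhammer (s ℕ.+ s) s₃ * pochhammer s₃ s₃
  pochhammer-triple s 1≤s = begin
    prod f N
      ≈⟨ prod-stable f (ℕ.m≤m*n N 3) (λ i N≤i → 1-q^-trivial (ℕ.≤-trans N≤i (ℕ.≤-trans (i≤s*i i) (ℕ.m≤n+m (s ℕ.* i) s)))) ⟨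
    prod f (N ℕ.* 3)
      ≈⟨ prod-triple f N ⟩
    prod (λ i → f (i ℕ.* 3)) N * prod (λ i → f (1 ℕ.+ i ℕ.* 3)) N * prod (λ i → f (2 ℕ.+ i ℕ.* 3)) N
      ≈⟨ *-cong (*-cong (prod-cong N λ i → reflexive (≡.cong 1-q^ (e₀ s i))) (prod-cong N λ i → reflexive (≡.cong 1-q^ (e₁ s i))))
                (prod-cong N λ i → reflexive (≡.cong 1-q^ (e₂ s i))) ⟩
    pochhammer s s₃ * pochhammer (s ℕ.+ s) s₃ * pochhammer s₃ s₃ ∎
    where
    s₃ = s ℕ.+ (s ℕ.+ s)
    f = λ i → 1-q^ (s ℕ.+ s ℕ.* i)
    i≤s*i : ∀ i → i ℕ.≤ s ℕ.* i
    i≤s*i i = ℕ.≤-trans (ℕ.≤-reflexive (≡.sym (ℕ.*-identityˡ i))) (ℕ.*-monoˡ-≤ i 1≤s)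
    open ℕ.+-*-Solver using () renaming (solve to ℕ-solve; con to c; _:+_ to _⊹_; _:*_ to _∙_; _:=_ to _≐_)
    e₀ : ∀ s i → s ℕ.+ s ℕ.* (i ℕ.* 3) ≡ s ℕ.+ (s ℕ.+ (s ℕ.+ s)) ℕ.* i
    e₀ = ℕ-solve 2 (λ s i → s ⊹ s ∙ (i ∙ c 3) ≐ s ⊹ (s ⊹ (s ⊹ s)) ∙ i) ≡.refl
    e₁ : ∀ s i → s ℕ.+ s ℕ.* (1 ℕ.+ i ℕ.* 3) ≡ s ℕ.+ s ℕ.+ (s ℕ.+ (s ℕ.+ s)) ℕ.* i
    e₁ = ℕ-solve 2 (λ s i → s ⊹ s ∙ (c 1 ⊹ i ∙ c 3) ≐ s ⊹ s ⊹ (s ⊹ (s ⊹ s)) ∙ i) ≡.refl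
    e₂ : ∀ s i → s ℕ.+ s ℕ.* (2 ℕ.+ i ℕ.* 3) ≡ s ℕ.+ (s ℕ.+ s) ℕ.+ (s ℕ.+ (s ℕ.+ s)) ℕ.* i
    e₂ = ℕ-solve 2 (λ s i → s ⊹ s ∙ (c 2 ⊹ i ∙ c 3) ≐ s ⊹ (s ⊹ s) ⊹ (s ⊹ (s ⊹ s)) ∙ i) ≡.refl

  θ-swap : ∀ c d p p′ → total (θ c d p) ≈ total (θ d c p′)
  θ-swap c d p p′ = trans (sym (θ-pochhammer {c} {d} ≡.refl p))
    (trans (*-congʳ (*-comm _ _)) (θ-pochhammer {d} {c} (ℕ.+-comm d c) p′))

  θ-pentagonal : ∀ s (1≤s : 1 ℕ.≤ s) p → pochhammer s s ≈ total (θ s (s ℕ.+ s) p)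
  θ-pentagonal s 1≤s p = trans (pochhammer-triple s 1≤s) (θ-pochhammer {s} {s ℕ.+ s} ≡.refl p)

  private
    p₁₂₁ : 1 ℕ.≤ 121
    p₁₂₁ = s≤s z≤n

  module Eleven
    (X U : ℕ → Carrier)
    (X-θ : ∀ i {c d} → c ≡ 11 ℕ.* i → c ℕ.+ d ≡ 121 → ∀ p → X i ≈ total (θ c d p))
    (X-sym : ∀ i j → i ℕ.+ j ≡ 11 → X i ≈ X j)
    where

    private
      -- Here 11 = 6 · 2 - 1, so t = 2. The offset 3 lets the representatives s - 3 run from -3 to
      -- 7, symmetrically about 2: class 5 is the middle one, and the classes 5 - i and 5 + i form a
      -- pair.
      open Pentagonal 11 2 ≡.refl (+ 3) {121} {242} ≡.refl ≡.refl (s≤s z≤n) (s≤s z≤n)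

      J₁₂₁ : Carrier
      J₁₂₁ = pochhammer 121 121

      h : Fin 11 → Carrier
      h s = total (pentagonal-part s)

      -1^ : ∀ {n} → ℕ → Expr n
      -1^ k = (:- con 1) :^ k

      -- The quintuple product identity divided by Xᵢ, with X₂ᵢ folded back to Xⱼ for some j ≤ 5.
      pair : ∀ i j s₁ s₂ k {c d c₂ d₂} δ≥0 → X i * U i ≈ 1# → X (2 ℕ.* i) ≈ X j →
             c ≡ 11 ℕ.* i → c ℕ.+ d ≡ 121 → c₂ ≡ 11 ℕ.* (2 ℕ.* i) → c₂ ℕ.+ d₂ ≡ 121 →
             + toℕ s₁ ℤ.- + 3 ≡ + 2 ℤ.- + i → + toℕ s₂ ℤ.- + 3 ≡ + 2 ℤ.+ + i →
             ∣ QuintupleExponents.δ (+ 2) (+ i) ∣ ≡ k → 1 ℕ.≤ c ℕ.+ d → 1 ℕ.≤ c₂ ℕ.+ d₂ →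
             h s₁ + h s₂ ≈ ε (+ 2 ℤ.+ + i) * q ^ k * (J₁₂₁ * X j * U i)
      pair i j s₁ s₂ k {c} {d} {c₂} {d₂} δ≥0 XU X₂ c≡ c+d≡ c₂≡ c₂+d₂≡ s₁≡ s₂≡ k≡ pc pc₂ = begin
        H
          ≈⟨ trans (sym (*-identityˡ _)) (*-congʳ (sym XU)) ⟩
        X i * U i * H
          ≈⟨ solve 3 (λ x u h → x :* u :* h := x :* h :* u) _ _ _ ⟩
        X i * H * U i
          ≈⟨ *-congʳ (trans (*-congʳ (X-θ i c≡ c+d≡ pc)) (quintuple i s₁ s₂ δ≥0 pc pc₂
               (≡.trans (≡.cong +_ c≡) (ℤ.pos-* 11 i)) (≡.cong +_ c+d≡)
               (≡.trans (≡.cong +_ c₂≡) (≡.trans (≡.cong +_ (commute i)) (≡.trans (ℤ.pos-* 2 (11 ℕ.* i)) (≡.cong (λ x → + 2 ℤ.* x) (ℤ.pos-* 11 i)))))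
               (≡.cong +_ c₂+d₂≡) s₁≡ s₂≡)) ⟩
        ε (+ 2 ℤ.+ + i) * q ^ ∣ QuintupleExponents.δ (+ 2) (+ i) ∣ * (total (θ 121 242 (s≤s z≤n)) * total (θ c₂ d₂ pc₂)) * U i
          ≈⟨ *-congʳ (*-cong (reflexive (≡.cong (λ k → ε (+ 2 ℤ.+ + i) * q ^ k) k≡))
               (*-cong (sym (θ-pentagonal 121 p₁₂₁ (s≤s z≤n))) (trans (sym (X-θ (2 ℕ.* i) c₂≡ c₂+d₂≡ pc₂)) X₂))) ⟩
        ε (+ 2 ℤ.+ + i) * q ^ k * (J₁₂₁ * X j) * U i
          ≈⟨ *-assoc _ _ _ ⟩
        ε (+ 2 ℤ.+ + i) * q ^ k * (J₁₂₁ * X j * U i) ∎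
        where
        H = h s₁ + h s₂
        commute : ∀ i → 11 ℕ.* (2 ℕ.* i) ≡ 2 ℕ.* (11 ℕ.* i)
        commute i = ≡.trans (≡.sym (ℕ.*-assoc 11 2 i)) (ℕ.*-assoc 2 11 i)

    -- The exponents 5, 1, 0, 2, 7, 15 are the pentagonal numbers 3 y (y - 1) / 2 + y at y = 2, 1,
    -- 0, -1, -2, -3.
    Y : Carrier
    Y = q ^ 5 - q ^ 1 * (X 2 * U 1) + q ^ 0 * (X 4 * U 2) - q ^ 2 * (X 5 * U 3) + q ^ 7 * (X 3 * U 4) - q ^ 15 * (X 1 * U 5)

    -- Ramanujan's 11-dissection of (q; q)_∞.
    pochhammer-dissection : X 1 * U 1 ≈ 1# → X 2 * U 2 ≈ 1# → X 3 * U 3 ≈ 1# → X 4 * U 4 ≈ 1# → X 5 * U 5 ≈ 1# →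
                            pochhammer 1 1 ≈ pochhammer 121 121 * Y
    pochhammer-dissection XU₁ XU₂ XU₃ XU₄ XU₅ = begin
      pochhammer 1 1
        ≈⟨ θ-pentagonal 1 (s≤s z≤n) (s≤s z≤n) ⟩
      total (θ 1 2 (s≤s z≤n))
        ≈⟨ total-split (Residue.residue-split 11 (+ 3)) (θ 1 2 (s≤s z≤n)) ⟩
      sumOver h (allFin 11)
        ≈⟨ solve 11 (λ a b c d e f g h i j k → a :+ (b :+ (c :+ (d :+ (e :+ (f :+ (g :+ (h :+ (i :+ (j :+ (k :+ con 0))))))))))
             := f :+ (e :+ g) :+ (d :+ h) :+ (c :+ i) :+ (b :+ j) :+ (a :+ k))
             (h (# 0)) (h (# 1)) (h (# 2)) (h (# 3)) (h (# 4)) (h (# 5)) (h (# 6)) (h (# 7)) (h (# 8)) (h (# 9)) (h (# 10)) ⟩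
      h (# 5) + (h (# 4) + h (# 6)) + (h (# 3) + h (# 7)) + (h (# 2) + h (# 8)) + (h (# 1) + h (# 9)) + (h (# 0) + h (# 10))
        ≈⟨ +-cong (+-cong (+-cong (+-cong (+-cong
             (trans (pentagonal-middle (# 5) (ℤ.+≤+ z≤n) ≡.refl) (*-congˡ (trans (θ-swap 242 121 (s≤s z≤n) (s≤s z≤n)) (sym (θ-pentagonal 121 p₁₂₁ (s≤s z≤n))))))
             (pair 1 2 (# 4) (# 6) 1  (ℤ.+≤+ z≤n) XU₁ refl ≡.refl ≡.refl ≡.refl ≡.refl ≡.refl ≡.refl ≡.refl p₁₂₁ p₁₂₁))
             (pair 2 4 (# 3) (# 7) 0  (ℤ.+≤+ z≤n) XU₂ refl ≡.refl ≡.refl ≡.refl ≡.refl ≡.refl ≡.refl ≡.refl p₁₂₁ p₁₂₁))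
             (pair 3 5 (# 2) (# 8) 2  (ℤ.+≤+ z≤n) XU₃ (X-sym 6 5 ≡.refl) ≡.refl ≡.refl ≡.refl ≡.refl ≡.refl ≡.refl ≡.refl p₁₂₁ p₁₂₁))
             (pair 4 3 (# 1) (# 9) 7  (ℤ.+≤+ z≤n) XU₄ (X-sym 8 3 ≡.refl) ≡.refl ≡.refl ≡.refl ≡.refl ≡.refl ≡.refl ≡.refl p₁₂₁ p₁₂₁))
             (pair 5 1 (# 0) (# 10) 15 (ℤ.+≤+ z≤n) XU₅ (X-sym 10 1 ≡.refl) ≡.refl ≡.refl ≡.refl ≡.refl ≡.refl ≡.refl ≡.refl p₁₂₁ p₁₂₁) ⟩
      ε (+ 2) * q ^ 5 * J₁₂₁ + ε (+ 3) * q ^ 1 * (J₁₂₁ * X 2 * U 1) + ε (+ 4) * q ^ 0 * (J₁₂₁ * X 4 * U 2)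
      + ε (+ 5) * q ^ 2 * (J₁₂₁ * X 5 * U 3) + ε (+ 6) * q ^ 7 * (J₁₂₁ * X 3 * U 4) + ε (+ 7) * q ^ 15 * (J₁₂₁ * X 1 * U 5)
        ≈⟨ solve 12 (λ q x₁ x₂ x₃ x₄ x₅ u₁ u₂ u₃ u₄ u₅ J →
             -1^ 2 :* q :^ 5 :* J :+ -1^ 3 :* q :^ 1 :* (J :* x₂ :* u₁) :+ -1^ 4 :* q :^ 0 :* (J :* x₄ :* u₂)
             :+ -1^ 5 :* q :^ 2 :* (J :* x₅ :* u₃) :+ -1^ 6 :* q :^ 7 :* (J :* x₃ :* u₄) :+ -1^ 7 :* q :^ 15 :* (J :* x₁ :* u₅)
             := J :* (q :^ 5 :- q :^ 1 :* (x₂ :* u₁) :+ q :^ 0 :* (x₄ :* u₂) :- q :^ 2 :* (x₅ :* u₃) :+ q :^ 7 :* (x₃ :* u₄) :- q :^ 15 :* (x₁ :* u₅)))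
             q (X 1) (X 2) (X 3) (X 4) (X 5) (U 1) (U 2) (U 3) (U 4) (U 5) J₁₂₁ ⟩
      J₁₂₁ * Y ∎

    -- The Plücker relations between X₁, ..., X₅

    private
      g f : ∀ a a′ → 1 ℕ.≤ a ℕ.+ a′ → Carrier
      g a a′ p = total (θ-even a a′ p)
      f a a′ p = total (θ-odd a a′ p)

      W : ∀ b e i j {a′ b′ c′ e′} → b ℕ.+ e ℕ.+ a′ ≡ 121 → b ℕ.+ b′ ≡ 121 → b ℕ.+ e ℕ.+ b ℕ.+ c′ ≡ 121 → e ℕ.+ e′ ≡ 121 →
          b ℕ.+ e ℕ.+ b ≡ 11 ℕ.* i → e ≡ 11 ℕ.* j → ∀ pa pb pc pe → ∀ {i′ j′} → X i ≈ X i′ → X j ≈ X j′ →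
          q ^ b * (X i′ * X j′) ≈ g (b ℕ.+ e) a′ pa * f b b′ pb - f (b ℕ.+ e) a′ pa * g b b′ pb
      W b e i j a≡ b≡ c≡ e≡ i≡ j≡ pa pb pc pe i≈ j≈ = trans
        (*-congˡ (*-cong (trans (sym i≈) (X-θ i i≡ c≡ pc)) (trans (sym j≈) (X-θ j j≡ e≡ pe))))
        (θ-determinant b e a≡ b≡ c≡ e≡ pa pb pc pe)

      -- The relation p₁₂ p₃₄ + p₁₄ p₂₃ = p₁₃ p₂₄ between the minors of a 2 × 4 matrix with columns
      -- (gᵢ, fᵢ). The fourth column always has index 0, which makes its minors with the others
      -- squares Xᵢ²; the subscripts in `relation₄₂₁` and its companions name the first three
      -- columns.
      plücker : ∀ {g₁ f₁ g₂ f₂ g₃ f₃ g₄ f₄} k l {a b c d e f x₁ x₂ x₃} →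
        q ^ (k ℕ.+ l) * (a * b) ≈ g₁ * f₂ - f₁ * g₂ → q ^ k * (c * d) ≈ g₁ * f₃ - f₁ * g₃ → q ^ k * (e * f) ≈ g₂ * f₃ - f₂ * g₃ →
        1# * (x₁ * x₁) ≈ g₁ * f₄ - f₁ * g₄ → 1# * (x₂ * x₂) ≈ g₂ * f₄ - f₂ * g₄ → 1# * (x₃ * x₃) ≈ g₃ * f₄ - f₃ * g₄ →
        q ^ k * (q ^ l * (a * b * x₃ * x₃) + x₁ * x₁ * e * f) ≈ q ^ k * (c * d * x₂ * x₂)
      plücker {g₁} {f₁} {g₂} {f₂} {g₃} {f₃} {g₄} {f₄} k l {a} {b} {c} {d} {e} {f} {x₁} {x₂} {x₃} w₁₂ w₁₃ w₂₃ w₁₄ w₂₄ w₃₄ = begin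
        q ^ k * (q ^ l * (a * b * x₃ * x₃) + x₁ * x₁ * e * f)
          ≈⟨ solve 8 (λ Q L a b x₁ x₃ e f → Q :* (L :* (a :* b :* x₃ :* x₃) :+ x₁ :* x₁ :* e :* f)
               := (Q :* L) :* (a :* b) :* (con 1 :* (x₃ :* x₃)) :+ (con 1 :* (x₁ :* x₁)) :* (Q :* (e :* f))) (q ^ k) (q ^ l) a b x₁ x₃ e f ⟩
        q ^ k * q ^ l * (a * b) * (1# * (x₃ * x₃)) + 1# * (x₁ * x₁) * (q ^ k * (e * f))
          ≈⟨ +-cong (*-cong (trans (*-congʳ (sym (^-homo-* q k l))) w₁₂) w₃₄) (*-cong w₁₄ w₂₃) ⟩
        (g₁ * f₂ - f₁ * g₂) * (g₃ * f₄ - f₃ * g₄) + (g₁ * f₄ - f₁ * g₄) * (g₂ * f₃ - f₂ * g₃)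
          ≈⟨ solve 8 (λ g₁ f₁ g₂ f₂ g₃ f₃ g₄ f₄ → (g₁ :* f₂ :- f₁ :* g₂) :* (g₃ :* f₄ :- f₃ :* g₄) :+ (g₁ :* f₄ :- f₁ :* g₄) :* (g₂ :* f₃ :- f₂ :* g₃)
               := (g₁ :* f₃ :- f₁ :* g₃) :* (g₂ :* f₄ :- f₂ :* g₄)) g₁ f₁ g₂ f₂ g₃ f₃ g₄ f₄ ⟩
        (g₁ * f₃ - f₁ * g₃) * (g₂ * f₄ - f₂ * g₄)
          ≈⟨ *-cong (sym w₁₃) (sym w₂₄) ⟩
        q ^ k * (c * d) * (1# * (x₂ * x₂))
          ≈⟨ solve 4 (λ Q c d x → Q :* (c :* d) :* (con 1 :* (x :* x)) := Q :* (c :* d :* x :* x)) (q ^ k) c d x₂ ⟩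
        q ^ k * (c * d * x₂ * x₂) ∎

      w₀ : ∀ i {a′} → 0 ℕ.+ 11 ℕ.* i ℕ.+ a′ ≡ 121 → ∀ pa pc pe → 1# * (X i * X i) ≈ g (0 ℕ.+ 11 ℕ.* i) a′ pa * f 0 121 p₁₂₁ - f (0 ℕ.+ 11 ℕ.* i) a′ pa * g 0 121 p₁₂₁
      w₀ i {a′} a≡ pa pc pe = W 0 (11 ℕ.* i) i i a≡ ≡.refl (≡.trans (≡.cong (ℕ._+ a′) (ℕ.+-identityʳ (11 ℕ.* i))) a≡) a≡ (ℕ.+-identityʳ (11 ℕ.* i)) ≡.refl pa p₁₂₁ pc pe refl refl

      w : ∀ b e i j {a′ b′ c′ e′} → b ℕ.+ e ℕ.+ a′ ≡ 121 → b ℕ.+ b′ ≡ 121 → b ℕ.+ e ℕ.+ b ℕ.+ c′ ≡ 121 → e ℕ.+ e′ ≡ 121 → 1 ℕ.≤ b ℕ.+ e ℕ.+ b ℕ.+ c′ → 1 ℕ.≤ e ℕ.+ e′ →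
          b ℕ.+ e ℕ.+ b ≡ 11 ℕ.* i → e ≡ 11 ℕ.* j → ∀ pa pb {i′} → X i ≈ X i′ →
          q ^ b * (X i′ * X j) ≈ g (b ℕ.+ e) a′ pa * f b b′ pb - f (b ℕ.+ e) a′ pa * g b b′ pb
      w b e i j a≡ b≡ c≡ e≡ pc pe i≡ j≡ pa pb i≈ = W b e i j a≡ b≡ c≡ e≡ i≡ j≡ pa pb pc pe i≈ refl

      w₁ = w₀ 1 {110} ≡.refl p₁₂₁ p₁₂₁ p₁₂₁
      w₂ = w₀ 2 {99}  ≡.refl p₁₂₁ p₁₂₁ p₁₂₁
      w₃ = w₀ 3 {88}  ≡.refl p₁₂₁ p₁₂₁ p₁₂₁
      w₄ = w₀ 4 {77}  ≡.refl p₁₂₁ p₁₂₁ p₁₂₁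
      w₅ = w₀ 5 {66}  ≡.refl p₁₂₁ p₁₂₁ p₁₂₁
      -- From `w₂₁` to `w₅₄`, the minor of the columns i and j is q^(11j) X with index i + j times X
      -- with index i - j, where indices above 5 are folded back by k ↦ 11 - k.
      w₂₁ = w 11 11 3 1 {99} {110} {88} {110} ≡.refl ≡.refl ≡.refl ≡.refl p₁₂₁ p₁₂₁ ≡.refl ≡.refl p₁₂₁ p₁₂₁ refl
      w₃₁ = w 11 22 4 2 {88} {110} {77} {99} ≡.refl ≡.refl ≡.refl ≡.refl p₁₂₁ p₁₂₁ ≡.refl ≡.refl p₁₂₁ p₁₂₁ refl
      w₄₁ = w 11 33 5 3 {77} {110} {66} {88} ≡.refl ≡.refl ≡.refl ≡.refl p₁₂₁ p₁₂₁ ≡.refl ≡.refl p₁₂₁ p₁₂₁ refl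
      w₅₁ = w 11 44 6 4 {66} {110} {55} {77} ≡.refl ≡.refl ≡.refl ≡.refl p₁₂₁ p₁₂₁ ≡.refl ≡.refl p₁₂₁ p₁₂₁ (X-sym 6 5 ≡.refl)
      w₃₂ = w 22 11 5 1 {88} {99} {66} {110} ≡.refl ≡.refl ≡.refl ≡.refl p₁₂₁ p₁₂₁ ≡.refl ≡.refl p₁₂₁ p₁₂₁ refl
      w₄₂ = w 22 22 6 2 {77} {99} {55} {99} ≡.refl ≡.refl ≡.refl ≡.refl p₁₂₁ p₁₂₁ ≡.refl ≡.refl p₁₂₁ p₁₂₁ (X-sym 6 5 ≡.refl)
      w₅₂ = w 22 33 7 3 {66} {99} {44} {88} ≡.refl ≡.refl ≡.refl ≡.refl p₁₂₁ p₁₂₁ ≡.refl ≡.refl p₁₂₁ p₁₂₁ (X-sym 7 4 ≡.refl)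
      w₄₃ = w 33 11 7 1 {77} {88} {44} {110} ≡.refl ≡.refl ≡.refl ≡.refl p₁₂₁ p₁₂₁ ≡.refl ≡.refl p₁₂₁ p₁₂₁ (X-sym 7 4 ≡.refl)
      w₅₃ = w 33 22 8 2 {66} {88} {33} {99} ≡.refl ≡.refl ≡.refl ≡.refl p₁₂₁ p₁₂₁ ≡.refl ≡.refl p₁₂₁ p₁₂₁ (X-sym 8 3 ≡.refl)
      w₅₄ = w 44 11 9 1 {66} {77} {22} {110} ≡.refl ≡.refl ≡.refl ≡.refl p₁₂₁ p₁₂₁ ≡.refl ≡.refl p₁₂₁ p₁₂₁ (X-sym 9 2 ≡.refl)

    relation₄₂₁ : q ^ 11 * (q ^ 11 * (X 5 * X 2 * X 1 * X 1) + X 4 * X 4 * X 3 * X 1) ≈ q ^ 11 * (X 5 * X 3 * X 2 * X 2)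
    relation₄₂₁ = plücker 11 11 w₄₂ w₄₁ w₂₁ w₄ w₂ w₁

    relation₄₃₂ : q ^ 22 * (q ^ 11 * (X 4 * X 1 * X 2 * X 2) + X 4 * X 4 * X 5 * X 1) ≈ q ^ 22 * (X 5 * X 2 * X 3 * X 3)
    relation₄₃₂ = plücker 22 11 w₄₃ w₄₂ w₃₂ w₄ w₃ w₂

    relation₅₄₃ : q ^ 33 * (q ^ 11 * (X 2 * X 1 * X 3 * X 3) + X 5 * X 5 * X 4 * X 1) ≈ q ^ 33 * (X 3 * X 2 * X 4 * X 4)
    relation₅₄₃ = plücker 33 11 w₅₄ w₅₃ w₄₃ w₅ w₄ w₃

    relation₅₃₁ : q ^ 11 * (q ^ 22 * (X 3 * X 2 * X 1 * X 1) + X 5 * X 5 * X 4 * X 2) ≈ q ^ 11 * (X 5 * X 4 * X 3 * X 3)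
    relation₅₃₁ = plücker 11 22 w₅₃ w₅₁ w₃₁ w₅ w₃ w₁

    relation₅₂₁ : q ^ 11 * (q ^ 11 * (X 4 * X 3 * X 1 * X 1) + X 5 * X 5 * X 3 * X 1) ≈ q ^ 11 * (X 5 * X 4 * X 2 * X 2)
    relation₅₂₁ = plücker 11 11 w₅₂ w₅₁ w₂₁ w₅ w₂ w₁

-- The identities between theta quotients

integer : ∀ {n} → ℤ → Expr n
integer (+ n)    = con n
integer -[1+ n ] = :- con (suc n)

-- Row a holds the arguments of v₁₁ in the expression for D_C(a, 11).
crankCoefficients : Vec (Vec ℤ 10) 11
crankCoefficients =
  (+ 10 ∷ -[1+ 11 ] ∷ -[1+ 1 ] ∷ + 8 ∷ + 6 ∷ + 4 ∷ -[1+ 3 ] ∷ -[1+ 5 ] ∷ -[1+ 7 ] ∷ + 2 ∷ []) ∷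
  (-[1+ 0 ] ∷ + 10 ∷ -[1+ 1 ] ∷ -[1+ 2 ] ∷ -[1+ 4 ] ∷ + 4 ∷ + 7 ∷ + 5 ∷ + 3 ∷ + 2 ∷ []) ∷
  (-[1+ 0 ] ∷ -[1+ 0 ] ∷ + 9 ∷ -[1+ 2 ] ∷ + 6 ∷ -[1+ 6 ] ∷ -[1+ 3 ] ∷ -[1+ 5 ] ∷ + 3 ∷ + 2 ∷ []) ∷
  (-[1+ 0 ] ∷ -[1+ 0 ] ∷ -[1+ 1 ] ∷ + 8 ∷ -[1+ 4 ] ∷ + 4 ∷ -[1+ 3 ] ∷ + 5 ∷ + 3 ∷ -[1+ 8 ] ∷ []) ∷
  (-[1+ 0 ] ∷ -[1+ 0 ] ∷ -[1+ 1 ] ∷ -[1+ 2 ] ∷ + 6 ∷ -[1+ 6 ] ∷ + 7 ∷ + 5 ∷ -[1+ 7 ] ∷ + 2 ∷ []) ∷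
  (-[1+ 0 ] ∷ -[1+ 0 ] ∷ -[1+ 1 ] ∷ -[1+ 2 ] ∷ -[1+ 4 ] ∷ + 4 ∷ -[1+ 3 ] ∷ -[1+ 5 ] ∷ + 3 ∷ + 2 ∷ []) ∷
  (-[1+ 0 ] ∷ -[1+ 0 ] ∷ -[1+ 1 ] ∷ -[1+ 2 ] ∷ -[1+ 4 ] ∷ + 4 ∷ -[1+ 3 ] ∷ -[1+ 5 ] ∷ + 3 ∷ + 2 ∷ []) ∷
  (-[1+ 0 ] ∷ -[1+ 0 ] ∷ -[1+ 1 ] ∷ -[1+ 2 ] ∷ + 6 ∷ -[1+ 6 ] ∷ + 7 ∷ + 5 ∷ -[1+ 7 ] ∷ + 2 ∷ []) ∷
  (-[1+ 0 ] ∷ -[1+ 0 ] ∷ -[1+ 1 ] ∷ + 8 ∷ -[1+ 4 ] ∷ + 4 ∷ -[1+ 3 ] ∷ + 5 ∷ + 3 ∷ -[1+ 8 ] ∷ []) ∷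
  (-[1+ 0 ] ∷ -[1+ 0 ] ∷ + 9 ∷ -[1+ 2 ] ∷ + 6 ∷ -[1+ 6 ] ∷ -[1+ 3 ] ∷ -[1+ 5 ] ∷ + 3 ∷ + 2 ∷ []) ∷
  (-[1+ 0 ] ∷ + 10 ∷ -[1+ 1 ] ∷ -[1+ 2 ] ∷ -[1+ 4 ] ∷ + 4 ∷ + 7 ∷ + 5 ∷ + 3 ∷ + 2 ∷ []) ∷ []

-- lhs a − rhs a (below) is 11 times the combination of the listed multiples with these coefficients;
-- they were found by linear algebra.
certificates : Vec (Vec ℤ 15) 11
certificates =
  (-[1+ 0 ] ∷ -[1+ 0 ] ∷ -[1+ 1 ] ∷ + 1 ∷ -[1+ 0 ] ∷ + 1 ∷ -[1+ 1 ] ∷ -[1+ 0 ] ∷ + 1 ∷ -[1+ 0 ] ∷ + 1 ∷ -[1+ 0 ] ∷ + 1 ∷ + 1 ∷ + 1 ∷ []) ∷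
  (+ 1 ∷ + 1 ∷ + 2 ∷ -[1+ 0 ] ∷ + 1 ∷ -[1+ 0 ] ∷ + 2 ∷ + 1 ∷ -[1+ 0 ] ∷ + 1 ∷ -[1+ 0 ] ∷ + 1 ∷ -[1+ 0 ] ∷ -[1+ 0 ] ∷ -[1+ 0 ] ∷ []) ∷
  (+ 0 ∷ + 0 ∷ -[1+ 0 ] ∷ -[1+ 0 ] ∷ + 0 ∷ + 0 ∷ -[1+ 0 ] ∷ + 0 ∷ + 0 ∷ + 0 ∷ -[1+ 0 ] ∷ + 0 ∷ + 0 ∷ + 0 ∷ + 0 ∷ []) ∷
  (+ 0 ∷ + 1 ∷ + 0 ∷ + 1 ∷ + 0 ∷ + 0 ∷ + 0 ∷ + 0 ∷ + 0 ∷ + 1 ∷ + 1 ∷ + 0 ∷ + 0 ∷ + 0 ∷ + 0 ∷ []) ∷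
  (+ 0 ∷ -[1+ 0 ] ∷ + 0 ∷ + 0 ∷ + 0 ∷ + 0 ∷ + 0 ∷ + 0 ∷ -[1+ 0 ] ∷ -[1+ 0 ] ∷ + 0 ∷ + 0 ∷ + 0 ∷ + 0 ∷ -[1+ 0 ] ∷ []) ∷
  (+ 0 ∷ + 0 ∷ + 0 ∷ + 0 ∷ + 1 ∷ + 0 ∷ + 0 ∷ + 0 ∷ + 1 ∷ + 0 ∷ + 0 ∷ + 0 ∷ + 0 ∷ -[1+ 0 ] ∷ + 1 ∷ []) ∷
  (+ 0 ∷ + 0 ∷ + 0 ∷ + 0 ∷ + 0 ∷ + 0 ∷ + 0 ∷ + 0 ∷ + 0 ∷ + 0 ∷ + 0 ∷ + 0 ∷ + 0 ∷ + 0 ∷ + 0 ∷ []) ∷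
  (+ 0 ∷ + 0 ∷ + 0 ∷ + 0 ∷ -[1+ 0 ] ∷ + 0 ∷ + 0 ∷ + 0 ∷ -[1+ 0 ] ∷ + 0 ∷ + 0 ∷ + 0 ∷ + 0 ∷ + 1 ∷ -[1+ 0 ] ∷ []) ∷
  (+ 0 ∷ + 1 ∷ + 0 ∷ + 0 ∷ + 0 ∷ + 0 ∷ + 0 ∷ + 0 ∷ + 1 ∷ + 1 ∷ + 0 ∷ + 0 ∷ + 0 ∷ + 0 ∷ + 1 ∷ []) ∷
  (+ 0 ∷ -[1+ 0 ] ∷ + 0 ∷ -[1+ 0 ] ∷ + 0 ∷ + 0 ∷ + 0 ∷ + 0 ∷ + 0 ∷ -[1+ 0 ] ∷ -[1+ 0 ] ∷ + 0 ∷ + 0 ∷ + 0 ∷ + 0 ∷ []) ∷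
  (+ 0 ∷ + 0 ∷ + 1 ∷ + 1 ∷ + 0 ∷ + 0 ∷ + 1 ∷ + 0 ∷ + 0 ∷ + 0 ∷ + 1 ∷ + 0 ∷ + 0 ∷ + 0 ∷ + 0 ∷ []) ∷ []

-- The variables are q, X₁, …, X₅ and the inverses of the latter.
module Variables where
  q x₁ x₂ x₃ x₄ x₅ u₁ u₂ u₃ u₄ u₅ : Expr 11
  q  = var (# 0)
  x₁ = var (# 1)
  x₂ = var (# 2)
  x₃ = var (# 3)
  x₄ = var (# 4)
  x₅ = var (# 5)
  u₁ = var (# 6)
  u₂ = var (# 7)
  u₃ = var (# 8)
  u₄ = var (# 9)
  u₅ = var (# 10)

  basisTerms : Vec (Expr 11) 10
  basisTerms = u₁ ∷ q :^ 1 :* (x₅ :* (u₂ :* u₃)) ∷ q :^ 2 :* (x₃ :* (u₁ :* u₄)) ∷ q :^ 3 :* (x₂ :* (u₁ :* u₃)) ∷ q :^ 4 :* u₂ ∷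
    q :^ 5 :* (x₄ :* (u₂ :* u₅)) ∷ q :^ 7 :* u₃ ∷ q :^ 19 :* (x₁ :* (u₄ :* u₅)) ∷ q :^ 9 :* u₄ ∷ q :^ 10 :* u₅ ∷ []

  combination : ∀ {n} → Vec ℤ n → Vec (Expr 11) n → Expr 11
  combination []       []       = con 0
  combination (c ∷ cs) (t ∷ ts) = integer c :* t :+ combination cs ts

  v : Fin 11 → Expr 11
  v a = combination (lookup crankCoefficients a) basisTerms

  -- The coefficients in Σₙ (−1)ⁿ zⁿ q^{n (n − 1) / 2} of the powers of z modulo z¹¹ = 1.
  ϑ : Vec (Expr 11) 11
  ϑ = x₅ ∷ :- x₅ ∷ q :^ 1 :* x₄ ∷ :- (q :^ 3 :* x₃) ∷ q :^ 6 :* x₂ ∷ :- (q :^ 10 :* x₁) ∷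
      con 0 ∷ q :^ 10 :* x₁ ∷ :- (q :^ 6 :* x₂) ∷ q :^ 3 :* x₃ ∷ :- (q :^ 1 :* x₄) ∷ []

  -- (q; q)_∞ / (q¹²¹; q¹²¹)_∞
  y : Expr 11
  y = q :^ 5 :- q :^ 1 :* (x₂ :* u₁) :+ q :^ 0 :* (x₄ :* u₂) :- q :^ 2 :* (x₅ :* u₃) :+ q :^ 7 :* (x₃ :* u₄) :- q :^ 15 :* (x₁ :* u₅)

  -- Component a of the two sides of ϑ(z) E(z) = (1 - z) (q; q)_∞², after removing J₁₂₁² and
  -- clearing the denominator 11.
  lhs rhs : Fin 11 → Expr 11
  lhs a = foldr (λ i e → lookup ϑ i :* v (a ⊝ i) :+ e) (con 0) (allFin 11)
  rhs a = con 11 :* (y :* y) :* lookup (con 1 ∷ :- con 1 ∷ con 0 ∷ con 0 ∷ con 0 ∷ con 0 ∷ con 0 ∷ con 0 ∷ con 0 ∷ con 0 ∷ con 0 ∷ []) a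

  Relation : Set
  Relation = Expr 11 × Expr 11

  r₄₂₁ r₄₃₂ r₅₄₃ r₅₃₁ r₅₂₁ : Relation
  r₄₂₁ = q :^ 11 :* (x₅ :* x₂ :* x₁ :* x₁) :+ x₄ :* x₄ :* x₃ :* x₁ , x₅ :* x₃ :* x₂ :* x₂
  r₄₃₂ = q :^ 11 :* (x₄ :* x₁ :* x₂ :* x₂) :+ x₄ :* x₄ :* x₅ :* x₁ , x₅ :* x₂ :* x₃ :* x₃
  r₅₄₃ = q :^ 11 :* (x₂ :* x₁ :* x₃ :* x₃) :+ x₅ :* x₅ :* x₄ :* x₁ , x₃ :* x₂ :* x₄ :* x₄
  r₅₃₁ = q :^ 22 :* (x₃ :* x₂ :* x₁ :* x₁) :+ x₅ :* x₅ :* x₄ :* x₂ , x₅ :* x₄ :* x₃ :* x₃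
  r₅₂₁ = q :^ 11 :* (x₄ :* x₃ :* x₁ :* x₁) :+ x₅ :* x₅ :* x₃ :* x₁ , x₅ :* x₄ :* x₂ :* x₂

  -- The relations have degree 4 in the Xᵢ, and each multiplier has degree -4; the terms of `lhs`
  -- and `rhs` are homogeneous of degree 0.
  multiples : List (Expr 11 × Relation)
  multiples =
    (u₁ :* u₂ :^ 2 :* u₃ , r₄₂₁) ∷
    (q :^ 6 :* u₁ :* u₂ :* u₃ :* u₅ , r₄₂₁) ∷
    (q :^ 8 :* u₁ :* u₂ :* u₄ :* u₅ , r₄₂₁) ∷
    (q :^ 2 :* u₁ :* u₂ :* u₃ :* u₄ , r₄₃₂) ∷
    (q :^ 5 :* u₁ :* u₂ :* u₄ :* u₅ , r₄₃₂) ∷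
    (q :^ 14 :* u₂ :* u₄ :^ 2 :* u₅ , r₄₃₂) ∷
    (q :^ 1 :* u₁ :* u₂ :* u₃ :* u₄ , r₅₄₃) ∷
    (q :^ 4 :* u₁ :* u₃ :^ 2 :* u₄ , r₅₄₃) ∷
    (q :^ 11 :* u₂ :* u₃ :* u₄ :* u₅ , r₅₄₃) ∷
    (q :^ 3 :* u₁ :* u₃ :* u₄ :* u₅ , r₅₃₁) ∷
    (q :^ 7 :* u₂ :* u₃ :* u₄ :* u₅ , r₅₃₁) ∷
    (q :^ 8 :* u₂ :* u₃ :* u₅ :^ 2 , r₅₃₁) ∷
    (q :^ 2 :* u₁ :^ 2 :* u₄ :* u₅ , r₅₂₁) ∷
    (q :^ 4 :* u₁ :* u₂ :* u₃ :* u₅ , r₅₂₁) ∷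
    (q :^ 9 :* u₁ :* u₃ :* u₄ :* u₅ , r₅₂₁) ∷ []

  sumUp : ∀ {n} → Vec ℤ n → List (Expr 11 × Relation) → Expr 11
  sumUp []       _                    = con 0
  sumUp (_ ∷ _)  []                   = con 0
  sumUp (c ∷ cs) ((m , (l , r)) ∷ ms) = integer c :* m :* (l :- r) :+ sumUp cs ms

  certificate : Fin 11 → Expr 11
  certificate a = con 11 :* sumUp (lookup certificates a) multiples

-- The normal form modulo xᵢ uᵢ = 1: truncated subtraction leaves the net exponent on whichever of
-- xᵢ and uᵢ prevails.
cancel : Monomial 11 → Monomial 11
cancel (e ∷ a₁ ∷ a₂ ∷ a₃ ∷ a₄ ∷ a₅ ∷ b₁ ∷ b₂ ∷ b₃ ∷ b₄ ∷ b₅ ∷ []) =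
  e ∷ a₁ ∸ b₁ ∷ a₂ ∸ b₂ ∷ a₃ ∸ b₃ ∷ a₄ ∸ b₄ ∷ a₅ ∸ b₅ ∷ b₁ ∸ a₁ ∷ b₂ ∸ a₂ ∷ b₃ ∸ a₃ ∷ b₄ ∸ a₄ ∷ b₅ ∸ a₅ ∷ []

-- Pure computation on syntax, carried out once and independent of the ring in which the expressions
-- are later evaluated.
certificates-valid : ∀ a → T (isZero (normalise cancel (Variables.lhs a :- (Variables.rhs a :+ Variables.certificate a))))
certificates-valid = from-yes (Fin.all? λ a → T? (isZero (normalise cancel (Variables.lhs a :- (Variables.rhs a :+ Variables.certificate a)))))

module CrankIdentity (B : CommutativeRing 0ℓ 0ℓ) where
  open CommutativeRing B
  open Exp semiring using (_^_)

  module Evaluation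
    (q : Carrier) (X U : ℕ → Carrier)
    (XU₁ : X 1 * U 1 ≈ 1#) (XU₂ : X 2 * U 2 ≈ 1#) (XU₃ : X 3 * U 3 ≈ 1#) (XU₄ : X 4 * U 4 ≈ 1#) (XU₅ : X 5 * U 5 ≈ 1#)
    (r₄₂₁ : q ^ 11 * (X 5 * X 2 * X 1 * X 1) + X 4 * X 4 * X 3 * X 1 ≈ X 5 * X 3 * X 2 * X 2)
    (r₄₃₂ : q ^ 11 * (X 4 * X 1 * X 2 * X 2) + X 4 * X 4 * X 5 * X 1 ≈ X 5 * X 2 * X 3 * X 3)
    (r₅₄₃ : q ^ 11 * (X 2 * X 1 * X 3 * X 3) + X 5 * X 5 * X 4 * X 1 ≈ X 3 * X 2 * X 4 * X 4)
    (r₅₃₁ : q ^ 22 * (X 3 * X 2 * X 1 * X 1) + X 5 * X 5 * X 4 * X 2 ≈ X 5 * X 4 * X 3 * X 3)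
    (r₅₂₁ : q ^ 11 * (X 4 * X 3 * X 1 * X 1) + X 5 * X 5 * X 3 * X 1 ≈ X 5 * X 4 * X 2 * X 2) where

    open RingProperties ring using (x≈y⇒x∙y⁻¹≈ε)
    open SetoidReasoning setoid
    open Solver B using (⟦_⟧; ⟦_⟧ᵐ; prove; solve)

    ρ : Vec Carrier 11
    ρ = q ∷ X 1 ∷ X 2 ∷ X 3 ∷ X 4 ∷ X 5 ∷ U 1 ∷ U 2 ∷ U 3 ∷ U 4 ∷ U 5 ∷ []

    private
      power-cancel : ∀ {x u} → x * u ≈ 1# → ∀ a b → x ^ (a ∸ b) * u ^ (b ∸ a) ≈ x ^ a * u ^ b
      power-cancel         xu≈1 zero    zero    = refl
      power-cancel         xu≈1 zero    (suc b) = refl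
      power-cancel         xu≈1 (suc a) zero    = refl
      power-cancel {x} {u} xu≈1 (suc a) (suc b) = begin
        x ^ (a ∸ b) * u ^ (b ∸ a)   ≈⟨ power-cancel xu≈1 a b ⟩
        x ^ a * u ^ b               ≈⟨ *-identityˡ _ ⟨
        1# * (x ^ a * u ^ b)        ≈⟨ *-congʳ xu≈1 ⟨
        x * u * (x ^ a * u ^ b)     ≈⟨ solve 4 (λ x u a b → x :* u :* (a :* b) := x :* a :* (u :* b)) _ _ _ _ ⟩
        x ^ suc a * u ^ suc b       ∎

      group : ∀ e x₁ x₂ x₃ x₄ x₅ u₁ u₂ u₃ u₄ u₅ →
              e * (x₁ * (x₂ * (x₃ * (x₄ * (x₅ * (u₁ * (u₂ * (u₃ * (u₄ * (u₅ * 1#)))))))))) ≈ e * ((x₁ * u₁) * ((x₂ * u₂) * ((x₃ * u₃) * ((x₄ * u₄) * (x₅ * u₅)))))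
      group = solve 11 λ e x₁ x₂ x₃ x₄ x₅ u₁ u₂ u₃ u₄ u₅ →
        e :* (x₁ :* (x₂ :* (x₃ :* (x₄ :* (x₅ :* (u₁ :* (u₂ :* (u₃ :* (u₄ :* (u₅ :* con 1)))))))))) := e :* ((x₁ :* u₁) :* ((x₂ :* u₂) :* ((x₃ :* u₃) :* ((x₄ :* u₄) :* (x₅ :* u₅)))))

      cancel-sound : ∀ m → ⟦ cancel m ⟧ᵐ ρ ≈ ⟦ m ⟧ᵐ ρ
      cancel-sound (e ∷ a₁ ∷ a₂ ∷ a₃ ∷ a₄ ∷ a₅ ∷ b₁ ∷ b₂ ∷ b₃ ∷ b₄ ∷ b₅ ∷ []) = trans (group _ _ _ _ _ _ _ _ _ _ _) (trans
        (*-congˡ (*-cong (power-cancel XU₁ a₁ b₁) (*-cong (power-cancel XU₂ a₂ b₂) (*-cong (power-cancel XU₃ a₃ b₃)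
          (*-cong (power-cancel XU₄ a₄ b₄) (power-cancel XU₅ a₅ b₅))))))
        (sym (group _ _ _ _ _ _ _ _ _ _ _)))

      Holds : Expr 11 × Variables.Relation → Set
      Holds (_ , (l , r)) = ⟦ l ⟧ ρ ≈ ⟦ r ⟧ ρ

      relations : All Holds Variables.multiples
      relations = r₄₂₁ ∷ r₄₂₁ ∷ r₄₂₁ ∷ r₄₃₂ ∷ r₄₃₂ ∷ r₄₃₂ ∷ r₅₄₃ ∷ r₅₄₃ ∷ r₅₄₃ ∷ r₅₃₁ ∷ r₅₃₁ ∷ r₅₃₁ ∷ r₅₂₁ ∷ r₅₂₁ ∷ r₅₂₁ ∷ []

      vanish : ∀ {n} (cs : Vec ℤ n) {ms} → All Holds ms → ⟦ Variables.sumUp cs ms ⟧ ρ ≈ 0#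
      vanish []       {[]}                   []          = refl
      vanish []       {_ ∷ _}                (_ ∷ _)     = refl
      vanish (_ ∷ _)  {[]}                   []          = refl
      vanish (c ∷ cs) {(m , (l , r)) ∷ ms}   (l≈r ∷ ls)  = trans
        (+-cong (*-congˡ (x≈y⇒x∙y⁻¹≈ε l≈r)) (vanish cs ls)) (trans (+-identityʳ _) (zeroʳ _))

    crank-identity : ∀ a → ⟦ Variables.lhs a ⟧ ρ ≈ ⟦ Variables.rhs a ⟧ ρ
    crank-identity a = begin
      ⟦ Variables.lhs a ⟧ ρ
        ≈⟨ prove cancel ρ cancel-sound (Variables.lhs a) (Variables.rhs a :+ Variables.certificate a) (certificates-valid a) ⟩
      ⟦ Variables.rhs a ⟧ ρ + ⟦ Variables.certificate a ⟧ ρ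
        ≈⟨ +-congˡ (trans (*-congˡ (vanish (lookup certificates a) relations)) (zeroʳ _)) ⟩
      ⟦ Variables.rhs a ⟧ ρ + 0#
        ≈⟨ +-identityʳ _ ⟩
      ⟦ Variables.rhs a ⟧ ρ ∎

-- The dissection of the crank generating function

-- For odd p = 2h + 1 the shift by h turns the linear coefficient into p r, so the class of r is
-- again a theta series, with base q^(p²).
triangular-exponent : ∀ h r l {p} → p ≡ + 2 ℤ.* h ℤ.+ 1ℤ →
  tri (p ℤ.* l ℤ.+ (r ℤ.- h)) ≡ tri (r ℤ.- h) ℤ.+ (p ℤ.* p ℤ.* tri l ℤ.+ p ℤ.* r ℤ.* l)
triangular-exponent h r l {p} ≡.refl = by-tri ((1ℤ , x) ∷ (ℤ.- 1ℤ , y) ∷ (ℤ.- (p ℤ.* p) , l) ∷ [])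
  (ℤ-Solver.solve 6 (λ h r l t₁ t₂ t₃ →
    let p = con 2 :* h :+ con 1 ; x = p :* l :+ (r :- h) ; y = r :- h
        R = t₂ :+ (p :* p :* t₃ :+ p :* r :* l)
        d = λ t x → (t :+ t) :- (x :* x :- x)
    in t₁ :+ t₁ := (R :+ R) :+ (con 1 :* d t₁ x :+ (:- con 1 :* d t₂ y :+ (:- (p :* p) :* d t₃ l :+ con 0))))
    h r l (tri x) (tri y) (tri l))
  where
  x = p ℤ.* l ℤ.+ (r ℤ.- h)
  y = r ℤ.- h

infixr 5 _◂_

_◂_ : ∀ {n} {P : Fin (suc n) → Set} → P Fin.zero → (∀ i → P (Fin.suc i)) → ∀ i → P i
_◂_ = Fin.∀-cons

module ThetaParts (B : CommutativeRing 0ℓ 0ℓ)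
                  (q : CommutativeRing.Carrier B) (N : ℕ) (q^N≈0 : PowerVanishes B q N) where
  open CommutativeRing B
  open Nilpotent B q N q^N≈0
  open Theta B q N q^N≈0
  open Powers B

  -- As a whole the series `θ 0 1` sums to zero. Its separate classes are what is needed: for p = 11
  -- they are Xₛ up to sign and a power of q.
  θ-part : (p : ℕ) .{{_ : NonZero p}} (h : ℤ) → Fin p → Family ℤ
  θ-part p h = pull (Residue.residue-split p h) (θ 0 1 (s≤s z≤n))

  θ-part-value : ∀ (p : ℕ) .{{_ : NonZero p}} (h : ℤ) s {c d} 1≤c+d → + p ≡ + 2 ℤ.* h ℤ.+ 1ℤ → c ≡ p ℕ.* toℕ s → + (c ℕ.+ d) ≡ + p ℤ.* + p →
                 total (θ-part p h s) ≈ ε (+ toℕ s ℤ.- h) * qᶻ (tri (+ toℕ s ℤ.- h)) * total (θ c d 1≤c+d)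
  θ-part-value p h s {c} {d} 1≤c+d p≡ c≡ c+d≡ = trans
    (total-cong (θ-part p h s) (scale (ε r) (tri r) (tri≥0 r) (θ c d 1≤c+d)) sign expo)
    (total-scale (ε r) (tri r) (tri≥0 r) (θ c d 1≤c+d))
    where
    r = + toℕ s ℤ.- h
    sign : ∀ l → ε (+ p ℤ.* l ℤ.+ r) ≈ ε r * ε l
    sign l = trans (ε-parity {j = r ℤ.+ l} (h ℤ.* l)
      (≡.trans (≡.cong (λ p → p ℤ.* l ℤ.+ r) p≡)
        (ℤ-Solver.solve 3 (λ h l r → (con 2 :* h :+ con 1) :* l :+ r := r :+ l :+ (h :* l :+ h :* l)) h l r)))
      (ε-+ r l)
    expo : ∀ l → θ-expo 0 1 (+ p ℤ.* l ℤ.+ r) ≡ tri r ℤ.+ θ-expo c d l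
    expo l = ≡.trans (≡.trans (≡.cong₂ ℤ._+_ (ℤ.*-zeroˡ (tri (1ℤ ℤ.+ x))) (ℤ.*-identityˡ (tri x))) (ℤ.+-identityˡ (tri x)))
      (≡.trans (triangular-exponent h (+ toℕ s) l p≡)
        (≡.cong (λ e → tri r ℤ.+ e) (≡.sym (≡.trans (θ-expo-formula c d l)
          (≡.cong₂ (λ m c → m ℤ.* tri l ℤ.+ c ℤ.* l) c+d≡ (≡.trans (≡.cong +_ c≡) (ℤ.pos-* p (toℕ s))))))))
      where x = + p ℤ.* l ℤ.+ r

⊝-basis : ∀ b c a → does (a ⊝ b Fin.≟ c) ≡ does (a Fin.≟ c ⊝ (Fin.zero ⊝ b))
⊝-basis = from-yes (Fin.all? λ b → Fin.all? λ c → Fin.all? λ a → does (a ⊝ b Fin.≟ c) Bool.≟ does (a Fin.≟ c ⊝ (Fin.zero ⊝ b)))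

⊝-select : ∀ a s → does (a ⊝ (s ⊝ # 5) Fin.≟ Fin.zero) ≡ does (s Fin.≟ a ⊝ # 6)
⊝-select = from-yes (Fin.all? λ a → Fin.all? λ s → does (a ⊝ (s ⊝ # 5) Fin.≟ Fin.zero) Bool.≟ does (s Fin.≟ a ⊝ # 6))

-- Residues obtained by repeatedly adding 1 or 10, parallel to the recursion of powers, so that `z^`
-- and `w^` are immediate inductions.
class⁺ class⁻ : ℕ → Fin 11
class⁺ zero    = Fin.zero
class⁺ (suc n) = class⁺ n ⊝ (Fin.zero ⊝ # 1)
class⁻ zero    = Fin.zero
class⁻ (suc n) = class⁻ n ⊝ (Fin.zero ⊝ # 10)

class : ℤ → Fin 11
class (+ n)    = class⁺ n
class -[1+ n ] = class⁻ (suc n)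

class-toℕ : ∀ s → class (+ toℕ s) ≡ s
class-toℕ = from-yes (Fin.all? λ s → class (+ toℕ s) Fin.≟ s)

class-shift : ∀ s → class (+ toℕ s ℤ.- + 5) ≡ s ⊝ # 5
class-shift = from-yes (Fin.all? λ s → class (+ toℕ s ℤ.- + 5) Fin.≟ s ⊝ # 5)

-- The generic eleventh root of unity in the group ring

module RootOfUnity (R : CommutativeRing 0ℓ 0ℓ) where
  open CommutativeRing R
  open GroupRing R
  open Exp semiring using (_^_)
  open Products R using (prod)
  private
    module A = CommutativeRing groupRing
    module AE = Exp A.semiring

  z w : Fin 11 → Carrier
  z = basis (# 1)
  w = basis (# 10)

  basis-mul : ∀ b c → basis b A.* basis c A.≈ basis (c ⊝ (Fin.zero ⊝ b))
  basis-mul b c = mk≋ λ a → trans (basis-* b (basis c) a) (reflexive (≡.cong (if_then 1# else 0#) (⊝-basis b c a)))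

  zw≈1 : z A.* w A.≈ A.1#
  zw≈1 = basis-mul (# 1) (# 10)

  open Powers.Unit groupRing z w zw≈1 public

  z^ : ∀ n → z AE.^ n A.≈ basis (class⁺ n)
  z^ zero    = A.refl
  z^ (suc n) = A.trans (A.*-congˡ {z} (z^ n)) (basis-mul (# 1) (class⁺ n))

  w^ : ∀ n → w AE.^ n A.≈ basis (class⁻ n)
  w^ zero    = A.refl
  w^ (suc n) = A.trans (A.*-congˡ {w} (w^ n)) (basis-mul (# 10) (class⁻ n))

  pow-class : ∀ k → pow k A.≈ basis (class k)
  pow-class (+ n)    = z^ n
  pow-class -[1+ n ] = w^ (suc n)

  private
    pow-11⁺ : ∀ n → pow (+ 11 ℤ.* + n) A.≈ A.1#
    pow-11⁺ zero    = A.refl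
    pow-11⁺ (suc n) = A.trans (A.reflexive (≡.cong pow (ℤ.*-suc (+ 11) (+ n))))
      (A.trans (pow-+ (+ 11) (+ 11 ℤ.* + n)) (A.trans (A.*-cong (z^ 11) (pow-11⁺ n)) (A.*-identityˡ A.1#)))

    pow-11 : ∀ l → pow (+ 11 ℤ.* l) A.≈ A.1#
    pow-11 (+ n)    = pow-11⁺ n
    pow-11 -[1+ n ] = A.trans (A.sym (A.*-identityʳ (pow (+ 11 ℤ.* -[1+ n ]))))
      (A.trans (A.*-congˡ {pow (+ 11 ℤ.* -[1+ n ])} (A.sym (pow-11⁺ (suc n))))
        (A.trans (A.sym (pow-+ (+ 11 ℤ.* -[1+ n ]) (+ 11 ℤ.* + suc n)))
          (A.reflexive (≡.cong pow (≡.trans (≡.sym (ℤ.*-distribˡ-+ (+ 11) -[1+ n ] (+ suc n))) (≡.trans (≡.cong (+ 11 ℤ.*_) (ℤ.+-inverseˡ (+ suc n))) (ℤ.*-zeroʳ (+ 11))))))))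

  pow-residue : ∀ l k → pow (+ 11 ℤ.* l ℤ.+ k) A.≈ basis (class k)
  pow-residue l k = A.trans (pow-+ (+ 11 ℤ.* l) k) (A.trans (A.*-cong (pow-11 l) (pow-class k)) (A.*-identityˡ (basis (class k))))

  scalar-cong : ∀ {c d} → c ≈ d → scalar c A.≈ scalar d
  scalar-cong c≈d = mk≋ λ a → *-congʳ c≈d

  scalar-mul : ∀ c d → scalar c A.* scalar d A.≈ scalar (c * d)
  scalar-mul c d = mk≋ λ a → trans (scalar-* c (scalar d) a) (sym (*-assoc _ _ _))

  scalar-1 : scalar 1# A.≈ A.1#
  scalar-1 = mk≋ λ a → *-identityˡ _

  scalar-0 : scalar 0# A.≈ A.0#
  scalar-0 = mk≋ λ a → zeroˡ _

  scalar-neg : ∀ c → scalar (- c) A.≈ A.- scalar c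
  scalar-neg c = mk≋ λ a → sym (RingProperties.-‿distribˡ-* ring c (basis Fin.zero a))

  scalar-+ : ∀ c d → scalar (c + d) A.≈ scalar c A.+ scalar d
  scalar-+ c d = mk≋ λ a → distribʳ _ _ _

  scalar-^ : ∀ c n → scalar c AE.^ n A.≈ scalar (c ^ n)
  scalar-^ c zero    = A.sym scalar-1
  scalar-^ c (suc n) = A.trans (A.*-congˡ {scalar c} (scalar-^ c n)) (scalar-mul c (c ^ n))

  scalar-prod : ∀ f g n → (∀ i → g i A.≈ scalar (f i)) → Products.prod groupRing g n A.≈ scalar (prod f n)
  scalar-prod f g zero    eq = A.sym scalar-1
  scalar-prod f g (suc n) eq = A.trans (A.*-cong (scalar-prod f g n eq) (eq n)) (scalar-mul (prod f n) (f n))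

  ε-scalar : ∀ k → Powers.ε groupRing k A.≈ scalar (Powers.ε R k)
  ε-scalar k = powers k
    where
    -1-scalar : A.- A.1# A.≈ scalar (- 1#)
    -1-scalar = A.trans (A.-‿cong (A.sym scalar-1)) (A.sym (scalar-neg 1#))
    power : ∀ n → (A.- A.1#) AE.^ n A.≈ scalar ((- 1#) ^ n)
    power n = A.trans (Exp.^-congˡ A.semiring n -1-scalar) (scalar-^ (- 1#) n)
    powers : ∀ k → Powers.ε groupRing k A.≈ scalar (Powers.ε R k)
    powers (+ n)    = power n
    powers -[1+ n ] = power (suc n)

module CrankTheorem
  (R : CommutativeRing 0ℓ 0ℓ)
  (q : CommutativeRing.Carrier R) (N : ℕ) (q^N≈0 : PowerVanishes R q N) where
  open CommutativeRing R
  open Exp semiring using (_^_)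

  open SetoidReasoning setoid
  open Solver R using (solve; ⟦_⟧; prove)
  open Nilpotent R q N q^N≈0
  open Theta R q N q^N≈0
  open ThetaProducts R q N q^N≈0
  open ThetaParts R q N q^N≈0
  open Products R using (prod; prod-cong)
  open Powers R using (ε)
  open GroupRing R
  open RootOfUnity R public

  private
    module A = CommutativeRing groupRing
    module AE = Exp A.semiring
    module AS = Sums groupRing
    module ASolver = Solver groupRing

  Q : Fin 11 → Carrier
  Q = scalar q

  Q^N≈0 : Q AE.^ N A.≈ A.0#
  Q^N≈0 = A.trans (scalar-^ q N) (A.trans (scalar-cong q^N≈0) scalar-0)

  AS-component : ∀ {I : Set} (f : I → Fin 11 → Carrier) xs a → AS.sumOver f xs a ≡ sumOver (λ i → f i a) xs
  AS-component f []       a = ≡.refl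
  AS-component f (x ∷ xs) a = ≡.cong (λ s → f x a + s) (AS-component f xs a)

  private
    module JTP = JacobiTripleProduct groupRing Q N Q^N≈0 z w zw≈1 0 1 (s≤s z≤n)
    module AN = Nilpotent groupRing Q N Q^N≈0
    module CA = CrankAlgebra groupRing Q N Q^N≈0 z w zw≈1
    module AP = Products groupRing
    module QP = AP.QPochhammer Q N Q^N≈0

    ⟨Q⟩ ⟨Q⟩⁻¹ : Fin 11 → Carrier
    ⟨Q⟩   = QP.⟨Q⟩ N
    ⟨Q⟩⁻¹ = QP.⟨Q⟩⁻¹ N

    θz : Fin 11 → Carrier
    θz = AN.total JTP.θ-family

    -- The triple product with α = z, c = 0, d = 1. Splitting 1 - z off (z; q)_∞ leaves one factor
    -- too few in a product of length N, hence the passage through length N + 1, whose last factor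
    -- is 1.
    θz-product : θz A.≈ (A.1# A.- z) A.* (CA.Z N A.* CA.W N) A.* ⟨Q⟩
    θz-product = A.trans (A.sym JTP.triple-product) (A.trans
      (A.*-cong {AP.prod f N A.* AP.prod g N} {(A.1# A.- z) A.* CA.Z N A.* CA.W N} {AP.prod h N} {⟨Q⟩}
        (A.*-cong {AP.prod f N} {(A.1# A.- z) A.* CA.Z N} {AP.prod g N} {CA.W N} first (AP.prod-cong N wQ)) (AP.prod-cong N λ i → A.+-congˡ {A.1#} (A.-‿cong (Q¹ (suc i)))))
      (ASolver.solve 4 (λ a b c d → a :* b :* c :* d := a :* (b :* c) :* d) (A.1# A.- z) (CA.Z N) (CA.W N) ⟨Q⟩))
      where
      f = λ i → A.1# A.- z A.* Q AE.^ 0 A.* (Q AE.^ 1) AE.^ i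
      g = λ i → A.1# A.- w A.* Q AE.^ 1 A.* (Q AE.^ 1) AE.^ i
      h = λ i → A.1# A.- (Q AE.^ 1) AE.^ suc i
      Q¹ : ∀ i → (Q AE.^ 1) AE.^ i A.≈ Q AE.^ i
      Q¹ i = Exp.^-congˡ A.semiring i (A.*-identityʳ Q)
      z-stable : AP.prod f (suc N) A.≈ AP.prod f N
      z-stable = AP.prod-stable f (ℕ.n≤1+n N) λ i N≤i → A.trans
        (A.+-congˡ {A.1#} (A.-‿cong (A.*-congˡ {z A.* Q AE.^ 0} (A.trans (Q¹ i) (AN.q^≥N N≤i)))))
        (ASolver.solve 1 (λ x → con 1 :- x :* con 0 := con 1) (z A.* Q AE.^ 0))
      zQ : ∀ x i → A.1# A.- x A.* Q AE.^ 0 A.* (Q AE.^ 1) AE.^ suc i A.≈ A.1# A.- x A.* Q AE.^ suc i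
      zQ x i = A.+-congˡ {A.1#} (A.-‿cong (A.*-cong (A.*-identityʳ x) (Q¹ (suc i))))
      first : AP.prod f N A.≈ (A.1# A.- z) A.* CA.Z N
      first = A.trans (A.sym z-stable) (A.trans (AP.prod-first f N)
        (A.*-cong {f 0} {A.1# A.- z} {AP.prod (f ∘ suc) N} {CA.Z N}
          (ASolver.solve 1 (λ z → con 1 :- z :* con 1 :* con 1 := con 1 :- z) z) (AP.prod-cong N (zQ z))))
      wQ : ∀ i → A.1# A.- w A.* Q AE.^ 1 A.* (Q AE.^ 1) AE.^ i A.≈ A.1# A.- w A.* Q AE.^ suc i
      wQ i = A.+-congˡ {A.1#} (A.-‿cong (A.trans (A.*-assoc w (Q AE.^ 1) ((Q AE.^ 1) AE.^ i))
               (A.*-congˡ {w} (A.*-cong (A.*-identityʳ Q) (Q¹ i)))))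

    parts : Split 11 ℤ ℤ
    parts = Residue.residue-split 11 (+ 5)

    part : Fin 11 → Carrier
    part s = total (θ-part 11 (+ 5) s)

    AS-scalar : ∀ {I : Set} (f : I → Carrier) xs → AS.sumOver (scalar ∘ f) xs A.≈ scalar (sumOver f xs)
    AS-scalar f []       = A.sym scalar-0
    AS-scalar f (x ∷ xs) = A.trans (A.+-congˡ {scalar (f x)} (AS-scalar f xs)) (A.sym (scalar-+ (f x) (sumOver f xs)))

    -- On the class k ≡ s - 5 the power z^k is a fixed basis element and factors out.
    θz-part : ∀ s → AN.total (AN.pull parts JTP.θ-family s) A.≈ basis (s ⊝ # 5) A.* scalar (part s)
    θz-part s = A.trans (AS.sumOver-cong F.support term≈)
      (A.trans (AS.sumOver-*ˡ (basis (s ⊝ # 5)) (scalar ∘ H.term) F.support) (A.*-congˡ {basis (s ⊝ # 5)} (A.trans (AS-scalar H.term F.support)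
        (scalar-cong (sumOver-unique H.term F.unique H.unique (λ {l} _ → H.supported l) (λ {l} _ → active l))))))
      where
      module F = AN.Family (AN.pull parts JTP.θ-family s)
      module H = Family (θ-part 11 (+ 5) s)
      k : ℤ → ℤ
      k = Split.join parts s
      term≈ : ∀ l → F.term l A.≈ basis (s ⊝ # 5) A.* scalar (H.term l)
      term≈ l = A.trans (A.*-cong (A.*-cong (ε-scalar (k l)) (A.trans (pow-residue l (+ toℕ s ℤ.- + 5)) (A.reflexive (≡.cong basis (class-shift s)))))
                                  (scalar-^ q ∣ θ-expo 0 1 (k l) ∣))
        (A.trans (ASolver.solve 3 (λ e b x → e :* b :* x := b :* (e :* x)) (scalar (ε (k l))) (basis (s ⊝ # 5)) (scalar (qᶻ (θ-expo 0 1 (k l)))))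
          (A.*-congˡ {basis (s ⊝ # 5)} (scalar-mul (ε (k l)) (qᶻ (θ-expo 0 1 (k l))))))
      active : ∀ l → l ∈ F.support ⊎ H.term l ≈ 0#
      active l = decide (∣ θ-expo 0 1 (k l) ∣ ℕ.<? N)
        where
        decide : Dec (∣ θ-expo 0 1 (k l) ∣ ℕ.< N) → l ∈ F.support ⊎ H.term l ≈ 0#
        decide (yes e<N) = inj₁ (F.covers l e<N)
        decide (no  e≮N) = inj₂ (trans (*-congˡ (q^≥N (ℕ.≮⇒≥ e≮N))) (zeroʳ _))

    -- The class contributing to component a has s - 5 ≡ a, that is s ≡ a + 5 ≡ a - 6 modulo 11.
    θz-component : ∀ a → θz a ≈ part (a ⊝ # 6)
    θz-component a = begin
      θz a
        ≈⟨ component (A.trans (AN.total-split parts JTP.θ-family) (AS.sumOver-cong (allFin 11) θz-part)) a ⟩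
      AS.sumOver (λ s → basis (s ⊝ # 5) A.* scalar (part s)) (allFin 11) a
        ≡⟨ ≡.cong (λ xs → AS.sumOver (λ s → basis (s ⊝ # 5) A.* scalar (part s)) xs a) (≡.sym residues-≡) ⟩
      AS.sumOver (λ s → basis (s ⊝ # 5) A.* scalar (part s)) residues a
        ≡⟨ AS-component (λ s → basis (s ⊝ # 5) A.* scalar (part s)) residues a ⟩
      sumOver (λ s → (basis (s ⊝ # 5) A.* scalar (part s)) a) residues
        ≈⟨ sumOver-cong residues (λ s → trans (basis-* (s ⊝ # 5) (scalar (part s)) a)
             (*-congˡ (reflexive (≡.cong (if_then 1# else 0#) (⊝-select a s))))) ⟩
      sumOver t residues
        ≈⟨ sumOver-unique t residues-unique ([] ∷ []) (λ {s} _ → only s (s Fin.≟ a ⊝ # 6)) (λ _ → inj₁ (∈-residues _)) ⟩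
      part (a ⊝ # 6) * basis (a ⊝ # 6) (a ⊝ # 6) + 0#
        ≈⟨ trans (+-identityʳ _) (trans (*-congˡ (reflexive (basis-≡ (a ⊝ # 6)))) (*-identityʳ _)) ⟩
      part (a ⊝ # 6) ∎
      where
      t : Fin 11 → Carrier
      t s = part s * basis (a ⊝ # 6) s
      only : ∀ s → Dec (s ≡ a ⊝ # 6) → s ∈ (a ⊝ # 6) ∷ [] ⊎ t s ≈ 0#
      only s (yes s≡) = inj₁ (here s≡)
      only s (no  s≢) = inj₂ (trans (*-congˡ (reflexive (basis-≢ s≢))) (zeroʳ _))

  open CrankGeneratingFunction groupRing Q N Q^N≈0 z w zw≈1 public using (crankSeries; crankTerm)
  open CrankGeneratingFunction groupRing Q N Q^N≈0 z w zw≈1 using (crank-generating-function)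

  module Dissection
    (X U : ℕ → Carrier)
    (X-θ : ∀ i {c d} → c ≡ 11 ℕ.* i → c ℕ.+ d ≡ 121 → ∀ p → X i ≈ total (θ c d p))
    (X-sym : ∀ i j → i ℕ.+ j ≡ 11 → X i ≈ X j)
    (XU₁ : X 1 * U 1 ≈ 1#) (XU₂ : X 2 * U 2 ≈ 1#) (XU₃ : X 3 * U 3 ≈ 1#) (XU₄ : X 4 * U 4 ≈ 1#) (XU₅ : X 5 * U 5 ≈ 1#)
    (r₄₂₁ : q ^ 11 * (X 5 * X 2 * X 1 * X 1) + X 4 * X 4 * X 3 * X 1 ≈ X 5 * X 3 * X 2 * X 2)
    (r₄₃₂ : q ^ 11 * (X 4 * X 1 * X 2 * X 2) + X 4 * X 4 * X 5 * X 1 ≈ X 5 * X 2 * X 3 * X 3)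
    (r₅₄₃ : q ^ 11 * (X 2 * X 1 * X 3 * X 3) + X 5 * X 5 * X 4 * X 1 ≈ X 3 * X 2 * X 4 * X 4)
    (r₅₃₁ : q ^ 22 * (X 3 * X 2 * X 1 * X 1) + X 5 * X 5 * X 4 * X 2 ≈ X 5 * X 4 * X 3 * X 3)
    (r₅₂₁ : q ^ 11 * (X 4 * X 3 * X 1 * X 1) + X 5 * X 5 * X 3 * X 1 ≈ X 5 * X 4 * X 2 * X 2)
    (e : Carrier) (e-inverse : ⟦ con 11 ⟧ [] * e ≈ 1#)
    where

    open Eleven X U X-θ X-sym using (Y; pochhammer-dissection)
    open CrankIdentity.Evaluation R q X U XU₁ XU₂ XU₃ XU₄ XU₅ r₄₂₁ r₄₃₂ r₅₄₃ r₅₃₁ r₅₂₁ public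

    J² : Carrier
    J² = pochhammer 121 121 * pochhammer 121 121

    V : Fin 11 → Carrier
    V a = ⟦ Variables.v a ⟧ ρ

    private
      J₁ : Carrier
      J₁ = pochhammer 1 1

      C E D : Fin 11 → Carrier
      C = crankSeries
      E a = e * J² * V a
      D = C A.- E

      part-value : ∀ i j s k {c d} → i ≡ toℕ s → X i ≈ X j → ∣ tri (+ toℕ s ℤ.- + 5) ∣ ≡ k → c ≡ 11 ℕ.* i → c ℕ.+ d ≡ 121 → 1 ℕ.≤ c ℕ.+ d →
                   part s ≈ ε (+ toℕ s ℤ.- + 5) * q ^ k * X j
      part-value i j s k ≡.refl X≈ ≡.refl c≡ c+d≡ p = trans
        (θ-part-value 11 (+ 5) s p ≡.refl c≡ (≡.cong +_ c+d≡))
        (*-congˡ (trans (sym (X-θ i c≡ c+d≡ p)) X≈))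

      p₁₂₁ : 1 ℕ.≤ 121
      p₁₂₁ = s≤s z≤n

      θz-value : ∀ a → θz a ≈ ⟦ lookup Variables.ϑ a ⟧ ρ
      θz-value a = trans (θz-component a) (value a)
        where
        value : ∀ a → part (a ⊝ # 6) ≈ ⟦ lookup Variables.ϑ a ⟧ ρ
        value =
            trans (part-value 5 5 (# 5) 0 ≡.refl refl ≡.refl ≡.refl ≡.refl p₁₂₁) (solve 2 (λ q x → con 1 :* con 1 :* x := x) q (X 5))
          ◂ trans (part-value 6 5 (# 6) 0 ≡.refl (X-sym 6 5 ≡.refl) ≡.refl ≡.refl ≡.refl p₁₂₁) (solve 1 (λ x → (:- con 1) :^ 1 :* con 1 :* x := :- x) (X 5))
          ◂ trans (part-value 7 4 (# 7) 1 ≡.refl (X-sym 7 4 ≡.refl) ≡.refl ≡.refl ≡.refl p₁₂₁) (solve 2 (λ q x → (:- con 1) :^ 2 :* q :^ 1 :* x := q :^ 1 :* x) q (X 4))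
          ◂ trans (part-value 8 3 (# 8) 3 ≡.refl (X-sym 8 3 ≡.refl) ≡.refl ≡.refl ≡.refl p₁₂₁) (solve 2 (λ q x → (:- con 1) :^ 3 :* q :^ 3 :* x := :- (q :^ 3 :* x)) q (X 3))
          ◂ trans (part-value 9 2 (# 9) 6 ≡.refl (X-sym 9 2 ≡.refl) ≡.refl ≡.refl ≡.refl p₁₂₁) (solve 2 (λ q x → (:- con 1) :^ 4 :* q :^ 6 :* x := q :^ 6 :* x) q (X 2))
          ◂ trans (part-value 10 1 (# 10) 10 ≡.refl (X-sym 10 1 ≡.refl) ≡.refl ≡.refl ≡.refl p₁₂₁) (solve 2 (λ q x → (:- con 1) :^ 5 :* q :^ 10 :* x := :- (q :^ 10 :* x)) q (X 1))
          -- Component 6 comes from the class s = 0, whose theta product contains the factor 1 - q⁰.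
          ◂ trans (θ-part-value 11 (+ 5) (# 0) {0} {121} p₁₂₁ ≡.refl ≡.refl ≡.refl) (trans (*-congˡ (θ-0 121 p₁₂₁)) (zeroʳ _))
          ◂ trans (part-value 1 1 (# 1) 10 ≡.refl refl ≡.refl ≡.refl ≡.refl p₁₂₁) (solve 2 (λ q x → (:- con 1) :^ 4 :* q :^ 10 :* x := q :^ 10 :* x) q (X 1))
          ◂ trans (part-value 2 2 (# 2) 6 ≡.refl refl ≡.refl ≡.refl ≡.refl p₁₂₁) (solve 2 (λ q x → (:- con 1) :^ 3 :* q :^ 6 :* x := :- (q :^ 6 :* x)) q (X 2))
          ◂ trans (part-value 3 3 (# 3) 3 ≡.refl refl ≡.refl ≡.refl ≡.refl p₁₂₁) (solve 2 (λ q x → (:- con 1) :^ 2 :* q :^ 3 :* x := q :^ 3 :* x) q (X 3))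
          ◂ trans (part-value 4 4 (# 4) 1 ≡.refl refl ≡.refl ≡.refl ≡.refl p₁₂₁) (solve 2 (λ q x → (:- con 1) :^ 1 :* q :^ 1 :* x := :- (q :^ 1 :* x)) q (X 4))
          ◂ λ ()

      δ : Fin 11 → Carrier
      δ = A.1# A.- z

      δ-value : ∀ a → ⟦ lookup (con 1 ∷ :- con 1 ∷ con 0 ∷ con 0 ∷ con 0 ∷ con 0 ∷ con 0 ∷ con 0 ∷ con 0 ∷ con 0 ∷ con 0 ∷ []) a ⟧ ρ ≈ δ a
      δ-value = solve 0 (con 1 := con 1 :- con 0) ◂ solve 0 (:- con 1 := con 0 :- con 1)
        ◂ z₀ ◂ z₀ ◂ z₀ ◂ z₀ ◂ z₀ ◂ z₀ ◂ z₀ ◂ z₀ ◂ z₀ ◂ λ ()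
        where z₀ = solve 0 (con 0 := con 0 :- con 0)

      θE : ∀ a → (θz A.* E) a ≈ J₁ * J₁ * δ a
      θE a = begin
        sumOver (λ i → θz i * (e * J² * V (a ⊝ i))) residues
          ≈⟨ sumOver-cong residues (λ i → trans (*-congʳ (θz-value i)) (solve 3 (λ t c v → t :* (c :* v) := c :* (t :* v)) _ _ _)) ⟩
        sumOver (λ i → e * J² * (⟦ lookup Variables.ϑ i ⟧ ρ * V (a ⊝ i))) residues
          ≈⟨ sumOver-*ˡ (e * J²) _ residues ⟩
        e * J² * sumOver (λ i → ⟦ lookup Variables.ϑ i ⟧ ρ * V (a ⊝ i)) residues
          ≡⟨ ≡.cong (λ xs → e * J² * sumOver (λ i → ⟦ lookup Variables.ϑ i ⟧ ρ * V (a ⊝ i)) xs) residues-≡ ⟩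
        e * J² * ⟦ Variables.lhs a ⟧ ρ
          ≈⟨ *-congˡ (crank-identity a) ⟩
        e * J² * (⟦ con 11 ⟧ [] * (Y * Y) * ⟦ lookup (con 1 ∷ :- con 1 ∷ con 0 ∷ con 0 ∷ con 0 ∷ con 0 ∷ con 0 ∷ con 0 ∷ con 0 ∷ con 0 ∷ con 0 ∷ []) a ⟧ ρ)
          ≈⟨ *-congˡ (*-congˡ (δ-value a)) ⟩
        e * J² * (⟦ con 11 ⟧ [] * (Y * Y) * δ a)
          ≈⟨ solve 5 (λ e j n y d → e :* (j :* j) :* (n :* (y :* y) :* d) := n :* e :* (j :* y :* (j :* y)) :* d) _ _ _ _ _ ⟩
        ⟦ con 11 ⟧ [] * e * (pochhammer 121 121 * Y * (pochhammer 121 121 * Y)) * δ a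
          ≈⟨ *-congʳ (trans (*-cong e-inverse (*-cong (sym J₁≈) (sym J₁≈))) (*-identityˡ _)) ⟩
        J₁ * J₁ * δ a ∎
        where
        J₁≈ : J₁ ≈ pochhammer 121 121 * Y
        J₁≈ = pochhammer-dissection XU₁ XU₂ XU₃ XU₄ XU₅

      ⟨Q⟩-scalar : ⟨Q⟩ A.≈ scalar J₁
      ⟨Q⟩-scalar = scalar-prod (λ i → 1# - q ^ (1 ℕ.+ 1 ℕ.* i)) QP.factor N λ i → A.sym (A.trans
        (scalar-+ 1# (- q ^ (1 ℕ.+ 1 ℕ.* i)))
        (A.+-cong scalar-1 (A.trans (scalar-neg (q ^ (1 ℕ.+ 1 ℕ.* i))) (A.-‿cong (A.trans (A.sym (scalar-^ q (1 ℕ.+ 1 ℕ.* i)))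
          (A.reflexive (≡.cong (λ k → Q AE.^ suc k) (ℕ.*-identityˡ i))))))))

      θE′ : θz A.* E A.≈ δ A.* (⟨Q⟩ A.* ⟨Q⟩)
      θE′ = mk≋ λ a → trans (θE a) (sym (trans
        (component (A.trans (A.*-comm δ (⟨Q⟩ A.* ⟨Q⟩)) (A.*-congʳ {δ} (A.trans (A.*-cong ⟨Q⟩-scalar ⟨Q⟩-scalar) (scalar-mul J₁ J₁)))) a)
        (scalar-* (J₁ * J₁) δ a)))

      θC : θz A.* C A.≈ δ A.* (⟨Q⟩ A.* ⟨Q⟩)
      θC = A.trans (A.*-congʳ {C} θz-product)
        (A.trans (ASolver.solve 4 (λ d zw Q C → d :* zw :* Q :* C := d :* (C :* zw :* Q)) δ (CA.Z N A.* CA.W N) ⟨Q⟩ C)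
          (A.*-congˡ {δ} (A.*-congʳ {⟨Q⟩} crank-generating-function)))

      -- ϑ(z) cannot be cancelled from ϑ(z) D = 0, as it contains the factor 1 - z. Multiplying by C
      -- instead turns ϑ(z) C into (1 - z) (q; q)_∞², and only the invertible (q; q)_∞² has to be
      -- removed.
      δD : δ A.* D A.≈ A.0#
      δD = A.trans (A.sym (A.*-identityʳ (δ A.* D))) (A.trans
        (A.*-congˡ {δ A.* D} (A.sym (A.trans (A.*-cong (QP.⟨Q⟩-inverse N) (QP.⟨Q⟩-inverse N)) (A.*-identityˡ A.1#))))
        (A.trans (ASolver.solve 4 (λ d D q r → d :* D :* ((q :* r) :* (q :* r)) := d :* (q :* q) :* D :* (r :* r)) δ D ⟨Q⟩ ⟨Q⟩⁻¹)
        (A.trans (A.*-congʳ {⟨Q⟩⁻¹ A.* ⟨Q⟩⁻¹} (A.trans (A.*-congʳ {D} (A.sym θC))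
          (A.trans (ASolver.solve 3 (λ t C E → t :* C :* (C :- E) := C :* (t :* C :- t :* E)) θz C E)
            (A.trans (A.*-congˡ {C} (A.trans (A.+-cong θC (A.-‿cong θE′)) (A.-‿inverseʳ (δ A.* (⟨Q⟩ A.* ⟨Q⟩))))) (A.zeroʳ C)))))
          (A.zeroˡ (⟨Q⟩⁻¹ A.* ⟨Q⟩⁻¹)))))

      D-step : ∀ a → D a ≈ D (a ⊝ # 1)
      D-step a = begin
        D a
          ≈⟨ solve 2 (λ x y → x := (x :- y) :+ y) (D a) (D (a ⊝ # 1)) ⟩
        (D a - D (a ⊝ # 1)) + D (a ⊝ # 1)
          ≈⟨ +-congʳ (+-congˡ (-‿cong (basis-* (# 1) D a))) ⟨
        (D A.- z A.* D) a + D (a ⊝ # 1)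
          ≈⟨ +-congʳ (component (A.trans (ASolver.solve 2 (λ z D → D :- z :* D := (con 1 :- z) :* D) z D) δD) a) ⟩
        0# + D (a ⊝ # 1)
          ≈⟨ +-identityˡ _ ⟩
        D (a ⊝ # 1) ∎

      D-constant : ∀ a → D a ≈ D (# 0)
      D-constant = refl ◂ d₁ ◂ d₂ ◂ d₃ ◂ d₄ ◂ d₅ ◂ d₆ ◂ d₇ ◂ d₈ ◂ d₉ ◂ trans (D-step (# 10)) d₉ ◂ λ ()
        where
        d₁ = D-step (# 1)
        d₂ = trans (D-step (# 2)) d₁
        d₃ = trans (D-step (# 3)) d₂
        d₄ = trans (D-step (# 4)) d₃
        d₅ = trans (D-step (# 5)) d₄
        d₆ = trans (D-step (# 6)) d₅
        d₇ = trans (D-step (# 7)) d₆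
        d₈ = trans (D-step (# 8)) d₇
        d₉ = trans (D-step (# 9)) d₈

      -- Each column of `crankCoefficients` adds up to zero.
      V-sum : sumOver V (allFin 11) ≈ 0#
      V-sum = prove id ρ (λ _ → refl) (foldr (λ a s → Variables.v a :+ s) (con 0) (allFin 11)) (con 0) _

      D₀ : sumOver C (allFin 11) ≈ ⟦ con 11 ⟧ [] * D (# 0)
      D₀ = begin
        sumOver C (allFin 11)
          ≈⟨ sumOver-cong (allFin 11) (λ a → trans (solve 2 (λ c e → c := (c :- e) :+ e) (C a) (E a)) (+-congʳ (D-constant a))) ⟩
        sumOver (λ a → D (# 0) + e * J² * V a) (allFin 11)
          ≈⟨ sumOver-+ (λ _ → D (# 0)) (λ a → e * J² * V a) (allFin 11) ⟩
        sumOver (λ _ → D (# 0)) (allFin 11) + sumOver (λ a → e * J² * V a) (allFin 11)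
          ≈⟨ +-congˡ (trans (sumOver-*ˡ (e * J²) V (allFin 11)) (trans (*-congˡ V-sum) (zeroʳ _))) ⟩
        sumOver (λ _ → D (# 0)) (allFin 11) + 0#
          ≈⟨ solve 1 (λ d → (d :+ (d :+ (d :+ (d :+ (d :+ (d :+ (d :+ (d :+ (d :+ (d :+ (d :+ con 0))))))))))) :+ con 0 := con 11 :* d) (D (# 0)) ⟩
        ⟦ con 11 ⟧ [] * D (# 0) ∎

    -- The components of E add up to zero and those of D are all equal, so the mean of the
    -- components of C is their common value D₀. Subtracting it from C leaves E.
    crank-deviation : ∀ a → crankSeries a - e * sumOver crankSeries (allFin 11) ≈ e * J² * V a
    crank-deviation a = begin
      C a - e * sumOver C (allFin 11)
        ≈⟨ +-congˡ (-‿cong (trans (*-congˡ D₀) (trans (solve 3 (λ e n d → e :* (n :* d) := n :* e :* d) _ _ _) (trans (*-congʳ e-inverse) (*-identityˡ _))))) ⟩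
      C a - D (# 0)
        ≈⟨ +-congˡ (-‿cong (D-constant a)) ⟨
      C a - (C a - E a)
        ≈⟨ solve 2 (λ c e → c :- (c :- e) := e) (C a) (E a) ⟩
      E a ∎

-- Counting partitions by the residue of the crank

fromℤ : ℤ → ℚ
fromℤ i = i ℚ./ 1

private
  toℚᵘ-/ : ∀ i n → ℚ.toℚᵘ (i ℚ./ suc n) ℚᵘ.≃ ℚᵘ.mkℚᵘ i n
  toℚᵘ-/ i n = ℚ.toℚᵘ-fromℚᵘ (ℚᵘ.mkℚᵘ i n)

-- Proved for unnormalised fractions, where addition is explicit; the reduction to lowest terms in ℚ
-- does not compute on variables.
fromℤ-+ : ∀ i j → fromℤ (i ℤ.+ j) ≡ fromℤ i ℚ.+ fromℤ j
fromℤ-+ i j = ℚ.toℚᵘ-injective (ℚᵘ.≃-trans (toℚᵘ-/ (i ℤ.+ j) 0)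
  (ℚᵘ.≃-trans (ℚᵘ.*≡* (ℤ-Solver.solve 2 (λ i j → (i :+ j) :* con 1 := (i :* con 1 :+ j :* con 1) :* con 1) i j))
    (ℚᵘ.≃-sym (ℚᵘ.≃-trans (ℚ.toℚᵘ-homo-+ (fromℤ i) (fromℤ j)) (ℚᵘ.+-cong (toℚᵘ-/ i 0) (toℚᵘ-/ j 0))))))

fromℤ-neg : ∀ i → fromℤ (ℤ.- i) ≡ ℚ.- fromℤ i
fromℤ-neg i = ℚ.toℚᵘ-injective (ℚᵘ.≃-trans (toℚᵘ-/ (ℤ.- i) 0)
  (ℚᵘ.≃-sym (ℚᵘ.≃-trans (ℚ.toℚᵘ-homo‿- (fromℤ i)) (ℚᵘ.-‿cong (toℚᵘ-/ i 0)))))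

/-as-* : ∀ i n → i ℚ./ suc n ≡ (+ 1 ℚ./ suc n) ℚ.* fromℤ i
/-as-* i n = ℚ.toℚᵘ-injective (ℚᵘ.≃-trans (toℚᵘ-/ i n)
  (ℚᵘ.≃-trans (ℚᵘ.*≡* (≡.cong₂ ℤ._*_ (≡.sym (ℤ.*-identityˡ i)) (≡.cong +_ (ℕ.*-identityʳ (suc n)))))
    (ℚᵘ.≃-sym (ℚᵘ.≃-trans (ℚ.toℚᵘ-homo-* (+ 1 ℚ./ suc n) (fromℤ i)) (ℚᵘ.*-cong (toℚᵘ-/ (+ 1) n) (toℚᵘ-/ i 0))))))

module ℚ-Sums = Sums ℚ.+-*-commutativeRing

class₁₁ : ℤ → Fin 11
class₁₁ k = proj₁ (Split.part (Residue.residue-split 11 0ℤ) k)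

class₁₁-quotient : ℤ → ℤ
class₁₁-quotient k = proj₂ (Split.part (Residue.residue-split 11 0ℤ) k)

class₁₁-decomposition : ∀ k → + 11 ℤ.* class₁₁-quotient k ℤ.+ + toℕ (class₁₁ k) ≡ k
class₁₁-decomposition k = ≡.trans (≡.cong (λ x → + 11 ℤ.* class₁₁-quotient k ℤ.+ x) (≡.sym (ℤ.+-identityʳ (+ toℕ (class₁₁ k)))))
  (Split.join-part (Residue.residue-split 11 0ℤ) k)

class₁₁-∣ : ∀ k a → + 11 ∣ (k ℤ.- + toℕ a) → class₁₁ k ≡ a
class₁₁-∣ k a (divides l eq) = ≡.cong proj₁ (≡.trans (≡.cong (Split.part (Residue.residue-split 11 0ℤ)) (≡.sym k≡)) (Split.part-join (Residue.residue-split 11 0ℤ) a l))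
  where
  k≡ : + 11 ℤ.* l ℤ.+ (+ toℕ a ℤ.- 0ℤ) ≡ k
  k≡ = ≡.trans (≡.cong₂ ℤ._+_ (≡.trans (ℤ.*-comm (+ 11) l) (≡.sym eq)) (ℤ.+-identityʳ (+ toℕ a)))
         (ℤ-Solver.solve 2 (λ k a → k :- a :+ a := k) k (+ toℕ a))

∣-class₁₁ : ∀ k → + 11 ∣ (k ℤ.- + toℕ (class₁₁ k))
∣-class₁₁ k = divides (class₁₁-quotient k)
  (≡.trans (≡.cong (ℤ._- + toℕ (class₁₁ k)) (≡.sym (class₁₁-decomposition k)))
    (≡.trans (ℤ-Solver.solve 2 (λ x s → x :+ s :- s := x) (+ 11 ℤ.* class₁₁-quotient k) (+ toℕ (class₁₁ k))) (ℤ.*-comm (+ 11) (class₁₁-quotient k))))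

crankClass : Fin 11 → ℕ → List (List ℕ)
crankClass a n = filter (λ π → class₁₁ (crank π) Fin.≟ a) (partitions n)

-- The components of (z - 1) q. The single partition of 1 has crank -1, while the conventional M(m,
-- 1) has in addition the value 1 at m = 1 and -1 at m = 0.
correction : Fin 11 → ℕ → ℤ
correction a 1 = (if does (a Fin.≟ # 1) then 1ℤ else 0ℤ) ℤ.- (if does (a Fin.≟ # 0) then 1ℤ else 0ℤ)
correction a _ = 0ℤ

private
  count : ∀ {I : Set} (xs : List I) → ℚ-Sums.sumOver (λ _ → 1ℚ) xs ≡ fromℤ (+ length xs)
  count []       = ≡.refl
  count (x ∷ xs) = ≡.trans (≡.cong (λ y → 1ℚ ℚ.+ y) (count xs)) (≡.sym (fromℤ-+ 1ℤ (+ length xs)))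

  fromℤ-sum : ∀ {I : Set} (f : I → ℤ) xs → fromℤ (foldr ℤ._+_ 0ℤ (map f xs)) ≡ ℚ-Sums.sumOver (fromℤ ∘ f) xs
  fromℤ-sum f []       = ≡.refl
  fromℤ-sum f (x ∷ xs) = ≡.trans (fromℤ-+ (f x) _) (≡.cong (λ y → fromℤ (f x) ℚ.+ y) (fromℤ-sum f xs))

-- For n ≤ 1, where M is conventional, this is a finite check. From n = 2 on the partitions in the
-- class are sorted by the exact value of the crank, which lies in `interval n`.
crankClass-M : ∀ a n → fromℤ M⟨ + toℕ a , 11 , n ⟩ ≡ ℚ-Sums.sumOver (λ _ → 1ℚ) (crankClass a n) ℚ.+ fromℤ (correction a n)
crankClass-M a 0 = ≡.trans (≡.cong fromℤ (small a)) (≡.trans (fromℤ-+ (+ length (crankClass a 0)) (correction a 0)) (≡.cong (ℚ._+ fromℤ (correction a 0)) (≡.sym (count (crankClass a 0)))))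
  where
  small : ∀ a → M⟨ + toℕ a , 11 , 0 ⟩ ≡ + length (crankClass a 0) ℤ.+ correction a 0
  small = from-yes (Fin.all? λ a → M⟨ + toℕ a , 11 , 0 ⟩ ℤ.≟ + length (crankClass a 0) ℤ.+ correction a 0)
crankClass-M a 1 = ≡.trans (≡.cong fromℤ (small a)) (≡.trans (fromℤ-+ (+ length (crankClass a 1)) (correction a 1)) (≡.cong (ℚ._+ fromℤ (correction a 1)) (≡.sym (count (crankClass a 1)))))
  where
  small : ∀ a → M⟨ + toℕ a , 11 , 1 ⟩ ≡ + length (crankClass a 1) ℤ.+ correction a 1
  small = from-yes (Fin.all? λ a → M⟨ + toℕ a , 11 , 1 ⟩ ℤ.≟ + length (crankClass a 1) ℤ.+ correction a 1)
crankClass-M a n@(suc (suc _)) = begin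
  fromℤ M⟨ + toℕ a , 11 , n ⟩
    ≡⟨ fromℤ-sum (λ m → M m n) ks ⟩
  ℚ-Sums.sumOver (λ m → fromℤ (M m n)) ks
    ≡⟨ ℚ-Sums.sumOver-cong∈ ks (λ {m} m∈ → ≡.trans (≡.sym (count (filter (λ π → crank π ℤ.≟ m) (partitions n)))) (restrict m m∈)) ⟩
  ℚ-Sums.sumOver (λ m → ℚ-Sums.sumOver (λ _ → 1ℚ) (filter (λ π → crank π ℤ.≟ m) (crankClass a n))) ks
    ≡⟨ ℚ-Sums.sumOver-classes ℤ._≟_ crank (λ _ → 1ℚ) (crankClass a n) ks-unique crank∈ ⟨
  ℚ-Sums.sumOver (λ _ → 1ℚ) (crankClass a n)
    ≡⟨ ℚ.+-identityʳ _ ⟨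
  ℚ-Sums.sumOver (λ _ → 1ℚ) (crankClass a n) ℚ.+ 0ℚ ∎
  where
  open ≡.≡-Reasoning
  mine : Decidable (λ π → class₁₁ (crank π) ≡ a)
  mine π = class₁₁ (crank π) Fin.≟ a
  ks = filter (λ m → + 11 ∣? (m ℤ.- + toℕ a)) (interval n)
  ks-unique = Unique.filter⁺ (λ m → + 11 ∣? (m ℤ.- + toℕ a)) (interval-unique n)
  crank∈ : ∀ {π} → π ∈ crankClass a n → crank π ∈ ks
  crank∈ {π} π∈ with π∈n , ≡.refl ← ∈-filter⁻ mine {xs = partitions n} π∈ =
    ∈-filter⁺ (λ m → + 11 ∣? (m ℤ.- + toℕ a)) (∈-interval⁺ (crank π) (∣crank∣≤ (∈-partitions⁻ {n} π∈n))) (∣-class₁₁ (crank π))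
  restrict : ∀ m → m ∈ ks → ℚ-Sums.sumOver (λ _ → 1ℚ) (filter (λ π → crank π ℤ.≟ m) (partitions n))
                            ≡ ℚ-Sums.sumOver (λ _ → 1ℚ) (filter (λ π → crank π ℤ.≟ m) (crankClass a n))
  restrict m m∈ = ℚ-Sums.sumOver-unique (λ _ → 1ℚ) (Unique.filter⁺ is-m (partitions-unique n)) (Unique.filter⁺ is-m (Unique.filter⁺ mine (partitions-unique n))) (inj₁ ∘ to) (inj₁ ∘ from)
    where
    is-m : Decidable (λ π → crank π ≡ m)
    is-m π = crank π ℤ.≟ m
    to : ∀ {π} → π ∈ filter is-m (partitions n) → π ∈ filter is-m (crankClass a n)
    to {π} π∈ with π∈n , ≡.refl ← ∈-filter⁻ is-m {xs = partitions n} π∈ =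
      ∈-filter⁺ is-m (∈-filter⁺ mine π∈n (class₁₁-∣ (crank π) a (proj₂ (∈-filter⁻ (λ m → + 11 ∣? (m ℤ.- + toℕ a)) {xs = interval n} m∈)))) ≡.refl
    from : ∀ {π} → π ∈ filter is-m (crankClass a n) → π ∈ filter is-m (partitions n)
    from {π} π∈ with π∈c , eq ← ∈-filter⁻ is-m {xs = crankClass a n} π∈ = ∈-filter⁺ is-m (proj₁ (∈-filter⁻ mine {xs = partitions n} π∈c)) eq

crankClass-total : ∀ n → ℚ-Sums.sumOver (λ a → ℚ-Sums.sumOver (λ _ → 1ℚ) (crankClass a n) ℚ.+ fromℤ (correction a n)) (allFin 11) ≡ fromℤ (+ p n)
crankClass-total n = begin
  ℚ-Sums.sumOver (λ a → ℚ-Sums.sumOver (λ _ → 1ℚ) (crankClass a n) ℚ.+ fromℤ (correction a n)) (allFin 11)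
    ≡⟨ ℚ-Sums.sumOver-+ (λ a → ℚ-Sums.sumOver (λ _ → 1ℚ) (crankClass a n)) (λ a → fromℤ (correction a n)) (allFin 11) ⟩
  ℚ-Sums.sumOver (λ a → ℚ-Sums.sumOver (λ _ → 1ℚ) (crankClass a n)) (allFin 11) ℚ.+ ℚ-Sums.sumOver (λ a → fromℤ (correction a n)) (allFin 11)
    ≡⟨ ≡.cong₂ ℚ._+_ (≡.sym (ℚ-Sums.sumOver-classes Fin._≟_ (class₁₁ ∘ crank) (λ _ → 1ℚ) (partitions n) (Unique.allFin⁺ 11) (λ _ → ∈-allFin _))) (corrections n) ⟩
  ℚ-Sums.sumOver (λ _ → 1ℚ) (partitions n) ℚ.+ 0ℚ
    ≡⟨ ≡.trans (ℚ.+-identityʳ _) (count (partitions n)) ⟩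
  fromℤ (+ p n) ∎
  where
  open ≡.≡-Reasoning
  corrections : ∀ n → ℚ-Sums.sumOver (λ a → fromℤ (correction a n)) (allFin 11) ≡ 0ℚ
  corrections 0             = ≡.refl
  corrections 1             = ≡.refl
  corrections (suc (suc n)) = ≡.refl

private
  ⊝-zero : ∀ a c → does (a ⊝ c Fin.≟ Fin.zero) ≡ does (c Fin.≟ a)
  ⊝-zero = from-yes (Fin.all? λ a → Fin.all? λ c → does (a ⊝ c Fin.≟ Fin.zero) Bool.≟ does (c Fin.≟ a))

-- Coefficients of the crank series

module CrankComponents (R : CommutativeRing 0ℓ 0ℓ)
                       (q : CommutativeRing.Carrier R) (N : ℕ) (q^N≈0 : PowerVanishes R q N) where
  open CommutativeRing R
  open Exp semiring using (_^_)
  open SetoidReasoning setoid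
  open Sums R
  open Solver R using (solve)
  open GroupRing R
  open CrankTheorem R q N q^N≈0 using (Q; z; pow; pow-residue; scalar-^; crankTerm; crankSeries; AS-component)
  private
    module A = CommutativeRing groupRing

  private
    select : ∀ x b → x * (if b then 1# else 0#) ≈ (if b then x else 0#)
    select x true  = *-identityʳ x
    select x false = zeroʳ x

  crankTerm-component : ∀ a π → crankTerm π a ≈ (if does (class₁₁ (crank π) Fin.≟ a) then q ^ sum π else 0#)
  crankTerm-component a π = begin
    crankTerm π a
      ≈⟨ component (A.*-cong (A.trans (A.reflexive (≡.cong pow (≡.sym (class₁₁-decomposition (crank π)))))
           (A.trans (pow-residue (class₁₁-quotient (crank π)) (+ toℕ c)) (A.reflexive (≡.cong basis (class-toℕ c))))) (scalar-^ q (sum π))) a ⟩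
    (basis c A.* scalar (q ^ sum π)) a
      ≈⟨ basis-* c (scalar (q ^ sum π)) a ⟩
    q ^ sum π * basis Fin.zero (a ⊝ c)
      ≡⟨ ≡.cong (λ b → q ^ sum π * (if b then 1# else 0#)) (⊝-zero a c) ⟩
    q ^ sum π * (if does (c Fin.≟ a) then 1# else 0#)
      ≈⟨ select (q ^ sum π) (does (c Fin.≟ a)) ⟩
    (if does (c Fin.≟ a) then q ^ sum π else 0#) ∎
    where c = class₁₁ (crank π)

  crankSeries-component : ∀ a → crankSeries a ≈
    sumOver (λ π → if does (class₁₁ (crank π) Fin.≟ a) then q ^ sum π else 0#) (partitionsBelow N)
    + ((if does (a Fin.≟ # 1) then q else 0#) - (if does (a Fin.≟ # 0) then q else 0#))
  crankSeries-component a = +-cong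
    (trans (reflexive (AS-component crankTerm (partitionsBelow N) a)) (sumOver-cong (partitionsBelow N) (crankTerm-component a)))
    (begin
      ((z A.- A.1#) A.* Q) a
        ≈⟨ component (A.*-comm (z A.- A.1#) Q) a ⟩
      (Q A.* (z A.- A.1#)) a
        ≈⟨ scalar-* q (z A.- A.1#) a ⟩
      q * (basis (# 1) a - basis (# 0) a)
        ≈⟨ solve 3 (λ q x y → q :* (x :- y) := q :* x :- q :* y) _ _ _ ⟩
      q * basis (# 1) a - q * basis (# 0) a
        ≈⟨ +-cong (select q (does (a Fin.≟ # 1))) (-‿cong (select q (does (a Fin.≟ # 0)))) ⟩
      (if does (a Fin.≟ # 1) then q else 0#) - (if does (a Fin.≟ # 0) then q else 0#) ∎)

module _ (N : ℕ) where
  private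
    module S = CommutativeRing (seriesRing N)
    module SS = Sums (seriesRing N)
    module CC = CrankComponents (seriesRing N) (q^ 1) N (q^N≈0 N)
    open ℚ-Sums

    coefficient-sum : ∀ {I : Set} (f : I → Series) xs n → SS.sumOver f xs n ≡ sumOver (λ x → f x n) xs
    coefficient-sum f []       n = ≡.refl
    coefficient-sum f (x ∷ xs) n = ≡.trans (⊞-≗ (f x) (SS.sumOver f xs) n) (≡.cong (λ y → f x n ℚ.+ y) (coefficient-sum f xs n))

    term : Fin 11 → List ℕ → Series
    term a π = if does (class₁₁ (crank π) Fin.≟ a) then q^ sum π else 0ˢ

    if-cong : ∀ b {f g : Series} → f S.≈ g → (if b then f else 0ˢ) S.≈ (if b then g else 0ˢ)
    if-cong true  f≈g = f≈g
    if-cong false _   = S.refl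

    term-yes : ∀ a π → class₁₁ (crank π) ≡ a → term a π (sum π) ≡ 1ℚ
    term-yes a π c≡a = ≡.trans
      (≡.cong (λ b → (if b then q^ sum π else 0ˢ) (sum π)) (dec-true (class₁₁ (crank π) Fin.≟ a) c≡a))
      (≡.cong (if_then 1ℚ else 0ℚ) (dec-true (sum π ℕ.≟ sum π) ≡.refl))

    term-no : ∀ a π n → class₁₁ (crank π) ≢ a ⊎ n ≢ sum π → term a π n ≡ 0ℚ
    term-no a π n (inj₁ c≢a) = ≡.cong (λ b → (if b then q^ sum π else 0ˢ) n) (dec-false (class₁₁ (crank π) Fin.≟ a) c≢a)
    term-no a π n (inj₂ n≢)  = vanish (does (class₁₁ (crank π) Fin.≟ a))
      where
      vanish : ∀ b → (if b then q^ sum π else 0ˢ) n ≡ 0ℚ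
      vanish true  = q^-≢ n≢
      vanish false = ≡.refl

    terms : ∀ a n → n < N → sumOver (λ π → term a π n) (partitionsBelow N) ≡ sumOver (λ _ → 1ℚ) (crankClass a n)
    terms a n n<N = ≡.trans
      (sumOver-unique (λ π → term a π n) (partitionsBelow-unique N) (Unique.filter⁺ mine (partitions-unique n)) (λ {π} → to π) (inj₁ ∘ from))
      (sumOver-cong∈ (crankClass a n) value)
      where
      mine = λ π → class₁₁ (crank π) Fin.≟ a
      to : ∀ π → π ∈ partitionsBelow N → π ∈ crankClass a n ⊎ term a π n ≡ 0ℚ
      to π π∈ = decide (mine π) (n ℕ.≟ sum π)
        where
        decide : Dec (class₁₁ (crank π) ≡ a) → Dec (n ≡ sum π) → π ∈ crankClass a n ⊎ term a π n ≡ 0ℚ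
        decide (no c≢a)  _           = inj₂ (term-no a π n (inj₁ c≢a))
        decide (yes _)   (no n≢)     = inj₂ (term-no a π n (inj₂ n≢))
        decide (yes c≡a) (yes ≡.refl) = inj₁ (∈-filter⁺ mine (∈-partitions⁺ (proj₁ (∈-partitionsBelow⁻ N π∈))) c≡a)
      from : ∀ {π} → π ∈ crankClass a n → π ∈ partitionsBelow N
      from {π} π∈ with π∈n , _ ← ∈-filter⁻ mine {xs = partitions n} π∈ with link , pos , ≡.refl ← ∈-partitions⁻ {n} π∈n =
        ∈-partitionsBelow⁺ N (link , pos , ≡.refl) n<N
      value : ∀ {π} → π ∈ crankClass a n → term a π n ≡ 1ℚ
      value {π} π∈ with π∈n , c≡a ← ∈-filter⁻ mine {xs = partitions n} π∈ with _ , _ , ≡.refl ← ∈-partitions⁻ {n} π∈n = term-yes a π c≡a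

    corrections : ∀ b b′ n → (if b then q^ 1 else 0ˢ) n ℚ.+ ℚ.- (if b′ then q^ 1 else 0ˢ) n
                             ≡ fromℤ (if does (n ℕ.≟ 1) then (if b then 1ℤ else 0ℤ) ℤ.- (if b′ then 1ℤ else 0ℤ) else 0ℤ)
    corrections true  true  0             = ≡.refl
    corrections true  true  1             = ≡.refl
    corrections true  true  (suc (suc n)) = ≡.refl
    corrections true  false 0             = ≡.refl
    corrections true  false 1             = ≡.refl
    corrections true  false (suc (suc n)) = ≡.refl
    corrections false true  0             = ≡.refl
    corrections false true  1             = ≡.refl
    corrections false true  (suc (suc n)) = ≡.refl
    corrections false false 0             = ≡.refl
    corrections false false 1             = ≡.refl
    corrections false false (suc (suc n)) = ≡.refl

    correction-if : ∀ a n → (if does (n ℕ.≟ 1) then (if does (a Fin.≟ # 1) then 1ℤ else 0ℤ) ℤ.- (if does (a Fin.≟ # 0) then 1ℤ else 0ℤ) else 0ℤ) ≡ correction a n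
    correction-if a 0             = ≡.refl
    correction-if a 1             = ≡.refl
    correction-if a (suc (suc n)) = ≡.refl

  open CrankTheorem (seriesRing N) (q^ 1) N (q^N≈0 N) using (crankSeries)

  crankSeries-coefficient : ∀ a n → n < N → crankSeries a n ≡ sumOver (λ _ → 1ℚ) (crankClass a n) ℚ.+ fromℤ (correction a n)
  crankSeries-coefficient a n n<N = ≡.trans (coefficients (CC.crankSeries-component a) n n<N) (≡.trans (⊞-≗ _ _ n) (≡.cong₂ ℚ._+_
    (≡.trans (coefficients (SS.sumOver-cong {g = term a} (partitionsBelow N) λ π → if-cong (does (class₁₁ (crank π) Fin.≟ a)) (q^-power N (sum π))) n n<N)
      (≡.trans (coefficient-sum (term a) (partitionsBelow N) n) (terms a n n<N)))
    (≡.trans (≡.trans (⊞-≗ _ _ n) (≡.cong (λ y → (if does (a Fin.≟ # 1) then q^ 1 else 0ˢ) n ℚ.+ y) (⊟-≗ (if does (a Fin.≟ # 0) then q^ 1 else 0ˢ) n)))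
      (≡.trans (corrections (does (a Fin.≟ # 1)) (does (a Fin.≟ # 0)) n) (≡.cong fromℤ (correction-if a n))))))

  crankSeries-total : ∀ n → n < N → SS.sumOver crankSeries (allFin 11) n ≡ fromℤ (+ p n)
  crankSeries-total n n<N = ≡.trans (coefficient-sum crankSeries (allFin 11) n)
    (≡.trans (sumOver-cong (allFin 11) λ a → crankSeries-coefficient a n n<N) (crankClass-total n))

-- Back to power series

module Quotients (R : CommutativeRing 0ℓ 0ℓ) where
  open CommutativeRing R
  open Solver R using (solve)
  open SetoidReasoning setoid

  inverse-unique : ∀ {x i u} → x * i ≈ 1# → x * u ≈ 1# → i ≈ u
  inverse-unique {x} {i} {u} xi xu = begin
    i             ≈⟨ *-identityʳ i ⟨
    i * 1#        ≈⟨ *-congˡ xu ⟨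
    i * (x * u)   ≈⟨ solve 3 (λ i x u → i :* (x :* u) := (x :* i) :* u) i x u ⟩
    (x * i) * u   ≈⟨ *-congʳ xi ⟩
    1# * u        ≈⟨ *-identityˡ u ⟩
    u             ∎

  -- A quotient in `v₁₁` inverts a product as a whole, whereas the certificates use a separate
  -- inverse for each Xᵢ; uniqueness of inverses reconciles the two.
  double-quotient : ∀ q q′ n x y i u v → q ≈ q′ → (x * y) * i ≈ 1# → x * u ≈ 1# → y * v ≈ 1# → q * (n * i) ≈ q′ * (n * (u * v))
  double-quotient q q′ n x y i u v q≈ xyi xu yv = *-cong q≈ (*-congˡ (inverse-unique xyi
    (trans (solve 4 (λ x y u v → (x :* y) :* (u :* v) := (x :* u) :* (y :* v)) x y u v) (trans (*-cong xu yv) (*-identityˡ 1#)))))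

  rewrite-powers : ∀ p p′ r r′ a b c → p ≈ p′ → r ≈ r′ → p * (r * a + b) ≈ p * c → p′ * (r′ * a + b) ≈ p′ * c
  rewrite-powers p p′ r r′ a b c p≈ r≈ eq =
    trans (*-cong (sym p≈) (+-congʳ (*-congʳ (sym r≈)))) (trans eq (*-congʳ p≈))

  restore-power : ∀ r r′ a b c → r ≈ r′ → r * a + b ≈ c → r′ * a + b ≈ c
  restore-power r r′ a b c r≈ eq = trans (+-congʳ (*-congʳ (sym r≈))) eq

  sum₁₀ : ∀ (f g : Fin 10 → Carrier) → (∀ i → f i ≈ g i) →
    f (# 0) + f (# 1) + f (# 2) + f (# 3) + f (# 4) + f (# 5) + f (# 6) + f (# 7) + f (# 8) + f (# 9)
    ≈ g (# 0) + (g (# 1) + (g (# 2) + (g (# 3) + (g (# 4) + (g (# 5) + (g (# 6) + (g (# 7) + (g (# 8) + (g (# 9) + 0#)))))))))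
  sum₁₀ f g f≈g = trans
    (+-cong (+-cong (+-cong (+-cong (+-cong (+-cong (+-cong (+-cong (+-cong (f≈g (# 0)) (f≈g (# 1))) (f≈g (# 2))) (f≈g (# 3))) (f≈g (# 4)))
      (f≈g (# 5))) (f≈g (# 6))) (f≈g (# 7))) (f≈g (# 8))) (f≈g (# 9)))
    (solve 10 (λ a b c d e f g h i j → a :+ b :+ c :+ d :+ e :+ f :+ g :+ h :+ i :+ j
      := a :+ (b :+ (c :+ (d :+ (e :+ (f :+ (g :+ (h :+ (i :+ (j :+ con 0))))))))))
      (g (# 0)) (g (# 1)) (g (# 2)) (g (# 3)) (g (# 4)) (g (# 5)) (g (# 6)) (g (# 7)) (g (# 8)) (g (# 9)))

-- Defined case by case, because the instance that the constant term is non-zero is found by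
-- evaluating `X i` at 0 for a concrete i.
U : ℕ → Series
U 1 = inverse (X 1)
U 2 = inverse (X 2)
U 3 = inverse (X 3)
U 4 = inverse (X 4)
U 5 = inverse (X 5)
U _ = 0ˢ

module Concrete (N : ℕ) where
  open CommutativeRing (seriesRing N)
  open Exp semiring using (_^_)
  open Nilpotent (seriesRing N) (q^ 1) N (q^N≈0 N) using (total)
  open Theta (seriesRing N) (q^ 1) N (q^N≈0 N) using (θ)
  open ThetaProducts (seriesRing N) (q^ 1) N (q^N≈0 N) using (pochhammer; θ-pochhammer; θ-swap; module Eleven)
  open Products (seriesRing N) using (prod; prod-cong)

  *ˢ-as-* : ∀ f g → f *ˢ g ≈ f * g
  *ˢ-as-* f g = sym (≗⇒≈ (⊛-≗ f g))

  private
    -ˢ-as-- : ∀ f g → f -ˢ g ≈ f - g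
    -ˢ-as-- f g = sym (trans (≗⇒≈ (⊞-≗ f (- g))) (≗⇒≈ λ k → ≡.cong (f k ℚ.+_) (⊟-≗ g k)))

    ∏≈prod : ∀ f n → ∏ n f ≈ prod f n
    ∏≈prod f zero    = refl
    ∏≈prod f (suc n) = trans (*ˢ-as-* (∏ n f) (f n)) (*-congʳ {f n} (∏≈prod f n))

  poch-pochhammer : ∀ a m .{{_ : NonZero m}} → poch a m ≈ pochhammer a m
  poch-pochhammer a m = trans (mk≈ λ k k<N → ≡.sym (poch-stable a m k N k<N))
    (trans (∏≈prod (λ i → 1ˢ -ˢ q^ (a ℕ.+ m ℕ.* i)) N) (prod-cong N λ i → trans (-ˢ-as-- 1ˢ (q^ (a ℕ.+ m ℕ.* i)))
      (+-congˡ {1#} (-‿cong (sym (q^-power N (a ℕ.+ m ℕ.* i)))))))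

  X-θ : ∀ i {c d} → c ≡ 11 ℕ.* i → c ℕ.+ d ≡ 121 → ∀ 1≤c+d → X i ≈ total (θ c d 1≤c+d)
  X-θ i {c} {d} ≡.refl c+d≡ 1≤c+d = trans (*ˢ-as-* (poch c 121 *ˢ poch (121 ∸ c) 121) (poch 121 121))
    (trans (*-cong (trans (*ˢ-as-* (poch c 121) (poch (121 ∸ c) 121)) (*-cong (poch-pochhammer c 121)
        (trans (reflexive (≡.cong (λ d → poch d 121) (≡.trans (≡.cong (_∸ c) (≡.sym c+d≡)) (ℕ.m+n∸m≡n c d)))) (poch-pochhammer d 121))))
      (poch-pochhammer 121 121))
    (θ-pochhammer {c} {d} c+d≡ 1≤c+d))

  X-sym : ∀ i j → i ℕ.+ j ≡ 11 → X i ≈ X j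
  X-sym i j i+j≡ = trans (X-θ i {11 ℕ.* i} {11 ℕ.* j} ≡.refl sum≡ 1≤)
    (trans (θ-swap (11 ℕ.* i) (11 ℕ.* j) 1≤ 1≤′) (sym (X-θ j {11 ℕ.* j} {11 ℕ.* i} ≡.refl sum≡′ 1≤′)))
    where
    sum≡ : 11 ℕ.* i ℕ.+ 11 ℕ.* j ≡ 121
    sum≡ = ≡.trans (≡.sym (ℕ.*-distribˡ-+ 11 i j)) (≡.cong (11 ℕ.*_) i+j≡)
    sum≡′ : 11 ℕ.* j ℕ.+ 11 ℕ.* i ≡ 121
    sum≡′ = ≡.trans (ℕ.+-comm (11 ℕ.* j) (11 ℕ.* i)) sum≡
    1≤ = ≡.subst (1 ℕ.≤_) (≡.sym sum≡) (s≤s z≤n)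
    1≤′ = ≡.subst (1 ℕ.≤_) (≡.sym sum≡′) (s≤s z≤n)

  open Eleven X U X-θ X-sym public using (relation₄₂₁; relation₄₃₂; relation₅₄₃; relation₅₃₁; relation₅₂₁)

  relation : ∀ k l a b c → (q^ 1) ^ k * ((q^ 1) ^ l * a + b) ≈ (q^ 1) ^ k * c → q^ k * (q^ l * a + b) ≈ q^ k * c
  relation k l a b c = Quotients.rewrite-powers (seriesRing N) ((q^ 1) ^ k) (q^ k) ((q^ 1) ^ l) (q^ l) a b c (q^-power N k) (q^-power N l)

-- The common powers of q in the Plücker relations can be cancelled because the relations hold modulo every q^N.
cancelled : ∀ k f g → (∀ N → q^ k ⊛ f ≈[ N ] q^ k ⊛ g) → ∀ N → f ≈[ N ] g
cancelled k f g eq N = ≗⇒≈ {f} {g} {N} (q^-cancel k {f} {g} λ n →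
  ≡.trans (≡.sym (⊛-≗ (q^ k) f n)) (≡.trans (≈⇒≗ {q^ k ⊛ f} {q^ k ⊛ g} eq n) (⊛-≗ (q^ k) g n)))

constant : ℚ → Series
constant c = c • 1ˢ

constant-+ : ∀ c d → constant (c ℚ.+ d) ≗ constant c ⊞ constant d
constant-+ c d n = ≡.trans (ℚ.*-distribʳ-+ (1ˢ n) c d) (≡.sym (⊞-≗ (constant c) (constant d) n))

constant-neg : ∀ c → constant (ℚ.- c) ≗ ⊟ constant c
constant-neg c n = ≡.trans (≡.sym (ℚ.neg-distribˡ-* c (1ˢ n))) (≡.sym (⊟-≗ (constant c) n))

•-constant : ∀ c f → c • f ≗ constant c ⊛ f
•-constant c f n = ≡.sym (≡.trans (⊛-≗ (constant c) f n) (≡.trans (•-*ˢ c 1ˢ f n) (≡.cong (c ℚ.*_) (≡.trans (*ˢ-comm 1ˢ f n) (*ˢ-identityʳ f n)))))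

module Integers (N : ℕ) where
  open CommutativeRing (seriesRing N)
  open Solver (seriesRing N) using (⟦_⟧; literal)

  literal-constant : ∀ n → literal n ≈ constant (fromℤ (+ n))
  literal-constant 0             = ≗⇒≈ λ k → ≡.sym (ℚ.*-zeroˡ (1ˢ k))
  literal-constant 1             = ≗⇒≈ λ k → ≡.sym (ℚ.*-identityˡ (1ˢ k))
  literal-constant (suc (suc n)) = trans (+-cong (≗⇒≈ λ k → ≡.sym (ℚ.*-identityˡ (1ˢ k))) (literal-constant (suc n)))
    (trans (sym (≗⇒≈ (constant-+ 1ℚ (fromℤ (+ suc n))))) (reflexive (≡.cong constant (≡.sym (fromℤ-+ 1ℤ (+ suc n))))))

  integer-constant : ∀ {n} c (ρ : Vec Series n) → ⟦ integer c ⟧ ρ ≈ constant (fromℤ c)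
  integer-constant (+ n)    ρ = literal-constant n
  integer-constant -[1+ n ] ρ = trans (-‿cong (literal-constant (suc n)))
    (trans (sym (≗⇒≈ (constant-neg (fromℤ (+ suc n))))) (reflexive (≡.cong constant (≡.sym (fromℤ-neg (+ suc n))))))

  scaled : ∀ {n} c (ρ : Vec Series n) s t → s ≈ t → (c ℚ./ 1) • s ≈ ⟦ integer c ⟧ ρ * t
  scaled c ρ s t s≈t = trans (≗⇒≈ (•-constant (fromℤ c) s)) (*-cong {constant (fromℤ c)} {⟦ integer c ⟧ ρ} {s} {t} (sym (integer-constant c ρ)) s≈t)

  eleventh : Series
  eleventh = constant (+ 1 ℚ./ 11)

  eleventh-inverse : ⟦ con 11 ⟧ [] * eleventh ≈ 1ˢ
  eleventh-inverse = trans (*-cong {⟦ con 11 ⟧ []} {constant (fromℤ (+ 11))} {eleventh} {eleventh} (literal-constant 11) refl)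
    (≗⇒≈ λ k → ≡.trans (≡.sym (•-constant (fromℤ (+ 11)) eleventh k))
      (≡.trans (≡.sym (ℚ.*-assoc (fromℤ (+ 11)) (+ 1 ℚ./ 11) (1ˢ k))) (ℚ.*-identityˡ (1ˢ k))))

module Deviation (N : ℕ) where
  open CommutativeRing (seriesRing N)
  open Exp semiring using (_^_)
  open Solver (seriesRing N) using (⟦_⟧)
  open Integers N
  open Concrete N
  open Quotients (seriesRing N)

  private
    reduce : ∀ k l a b c → (∀ M → q^ k ⊛ (q^ l ⊛ a ⊞ b) ≈[ M ] q^ k ⊛ c) → (q^ 1) ^ l * a + b ≈ c
    reduce k l a b c eq = restore-power (q^ l) ((q^ 1) ^ l) a b c (sym (q^-power N l)) (cancelled k (q^ l ⊛ a ⊞ b) c eq N)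

    r₄₂₁ : (q^ 1) ^ 11 * (X 5 * X 2 * X 1 * X 1) + X 4 * X 4 * X 3 * X 1 ≈ X 5 * X 3 * X 2 * X 2
    r₄₂₁ = reduce 11 11 (X 5 * X 2 * X 1 * X 1) (X 4 * X 4 * X 3 * X 1) (X 5 * X 3 * X 2 * X 2) λ M → Concrete.relation M 11 11 (X 5 * X 2 * X 1 * X 1) (X 4 * X 4 * X 3 * X 1) (X 5 * X 3 * X 2 * X 2) (Concrete.relation₄₂₁ M)

    r₄₃₂ : (q^ 1) ^ 11 * (X 4 * X 1 * X 2 * X 2) + X 4 * X 4 * X 5 * X 1 ≈ X 5 * X 2 * X 3 * X 3
    r₄₃₂ = reduce 22 11 (X 4 * X 1 * X 2 * X 2) (X 4 * X 4 * X 5 * X 1) (X 5 * X 2 * X 3 * X 3) λ M → Concrete.relation M 22 11 (X 4 * X 1 * X 2 * X 2) (X 4 * X 4 * X 5 * X 1) (X 5 * X 2 * X 3 * X 3) (Concrete.relation₄₃₂ M)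

    r₅₄₃ : (q^ 1) ^ 11 * (X 2 * X 1 * X 3 * X 3) + X 5 * X 5 * X 4 * X 1 ≈ X 3 * X 2 * X 4 * X 4
    r₅₄₃ = reduce 33 11 (X 2 * X 1 * X 3 * X 3) (X 5 * X 5 * X 4 * X 1) (X 3 * X 2 * X 4 * X 4) λ M → Concrete.relation M 33 11 (X 2 * X 1 * X 3 * X 3) (X 5 * X 5 * X 4 * X 1) (X 3 * X 2 * X 4 * X 4) (Concrete.relation₅₄₃ M)

    r₅₃₁ : (q^ 1) ^ 22 * (X 3 * X 2 * X 1 * X 1) + X 5 * X 5 * X 4 * X 2 ≈ X 5 * X 4 * X 3 * X 3
    r₅₃₁ = reduce 11 22 (X 3 * X 2 * X 1 * X 1) (X 5 * X 5 * X 4 * X 2) (X 5 * X 4 * X 3 * X 3) λ M → Concrete.relation M 11 22 (X 3 * X 2 * X 1 * X 1) (X 5 * X 5 * X 4 * X 2) (X 5 * X 4 * X 3 * X 3) (Concrete.relation₅₃₁ M)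

    r₅₂₁ : (q^ 1) ^ 11 * (X 4 * X 3 * X 1 * X 1) + X 5 * X 5 * X 3 * X 1 ≈ X 5 * X 4 * X 2 * X 2
    r₅₂₁ = reduce 11 11 (X 4 * X 3 * X 1 * X 1) (X 5 * X 5 * X 3 * X 1) (X 5 * X 4 * X 2 * X 2) λ M → Concrete.relation M 11 11 (X 4 * X 3 * X 1 * X 1) (X 5 * X 5 * X 3 * X 1) (X 5 * X 4 * X 2 * X 2) (Concrete.relation₅₂₁ M)

    inverse-series : ∀ f .{{_ : ℚ.NonZero (f 0)}} → f * inverse f ≈ 1#
    inverse-series f = trans (sym (*ˢ-as-* f (inverse f))) (≗⇒≈ (inverseʳ f))

    XU₁ : X 1 * U 1 ≈ 1#
    XU₁ = inverse-series (X 1)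

    XU₂ : X 2 * U 2 ≈ 1#
    XU₂ = inverse-series (X 2)

    XU₃ : X 3 * U 3 ≈ 1#
    XU₃ = inverse-series (X 3)

    XU₄ : X 4 * U 4 ≈ 1#
    XU₄ = inverse-series (X 4)

    XU₅ : X 5 * U 5 ≈ 1#
    XU₅ = inverse-series (X 5)

  open CrankTheorem (seriesRing N) (q^ 1) N (q^N≈0 N) using (crankSeries; module Dissection)
  open Dissection X U X-θ X-sym
    XU₁ XU₂ XU₃ XU₄ XU₅
    r₄₂₁ r₄₃₂ r₅₄₃ r₅₃₁ r₅₂₁
    eleventh eleventh-inverse public

  -- Below q^N the counts M are the coefficients of component a of the crank series and p(n) those
  -- of the sum of its components, so `crank-deviation` can be read off coefficientwise.
  deviation : ∀ a n → n < N → D_C (+ toℕ a) 11 n ≡ (eleventh * J² * V a) n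
  deviation a n n<N = ≡.trans (≡.cong₂ ℚ._-_ counts average) (≡.trans (≡.sym difference) (coefficients (crank-deviation a) n n<N))
    where
    S = Sums.sumOver (seriesRing N) crankSeries (allFin 11)
    counts : fromℤ M⟨ + toℕ a , 11 , n ⟩ ≡ crankSeries a n
    counts = ≡.trans (crankClass-M a n) (≡.sym (crankSeries-coefficient N a n n<N))
    average : + p n ℚ./ 11 ≡ (eleventh * S) n
    average = ≡.trans (/-as-* (+ p n) 10) (≡.trans (≡.cong ((+ 1 ℚ./ 11) ℚ.*_) (≡.sym (crankSeries-total N n n<N))) (•-constant (+ 1 ℚ./ 11) S n))
    difference : (crankSeries a - eleventh * S) n ≡ crankSeries a n ℚ.- (eleventh * S) n
    difference = ≡.trans (⊞-≗ (crankSeries a) (- (eleventh * S)) n) (≡.cong (crankSeries a n ℚ.+_) (⊟-≗ (eleventh * S) n))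

  private
    +ˢ-as-+ : ∀ f f′ g g′ → f ≈ f′ → g ≈ g′ → f +ˢ g ≈ f′ + g′
    +ˢ-as-+ f f′ g g′ f≈ g≈ = trans (sym (≗⇒≈ (⊞-≗ f g))) (+-cong f≈ g≈)

    +ˢ-sum : ∀ (f : Fin 10 → Series) →
      f (# 0) +ˢ f (# 1) +ˢ f (# 2) +ˢ f (# 3) +ˢ f (# 4) +ˢ f (# 5) +ˢ f (# 6) +ˢ f (# 7) +ˢ f (# 8) +ˢ f (# 9)
      ≈ f (# 0) + f (# 1) + f (# 2) + f (# 3) + f (# 4) + f (# 5) + f (# 6) + f (# 7) + f (# 8) + f (# 9)
    +ˢ-sum f = add (# 9) (add (# 8) (add (# 7) (add (# 6) (add (# 5) (add (# 4) (add (# 3) (add (# 2) (add (# 1) refl))))))))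
      where
      add : ∀ i {g h} → g ≈ h → g +ˢ f i ≈ h + f i
      add i {g} {h} g≈h = +ˢ-as-+ g h (f i) (f i) g≈h refl

    -- The bracket of `v₁₁` as an indexed family; the left-nested sum of its members is
    -- definitionally the bracket itself.
    summands : Vec ℤ 10 → Fin 10 → Series
    summands (a₀ ∷ a₁ ∷ a₂ ∷ a₃ ∷ a₄ ∷ a₅ ∷ a₇ ∷ a₈ ∷ a₉ ∷ a₁₀ ∷ []) = lookup
      ( (a₀ ℚ./ 1)  • (1ˢ /ˢ X 1)
      ∷ (a₁ ℚ./ 1)  • (q^ 1  *ˢ (X 5 /ˢ (X 2 *ˢ X 3)))
      ∷ (a₂ ℚ./ 1)  • (q^ 2  *ˢ (X 3 /ˢ (X 1 *ˢ X 4)))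
      ∷ (a₃ ℚ./ 1)  • (q^ 3  *ˢ (X 2 /ˢ (X 1 *ˢ X 3)))
      ∷ (a₄ ℚ./ 1)  • (q^ 4  *ˢ (1ˢ /ˢ X 2))
      ∷ (a₅ ℚ./ 1)  • (q^ 5  *ˢ (X 4 /ˢ (X 2 *ˢ X 5)))
      ∷ (a₇ ℚ./ 1)  • (q^ 7  *ˢ (1ˢ /ˢ X 3))
      ∷ (a₈ ℚ./ 1)  • (q^ 19 *ˢ (X 1 /ˢ (X 4 *ˢ X 5)))
      ∷ (a₉ ℚ./ 1)  • (q^ 9  *ˢ (1ˢ /ˢ X 4))
      ∷ (a₁₀ ℚ./ 1) • (q^ 10 *ˢ (1ˢ /ˢ X 5))
      ∷ [] )

    unit-quotient : ∀ f .{{_ : ℚ.NonZero (f 0)}} u → f * u ≈ 1# → 1ˢ /ˢ f ≈ u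
    unit-quotient f u fu = trans (*ˢ-as-* 1ˢ (inverse f)) (trans (*-identityˡ (inverse f)) (inverse-unique (inverse-series f) fu))

    power-quotient : ∀ k f .{{_ : ℚ.NonZero (f 0)}} u → f * u ≈ 1# → q^ k *ˢ (1ˢ /ˢ f) ≈ (q^ 1) ^ k * u
    power-quotient k f u fu = trans (*ˢ-as-* (q^ k) (1ˢ /ˢ f)) (*-cong (sym (q^-power N k)) (unit-quotient f u fu))

    quotient : ∀ k n f g .{{_ : ℚ.NonZero ((f *ˢ g) 0)}} u v → f * u ≈ 1# → g * v ≈ 1# → q^ k *ˢ (n /ˢ (f *ˢ g)) ≈ (q^ 1) ^ k * (n * (u * v))
    quotient k n f g u v fu gv = trans (*ˢ-as-* (q^ k) (n /ˢ (f *ˢ g))) (trans (*-congˡ {q^ k} (*ˢ-as-* n (inverse (f *ˢ g))))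
      (double-quotient (q^ k) ((q^ 1) ^ k) n f g (inverse (f *ˢ g)) u v (sym (q^-power N k))
        (trans (*-congʳ {inverse (f *ˢ g)} (sym (*ˢ-as-* f g))) (inverse-series (f *ˢ g))) fu gv))

    values : Vec ℤ 10 → Fin 10 → Series
    values as i = ⟦ integer (lookup as i) ⟧ ρ * ⟦ lookup Variables.basisTerms i ⟧ ρ

    summands-values : ∀ as i → summands as i ≈ values as i
    summands-values (a₀ ∷ a₁ ∷ a₂ ∷ a₃ ∷ a₄ ∷ a₅ ∷ a₇ ∷ a₈ ∷ a₉ ∷ a₁₀ ∷ []) =
        scaled a₀ ρ (1ˢ /ˢ X 1) (U 1) (unit-quotient (X 1) (U 1) XU₁)
      ◂ scaled a₁ ρ (q^ 1 *ˢ (X 5 /ˢ (X 2 *ˢ X 3))) ((q^ 1) ^ 1 * (X 5 * (U 2 * U 3))) (quotient 1 (X 5) (X 2) (X 3) (U 2) (U 3) XU₂ XU₃)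
      ◂ scaled a₂ ρ (q^ 2 *ˢ (X 3 /ˢ (X 1 *ˢ X 4))) ((q^ 1) ^ 2 * (X 3 * (U 1 * U 4))) (quotient 2 (X 3) (X 1) (X 4) (U 1) (U 4) XU₁ XU₄)
      ◂ scaled a₃ ρ (q^ 3 *ˢ (X 2 /ˢ (X 1 *ˢ X 3))) ((q^ 1) ^ 3 * (X 2 * (U 1 * U 3))) (quotient 3 (X 2) (X 1) (X 3) (U 1) (U 3) XU₁ XU₃)
      ◂ scaled a₄ ρ (q^ 4 *ˢ (1ˢ /ˢ X 2)) ((q^ 1) ^ 4 * U 2) (power-quotient 4 (X 2) (U 2) XU₂)
      ◂ scaled a₅ ρ (q^ 5 *ˢ (X 4 /ˢ (X 2 *ˢ X 5))) ((q^ 1) ^ 5 * (X 4 * (U 2 * U 5))) (quotient 5 (X 4) (X 2) (X 5) (U 2) (U 5) XU₂ XU₅)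
      ◂ scaled a₇ ρ (q^ 7 *ˢ (1ˢ /ˢ X 3)) ((q^ 1) ^ 7 * U 3) (power-quotient 7 (X 3) (U 3) XU₃)
      ◂ scaled a₈ ρ (q^ 19 *ˢ (X 1 /ˢ (X 4 *ˢ X 5))) ((q^ 1) ^ 19 * (X 1 * (U 4 * U 5))) (quotient 19 (X 1) (X 4) (X 5) (U 4) (U 5) XU₄ XU₅)
      ◂ scaled a₉ ρ (q^ 9 *ˢ (1ˢ /ˢ X 4)) ((q^ 1) ^ 9 * U 4) (power-quotient 9 (X 4) (U 4) XU₄)
      ◂ scaled a₁₀ ρ (q^ 10 *ˢ (1ˢ /ˢ X 5)) ((q^ 1) ^ 10 * U 5) (power-quotient 10 (X 5) (U 5) XU₅)
      ◂ λ ()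

  v₁₁-value : ∀ a₀ a₁ a₂ a₃ a₄ a₅ a₇ a₈ a₉ a₁₀ →
    v₁₁ a₀ a₁ a₂ a₃ a₄ a₅ a₇ a₈ a₉ a₁₀
    ≈ eleventh * J² * ⟦ Variables.combination (a₀ ∷ a₁ ∷ a₂ ∷ a₃ ∷ a₄ ∷ a₅ ∷ a₇ ∷ a₈ ∷ a₉ ∷ a₁₀ ∷ []) Variables.basisTerms ⟧ ρ
  v₁₁-value a₀ a₁ a₂ a₃ a₄ a₅ a₇ a₈ a₉ a₁₀ = trans (*ˢ-as-* prefactor S)
    (*-cong prefactor≈ (trans (+ˢ-sum (summands as)) (sum₁₀ (summands as) (values as) (summands-values as))))
    where
    as = a₀ ∷ a₁ ∷ a₂ ∷ a₃ ∷ a₄ ∷ a₅ ∷ a₇ ∷ a₈ ∷ a₉ ∷ a₁₀ ∷ []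
    f = summands as
    S = f (# 0) +ˢ f (# 1) +ˢ f (# 2) +ˢ f (# 3) +ˢ f (# 4) +ˢ f (# 5) +ˢ f (# 6) +ˢ f (# 7) +ˢ f (# 8) +ˢ f (# 9)
    prefactor = (+ 1 ℚ./ 11) • (J 121 *ˢ J 121)
    prefactor≈ : prefactor ≈ eleventh * J²
    prefactor≈ = trans (≗⇒≈ (•-constant (+ 1 ℚ./ 11) (J 121 *ˢ J 121)))
      (*-congˡ {eleventh} (trans (*ˢ-as-* (J 121) (J 121)) (*-cong (poch-pochhammer 121 121) (poch-pochhammer 121 121))))

open import Data.Integer using (-_)

theorem1p1 : (D_C (+ 0) 11 ≗ v₁₁ (+ 10) (- + 12) (- + 2) (+ 8) (+ 6) (+ 4) (- + 4) (- + 6) (- + 8) (+ 2))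
    × (D_C (+ 1) 11 ≗ v₁₁ (- + 1) (+ 10) (- + 2) (- + 3) (- + 5) (+ 4) (+ 7) (+ 5) (+ 3) (+ 2))
    × (D_C (+ 2) 11 ≗ v₁₁ (- + 1) (- + 1) (+ 9) (- + 3) (+ 6) (- + 7) (- + 4) (- + 6) (+ 3) (+ 2))
    × (D_C (+ 3) 11 ≗ v₁₁ (- + 1) (- + 1) (- + 2) (+ 8) (- + 5) (+ 4) (- + 4) (+ 5) (+ 3) (- + 9))
    × (D_C (+ 4) 11 ≗ v₁₁ (- + 1) (- + 1) (- + 2) (- + 3) (+ 6) (- + 7) (+ 7) (+ 5) (- + 8) (+ 2))
    × (D_C (+ 5) 11 ≗ v₁₁ (- + 1) (- + 1) (- + 2) (- + 3) (- + 5) (+ 4) (- + 4) (- + 6) (+ 3) (+ 2))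
theorem1p1 = row₀ , row₁ , row₂ , row₃ , row₄ , row₅
  where
  row₀ : D_C (+ 0) 11 ≗ v₁₁ (+ 10) (- + 12) (- + 2) (+ 8) (+ 6) (+ 4) (- + 4) (- + 6) (- + 8) (+ 2)
  -- The modulus q^(n+1) is the smallest one that still determines the coefficient of q^n.
  row₀ n = ≡.trans (Deviation.deviation (suc n) (# 0) n ℕ.≤-refl)
    (≡.sym (coefficients (Deviation.v₁₁-value (suc n) (+ 10) (- + 12) (- + 2) (+ 8) (+ 6) (+ 4) (- + 4) (- + 6) (- + 8) (+ 2)) n ℕ.≤-refl))
  row₁ : D_C (+ 1) 11 ≗ v₁₁ (- + 1) (+ 10) (- + 2) (- + 3) (- + 5) (+ 4) (+ 7) (+ 5) (+ 3) (+ 2)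
  row₁ n = ≡.trans (Deviation.deviation (suc n) (# 1) n ℕ.≤-refl)
    (≡.sym (coefficients (Deviation.v₁₁-value (suc n) (- + 1) (+ 10) (- + 2) (- + 3) (- + 5) (+ 4) (+ 7) (+ 5) (+ 3) (+ 2)) n ℕ.≤-refl))
  row₂ : D_C (+ 2) 11 ≗ v₁₁ (- + 1) (- + 1) (+ 9) (- + 3) (+ 6) (- + 7) (- + 4) (- + 6) (+ 3) (+ 2)
  row₂ n = ≡.trans (Deviation.deviation (suc n) (# 2) n ℕ.≤-refl)
    (≡.sym (coefficients (Deviation.v₁₁-value (suc n) (- + 1) (- + 1) (+ 9) (- + 3) (+ 6) (- + 7) (- + 4) (- + 6) (+ 3) (+ 2)) n ℕ.≤-refl))
  row₃ : D_C (+ 3) 11 ≗ v₁₁ (- + 1) (- + 1) (- + 2) (+ 8) (- + 5) (+ 4) (- + 4) (+ 5) (+ 3) (- + 9)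
  row₃ n = ≡.trans (Deviation.deviation (suc n) (# 3) n ℕ.≤-refl)
    (≡.sym (coefficients (Deviation.v₁₁-value (suc n) (- + 1) (- + 1) (- + 2) (+ 8) (- + 5) (+ 4) (- + 4) (+ 5) (+ 3) (- + 9)) n ℕ.≤-refl))
  row₄ : D_C (+ 4) 11 ≗ v₁₁ (- + 1) (- + 1) (- + 2) (- + 3) (+ 6) (- + 7) (+ 7) (+ 5) (- + 8) (+ 2)
  row₄ n = ≡.trans (Deviation.deviation (suc n) (# 4) n ℕ.≤-refl)
    (≡.sym (coefficients (Deviation.v₁₁-value (suc n) (- + 1) (- + 1) (- + 2) (- + 3) (+ 6) (- + 7) (+ 7) (+ 5) (- + 8) (+ 2)) n ℕ.≤-refl))
  row₅ : D_C (+ 5) 11 ≗ v₁₁ (- + 1) (- + 1) (- + 2) (- + 3) (- + 5) (+ 4) (- + 4) (- + 6) (+ 3) (+ 2)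
  row₅ n = ≡.trans (Deviation.deviation (suc n) (# 5) n ℕ.≤-refl)
    (≡.sym (coefficients (Deviation.v₁₁-value (suc n) (- + 1) (- + 1) (- + 2) (- + 3) (- + 5) (+ 4) (- + 4) (- + 6) (+ 3) (+ 2)) n ℕ.≤-refl))
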